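{- Consider the unit-weight \textsc{Spanner} problem parameterized by removed edges: given a connected undirected graph $G=(V,E)$ with $n=|V|$, $m=|E|$, unit edge weights $w(e)=1$ for all $e\in E$, edge lengths $\ell\colon E\to\mathbb{N}_{\ge1}$, a stretch factor $\alpha\ge1$ and $\varrho\in\mathbb{N}$, decide whether $G$ has an $\alpha$-spanner $H=(V,F)$ obtained by removing at least $\varrho$ nontrivial edges from $G$. (i) There is an algorithm that is FPT w.r.t. $(\varrho,\tau)$, where $\tau$ is the tightness of the instance, which decides this problem in time $$\mathcal{T}\in\mathcal{O}\big(\varrho^{2\varrho+1}\tau^{2\varrho}\cdot\mathrm{SPSP}(n,m)+\mathrm{APSP}_2(n,m)\big)$$ and identifies a witness (if it exists) in $\mathcal{O}(\mathcal{T}+n^2m^2)$ time. (ii) For basic instances (i.e., additionally $\ell(e)=1$ for all $e\in E$), there is an algorithm that is FPT w.r.t. $(\varrho,\alpha)$ only; it decides the problem, including finding a witness if it exists, in $\mathcal{O}\big(\varrho^{2\varrho+1}\alpha^{2\varrho}\cdot m+nm\big)$ time.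
   Context: For a subgraph $G'\subseteq G$ and $u,v\in V$, $\ell_{G'}[u,v]$ is the length of a shortest $u$-$v$-path in $G'$ w.r.t. $\ell$. A subgraph $H=(V,F)$, $F\subseteq E$, is an $\alpha$-spanner of $G$ if $\ell_H[u,v]\le\alpha\,\ell_G[u,v]$ for all $u,v\in V$; equivalently, for all $\{u,v\}\in E$. The set of terminal pairs is $K=E$. For $\{u,v\}\in E$, a simple $u$-$v$-path $P$ is settling if $\ell(P)\le\alpha\,\ell_G[u,v]$; it is alternative if it does not contain the edge $\{u,v\}$. $\mathcal{P}_{uv}$ is the set of all settling $u$-$v$-paths. As a preprocessing convention, edges that do not settle themselves (i.e., $\ell(\{u,v\})>\alpha\,\ell_G[u,v]$) are assumed to have been removed from the instance. An edge $\{u,v\}$ is mandatory if $\mathcal{P}_{uv}$ contains no alternative path. The trivial edges $T\subseteq E$ are the mandatory edges and the edges of weight $0$ (none of the latter exist for unit weights); the nontrivial edges are $N=E\setminus T$. A terminal pair $\{u,v\}\in E$ is critical if no settling $u$-$v$-path consists only of trivial edges; $C$ denotes the set of critical terminal pairs ($C\subseteq N$). For $\{u,v\}\in C$, the tightest alternative path $A_{uv}\in\mathcal{P}_{uv}$ is an alternative settling path with the minimum number of nontrivial edges, and $A^N_{uv}=A_{uv}\cap N$. The tightness of the instance is $\tau=\max\{|A^N_{uv}| : \{u,v\}\in C\}$. $\mathrm{SPSP}(n,m)$ and $\mathrm{APSP}_2(n,m)$ denote the running time of suitable algorithms for the single-pair shortest path problem and for the all-pairs-2-shortest-paths problem (two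 shortest paths for each node pair), respectively, on a graph with $n$ nodes and $m$ edges; $\mathrm{APSP}_2(n,m)\in\mathcal{O}(nm+n^2\log n)$. An algorithm is FPT w.r.t. a (possibly combined) parameter $k$ if on instance $I$ it runs in $\mathcal{O}(f(k)\cdot p(\langle I\rangle))$ time for a computable function $f$ and a polynomial $p$ in the encoding length $\langle I\rangle$. -}

module Defs where

open import Data.Bool.Base using (if_then_else_)
open import Data.Fin.Base using (Fin; toℕ)
open import Data.Fin.Subset using (Subset; _∈_; ⊤; ∁; ∣_∣)
open import Data.Fin.Subset.Properties using (_∈?_)
open import Data.Integer.Base as ℤ using ()
open import Data.List.Base
  using (List; []; _∷_; length; map; filter; concatMap; allFin; applyUpTo)
import Data.List.Membership.Propositional as List
open import Data.List.Relation.Unary.All using (All)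
open import Data.List.Relation.Unary.Unique.Propositional using (Unique)
open import Data.Nat.Base
open import Data.Nat.ListAction using (sum)
open import Data.Nat.Logarithm using (⌊log₂_⌋; ⌈log₂_⌉)
open import Data.Product.Base using (Σ; ∃-syntax; _×_; _,_; proj₁; proj₂)
open import Data.Rational.Base as ℚ using (ℚ)
open import Data.Sum.Base using (_⊎_)
import Data.Vec.Base as Vec
open import Function.Base using (_∘_; const)
open import Function.Bundles using (_⇔_)
open import Relation.Binary.PropositionalEquality using (_≡_; _≢_)
open import Relation.Nullary using (¬_)
open import Algebra.Definitions.RawSemiring ℚ.+-*-rawSemiring public
  using () renaming (_^_ to _^ℚ_)

-- Finite simple undirected graphs with positive integral edge lengths.
-- Vertices are Fin n and edges are Fin m; the order in which `ends` lists
-- the two end points of an edge carries no meaning.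

record Graph : Set where
  field
    n m      : ℕ
    ends     : Fin m → Fin n × Fin n
    ℓ        : Fin m → ℕ

  src : Fin m → Fin n
  src e = proj₁ (ends e)

  tgt : Fin m → Fin n
  tgt e = proj₂ (ends e)

  Joins : Fin m → Fin n → Fin n → Set
  Joins e u v = (ends e ≡ (u , v)) ⊎ (ends e ≡ (v , u))

  field
    positive   : ∀ e → 1 ≤ ℓ e
    loopless   : ∀ e → src e ≢ tgt e
    noParallel : ∀ {e f u v} → Joins e u v → Joins f u v → e ≡ f

module _ (G : Graph) where
  open Graph G

  data Walk : Fin n → Fin n → Set where
    stop : ∀ {u} → Walk u u
    step : ∀ {u v w} (e : Fin m) → Joins e u v → Walk v w → Walk u w

module _ {G : Graph} where
  open Graph G

  edges : ∀ {u v} → Walk G u v → List (Fin m)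
  edges stop         = []
  edges (step e _ P) = e ∷ edges P

  vertices : ∀ {u v} → Walk G u v → List (Fin n)
  vertices {u} stop         = u ∷ []
  vertices {u} (step _ _ P) = u ∷ vertices P

  len : ∀ {u v} → Walk G u v → ℕ
  len P = sum (map ℓ (edges P))

  Simple : ∀ {u v} → Walk G u v → Set
  Simple P = Unique (vertices P)

  _within_ : ∀ {u v} → Walk G u v → Subset m → Set
  P within F = All (_∈ F) (edges P)

Connected : Graph → Set
Connected G = ∀ u v → Walk G u v

-- d = ℓ_H[u,v] for H = (V,F); no such d exists if v is unreachable in H.
IsDist : (G : Graph) → Subset (Graph.m G) → (u v : Fin (Graph.n G)) → ℕ → Set
IsDist G F u v d =
    (∃[ P ] P within F × len {G} {u} {v} P ≡ d)
  × (∀ (P : Walk G u v) → P within F → d ≤ len P)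

fromℕ : ℕ → ℚ
fromℕ k = ℤ.+ k ℚ./ 1

-- a ≤ α b
_≤[_]_ : ℕ → ℚ → ℕ → Set
a ≤[ α ] b = fromℕ a ℚ.≤ α ℚ.* fromℕ b

IsSpanner : (G : Graph) → ℚ → Subset (Graph.m G) → Set
IsSpanner G α F = ∀ u v d → IsDist G ⊤ u v d → ∃[ d′ ] IsDist G F u v d′ × d′ ≤[ α ] d

-- `selfSettling` is the standing assumption that edges which do not settle
-- themselves have been removed from the instance.
record Instance : Set where
  field
    graph        : Graph
    connected    : Connected graph
    α            : ℚ
    1≤α          : ℚ.1ℚ ℚ.≤ α
    ϱ            : ℕ
  open Graph graph public
  field
    selfSettling : ∀ e d → IsDist graph ⊤ (src e) (tgt e) d → ℓ e ≤[ α ] d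

  weight : Fin m → ℕ
  weight _ = 1

module _ (I : Instance) where
  open Instance I

  Settling : (e : Fin m) → Walk graph (src e) (tgt e) → Set
  Settling e P = Simple P × ∃[ d ] IsDist graph ⊤ (src e) (tgt e) d × len P ≤[ α ] d

  Alternative : (e : Fin m) → Walk graph (src e) (tgt e) → Set
  Alternative e P = ¬ (e List.∈ edges P)

  Mandatory Trivial Nontrivial Critical : Fin m → Set
  Mandatory  e = ¬ (∃[ P ] Settling e P × Alternative e P)
  Trivial    e = Mandatory e ⊎ weight e ≡ 0
  Nontrivial e = ¬ Trivial e
  Critical   e = ¬ (∃[ P ] Settling e P × All Trivial (edges P))

  -- k = |A^N_e|, where N is the set of nontrivial edges.  Simple walks do not
  -- repeat edges, so counting along the edge list gives a cardinality.
  IsTightestCount : Subset m → Fin m → ℕ → Set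
  IsTightestCount N e k =
      (∃[ P ] Settling e P × Alternative e P × count P ≡ k)
    × (∀ P → Settling e P → Alternative e P → k ≤ count P)
    where
    count : ∀ {u v} → Walk graph u v → ℕ
    count P = length (filter (_∈? N) (edges P))

  -- The maximum over an empty set of critical pairs is read as 0.
  IsTightness : ℕ → Set
  IsTightness τ = ∃[ N ]
      (∀ e → e ∈ N ⇔ Nontrivial e)
    × (∀ e k → Critical e → IsTightestCount N e k → k ≤ τ)
    × (τ ≡ 0 ⊎ (∃[ e ] Critical e × IsTightestCount N e τ))

  IsWitness : Subset m → Set
  IsWitness F = IsSpanner graph α F × (∀ e → e ∈ ∁ F → Nontrivial e) × ϱ ≤ ∣ ∁ F ∣

  Feasible : Set
  Feasible = ∃[ F ] IsWitness F

  IsBasic : Set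
  IsBasic = ∀ e → ℓ e ≡ 1

BasicInstance : Set
BasicInstance = Σ Instance IsBasic

-- The time model is a unit-cost word RAM, programmed in a structured language.
-- Memory consists of registers and of finitely many (the array names are
-- fixed in the program text) arrays, all initially 0.  Every value that is
-- stored, read or computed must not exceed the word capacity W.

record State : Set where
  constructor ⟨_,_⟩
  field
    regs   : ℕ → ℕ
    arrays : ℕ → ℕ → ℕ
open State public

infixl 7 _⊛_
infixl 6 _⊕_ _⊝_

data Exp : Set where
  lit         : ℕ → Exp
  var         : ℕ → Exp
  get         : ℕ → Exp → Exp
  _⊕_ _⊝_ _⊛_ : Exp → Exp → Exp

infix  5 _≔_
infixr 4 _⨟_

data Program : Set where
  skip : Program
  _≔_  : ℕ → Exp → Program
  put  : ℕ → Exp → Exp → Program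
  _⨟_  : Program → Program → Program
  ite  : Exp → Program → Program → Program
  loop : Exp → Program → Program
  call : ℕ → Program → ℕ → Exp → Program

eval : Exp → State → ℕ
eval (lit k)   s = k
eval (var r)   s = regs s r
eval (get a e) s = arrays s a (eval e s)
eval (e ⊕ f)   s = eval e s + eval f s
eval (e ⊝ f)   s = eval e s ∸ eval f s
eval (e ⊛ f)   s = eval e s * eval f s

-- The largest intermediate value.
peak : Exp → State → ℕ
peak e@(lit _)   s = eval e s
peak e@(var _)   s = eval e s
peak e@(get _ f) s = eval e s ⊔ peak f s
peak e@(f ⊕ g)   s = eval e s ⊔ (peak f s ⊔ peak g s)
peak e@(f ⊝ g)   s = eval e s ⊔ (peak f s ⊔ peak g s)
peak e@(f ⊛ g)   s = eval e s ⊔ (peak f s ⊔ peak g s)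

cost : Exp → ℕ
cost (lit _)   = 1
cost (var _)   = 1
cost (get _ e) = 1 + cost e
cost (e ⊕ f)   = 1 + (cost e + cost f)
cost (e ⊝ f)   = 1 + (cost e + cost f)
cost (e ⊛ f)   = 1 + (cost e + cost f)

update : {A : Set} → (ℕ → A) → ℕ → A → ℕ → A
update g i x j = if i ≡ᵇ j then x else g j

setReg : ℕ → ℕ → State → State
setReg r x ⟨ ρ , μ ⟩ = ⟨ update ρ r x , μ ⟩

setCell : ℕ → ℕ → ℕ → State → State
setCell a i x ⟨ ρ , μ ⟩ = ⟨ ρ , update μ a (update (μ a) i x) ⟩

-- Overwrite an initial segment.
overlay : List ℕ → (ℕ → ℕ) → ℕ → ℕ
overlay []       g i       = g i
overlay (x ∷ xs) g zero    = x
overlay (x ∷ xs) g (suc i) = overlay xs (g ∘ suc) i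

setPrefix : ℕ → List ℕ → State → State
setPrefix a xs ⟨ ρ , μ ⟩ = ⟨ ρ , update μ a (overlay xs (μ a)) ⟩

-- Input and output occupy array 0; their lengths are kept in register 0.
initial : List ℕ → State
initial xs = ⟨ update (const 0) 0 (length xs)
             , update (const (const 0)) 0 (overlay xs (const 0)) ⟩

slice : State → ℕ → ℕ → List ℕ
slice s a k = applyUpTo (arrays s a) k

output : State → List ℕ
output s = slice s 0 (regs s 0)

-- Conditions hold when nonzero.  `call b p a e` runs p, in a fresh memory, on
-- the first e cells of array a and copies its output to the front of array b;
-- the copying is paid for.
infix 3 _⊢_,_⇓_,_
data _⊢_,_⇓_,_ (W : ℕ) : Program → State → State → ℕ → Set where
  skip  : ∀ {s} → W ⊢ skip , s ⇓ s , 1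
  assign : ∀ {r e s} → peak e s ≤ W →
           W ⊢ r ≔ e , s ⇓ setReg r (eval e s) s , 1 + cost e
  put   : ∀ {a i e s} → peak i s ≤ W → peak e s ≤ W →
          W ⊢ put a i e , s ⇓ setCell a (eval i s) (eval e s) s , 1 + cost i + cost e
  seq   : ∀ {p q s s′ s″ t t′} →
          W ⊢ p , s ⇓ s′ , t → W ⊢ q , s′ ⇓ s″ , t′ →
          W ⊢ p ⨟ q , s ⇓ s″ , t + t′
  then′ : ∀ {e p q s s′ t} → peak e s ≤ W → eval e s ≢ 0 →
          W ⊢ p , s ⇓ s′ , t → W ⊢ ite e p q , s ⇓ s′ , 1 + cost e + t
  else′ : ∀ {e p q s s′ t} → peak e s ≤ W → eval e s ≡ 0 →
          W ⊢ q , s ⇓ s′ , t → W ⊢ ite e p q , s ⇓ s′ , 1 + cost e + t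
  done  : ∀ {e p s} → peak e s ≤ W → eval e s ≡ 0 →
          W ⊢ loop e p , s ⇓ s , 1 + cost e
  again : ∀ {e p s s′ s″ t t′} → peak e s ≤ W → eval e s ≢ 0 →
          W ⊢ p , s ⇓ s′ , t → W ⊢ loop e p , s′ ⇓ s″ , t′ →
          W ⊢ loop e p , s ⇓ s″ , 1 + cost e + t + t′
  call  : ∀ {b p a e s s′ t} → peak e s ≤ W →
          W ⊢ p , initial (slice s a (eval e s)) ⇓ s′ , t →
          W ⊢ call b p a e , s ⇓ setPrefix b (output s′) s
            , 1 + cost e + (eval e s + t + length (output s′))

-- On input xs, p halts with output ys; the time t includes reading the input
-- and writing the output.
Runs : ℕ → Program → List ℕ → List ℕ → ℕ → Set
Runs W p xs ys t = ∃[ s ] ∃[ t₀ ]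
    (W ⊢ p , initial xs ⇓ s , t₀)
  × ys ≡ output s
  × t ≡ length xs + t₀ + length ys

record Problem : Set₁ where
  field
    Input   : Set
    encode  : Input → List ℕ
    Correct : Input → List ℕ → Set

-- Words of O(log (length + largest entry of the input)) bits suffice, i.e. word
-- capacities polynomial in `room`; this is what keeps unit-cost multiplication
-- honest.
room : List ℕ → ℕ
room xs = 2 + length xs + sum xs

Solves : Program → (Π : Problem) → (Problem.Input Π → ℕ) → Set
Solves p Π T = ∃[ K ] ∀ x W → room (encode x) ^ K ≤ W →
  ∃[ ys ] ∃[ t ] Runs W p (encode x) ys t × Correct x ys × t ≤ T x
  where open Problem Π

-- The factor f of an FPT bound has to be computable, without resource bounds.
Computable : (List ℕ → ℕ) → Set
Computable f = ∃[ p ] ∀ ks → ∃[ W ] ∃[ t ] Runs W p ks (f ks ∷ []) t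

encodingLength : List ℕ → ℕ
encodingLength xs = sum (map (λ x → 1 + ⌊log₂ x ⌋) xs)

-- T is bounded by f(k) · poly(⟨I⟩), the parameter k being given as a relation.
FPT : (Π : Problem) → (Problem.Input Π → List ℕ → Set) → (Problem.Input Π → ℕ) → Set
FPT Π Param T = ∃[ f ] Computable f × ∃[ c ] ∃[ d ]
  ∀ x k → Param x k → T x ≤ f k * (c * encodingLength (encode x) ^ d)
  where open Problem Π

-- The "+ 1" only matters where g vanishes (e.g. n m for the one-vertex graph).
_∈O_ : {X : Set} → (X → ℕ) → (X → ℕ) → Set
T ∈O g = ∃[ c ] ∀ x → T x ≤ c * (g x + 1)

_∈Oℚ_ : {X : Set} → (X → ℕ) → (X → ℚ) → Set
T ∈Oℚ g = ∃[ c ] ∀ x → fromℕ (T x) ℚ.≤ fromℕ c ℚ.* (g x ℚ.+ ℚ.1ℚ)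

encodeEdges : Graph → List ℕ
encodeEdges G = concatMap (λ e → toℕ (src e) ∷ toℕ (tgt e) ∷ ℓ e ∷ []) (allFin m)
  where open Graph G

encodeInstance : Instance → List ℕ
encodeInstance I =
  n ∷ m ∷ ℤ.∣ ℚ.↥ α ∣ ∷ ℚ.↧ₙ α ∷ ϱ ∷ encodeEdges graph
  where open Instance I

bits : ∀ {k} → Subset k → List ℕ
bits F = map (λ b → if b then 1 else 0) (Vec.toList F)

DecidesCorrectly : Instance → List ℕ → Set
DecidesCorrectly I ys = (ys ≡ 1 ∷ [] × Feasible I) ⊎ (ys ≡ 0 ∷ [] × ¬ Feasible I)

FindsCorrectly : Instance → List ℕ → Set
FindsCorrectly I ys =
    (∃[ F ] IsWitness I F × ys ≡ 1 ∷ bits F)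
  ⊎ (ys ≡ 0 ∷ [] × ¬ Feasible I)

SpannerDecision : Problem
SpannerDecision = record
  { Input = Instance ; encode = encodeInstance ; Correct = DecidesCorrectly }

SpannerWitness : Problem
SpannerWitness = record
  { Input = Instance ; encode = encodeInstance ; Correct = FindsCorrectly }

BasicSpannerWitness : Problem
BasicSpannerWitness = record
  { Input   = BasicInstance
  ; encode  = encodeInstance ∘ proj₁
  ; Correct = FindsCorrectly ∘ proj₁
  }

-- For both shortest path problems only the reported lengths are specified; an
-- algorithm may append further output, such as the paths themselves.

ConnectedGraph : Set
ConnectedGraph = Σ Graph Connected

record PairQuery : Set where
  field
    graph     : Graph
    connected : Connected graph
    source    : Fin (Graph.n graph)
    target    : Fin (Graph.n graph)
  open Graph graph public

SinglePairShortestPath : Problem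
SinglePairShortestPath = record
  { Input   = PairQuery
  ; encode  = λ Q → let open PairQuery Q in
                n ∷ m ∷ toℕ source ∷ toℕ target ∷ encodeEdges graph
  ; Correct = λ Q ys → let open PairQuery Q in
                ∃[ d ] ∃[ rest ] ys ≡ d ∷ rest × IsDist graph ⊤ source target d
  }

-- d₁ and d₂ are the lengths of a shortest and of a second shortest simple
-- u-v-path, for u ≢ v; d₂ = 0 signals that there is no second path.
IsTwoShortest : (G : Graph) (u v : Fin (Graph.n G)) → ℕ → ℕ → Set
IsTwoShortest G u v d₁ d₂ =
  Σ (Walk G u v) λ P →
      Simple P × len P ≡ d₁ × (∀ (R : Walk G u v) → Simple R → d₁ ≤ len R)
    × ( (d₂ ≡ 0 × (∀ (R : Walk G u v) → Simple R → edges R ≡ edges P))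
      ⊎ (Σ (Walk G u v) λ Q →
           Simple Q × edges Q ≢ edges P × len Q ≡ d₂
         × (∀ (R : Walk G u v) → Simple R → edges R ≢ edges P → d₂ ≤ len R)))

AllPairsTwoShortestPaths : Problem
AllPairsTwoShortestPaths = record
  { Input   = ConnectedGraph
  ; encode  = λ (G , _) → Graph.n G ∷ Graph.m G ∷ encodeEdges G
  ; Correct = λ (G , _) ys → ∀ (u v : Fin (Graph.n G)) → u ≢ v →
      let i = 2 * (toℕ u * Graph.n G + toℕ v)
          y = overlay ys (const 0)
      in IsTwoShortest G u v (y i) (y (1 + i))
  }

PolynomiallyBounded : (ℕ → ℕ → ℕ) → Set
PolynomiallyBounded S = ∃[ c ] ∃[ d ] ∀ n m → S n m ≤ c * (1 + n + m) ^ d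

SPSP-Algorithm : Program → (ℕ → ℕ → ℕ) → Set
SPSP-Algorithm p S =
    Solves p SinglePairShortestPath (λ Q → S (PairQuery.n Q) (PairQuery.m Q))
  × PolynomiallyBounded S

APSP₂-Algorithm : Program → (ℕ → ℕ → ℕ) → Set
APSP₂-Algorithm p A =
    Solves p AllPairsTwoShortestPaths (λ (G , _) → A (Graph.n G) (Graph.m G))
  × _∈O_ {ℕ × ℕ} (λ (n , m) → A n m) (λ (n , m) → n * m + n ^ 2 * ⌈log₂ n ⌉)

ByϱAndτ : Instance → List ℕ → Set
ByϱAndτ I k = ∃[ τ ] IsTightness I τ × k ≡ Instance.ϱ I ∷ τ ∷ []

-- The rational α is passed as its reduced fraction.
ByϱAndα : BasicInstance → List ℕ → Set
ByϱAndα (I , _) k = k ≡ ϱ ∷ ℤ.∣ ℚ.↥ α ∣ ∷ ℚ.↧ₙ α ∷ []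
  where open Instance I

TightInstance : Set
TightInstance = Σ Instance λ I → ∃[ τ ] IsTightness I τ

decisionBound : (S A : ℕ → ℕ → ℕ) → TightInstance → ℕ
decisionBound S A (I , τ , _) = ϱ ^ (2 * ϱ + 1) * τ ^ (2 * ϱ) * S n m + A n m
  where open Instance I

basicBound : BasicInstance → ℚ
basicBound (I , _) =
  fromℕ (ϱ ^ (2 * ϱ + 1)) ℚ.* α ^ℚ (2 * ϱ) ℚ.* fromℕ m ℚ.+ fromℕ (n * m)
  where open Instance I

witnessBound : (Instance → ℕ) → Instance → ℕ
witnessBound T I = T I + n ^ 2 * m ^ 2
  where open Instance I

{-# OPTIONS --safe #-}
module Submission where

open import Defs
open import Data.Bool.Base using (Bool; true; false; not; _∧_; if_then_else_; T)
open import Data.Bool.Properties using (T-∧)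
open import Data.Empty using (⊥; ⊥-elim)
open import Data.Fin.Base using (Fin; toℕ) renaming (zero to fzero; suc to fsuc)
import Data.Fin.Base as Fin
import Data.Fin.Properties as Fin
open import Data.Fin.Subset using (Subset; ⊤; ∁; ∣_∣) renaming (_∈_ to _∈ˢ_; _∉_ to _∉ˢ_)
import Data.Fin.Subset as Subset
import Data.Fin.Subset.Properties as Subset
import Data.Integer.Base as ℤ
import Data.Integer.Properties as ℤ
open import Data.List.Base using (List; []; _∷_; _++_; length; map; filter; concatMap; allFin; tabulate; take; applyUpTo; upTo)
open import Data.List.Properties using (length-applyUpTo; length-++; length-map; length-tabulate; map-tabulate; length-filter; take-all; length-upTo; map-++; ++-identityʳ; ++-assoc; ∷-injectiveˡ; ∷-injectiveʳ)
open import Data.List.Membership.Propositional using (_∈_; _∉_)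
open import Data.List.Membership.Propositional.Properties using (∈-filter⁺; ∈-filter⁻; ∈-allFin; ∈-++⁺ˡ; ∈-++⁺ʳ; ∈-++⁻; ∈-∃++; ∈-map⁺; ∈-map⁻; ∈-upTo⁺)
open import Data.List.Relation.Unary.All using (All; []; _∷_)
import Data.List.Relation.Unary.All as All
import Data.List.Relation.Unary.All.Properties as All
open import Data.List.Relation.Unary.Any using (Any; here; there)
import Data.List.Relation.Unary.Any as Any
open import Data.List.Relation.Unary.AllPairs using (AllPairs; []; _∷_)
import Data.List.Relation.Unary.AllPairs as AllPairs
open import Data.List.Relation.Unary.Unique.Propositional using (Unique)
import Data.List.Relation.Unary.Unique.Propositional.Properties as Unique
open import Data.Nat.Base
open import Data.Nat.ListAction using (sum)
open import Data.Nat.Properties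
open import Data.Nat.Logarithm using (⌊log₂_⌋; ⌈log₂_⌉; ⌈log₂⌉-mono-≤; ⌈log₂2^n⌉≡n)
open import Data.Nat.Tactic.RingSolver using (solve-∀)
open import Data.Product.Base using (Σ; ∃; ∃-syntax; _×_; _,_; proj₁; proj₂)
import Data.Rational.Base as ℚ
import Data.Rational.Properties as ℚ
import Data.Rational.Unnormalised.Base as ℚᵘ
import Data.Rational.Unnormalised.Properties as ℚᵘ
open import Data.Sum.Base using (_⊎_; inj₁; inj₂; [_,_]′)
import Data.Unit.Base as Unit
import Data.Vec.Base as Vec
import Data.Vec.Properties as Vec
open import Function.Base using (_∘_; const; id; _$_; case_of_)
open import Function.Bundles using (_⇔_; Equivalence; mk⇔)
open import Relation.Binary.PropositionalEquality
open import Relation.Nullary using (¬_; Dec; yes; no; contradiction)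
open import Relation.Nullary.Decidable using (decidable-stable; _×-dec_; _⊎-dec_; ¬?)
open import Data.List.Relation.Binary.Sublist.Propositional using (_⊆_; []; _∷ʳ_; _∷_; ⊆-trans)
import Data.List.Relation.Binary.Sublist.Propositional.Properties as Sublist
open import Relation.Binary.Definitions using (tri<; tri≈; tri>)

-- Say that an edge e has a detour around a set X of edges if some walk between the ends of e avoids
-- X and has length at most α times the distance of these ends (`Detour`). Replacing edges by
-- detours along a shortest walk shows that removing X leaves an α-spanner exactly when every edge
-- of X has a detour around X. The nontrivial edges are those with a detour around themselves alone
-- (`Removable`). They are the candidates, and a removal of at least ϱ edges can be cut down to
-- exactly ϱ of them.
--
-- Many candidates guarantee a solution. Choose for each candidate a short alternative path with at
-- most τ nontrivial edges: the tightest alternative path if the pair is critical, a settling path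
-- of trivial edges otherwise. Let e point to the candidates on its path. All out-degrees are at
-- most τ, so in every nonempty set of candidates some member has in-degree at most τ. Picking it,
-- deleting its at most 2τ neighbours and repeating finds ϱ independent candidates among any ϱ(2τ+1)
-- (`independent-set`). Their paths avoid one another, so they can be removed together
-- (`small-removal`).
--
-- The algorithm tests the weakly increasing ϱ-tuples of candidate positions in colexicographic
-- order. All tuples with entries below J come before all others. Hence the search makes at most
-- (ϱ(2τ+1))^ϱ tests without knowing τ: with fewer than ϱ(2τ+1) candidates the tuples run out, and
-- otherwise a solution lies among the first ϱ(2τ+1) candidates (`search-loop`, `few`). For τ ≥ 1
-- this number is at most 9 ϱ^(2ϱ) τ^ϱ (`few-≤`). If τ = 0, all candidates can be removed together;
-- this is tested beforehand, and a failure of that test proves τ ≥ 1 (`positive-τ`).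
--
-- In general, one detour test takes two single-pair queries, in G and in G with the removed edges
-- made unaffordably long, and the candidates come from comparing shortest with second shortest
-- paths (`removable⇔`). In basic instances a detour has at most ⌊α⌋ edges, so ⌊α⌋ takes the role of
-- τ. A detour test is then ⌊α⌋ rounds of Bellman-Ford, and the candidates come from one
-- breadth-first search per vertex: the edge from u to a is removable exactly when an edge away from
-- u joins the branch of a to another branch and closes a short enough cycle (`removable⇔hit`).
--
-- The programs are verified by timed triples (`Logic`), in which all controlled values are at most
-- some R polynomial in the input and every expression has few enough leaves to fit into a word.
-- Paths witnessing tightness are available only up to double negation; the bound on the number of
-- tests survives because ≤ is decidable.

-- Memory updates and array prefixes.

update-cases : ∀ {A : Set} (g : ℕ → A) i x j →
  (i ≡ j × update g i x j ≡ x) ⊎ (i ≢ j × update g i x j ≡ g j)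
update-cases g i x j with i ≡ᵇ j in eq
... | true  = inj₁ (≡ᵇ⇒≡ i j (subst T (sym eq) _) , refl)
... | false = inj₂ ((λ i≡j → subst T eq (≡⇒≡ᵇ i j i≡j)) , refl)

update-≡ : ∀ {A : Set} (g : ℕ → A) {i j} x → i ≡ j → update g i x j ≡ x
update-≡ g {i} {j} x i≡j with update-cases g i x j
... | inj₁ (_ , eq) = eq
... | inj₂ (i≢j , _) = contradiction i≡j i≢j

update-≢ : ∀ {A : Set} (g : ℕ → A) {i j} x → i ≢ j → update g i x j ≡ g j
update-≢ g {i} {j} x i≢j with update-cases g i x j
... | inj₁ (i≡j , _) = contradiction i≡j i≢j
... | inj₂ (_ , eq) = eq

overlay-≤ : ∀ {R g xs} → All (_≤ R) xs → (∀ i → g i ≤ R) → ∀ i → overlay xs g i ≤ R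
overlay-≤ []         g≤ i       = g≤ i
overlay-≤ (x≤ ∷ xs≤) g≤ zero    = x≤
overlay-≤ (x≤ ∷ xs≤) g≤ (suc i) = overlay-≤ xs≤ (g≤ ∘ suc) i

overlay-< : ∀ xs {g h i} → i < length xs → overlay xs g i ≡ overlay xs h i
overlay-< (x ∷ xs) {i = zero}  _       = refl
overlay-< (x ∷ xs) {i = suc i} (s≤s p) = overlay-< xs p

overlay-++ˡ : ∀ xs ys {g h i} → i < length xs → overlay (xs ++ ys) g i ≡ overlay xs h i
overlay-++ˡ (x ∷ xs) ys {i = zero}  _       = refl
overlay-++ˡ (x ∷ xs) ys {i = suc i} (s≤s p) = overlay-++ˡ xs ys p

overlay-++ʳ : ∀ xs ys g i → overlay (xs ++ ys) g (length xs + i) ≡ overlay ys (g ∘ (length xs +_)) i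
overlay-++ʳ []       ys g i = refl
overlay-++ʳ (x ∷ xs) ys g i = overlay-++ʳ xs ys (g ∘ suc) i

overlay-≥ : ∀ xs {g i} → length xs ≤ i → overlay xs g i ≡ g i
overlay-≥ []       p = refl
overlay-≥ (x ∷ xs) {i = suc i} (s≤s p) = overlay-≥ xs p

infix 4 _⊒_

-- The array `f` starts with the list `xs`. Wrapping the equation in a record keeps `f` and `xs`
-- visible to unification, where the bare equation would reduce.
record _⊒_ (f : ℕ → ℕ) (xs : List ℕ) : Set where
  constructor prefix
  field prefix⁻ : applyUpTo f (length xs) ≡ xs
open _⊒_ public

⊒-[] : ∀ {f} → f ⊒ []
⊒-[] = prefix refl

⊒-∷ : ∀ {f x xs} → f 0 ≡ x → f ∘ suc ⊒ xs → f ⊒ x ∷ xs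
⊒-∷ p (prefix q) = prefix (cong₂ _∷_ p q)

⊒-++ : ∀ {f} xs {ys} → f ⊒ xs → (λ i → f (length xs + i)) ⊒ ys → f ⊒ xs ++ ys
⊒-++ []       p q = q
⊒-++ (x ∷ xs) (prefix p) q = ⊒-∷ (∷-injectiveˡ p) (⊒-++ xs (prefix (∷-injectiveʳ p)) q)

⊒-pointwise : ∀ {f} xs → (∀ i → i < length xs → f i ≡ overlay xs (const 0) i) → f ⊒ xs
⊒-pointwise []       p = ⊒-[]
⊒-pointwise (x ∷ xs) p = ⊒-∷ (p 0 (s≤s z≤n)) (⊒-pointwise xs (λ i i< → p (suc i) (s≤s i<)))

slice-⊒ : ∀ {f xs} k → f ⊒ xs → k ≡ length xs → applyUpTo f k ≡ xs
slice-⊒ _ (prefix p) refl = p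

⊒-overlay : ∀ xs g → overlay xs g ⊒ xs
⊒-overlay xs g = ⊒-pointwise xs λ i i< → overlay-< xs i<

-- Semantics of programs: word capacity and framing.

mono-capacity : ∀ {W W′ p s s′ t} → W ≤ W′ → W ⊢ p , s ⇓ s′ , t → W′ ⊢ p , s ⇓ s′ , t
mono-capacity le skip            = skip
mono-capacity le (assign b)      = assign (≤-trans b le)
mono-capacity le (put b c)       = put (≤-trans b le) (≤-trans c le)
mono-capacity le (seq d e)       = seq (mono-capacity le d) (mono-capacity le e)
mono-capacity le (then′ b c d)   = then′ (≤-trans b le) c (mono-capacity le d)
mono-capacity le (else′ b c d)   = else′ (≤-trans b le) c (mono-capacity le d)
mono-capacity le (done b c)      = done (≤-trans b le) c
mono-capacity le (again b c d e) = again (≤-trans b le) c (mono-capacity le d) (mono-capacity le e)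
mono-capacity le (call b d)      = call (≤-trans b le) (mono-capacity le d)

-- A syntactic test that a program never writes a given register or array. It is Boolean so that for
-- concrete programs the side conditions in `Frame` compute to the unit type and are filled in
-- silently. A call writes no registers, as the callee has a fresh memory.
keepsReg keepsArr : ℕ → Program → Bool
keepsReg r skip           = true
keepsReg r (x ≔ _)        = not (x ≡ᵇ r)
keepsReg r (put _ _ _)    = true
keepsReg r (p ⨟ q)        = keepsReg r p ∧ keepsReg r q
keepsReg r (ite _ p q)    = keepsReg r p ∧ keepsReg r q
keepsReg r (loop _ p)     = keepsReg r p
keepsReg r (call _ _ _ _) = true
keepsArr a skip           = true
keepsArr a (_ ≔ _)        = true
keepsArr a (put b _ _)    = not (b ≡ᵇ a)
keepsArr a (p ⨟ q)        = keepsArr a p ∧ keepsArr a q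
keepsArr a (ite _ p q)    = keepsArr a p ∧ keepsArr a q
keepsArr a (loop _ p)     = keepsArr a p
keepsArr a (call b _ _ _) = not (b ≡ᵇ a)

record Frame (p : Program) (s s′ : State) : Set where
  field
    reg : ∀ r → {T (keepsReg r p)} → regs s′ r ≡ regs s r
    arr : ∀ a → {T (keepsArr a p)} → arrays s′ a ≡ arrays s a
open Frame public

frame-refl : ∀ {p s} → Frame p s s
frame-refl = record { reg = λ _ → refl ; arr = λ _ → refl }

frame-trans : ∀ {p s s′ s″} → Frame p s s′ → Frame p s′ s″ → Frame p s s″
frame-trans F F′ = record
  { reg = λ r {k} → trans (reg F′ r {k}) (reg F r {k})
  ; arr = λ a {k} → trans (arr F′ a {k}) (arr F a {k}) }

∧-left : ∀ b {c} → T (b ∧ c) → T b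
∧-left b h = proj₁ (Equivalence.to (T-∧ {b}) h)

∧-right : ∀ b {c} → T (b ∧ c) → T c
∧-right b h = proj₂ (Equivalence.to (T-∧ {b}) h)

update-not : ∀ {A : Set} (g : ℕ → A) i x j → T (not (i ≡ᵇ j)) → update g i x j ≡ g j
update-not g i x j h with i ≡ᵇ j
... | false = refl

frame : ∀ {W p s s′ t} → W ⊢ p , s ⇓ s′ , t → Frame p s s′
frame {p = p} d = record { reg = λ r {k} → regs-kept r p d k ; arr = λ a {k} → arrays-kept a p d k }
  where
  regs-kept : ∀ {W s s′ t} r p → W ⊢ p , s ⇓ s′ , t → T (keepsReg r p) → regs s′ r ≡ regs s r
  regs-kept r skip skip h = refl
  regs-kept {s = s} r (x ≔ e) (assign _) h = update-not (regs s) x _ r h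
  regs-kept r (put _ _ _) (put _ _) h = refl
  regs-kept r (p ⨟ q) (seq d e) h =
    trans (regs-kept r q e (∧-right (keepsReg r p) h)) (regs-kept r p d (∧-left (keepsReg r p) h))
  regs-kept r (ite _ p q) (then′ _ _ d) h = regs-kept r p d (∧-left (keepsReg r p) h)
  regs-kept r (ite _ p q) (else′ _ _ d) h = regs-kept r q d (∧-right (keepsReg r p) h)
  regs-kept r (loop _ p) (done _ _) h = refl
  regs-kept r (loop e p) (again _ _ d d′) h =
    trans (regs-kept r (loop e p) d′ h) (regs-kept r p d h)
  regs-kept r (call _ _ _ _) (call _ _) h = refl

  arrays-kept : ∀ {W s s′ t} a p → W ⊢ p , s ⇓ s′ , t → T (keepsArr a p) → arrays s′ a ≡ arrays s a
  arrays-kept a skip skip h = refl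
  arrays-kept a (_ ≔ _) (assign _) h = refl
  arrays-kept {s = s} a (put b _ _) (put _ _) h = update-not (arrays s) b _ a h
  arrays-kept a (p ⨟ q) (seq d e) h =
    trans (arrays-kept a q e (∧-right (keepsArr a p) h)) (arrays-kept a p d (∧-left (keepsArr a p) h))
  arrays-kept a (ite _ p q) (then′ _ _ d) h = arrays-kept a p d (∧-left (keepsArr a p) h)
  arrays-kept a (ite _ p q) (else′ _ _ d) h = arrays-kept a q d (∧-right (keepsArr a p) h)
  arrays-kept a (loop _ p) (done _ _) h = refl
  arrays-kept a (loop e p) (again _ _ d d′) h =
    trans (arrays-kept a (loop e p) d′ h) (arrays-kept a p d h)
  arrays-kept {s = s} a (call b _ _ _) (call _ _) h = update-not (arrays s) b _ a h

-- A program logic with time bounds and bounded values.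

for : ℕ → ℕ → Program → Program
for i b p = i ≔ lit 0 ⨟ loop (var b ⊝ var i) (p ⨟ i ≔ var i ⊕ lit 1)

frame-body : ∀ {i b p s s′} → Frame (p ⨟ i ≔ var i ⊕ lit 1) s s′ → Frame (for i b p) s s′
frame-body {i} F = record { reg = λ r {h} → reg F r {∧-right (not (i ≡ᵇ r)) h} ; arr = λ a {h} → arr F a {h} }

-- The number of leaves, which is the exponent that matters: if literals, registers and cells are at
-- most R, sums and products are at most R to the number of leaves. A read adds nothing, since the
-- cell itself is at most R again.
depth : Exp → ℕ
depth (lit _)   = 1
depth (var _)   = 1
depth (get _ e) = depth e
depth (e ⊕ f)   = depth e + depth f
depth (e ⊝ f)   = depth e + depth f
depth (e ⊛ f)   = depth e + depth f

depth>0 : ∀ e → 1 ≤ depth e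
depth>0 (lit _)   = s≤s z≤n
depth>0 (var _)   = s≤s z≤n
depth>0 (get _ e) = depth>0 e
depth>0 (e ⊕ f)   = ≤-trans (depth>0 e) (m≤m+n _ _)
depth>0 (e ⊝ f)   = ≤-trans (depth>0 e) (m≤m+n _ _)
depth>0 (e ⊛ f)   = ≤-trans (depth>0 e) (m≤m+n _ _)

+≤* : ∀ {a b} → 2 ≤ a → 2 ≤ b → a + b ≤ a * b
+≤* {suc (suc a)} {suc (suc b)} _ _ =
  subst (suc (suc a) + suc (suc b) ≤_) (eq a b) (m≤m+n _ _)
  where
  eq : ∀ a b → suc (suc a) + suc (suc b) + (a + b + a * b) ≡ suc (suc a) * suc (suc b)
  eq = solve-∀
+≤* {suc zero} (s≤s ()) _
+≤* {suc (suc _)} {suc zero} _ (s≤s ())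

-- p returns on xs, within time t ≤ T, some ys satisfying P.
Calls : ℕ → Program → List ℕ → (List ℕ → Set) → ℕ → Set
Calls W p xs P T = ∃[ ys ] ∃[ t ] Runs W p xs ys t × P ys × t ≤ T

-- All registers, and all cells of the arrays numbered below 8, hold values of
-- at most R.  The remaining arrays may receive results of unknown size.
module Logic (R W : ℕ) (7≤R : 7 ≤ R) (capacity : R ^ 16 ≤ W) where

  instance
    R≢0 : NonZero R
    R≢0 = >-nonZero (≤-trans (s≤s z≤n) 7≤R)

  record Small (s : State) : Set where
    field
      reg≤ : ∀ r → regs s r ≤ R
      arr≤ : ∀ a i → T (a <ᵇ 8) → arrays s a i ≤ R
  open Small public

  Leaves : Exp → State → Set
  Leaves (lit k)   s = T (k ≤ᵇ 7)
  Leaves (var r)   s = Unit.⊤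
  Leaves (get a e) s = Leaves e s × (if a <ᵇ 8 then Unit.⊤ else arrays s a (eval e s) ≤ R)
  Leaves (e ⊕ f)   s = Leaves e s × Leaves f s
  Leaves (e ⊝ f)   s = Leaves e s × Leaves f s
  Leaves (e ⊛ f)   s = Leaves e s × Leaves f s

  -- For concrete expressions both fields compute to unit types, so that the implicit arguments of
  -- this type are solved by eta. Only reads from arrays numbered 8 or more leave a bound to be
  -- supplied.
  record Safe (e : Exp) (s : State) : Set where
    constructor _,_
    field
      shallow : T (depth e ≤ᵇ 16)
      leaves  : Leaves e s

  eval≤peak : ∀ e s → eval e s ≤ peak e s
  eval≤peak (lit k)   s = ≤-refl
  eval≤peak (var r)   s = ≤-refl
  eval≤peak (get a e) s = m≤m⊔n _ _
  eval≤peak (e ⊕ f)   s = m≤m⊔n _ _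
  eval≤peak (e ⊝ f)   s = m≤m⊔n _ _
  eval≤peak (e ⊛ f)   s = m≤m⊔n _ _

  R≤R^ : ∀ {k} → 1 ≤ k → R ≤ R ^ k
  R≤R^ 1≤k = ≤-trans (≤-reflexive (sym (^-identityʳ R))) (^-monoʳ-≤ R 1≤k)

  private
    2≤R^ : ∀ e → 2 ≤ R ^ depth e
    2≤R^ e = ≤-trans (≤-trans (s≤s (s≤s z≤n)) 7≤R) (R≤R^ (depth>0 e))

    leftᵈ : ∀ e f → R ^ depth e ≤ R ^ (depth e + depth f)
    leftᵈ e f = ^-monoʳ-≤ R (m≤m+n (depth e) (depth f))

    rightᵈ : ∀ e f → R ^ depth f ≤ R ^ (depth e + depth f)
    rightᵈ e f = ^-monoʳ-≤ R (m≤n+m (depth f) (depth e))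

  peak≤ : ∀ {s} → Small s → ∀ e → Leaves e s → peak e s ≤ R ^ depth e
  peak≤ S (lit k) l = ≤-trans (≤-trans (≤ᵇ⇒≤ k 7 l) 7≤R) (R≤R^ ≤-refl)
  peak≤ S (var r) l = ≤-trans (reg≤ S r) (R≤R^ ≤-refl)
  peak≤ {s} S (get a e) (l , c) = ⊔-lub (≤-trans (cell (a <ᵇ 8) refl c) (R≤R^ (depth>0 e))) (peak≤ S e l)
    where
    cell : ∀ b → (a <ᵇ 8) ≡ b → (if b then Unit.⊤ else arrays s a (eval e s) ≤ R) → arrays s a (eval e s) ≤ R
    cell true  eq _ = arr≤ S a _ (subst T (sym eq) _)
    cell false _  c = c
  peak≤ {s} S (e ⊕ f) (l , l′) = ⊔-lub sum≤ (⊔-lub (≤-trans pe (leftᵈ e f)) (≤-trans pf (rightᵈ e f)))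
    where
    pe = peak≤ S e l
    pf = peak≤ S f l′
    sum≤ : eval e s + eval f s ≤ R ^ (depth e + depth f)
    sum≤ = begin
      eval e s + eval f s         ≤⟨ +-mono-≤ (≤-trans (eval≤peak e s) pe) (≤-trans (eval≤peak f s) pf) ⟩
      R ^ depth e + R ^ depth f   ≤⟨ +≤* (2≤R^ e) (2≤R^ f) ⟩
      R ^ depth e * R ^ depth f   ≡⟨ ^-distribˡ-+-* R (depth e) (depth f) ⟨
      R ^ (depth e + depth f)     ∎
      where open ≤-Reasoning
  peak≤ {s} S (e ⊝ f) (l , l′) =
    ⊔-lub (≤-trans (m∸n≤m (eval e s) (eval f s)) (≤-trans (eval≤peak e s) pe′)) (⊔-lub pe′ (≤-trans (peak≤ S f l′) (rightᵈ e f)))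
    where pe′ = ≤-trans (peak≤ S e l) (leftᵈ e f)
  peak≤ {s} S (e ⊛ f) (l , l′) =
    ⊔-lub (subst (eval e s * eval f s ≤_) (sym (^-distribˡ-+-* R (depth e) (depth f)))
            (*-mono-≤ (≤-trans (eval≤peak e s) pe) (≤-trans (eval≤peak f s) pf)))
          (⊔-lub (≤-trans pe (leftᵈ e f)) (≤-trans pf (rightᵈ e f)))
    where
    pe = peak≤ S e l
    pf = peak≤ S f l′

  safe : ∀ {s} e → Small s → Safe e s → peak e s ≤ W
  safe e S (d , l) = ≤-trans (peak≤ S e l) (≤-trans (^-monoʳ-≤ R (≤ᵇ⇒≤ (depth e) 16 d)) capacity)

  setReg-small : ∀ {s} r {x} → Small s → x ≤ R → Small (setReg r x s)
  setReg-small {s} r {x} S x≤ = record { reg≤ = bound ; arr≤ = arr≤ S }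
    where
    bound : ∀ j → update (regs s) r x j ≤ R
    bound j with r ≡ᵇ j
    ... | true  = x≤
    ... | false = reg≤ S j

  setCell-small : ∀ {s} a i {x} → Small s → x ≤ R → Small (setCell a i x s)
  setCell-small {s} a i {x} S x≤ = record { reg≤ = reg≤ S ; arr≤ = bound }
    where
    bound : ∀ b j → T (b <ᵇ 8) → update (arrays s) a (update (arrays s a) i x) b j ≤ R
    bound b j b< with update-cases (arrays s) a (update (arrays s a) i x) b
    ... | inj₂ (_ , eq) = subst (_≤ R) (sym (cong (_$ j) eq)) (arr≤ S b j b<)
    ... | inj₁ (refl , eq) with update-cases (arrays s a) i x j
    ...   | inj₁ (_ , eq′) = subst (_≤ R) (sym (trans (cong (_$ j) eq) eq′)) x≤
    ...   | inj₂ (_ , eq′) = subst (_≤ R) (sym (trans (cong (_$ j) eq) eq′)) (arr≤ S a j b<)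

  setPrefix-small : ∀ {s} b {ys} → Small s → (T (b <ᵇ 8) → All (_≤ R) ys) → Small (setPrefix b ys s)
  setPrefix-small {s} b {ys} S ys≤ = record { reg≤ = reg≤ S ; arr≤ = bound }
    where
    bound : ∀ c j → T (c <ᵇ 8) → update (arrays s) b (overlay ys (arrays s b)) c j ≤ R
    bound c j c< with update-cases (arrays s) b (overlay ys (arrays s b)) c
    ... | inj₂ (_ , eq) = subst (_≤ R) (sym (cong (_$ j) eq)) (arr≤ S c j c<)
    ... | inj₁ (refl , eq) =
      subst (_≤ R) (sym (cong (_$ j) eq)) (overlay-≤ (ys≤ c<) (λ i → arr≤ S b i c<) j)

  initial-small : ∀ {xs} → All (_≤ R) xs → length xs ≤ R → Small (initial xs)
  initial-small {xs} xs≤ l≤ = record { reg≤ = r≤ ; arr≤ = a≤ }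
    where
    r≤ : ∀ r → update (const 0) 0 (length xs) r ≤ R
    r≤ zero    = l≤
    r≤ (suc r) = z≤n
    a≤ : ∀ a i → T (a <ᵇ 8) → arrays (initial xs) a i ≤ R
    a≤ zero    i _ = overlay-≤ xs≤ (λ _ → z≤n) i
    a≤ (suc a) i _ = z≤n

  -- A total-correctness triple with a time bound. The postcondition speaks of the final state
  -- alone; what the program leaves untouched is recovered from the run through `frame`.
  record Exec (p : Program) (s : State) (Q : State → Set) (T : ℕ) : Set where
    constructor exec
    field
      {post}  : State
      {time}  : ℕ
      run     : W ⊢ p , s ⇓ post , time
      small   : Small post
      holds   : Q post
      bounded : time ≤ T
  open Exec public

  weaken : ∀ {p s Q Q′ T T′} → (∀ {s′} → Frame p s s′ → Small s′ → Q s′ → Q′ s′) → T ≤ T′ →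
           Exec p s Q T → Exec p s Q′ T′
  weaken f le (exec d S q b) = exec d S (f (frame d) S q) (≤-trans b le)

  skipE : ∀ {s Q} → Small s → Q s → Exec skip s Q 1
  skipE S q = exec skip S q ≤-refl

  -- The rules for statements take the rest of the program as a continuation in the updated state.
  -- Proofs thus execute programs symbolically, and most later side conditions hold by computation.
  assign⨾ : ∀ {r e q s Q T} → Small s → {Safe e s} → eval e s ≤ R →
            (Small (setReg r (eval e s) s) → Exec q (setReg r (eval e s) s) Q T) →
            Exec (r ≔ e ⨟ q) s Q (1 + cost e + T)
  assign⨾ {r} {e} S {sf} v≤ k with k (setReg-small r S v≤)
  ... | exec d S′ q b = exec (seq (assign (safe e S sf)) d) S′ q (+-monoʳ-≤ _ b)

  put⨾ : ∀ {a i e q s Q T} → Small s → {Safe i s} → {Safe e s} → eval e s ≤ R →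
         (Small (setCell a (eval i s) (eval e s) s) → Exec q (setCell a (eval i s) (eval e s) s) Q T) →
         Exec (put a i e ⨟ q) s Q (1 + cost i + cost e + T)
  put⨾ {a} {i} {e} {s = s} S {sfi} {sfe} v≤ k with k (setCell-small a (eval i s) S v≤)
  ... | exec d S′ q b = exec (seq (put (safe i S sfi) (safe e S sfe)) d) S′ q (+-monoʳ-≤ _ b)

  assign= : ∀ {r e q s Q T v} → Small s → {Safe e s} → eval e s ≡ v → v ≤ R →
            (Small (setReg r v s) → Exec q (setReg r v s) Q T) → Exec (r ≔ e ⨟ q) s Q (1 + cost e + T)
  assign= S {sf} refl = assign⨾ S {sf}

  put= : ∀ {a i e q s Q T k v} → Small s → {Safe i s} → {Safe e s} → eval i s ≡ k → eval e s ≡ v → v ≤ R →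
         (Small (setCell a k v s) → Exec q (setCell a k v s) Q T) → Exec (put a i e ⨟ q) s Q (1 + cost i + cost e + T)
  put= S {sfi} {sfe} refl refl = put⨾ S {sfi} {sfe}

  seq⨾ : ∀ {p q s Q Q′ T T′} → Exec p s Q T →
         (∀ {s′} → Small s′ → Frame p s s′ → Q s′ → Exec q s′ Q′ T′) → Exec (p ⨟ q) s Q′ (T + T′)
  seq⨾ (exec d S q b) k with k S (frame d) q
  ... | exec d′ S′ q′ b′ = exec (seq d d′) S′ q′ (+-mono-≤ b b′)

  seqE : ∀ {p q s Q Q′ T T′} (x : Exec p s Q T) → Exec q (post x) Q′ T′ → Exec (p ⨟ q) s Q′ (T + T′)
  seqE (exec d S q b) (exec d′ S′ q′ b′) = exec (seq d d′) S′ q′ (+-mono-≤ b b′)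

  iteThen : ∀ {e p q s Q T} → Small s → {Safe e s} → eval e s ≢ 0 → Exec p s Q T → Exec (ite e p q) s Q (1 + cost e + T)
  iteThen {e} S {sf} nz (exec d S′ q b) = exec (then′ (safe e S sf) nz d) S′ q (+-monoʳ-≤ _ b)

  iteElse : ∀ {e p q s Q T} → Small s → {Safe e s} → eval e s ≡ 0 → Exec q s Q T → Exec (ite e p q) s Q (1 + cost e + T)
  iteElse {e} S {sf} z (exec d S′ q b) = exec (else′ (safe e S sf) z d) S′ q (+-monoʳ-≤ _ b)

  -- The time in `Calls` includes reading the input and writing the output, which is exactly what a
  -- call is charged for the two copies. The output has to be small only if it lands in an array
  -- numbered below 8.
  call⨾ : ∀ {b p a e q s xs P Q T T′} → Small s → {Safe e s} → slice s a (eval e s) ≡ xs →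
          Calls W p xs P T → (∀ ys → P ys → Data.Bool.Base.T (b <ᵇ 8) → All (_≤ R) ys) →
          (∀ ys → P ys → Small (setPrefix b ys s) → Exec q (setPrefix b ys s) Q T′) →
          Exec (call b p a e ⨟ q) s Q (1 + cost e + T + T′)
  call⨾ {b} {e = e} {s = s} S {sf} refl (_ , _ , (s′ , t₀ , d , refl , refl) , Pys , t≤) ys≤ k
    with k _ Pys (setPrefix-small b S (ys≤ _ Pys))
  ... | exec d′ S′ q b′ = exec (seq (call (safe e S sf) d) d′) S′ q
        (+-mono-≤ (+-monoʳ-≤ (1 + cost e) (subst (λ k → k + t₀ + length (output s′) ≤ _) (length-applyUpTo _ (eval e s)) t≤)) b′)

  for-loop : ∀ {i b p s₀ s k T} (Inv : ℕ → State → Set) →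
             {Data.Bool.Base.T (keepsReg i p)} → {Data.Bool.Base.T (keepsReg b p)} → {Data.Bool.Base.T (not (i ≡ᵇ b))} →
             (∀ j s₁ → j < k → Small s₁ → Frame (for i b p) s₀ s₁ → regs s₁ i ≡ j → regs s₁ b ≡ k → Inv j s₁ →
               Exec p s₁ (λ s₂ → Inv (suc j) (setReg i (suc j) s₂)) T) →
             ∀ gas j → j + gas ≡ k → Small s → Frame (for i b p) s₀ s → regs s i ≡ j → regs s b ≡ k → Inv j s →
             Exec (loop (var b ⊝ var i) (p ⨟ i ≔ var i ⊕ lit 1)) s (Inv k) (gas * (T + 8) + 4)
  for-loop {i} {b} {s = s} Inv body zero j j+gas≡k S F si sb inv =
    exec (done (safe (var b ⊝ var i) S _) (trans (cong₂ _∸_ sb si) (trans (cong (_∸ j) (trans (sym j+gas≡k) (+-identityʳ j))) (n∸n≡0 j))))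
         S (subst (λ j → Inv j s) (trans (sym (+-identityʳ j)) j+gas≡k) inv) ≤-refl
  for-loop {i} {b} {p} {s₀} {s} {k} {T} Inv {ki} {kb} {i≢b} body (suc gas) j refl S F si sb inv
    with body j s (m<m+n j (s≤s z≤n)) S F si sb inv
  ... | exec {s₂} {t} d S₂ inv₂ t≤ = combine
        (for-loop Inv {ki} {kb} {i≢b} body gas (suc j) (sym (+-suc j gas)) S₃
          (frame-trans F (frame-body (frame step-run))) i₃ b₃ inv₃)
    where
    si₂ : regs s₂ i ≡ j
    si₂ = trans (reg (frame d) i {ki}) si
    sb₂ : regs s₂ b ≡ k
    sb₂ = trans (reg (frame d) b {kb}) sb
    next : regs s₂ i + 1 ≡ suc j
    next = trans (cong (_+ 1) si₂) (+-comm j 1)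
    next≤ : regs s₂ i + 1 ≤ R
    next≤ = subst (_≤ R) (sym next) (≤-trans (≤-trans (s≤s (m≤m+n j gas)) (≤-reflexive (sym (+-suc j gas))))
              (subst (_≤ R) sb (reg≤ S b)))
    s₃ = setReg i (regs s₂ i + 1) s₂
    S₃ : Small s₃
    S₃ = setReg-small i S₂ next≤
    step-run : W ⊢ p ⨟ i ≔ var i ⊕ lit 1 , s ⇓ s₃ , t + 4
    step-run = seq d (assign (safe (var i ⊕ lit 1) S₂ _))
    i₃ : regs s₃ i ≡ suc j
    i₃ = trans (update-≡ (regs s₂) _ refl) next
    b₃ : regs s₃ b ≡ k
    b₃ = trans (update-not (regs s₂) i _ b i≢b) sb₂
    inv₃ : Inv (suc j) s₃
    inv₃ = subst (λ x → Inv (suc j) (setReg i x s₂)) (sym next) inv₂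
    combine : Exec (loop (var b ⊝ var i) (p ⨟ i ≔ var i ⊕ lit 1)) s₃ (Inv k) (gas * (T + 8) + 4) →
              Exec (loop (var b ⊝ var i) (p ⨟ i ≔ var i ⊕ lit 1)) s (Inv k) (suc gas * (T + 8) + 4)
    combine (exec {time = t′} d′ S′ q b′) = exec (again (safe (var b ⊝ var i) S _) positive′ step-run d′) S′ q (begin
      4 + (t + 4) + t′                       ≤⟨ +-mono-≤ (+-monoʳ-≤ 4 (+-monoˡ-≤ 4 t≤)) b′ ⟩
      4 + (T + 4) + (gas * (T + 8) + 4)      ≡⟨ arith T (gas * (T + 8)) ⟩
      suc gas * (T + 8) + 4                  ∎)
      where
      open ≤-Reasoning
      arith : ∀ T x → 4 + (T + 4) + (x + 4) ≡ T + 8 + x + 4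
      arith = solve-∀
      positive′ : regs s b ∸ regs s i ≢ 0
      positive′ z = m>n⇒m∸n≢0 (m<m+n j (s≤s z≤n)) (trans (sym (cong₂ _∸_ sb si)) z)

  -- The body has to establish the invariant for the state with the counter already advanced. Of the
  -- 8 units added per round, 4 pay for the loop condition and 4 for the increment.
  forE : ∀ {i b p s k T} (Inv : ℕ → State → Set) →
         {Data.Bool.Base.T (keepsReg i p)} → {Data.Bool.Base.T (keepsReg b p)} → {Data.Bool.Base.T (not (i ≡ᵇ b))} →
         Small s → regs s b ≡ k → Inv 0 (setReg i 0 s) →
         (∀ j s₁ → j < k → Small s₁ → Frame (for i b p) s s₁ → regs s₁ i ≡ j → regs s₁ b ≡ k → Inv j s₁ →
           Exec p s₁ (λ s₂ → Inv (suc j) (setReg i (suc j) s₂)) T) →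
         Exec (for i b p) s (Inv k) (2 + (k * (T + 8) + 4))
  forE {i} {b} {p} {s} {k} Inv {ki} {kb} {i≢b} S sb inv body = assign⨾ S z≤n λ S₁ →
    for-loop Inv {ki} {kb} {i≢b} body k 0 refl S₁
      (record { reg = λ r {h} → update-not (regs s) i 0 r (∧-left (not (i ≡ᵇ r)) h)
              ; arr = λ a → refl })
      (update-≡ (regs s) 0 refl) (trans (update-not (regs s) i 0 b i≢b) sb) inv

  -- The index of an invariant is the time left to spend on the loop.
  whileE : ∀ {e p s₀ Q} (Inv : ℕ → State → Set) →
           (∀ φ s → Small s → Frame p s₀ s → Inv φ s → Safe e s ×
             ((eval e s ≡ 0 × Q s) ⊎
              (eval e s ≢ 0 × ∃[ φ′ ] ∃[ T ] 1 + cost e + T + φ′ ≤ φ × Exec p s (Inv φ′) T))) →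
           ∀ {φ s} → Small s → Frame p s₀ s → Inv φ s → Exec (loop e p) s Q (φ + (1 + cost e))
  whileE {e} {p} {s₀} {Q} Inv body {φ} = go φ ≤-refl
    where
    go : ∀ gas {φ s} → φ ≤ gas → Small s → Frame p s₀ s → Inv φ s → Exec (loop e p) s Q (φ + (1 + cost e))
    go gas {φ} {s} φ≤ S F inv with body φ s S F inv
    go gas {φ} φ≤ S F inv | sf , inj₁ (z , q) = exec (done (safe e S sf) z) S q (m≤n+m _ φ)
    go zero φ≤ S F inv | sf , inj₂ (nz , φ′ , T , le , _) = contradiction (≤-trans le φ≤) (λ ())
    go (suc gas) {φ} φ≤ S F inv | sf , inj₂ (nz , φ′ , T , le , exec {time = t} d S′ inv′ b)
      with go gas (≤-pred (≤-trans (≤-trans (s≤s (m≤n+m φ′ (cost e + T))) le) φ≤)) S′ (frame-trans F (frame d)) inv′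
    ... | exec {time = t′} d′ S″ q b′ = exec (again (safe e S sf) nz d d′) S″ q (begin
      1 + cost e + t + t′                        ≤⟨ +-mono-≤ (+-monoʳ-≤ (1 + cost e) b) b′ ⟩
      1 + cost e + T + (φ′ + (1 + cost e))       ≡⟨ +-assoc (1 + cost e + T) φ′ (1 + cost e) ⟨
      1 + cost e + T + φ′ + (1 + cost e)         ≤⟨ +-monoˡ-≤ (1 + cost e) le ⟩
      φ + (1 + cost e)                           ∎)
      where open ≤-Reasoning

  toCalls : ∀ {p xs L T P} → Exec p (initial xs) (λ s → P (output s) × regs s 0 ≤ L) T →
            Calls W p xs P (length xs + T + L)
  toCalls {xs = xs} (exec {s′} {t} d _ (Pys , l≤) b) =
    _ , _ , (_ , _ , d , refl , refl) , Pys ,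
    +-mono-≤ (+-monoʳ-≤ (length xs) b) (≤-trans (≤-reflexive (length-applyUpTo _ (regs s′ 0))) l≤)

-- Finite sums, pigeonhole and independent sets in sparse digraphs.

sum-map-+ : ∀ {A : Set} (f g : A → ℕ) xs →
  sum (map (λ x → f x + g x) xs) ≡ sum (map f xs) + sum (map g xs)
sum-map-+ f g []       = refl
sum-map-+ f g (x ∷ xs) = trans (cong (f x + g x +_) (sum-map-+ f g xs)) (swap (f x) (g x) _ _)
  where
  swap : ∀ a b c d → a + b + (c + d) ≡ a + c + (b + d)
  swap = solve-∀

sum-map-0 : ∀ {A : Set} (xs : List A) → sum (map (const 0) xs) ≡ 0
sum-map-0 []       = refl
sum-map-0 (x ∷ xs) = sum-map-0 xs

sum-map-1 : ∀ {A : Set} (xs : List A) → sum (map (const 1) xs) ≡ length xs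
sum-map-1 []       = refl
sum-map-1 (x ∷ xs) = cong suc (sum-map-1 xs)

sum-swap : ∀ {A B : Set} (f : A → B → ℕ) xs ys →
  sum (map (λ x → sum (map (f x) ys)) xs) ≡ sum (map (λ y → sum (map (λ x → f x y) xs)) ys)
sum-swap f []       ys = sym (sum-map-0 ys)
sum-swap f (x ∷ xs) ys = trans (cong (sum (map (f x) ys) +_) (sum-swap f xs ys))
  (sym (sum-map-+ (f x) (λ y → sum (map (λ x → f x y) xs)) ys))

sum-mono : ∀ {A : Set} (f g : A → ℕ) xs → (∀ {x} → x ∈ xs → f x ≤ g x) → sum (map f xs) ≤ sum (map g xs)
sum-mono f g []       le = z≤n
sum-mono f g (x ∷ xs) le = +-mono-≤ (le (here refl)) (sum-mono f g xs (le ∘ there))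

sum-split : ∀ {A : Set} (f : A → ℕ) xs {x ys} → sum (map f (xs ++ x ∷ ys)) ≡ f x + sum (map f (xs ++ ys))
sum-split f []       = refl
sum-split f (z ∷ zs) {x} {ys} = trans (cong (f z +_) (sum-split f zs)) (swap (f z) (f x) _)
  where
  swap : ∀ a b c → a + (b + c) ≡ b + (a + c)
  swap = solve-∀

∈-split-≢ : ∀ {A : Set} {x y : A} as {bs} → y ∈ as ++ x ∷ bs → x ≢ y → y ∈ as ++ bs
∈-split-≢ as y∈ x≢y with ∈-++⁻ as y∈
... | inj₁ y∈as         = ∈-++⁺ˡ y∈as
... | inj₂ (here refl)  = contradiction refl x≢y
... | inj₂ (there y∈bs) = ∈-++⁺ʳ as y∈bs

-- Each element of `xs` is split off `ys` in turn. As `xs` has no repetitions, the elements still to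
-- come survive the split.
sum-⊆ : ∀ {A : Set} (f : A → ℕ) {xs ys} → Unique xs → (∀ {x} → x ∈ xs → x ∈ ys) →
        sum (map f xs) ≤ sum (map f ys)
sum-⊆ f []        xs⊆ = z≤n
sum-⊆ f {x ∷ xs} (x∉ ∷ u) xs⊆ with ∈-∃++ (xs⊆ (here refl))
... | as , bs , refl = subst (f x + sum (map f xs) ≤_) (sym (sum-split f as))
  (+-monoʳ-≤ (f x) (sum-⊆ f u λ y∈ → ∈-split-≢ as (xs⊆ (there y∈)) (All.lookup x∉ y∈)))

length-⊆ : ∀ {A : Set} {xs ys : List A} → Unique xs → (∀ {x} → x ∈ xs → x ∈ ys) → length xs ≤ length ys
length-⊆ {xs = xs} {ys} u xs⊆ = subst₂ _≤_ (sum-map-1 xs) (sum-map-1 ys) (sum-⊆ (const 1) u xs⊆)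

length-≤-filter : ∀ {A : Set} {P : A → Set} (P? : ∀ x → Dec (P x)) (g : A → ℕ) → (∀ x → ¬ P x → 1 ≤ g x) →
                  ∀ xs → length xs ≤ length (filter P? xs) + sum (map g xs)
length-≤-filter P? g g≥1 [] = z≤n
length-≤-filter P? g g≥1 (x ∷ xs) with P? x
... | yes _ = s≤s (≤-trans (length-≤-filter P? g g≥1 xs) (+-monoʳ-≤ (length (filter P? xs)) (m≤n+m (sum (map g xs)) (g x))))
... | no ¬p = subst (suc (length xs) ≤_) (swap (g x) (length (filter P? xs)) (sum (map g xs))) (+-mono-≤ (g≥1 x ¬p) (length-≤-filter P? g g≥1 xs))
  where
  swap : ∀ a b c → a + (b + c) ≡ b + (a + c)
  swap = solve-∀

bit : Bool → ℕ
bit b = if b then 1 else 0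

module _ {A : Set} (_≟_ : (x y : A) → Dec (x ≡ y)) (c : A → A → Bool) (c-irrefl : ∀ x → c x x ≡ false) where

  out in′ : A → List A → ℕ
  out x ys = sum (map (λ y → bit (c x y)) ys)
  in′ y xs = sum (map (λ x → bit (c x y)) xs)

  below-average : ∀ (f : A → ℕ) τ xs → 0 < length xs → sum (map f xs) ≤ length xs * τ →
                  ∃[ x ] x ∈ xs × f x ≤ τ
  below-average f τ (x ∷ xs) _ le with f x ≤? τ
  ... | yes fx≤ = x , here refl , fx≤
  ... | no  fx≰ with xs
  ...   | [] = contradiction (≤-trans (m≤m+n (f x) 0) (≤-trans le (≤-reflexive (+-identityʳ τ)))) fx≰
  ...   | xs′@(_ ∷ _) with below-average f τ xs′ (s≤s z≤n)
                        (+-cancelˡ-≤ τ _ _ (≤-trans (+-monoˡ-≤ _ (<⇒≤ (≰⇒> fx≰))) le))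
  ...     | y , y∈ , fy≤ = y , there y∈ , fy≤

  Far : A → A → Set
  Far v x = c v x ≡ false × c x v ≡ false × x ≢ v

  far? : ∀ v x → Dec (Far v x)
  far? v x = (c v x Bool.≟ false) ×-dec ((c x v Bool.≟ false) ×-dec ¬? (x ≟ v))
    where import Data.Bool.Properties as Bool

  same : A → A → ℕ
  same v x with x ≟ v
  ... | yes _ = 1
  ... | no  _ = 0

  -- Counts the reasons for which `x` is lost once `v` is chosen. Summed over a list, it is the
  -- out-degree of `v` plus its in-degree plus at most 1 for `v` itself.
  near : A → A → ℕ
  near v x = bit (c v x) + bit (c x v) + same v x

  near-≥1 : ∀ v x → ¬ Far v x → 1 ≤ near v x
  near-≥1 v x ¬far with c v x | c x v
  ... | true  | _     = s≤s z≤n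
  ... | false | true  = s≤s z≤n
  ... | false | false with x ≟ v
  ...   | yes _   = s≤s z≤n
  ...   | no  x≢v = contradiction (refl , refl , x≢v) ¬far

  length-far : ∀ v xs → length xs ≤ length (filter (far? v) xs) + sum (map (near v) xs)
  length-far v = length-≤-filter (far? v) (near v) (near-≥1 v)

  same-≤1 : ∀ v {xs} → Unique xs → sum (map (same v) xs) ≤ 1
  same-≤1 v [] = z≤n
  same-≤1 v {x ∷ xs} (x∉ ∷ u) with x ≟ v
  ... | no  _    = same-≤1 v u
  ... | yes refl = s≤s (≤-reflexive (zeros x∉))
    where
    zeros : ∀ {ys} → All (v ≢_) ys → sum (map (same v) ys) ≡ 0
    zeros [] = refl
    zeros {y ∷ _} (v≢y ∷ r) with y ≟ v
    ... | yes refl = contradiction refl v≢y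
    ... | no  _    = zeros r

  -- A digraph of out-degree at most τ has, by averaging, a vertex of in-degree
  -- at most τ; removing it with its at most 2 τ neighbours and iterating
  -- leaves an independent set.
  independent-set : ∀ τ ϱ xs → Unique xs → ϱ * (τ + τ + 1) ≤ length xs →
    (∀ {x} → x ∈ xs → out x xs ≤ τ) →
    ∃[ ys ] Unique ys × (∀ {y} → y ∈ ys → y ∈ xs) × length ys ≡ ϱ ×
            (∀ {y z} → y ∈ ys → z ∈ ys → c y z ≡ false)
  independent-set τ zero    xs u le out≤ = [] , [] , (λ ()) , refl , λ ()
  independent-set τ (suc ϱ) xs u le out≤
    with below-average (λ y → in′ y xs) τ xs (≤-trans (≤-trans (m≤n+m 1 (τ + τ)) (m≤m+n _ _)) le)
           (subst (_≤ length xs * τ) (sum-swap (λ x y → bit (c x y)) xs xs)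
             (subst (sum (map (λ x → out x xs) xs) ≤_) (sum-const τ xs) (sum-mono _ (const τ) xs out≤)))
    where
    sum-const : ∀ k zs → sum (map (const {B = A} k) zs) ≡ length zs * k
    sum-const k []       = refl
    sum-const k (_ ∷ zs) = cong (k +_) (sum-const k zs)
  ... | v , v∈ , in≤ with independent-set τ ϱ (filter (far? v) xs) (Unique.filter⁺ (far? v) u) enough out′≤
    where
    near-sum : sum (map (near v) xs) ≤ τ + τ + 1
    near-sum = subst (_≤ τ + τ + 1)
      (sym (trans (sum-map-+ (λ x → bit (c v x) + bit (c x v)) (same v) xs)
                  (cong (_+ sum (map (same v) xs)) (sum-map-+ (λ x → bit (c v x)) (λ x → bit (c x v)) xs))))
      (+-mono-≤ (+-mono-≤ (out≤ v∈) in≤) (same-≤1 v u))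
    enough : ϱ * (τ + τ + 1) ≤ length (filter (far? v) xs)
    enough = +-cancelˡ-≤ (τ + τ + 1) _ _ (≤-trans le (≤-trans (length-far v xs)
      (≤-trans (+-monoʳ-≤ _ near-sum) (≤-reflexive (+-comm _ (τ + τ + 1))))))
    out′≤ : ∀ {x} → x ∈ filter (far? v) xs → out x (filter (far? v) xs) ≤ τ
    out′≤ {x} x∈ = ≤-trans (sum-⊆ (λ y → bit (c x y)) (Unique.filter⁺ (far? v) u) (λ y∈ → proj₁ (∈-filter⁻ (far? v) {xs = xs} y∈)))
      (out≤ (proj₁ (∈-filter⁻ (far? v) {xs = xs} x∈)))
  ...   | ys , u′ , ys⊆ , len≡ , indep = v ∷ ys , fresh ∷ u′ , sub , cong suc len≡ , indep′
    where
    far : ∀ {y} → y ∈ ys → Far v y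
    far y∈ = proj₂ (∈-filter⁻ (far? v) {xs = xs} (ys⊆ y∈))
    fresh : All (v ≢_) ys
    fresh = All.tabulate λ y∈ v≡y → proj₂ (proj₂ (far y∈)) (sym v≡y)
    sub : ∀ {y} → y ∈ v ∷ ys → y ∈ xs
    sub (here refl) = v∈
    sub (there y∈)  = proj₁ (∈-filter⁻ (far? v) {xs = xs} (ys⊆ y∈))
    indep′ : ∀ {y z} → y ∈ v ∷ ys → z ∈ v ∷ ys → c y z ≡ false
    indep′ (here refl) (here refl) = c-irrefl v
    indep′ (here refl) (there z∈)  = proj₁ (far z∈)
    indep′ (there y∈)  (here refl) = proj₁ (proj₂ (far y∈))
    indep′ (there y∈)  (there z∈)  = indep y∈ z∈

-- Weakly increasing tuples in colexicographic order.

cell : List ℕ → ℕ → ℕ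
cell xs = overlay xs (const 0)

-- Turns a sublist into a tuple of positions. Weak monotonicity is what `Tuple` asks for.
sublist-positions : ∀ {xs ys : List ℕ} → xs ⊆ ys → ∃[ e ]
  (∀ i → suc i < length xs → e i ≤ e (suc i)) ×
  (∀ i → i < length xs → e i < length ys × cell ys (e i) ≡ cell xs i)
sublist-positions xs⊆ys with go xs⊆ys
  where
  go : ∀ {xs ys : List ℕ} → xs ⊆ ys → ∃[ e ]
    (∀ i → suc i < length xs → e i ≤ e (suc i)) ×
    (∀ i → i < length xs → e i < length ys × cell ys (e i) ≡ cell xs i)
  go [] = id , (λ _ ()) , λ _ ()
  go (y ∷ʳ p) with go p
  ... | e , mono , at = suc ∘ e , (λ i i< → s≤s (mono i i<)) , λ i i< → s≤s (proj₁ (at i i<)) , proj₂ (at i i<)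
  go (refl ∷ p) with go p
  ... | e , mono , at = e′ , mono′ , at′
    where
    e′ : ℕ → ℕ
    e′ zero    = 0
    e′ (suc i) = suc (e i)
    mono′ : ∀ i → suc i < _ → e′ i ≤ e′ (suc i)
    mono′ zero    _        = z≤n
    mono′ (suc i) (s≤s i<) = s≤s (mono i i<)
    at′ : ∀ i → i < _ → _
    at′ zero    _        = s≤s z≤n , refl
    at′ (suc i) (s≤s i<) = s≤s (proj₁ (at i i<)) , proj₂ (at i i<)
... | r = r

-- Weakly increasing ϱ-tuples over {0, …, k − 1}, in colexicographic order.
record Tuple (k ϱ : ℕ) (d : ℕ → ℕ) : Set where
  field
    increasing : ∀ i → suc i < ϱ → d i ≤ d (suc i)
    digits     : ∀ i → i < ϱ → d i < k
open Tuple public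

-- Colexicographic comparison: the last position of disagreement decides. The last digit of a weakly
-- increasing tuple is its largest, so the tuples with digits below J precede all those with a digit
-- of J or more.
Before Same : ℕ → (d e : ℕ → ℕ) → Set
Before ϱ d e = ∃[ p ] p < ϱ × d p < e p × (∀ l → p < l → l < ϱ → d l ≡ e l)
Same   ϱ d e = ∀ l → l < ϱ → d l ≡ e l

zeros-first : ∀ ϱ {d} e → (∀ l → l < ϱ → d l ≡ 0) → Same ϱ d e ⊎ Before ϱ d e
zeros-first zero    e d≡0 = inj₁ λ _ ()
zeros-first (suc ϱ) {d} e d≡0 with e ϱ in eq
... | suc k = inj₂ (ϱ , ≤-refl , subst₂ _<_ (sym (d≡0 ϱ ≤-refl)) (sym eq) (s≤s z≤n) ,
                    λ l ϱ<l l< → contradiction (≤-trans ϱ<l (≤-pred l<)) 1+n≰n)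
... | zero with zeros-first ϱ e (λ l l< → d≡0 l (m≤n⇒m≤1+n l<))
...   | inj₁ same = inj₁ λ l l< → case m≤n⇒m<n∨m≡n (≤-pred l<) of λ where
          (inj₁ l<ϱ)  → same l l<ϱ
          (inj₂ refl) → trans (d≡0 l l<) (sym eq)
...   | inj₂ (p , p< , lt , above) = inj₂ (p , m≤n⇒m≤1+n p< , lt , λ l p<l l< → case m≤n⇒m<n∨m≡n (≤-pred l<) of λ where
          (inj₁ l<ϱ)  → above l p<l l<ϱ
          (inj₂ refl) → trans (d≡0 l l<) (sym eq))

-- The effect of a carry that stops at `i`. The new tuple is again increasing if digit `i` was below
-- its right neighbour.
record Bump (i : ℕ) (d d′ : ℕ → ℕ) : Set where
  field
    low   : ∀ l → l < i → d′ l ≡ 0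
    peakᵇ : d′ i ≡ suc (d i)
    high  : ∀ l → i < l → d′ l ≡ d l
open Bump public

increasing-≤ : ∀ {k ϱ e} → Tuple k ϱ e → ∀ l i → l ≤ i → i < ϱ → e l ≤ e i
increasing-≤ t l zero    z≤n i< = ≤-refl
increasing-≤ t l (suc i) l≤ i< with m≤n⇒m<n∨m≡n l≤
... | inj₁ (s≤s l≤i) = ≤-trans (increasing-≤ t l i l≤i (<⇒≤ i<)) (increasing t i i<)
... | inj₂ refl      = ≤-refl

-- No increasing tuple lies strictly between `d` and its successor. If the deciding position `p`
-- were below `i`, then e p ≤ e i = d i = d p, a contradiction. If `p` is `i`, then `e` has at least
-- the raised digit there, and the zeros below are the least possible continuation.
bump-next : ∀ {k ϱ i d d′ e} → Tuple k ϱ e → Before ϱ d e → Bump i d d′ → i < ϱ →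
            (∀ l → l < i → d l ≡ d i) → Same ϱ d′ e ⊎ Before ϱ d′ e
bump-next {i = i} {d} {d′} {e} t (p , p< , lt , above) b i< const′ with <-cmp p i
... | tri> _ _ i<p = inj₂ (p , p< , subst (_< e p) (sym (high b p i<p)) lt ,
                           λ l p<l l< → trans (high b l (<-trans i<p p<l)) (above l p<l l<))
... | tri< p<i _ _ = contradiction (≤-trans lt (increasing-≤ t p i (<⇒≤ p<i) i<))
                       (<-irrefl (trans (const′ p p<i) (above i p<i i<)))
... | tri≈ _ refl _ with m≤n⇒m<n∨m≡n lt
...   | inj₁ lt′ = inj₂ (p , p< , subst (_< e p) (sym (peakᵇ b)) lt′ ,
                         λ l p<l l< → trans (high b l p<l) (above l p<l l<))
...   | inj₂ e≡ with zeros-first p e (low b)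
...     | inj₁ same = inj₁ λ l l< → case <-cmp l p of λ where
            (tri< l<p _ _)  → same l l<p
            (tri≈ _ refl _) → trans (peakᵇ b) e≡
            (tri> _ _ p<l)  → trans (high b l p<l) (above l p<l l<)
...     | inj₂ (r , r< , lt″ , above′) = inj₂ (r , <-trans r< p< , lt″ , λ l r<l l< → case <-cmp l p of λ where
            (tri< l<p _ _)  → above′ l r<l l<p
            (tri≈ _ refl _) → trans (peakᵇ b) e≡
            (tri> _ _ p<l)  → trans (high b l p<l) (above l p<l l<))

-- The number with digits `d` in base `J`. It grows with every successor step and stays below J^ϱ
-- while the digits stay below `J`, so it bounds the number of rounds for every admissible base at
-- once.
value : ℕ → ℕ → (ℕ → ℕ) → ℕ
value J zero    d = 0
value J (suc n) d = value J n d + d n * J ^ n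

value-< : ∀ J n d → (∀ l → l < n → d l < J) → value J n d < J ^ n
value-< J zero    d d<J = s≤s z≤n
value-< J (suc n) d d<J = begin-strict
  value J n d + d n * J ^ n  <⟨ +-monoˡ-< (d n * J ^ n) (value-< J n d (λ l l< → d<J l (m≤n⇒m≤1+n l<))) ⟩
  J ^ n + d n * J ^ n        ≤⟨ *-monoˡ-≤ (J ^ n) (d<J n ≤-refl) ⟩
  J * J ^ n                  ∎
  where open ≤-Reasoning

value-cong : ∀ J n {d d′} → (∀ l → l < n → d′ l ≡ d l) → value J n d′ ≡ value J n d
value-cong J zero    eq = refl
value-cong J (suc n) eq = cong₂ _+_ (value-cong J n (λ l l< → eq l (m≤n⇒m≤1+n l<))) (cong (_* J ^ n) (eq n ≤-refl))

-- Resetting the digits below `i` loses less than J^i, the weight gained at `i`.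
value-bump : ∀ J n {i d d′} → Bump i d d′ → i < n → (∀ l → l < i → d l < J) → value J n d < value J n d′
value-bump J (suc n) {i} {d} {d′} b i< d<J with m≤n⇒m<n∨m≡n (≤-pred i<)
... | inj₁ i<n  = subst (λ x → _ < value J n d′ + x * J ^ n) (sym (high b n i<n))
                    (+-monoˡ-< (d n * J ^ n) (value-bump J n b i<n d<J))
... | inj₂ refl = begin-strict
  value J n d + d n * J ^ n    <⟨ +-monoˡ-< (d n * J ^ n) (value-< J n d d<J) ⟩
  J ^ n + d n * J ^ n          ≡⟨ cong (_* J ^ n) (peakᵇ b) ⟨
  d′ n * J ^ n                 ≤⟨ m≤n+m _ _ ⟩
  value J n d′ + d′ n * J ^ n  ∎
  where open ≤-Reasoning

least : ∀ {P : ℕ → Set} → (∀ k → Dec (P k)) → ∀ {k} → P k → ∃[ j ] P j × (∀ i → P i → j ≤ i)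
least {P} P? {k} Pk = go k 0 refl λ _ ()
  where
  go : ∀ gas j → j + gas ≡ k → (∀ i → i < j → ¬ P i) → ∃[ j ] P j × (∀ i → P i → j ≤ i)
  go gas j eq none with P? j
  ... | yes Pj = j , Pj , λ i Pi → ≮⇒≥ λ i<j → none i i<j Pi
  go zero j eq none | no ¬Pj = contradiction (subst P (trans (sym eq) (+-identityʳ j)) Pk) ¬Pj
  go (suc gas) j eq none | no ¬Pj = go gas (suc j) (trans (sym (+-suc j gas)) eq) λ i i< → case m≤n⇒m<n∨m≡n (≤-pred i<) of λ where
    (inj₁ i<j)  → none i i<j
    (inj₂ refl) → ¬Pj

-- Walks and distances.

module Walks (G : Graph) where
  open Graph G

  joins-sym : ∀ {e u v} → Joins e u v → Joins e v u
  joins-sym (inj₁ eq) = inj₂ eq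
  joins-sym (inj₂ eq) = inj₁ eq

  joins-ends : ∀ e → Joins e (src e) (tgt e)
  joins-ends e = inj₁ refl

  edgeʷ : ∀ e → Walk G (src e) (tgt e)
  edgeʷ e = step e (joins-ends e) stop

  len-edgeʷ : ∀ e → len (edgeʷ e) ≡ ℓ e
  len-edgeʷ e = +-identityʳ (ℓ e)

  append : ∀ {u v w} → Walk G u v → Walk G v w → Walk G u w
  append stop         Q = Q
  append (step e j P) Q = step e j (append P Q)

  len-append : ∀ {u v w} (P : Walk G u v) (Q : Walk G v w) → len (append P Q) ≡ len P + len Q
  len-append stop         Q = refl
  len-append (step e j P) Q = trans (cong (ℓ e +_) (len-append P Q)) (sym (+-assoc (ℓ e) (len P) (len Q)))

  all-append : ∀ {X : Fin m → Set} {u v w} (P : Walk G u v) {Q : Walk G v w} →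
               All X (edges P) → All X (edges Q) → All X (edges (append P Q))
  all-append stop         []       q = q
  all-append (step e j P) (x ∷ p) q = x ∷ all-append P p q

  reverse : ∀ {u v} → Walk G u v → Walk G v u
  reverse stop         = stop
  reverse (step e j P) = append (reverse P) (step e (joins-sym j) stop)

  len-reverse : ∀ {u v} (P : Walk G u v) → len (reverse P) ≡ len P
  len-reverse stop         = refl
  len-reverse (step e j P) = trans (len-append (reverse P) (step e (joins-sym j) stop))
    (trans (cong₂ _+_ (len-reverse P) (+-identityʳ (ℓ e))) (+-comm (len P) (ℓ e)))

  all-reverse : ∀ {X : Fin m → Set} {u v} (P : Walk G u v) → All X (edges P) → All X (edges (reverse P))
  all-reverse stop         []      = []
  all-reverse (step e j P) (x ∷ p) = all-append (reverse P) (all-reverse P p) (x ∷ [])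

  Shrinks : ∀ {u v u′ v′} → Walk G u v → Walk G u′ v′ → Set
  Shrinks P Q = Simple P × (∀ {e} → e ∈ edges P → e ∈ edges Q) × len P ≤ len Q

  suffix : ∀ {u v x} (P : Walk G u v) → x ∈ vertices P → Simple P → ∃[ Q ] Shrinks {x} {v} Q P
  suffix stop         (here refl) s = stop , s , id , ≤-refl
  suffix (step e j P) (here refl) s = step e j P , s , id , ≤-refl
  suffix (step e j P) (there x∈) (_ ∷ s) with suffix P x∈ s
  ... | Q , sQ , sub , le = Q , sQ , there ∘ sub , ≤-trans le (m≤n+m _ (ℓ e))

  erase-loops : ∀ {u v} (P : Walk G u v) → ∃[ Q ] Shrinks {u} {v} Q P
  erase-loops stop = stop , ([] ∷ []) , id , ≤-refl
  erase-loops {u} (step e j P) with erase-loops P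
  ... | Q , sQ , sub , le with Any.any? (u Fin.≟_) (vertices Q)
   
  ...   | no u∉ = step e j Q , (All.¬Any⇒All¬ _ u∉ ∷ sQ) , (λ where (here refl) → here refl ; (there f∈) → there (sub f∈)) , +-monoʳ-≤ (ℓ e) le
  ...   | yes u∈ with suffix Q u∈ sQ
  ...     | Q′ , sQ′ , sub′ , le′ = Q′ , sQ′ , there ∘ sub ∘ sub′ , ≤-trans le′ (≤-trans le (m≤n+m _ (ℓ e)))

  joins? : ∀ e u v → Dec (Joins e u v)
  joins? e u v = (ends e ≟ᵖ (u , v)) ⊎-dec (ends e ≟ᵖ (v , u))
    where
    import Data.Product.Properties as Product
    _≟ᵖ_ = Product.≡-dec Fin._≟_ Fin._≟_

  -- Edge lengths are positive, so the remaining length drops with every edge and bounds the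
  -- recursion. Decidability for each length is what makes distances exist constructively.
  walk-of-length? : ∀ F gas k → k ≤ gas → ∀ u v → Dec (∃[ P ] P within F × len {G} {u} {v} P ≡ k)
  walk-of-length? F gas zero _ u v with u Fin.≟ v
  ... | yes refl = yes (stop , [] , refl)
  ... | no u≢v   = no λ where
    (stop , _ , _)        → u≢v refl
    (step e j P , _ , eq) → contradiction (subst (1 ≤_) eq (≤-trans (positive e) (m≤m+n (ℓ e) _))) λ ()
  walk-of-length? F (suc gas) (suc k) (s≤s k≤) u v
    with Fin.any? (λ e → Fin.any? (λ w → (e Subset.∈? F) ×-dec (joins? e u w ×-dec
           ((ℓ e ≤? suc k) ×-dec walk-of-length? F gas (suc k ∸ ℓ e) (shorter e) w v))))
    where
    shorter : ∀ e → suc k ∸ ℓ e ≤ gas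
    shorter e = ≤-trans (∸-monoʳ-≤ (suc k) (positive e)) k≤
  ... | yes (e , w , e∈ , j , le , P , P⊆ , eq) =
        yes (step e j P , e∈ ∷ P⊆ , trans (cong (ℓ e +_) eq) (m+[n∸m]≡n le))
  ... | no none = no λ where
    (step e j P , e∈ ∷ P⊆ , eq) → none (e , _ , e∈ , j , subst (ℓ e ≤_) eq (m≤m+n (ℓ e) _) ,
      P , P⊆ , trans (sym (m+n∸m≡n (ℓ e) (len P))) (cong (_∸ ℓ e) eq))

  distance : ∀ {F u v} (P : Walk G u v) → P within F → ∃[ d ] IsDist G F u v d
  distance {F} {u} {v} P P⊆ with least (λ k → walk-of-length? F k k ≤-refl u v) (P , P⊆ , refl)
  ... | d , shortest , d≤ = d , shortest , λ Q Q⊆ → d≤ _ (Q , Q⊆ , refl)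

  within-⊤ : ∀ {u v} (P : Walk G u v) → P within ⊤
  within-⊤ P = All.tabulate λ _ → Subset.∈⊤

-- The stretch condition in integers; detours and spanners.

toℚᵘ-fromℕ : ∀ k → ℚ.toℚᵘ (fromℕ k) ℚᵘ.≃ ℚᵘ.mkℚᵘ (ℤ.+ k) 0
toℚᵘ-fromℕ k = ℚ.toℚᵘ-fromℚᵘ (ℚᵘ.mkℚᵘ (ℤ.+ k) 0)

-- Clears the denominator of α. The absolute value is the numerator because α ≥ 1 excludes a
-- negative one.
≤[]⇔ : ∀ α → ℚ.1ℚ ℚ.≤ α → ∀ a b → a ≤[ α ] b ⇔ (ℚ.↧ₙ α * a ≤ ℤ.∣ ℚ.↥ α ∣ * b)
≤[]⇔ (ℚ.mkℚ ℤ.-[1+ p ] q c) (ℚ.*≤* ())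
≤[]⇔ α@(ℚ.mkℚ (ℤ.+ p) q c) _ a b = mk⇔ to from
  where
  product : ℚ.toℚᵘ (α ℚ.* fromℕ b) ℚᵘ.≃ ℚᵘ.mkℚᵘ (ℤ.+ p) q ℚᵘ.* ℚᵘ.mkℚᵘ (ℤ.+ b) 0
  product = ℚᵘ.≃-trans (ℚ.toℚᵘ-homo-* α (fromℕ b)) (ℚᵘ.*-congˡ {ℚ.toℚᵘ α} (toℚᵘ-fromℕ b))
  lhs : ℤ.+ a ℤ.* ℤ.+ (suc q * 1) ≡ ℤ.+ (suc q * a)
  lhs = trans (sym (ℤ.pos-* a (suc q * 1))) (cong ℤ.+_ (trans (cong (a *_) (*-identityʳ (suc q))) (*-comm a (suc q))))
  rhs : ℤ.+ p ℤ.* ℤ.+ b ℤ.* ℤ.1ℤ ≡ ℤ.+ (p * b)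
  rhs = trans (ℤ.*-identityʳ _) (sym (ℤ.pos-* p b))
  to : a ≤[ α ] b → suc q * a ≤ p * b
  to le = ℤ.drop‿+≤+ (subst₂ ℤ._≤_ lhs rhs (ℚᵘ.drop-*≤*
    (ℚᵘ.≤-respʳ-≃ product (ℚᵘ.≤-respˡ-≃ (toℚᵘ-fromℕ a) (ℚ.toℚᵘ-mono-≤ le)))))
  from : suc q * a ≤ p * b → a ≤[ α ] b
  from le = ℚ.toℚᵘ-cancel-≤ (ℚᵘ.≤-respʳ-≃ (ℚᵘ.≃-sym product) (ℚᵘ.≤-respˡ-≃ (ℚᵘ.≃-sym (toℚᵘ-fromℕ a))
    (ℚᵘ.*≤* (subst₂ ℤ._≤_ (sym lhs) (sym rhs) (ℤ.+≤+ le)))))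

den≤num-of : ∀ α → ℚ.1ℚ ℚ.≤ α → ℚ.↧ₙ α ≤ ℤ.∣ ℚ.↥ α ∣
den≤num-of (ℚ.mkℚ ℤ.-[1+ p ] q c) (ℚ.*≤* ())
den≤num-of (ℚ.mkℚ (ℤ.+ p) q c) (ℚ.*≤* le) =
  ℤ.drop‿+≤+ (subst₂ ℤ._≤_ (ℤ.*-identityˡ (ℤ.+ suc q)) (ℤ.*-identityʳ (ℤ.+ p)) le)

module _ (I : Instance) where
  open Instance I
  open Walks graph

  num den : ℕ
  num = ℤ.∣ ℚ.↥ α ∣
  den = ℚ.↧ₙ α

  Fits : ℕ → ℕ → Set
  Fits a b = den * a ≤ num * b

  den≤num : den ≤ num
  den≤num = den≤num-of α 1≤α

  1≤num : 1 ≤ num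
  1≤num = ≤-trans (s≤s z≤n) den≤num

  to-fits : ∀ {a b} → a ≤[ α ] b → Fits a b
  to-fits {a} {b} = Equivalence.to (≤[]⇔ α 1≤α a b)

  from-fits : ∀ {a b} → Fits a b → a ≤[ α ] b
  from-fits {a} {b} = Equivalence.from (≤[]⇔ α 1≤α a b)

  fits-mono : ∀ {a a′ b b′} → a′ ≤ a → b ≤ b′ → Fits a b → Fits a′ b′
  fits-mono a≤ b≤ f = ≤-trans (*-monoʳ-≤ den a≤) (≤-trans f (*-monoʳ-≤ num b≤))

  fits-refl : ∀ a → Fits a a
  fits-refl a = *-monoˡ-≤ a den≤num

  -- The length condition of `Settling` in a form that compares with all walks instead of naming a
  -- distance, and that leaves out simplicity; loops can be erased when a simple walk is wanted.
  Short : ∀ {u v} → Walk graph u v → Set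
  Short {u} {v} P = ∀ (Q : Walk graph u v) → Fits (len P) (len Q)

  -- The notion to which all others are reduced. With the removed edges for `X` it is the spanner
  -- condition at `e`; with `e` alone it says that `e` is nontrivial; with all nontrivial edges it
  -- says that `e` is not critical.
  Detour : (Fin m → Set) → Fin m → Set
  Detour X e = ∃[ P ] All (¬_ ∘ X) (edges P) × Short {src e} {tgt e} P

  detour-mono : ∀ {X Y : Fin m → Set} {e} → (∀ {f} → X f → Y f) → Detour Y e → Detour X e
  detour-mono X⊆Y (P , avoids , short) = P , All.map (_∘ X⊆Y) avoids , short

  G-distance : ∀ {u v} (P : Walk graph u v) → ∃[ d ] IsDist graph ⊤ u v d
  G-distance P = distance P (within-⊤ P)

  short-dist : ∀ {u v d} {P : Walk graph u v} → IsDist graph ⊤ u v d → Fits (len P) d → Short P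
  short-dist (_ , d≤) fits Q = fits-mono ≤-refl (d≤ Q (within-⊤ Q)) fits

  dist-short : ∀ {u v d} {P : Walk graph u v} → IsDist graph ⊤ u v d → Short P → Fits (len P) d
  dist-short {P = P} ((Q , _ , refl) , _) short = short Q

  -- This is where the assumption enters that every edge settles itself.
  edge-short : ∀ e → Short (edgeʷ e)
  edge-short e Q with G-distance (edgeʷ e)
  ... | d , dist = short-dist {P = edgeʷ e} dist
    (subst (λ x → Fits x d) (sym (len-edgeʷ e)) (to-fits (selfSettling e d dist))) Q

  within-∁ : ∀ {F u v} (P : Walk graph u v) → All (_∉ˢ F) (edges P) → P within ∁ F
  within-∁ P = All.map Subset.x∉p⇒x∈∁p

  -- Along a shortest walk every removed edge is replaced by its detour, reversed if necessary. Each
  -- summand of the length grows by a factor of at most α, and so does the sum.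
  detours⇒spanner : ∀ {F} → (∀ e → e ∉ˢ F → Detour (_∉ˢ F) e) → IsSpanner graph α F
  detours⇒spanner {F} detour u v d ((P , _ , refl) , _) with replace P
    where
    stable : ∀ {e} → ¬ (e ∉ˢ F) → e ∈ˢ F
    stable {e} = decidable-stable (e Subset.∈? F)
    scale : ∀ a b c d → den * a ≤ num * b → den * c ≤ num * d → den * (a + c) ≤ num * (b + d)
    scale a b c d p q = subst₂ _≤_ (sym (*-distribˡ-+ den a c)) (sym (*-distribˡ-+ num b d)) (+-mono-≤ p q)
    segment : ∀ {u v} e → Joins e u v → ∃[ Q ] (Q within F) × Fits (len {graph} {u} {v} Q) (ℓ e)
    segment e j with e Subset.∈? F
    ... | yes e∈ = step e j stop , e∈ ∷ [] , subst (λ x → Fits x (ℓ e)) (sym (+-identityʳ (ℓ e))) (fits-refl (ℓ e))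
    ... | no e∉ with detour e e∉
    ...   | Q , avoids , short with subst (Fits (len Q)) (len-edgeʷ e) (short (edgeʷ e)) | j
    ...     | fits | inj₁ refl = Q , All.map stable avoids , fits
    ...     | fits | inj₂ refl = reverse Q , all-reverse Q (All.map stable avoids) ,
                                 subst (λ x → Fits x (ℓ e)) (sym (len-reverse Q)) fits
    replace : ∀ {u v} (P : Walk graph u v) → ∃[ Q ] (Q within F) × Fits (len {graph} {u} {v} Q) (len P)
    replace stop = stop , [] , subst₂ _≤_ (sym (*-zeroʳ den)) (sym (*-zeroʳ num)) z≤n
    replace (step e j P) with segment e j | replace P
    ... | A , A⊆ , fA | B , B⊆ , fB = append A B , all-append A A⊆ B⊆ ,
          subst (λ x → Fits x (ℓ e + len P)) (sym (len-append A B)) (scale (len A) (ℓ e) (len B) (len P) fA fB)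
  ... | Q , Q⊆ , fits with distance Q Q⊆
  ...   | d′ , dist′ = d′ , dist′ , from-fits (fits-mono (proj₂ dist′ Q Q⊆) ≤-refl fits)

  spanner⇒detour : ∀ {F} → IsSpanner graph α F → ∀ e → Detour (_∉ˢ F) e
  spanner⇒detour spanner e with G-distance (edgeʷ e)
  ... | d , dist with spanner _ _ d dist
  ...   | d′ , ((P , P⊆ , refl) , _) , le = P , All.map (λ e∈ e∉ → e∉ e∈) P⊆ , short-dist {P = P} dist (to-fits le)

  -- Removing e alone is possible exactly for nontrivial e.
  Removable : Fin m → Set
  Removable e = Detour (_≡ e) e

  removable⇒alternative : ∀ {e} → Removable e → ∃[ P ] Settling I e P × Alternative I e P
  removable⇒alternative {e} (P , avoids , short) with erase-loops P | G-distance P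
  ... | Q , simple , sub , le | d , dist =
        Q , (simple , d , dist , from-fits (fits-mono le ≤-refl (dist-short {P = P} dist short))) ,
        λ e∈ → All.lookup avoids (sub e∈) refl

  alternative⇒removable : ∀ {e P} → Settling I e P → Alternative I e P → Removable e
  alternative⇒removable {e} {P} (_ , d , dist , le) alt =
    P , All.tabulate (λ { f∈ refl → alt f∈ }) , short-dist {P = P} dist (to-fits le)

  removable⇒nontrivial : ∀ {e} → Removable e → Nontrivial I e
  removable⇒nontrivial r (inj₁ mandatory) = mandatory (removable⇒alternative r)
  removable⇒nontrivial r (inj₂ ())

  nonremovable⇒trivial : ∀ {e} → ¬ Removable e → Trivial I e
  nonremovable⇒trivial ¬r = inj₁ λ { (P , settling , alt) → ¬r (alternative⇒removable settling alt) }

-- Removals, and their existence among few candidates.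

-- Double-negation shift over a finite index set. It allows one undecidable choice per edge, made
-- for all edges simultaneously.
¬¬-all : ∀ {k} {P : Fin k → Set} → (∀ i → ¬ ¬ P i) → ¬ ¬ (∀ i → P i)
¬¬-all {zero}  h k = k λ ()
¬¬-all {suc _} h k = h fzero λ p₀ → ¬¬-all (h ∘ fsuc) λ p → k λ { fzero → p₀ ; (fsuc i) → p i }

¬¬-em : ∀ {P : Set} → ¬ ¬ (P ⊎ ¬ P)
¬¬-em k = k (inj₂ λ p → k (inj₁ p))

sum-bits : ∀ {A : Set} {P : A → Set} (P? : ∀ x → Dec (P x)) xs →
           sum (map (λ x → bit (Dec.does (P? x))) xs) ≡ length (filter P? xs)
sum-bits P? [] = refl
sum-bits P? (x ∷ xs) with P? x
... | yes _ = cong suc (sum-bits P? xs)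
... | no  _ = sum-bits P? xs

elements : ∀ {k} → Subset k → List (Fin k)
elements Vec.[]            = []
elements (true  Vec.∷ S) = fzero ∷ map fsuc (elements S)
elements (false Vec.∷ S) = map fsuc (elements S)

length-elements : ∀ {k} (S : Subset k) → length (elements S) ≡ ∣ S ∣
length-elements Vec.[]          = refl
length-elements (true  Vec.∷ S) = cong suc (trans (length-map fsuc (elements S)) (length-elements S))
length-elements (false Vec.∷ S) = trans (length-map fsuc (elements S)) (length-elements S)

elements-unique : ∀ {k} (S : Subset k) → Unique (elements S)
elements-unique Vec.[]          = []
elements-unique (true  Vec.∷ S) =
  All.map⁺ (All.tabulate (λ _ ())) ∷ Unique.map⁺ Fin.suc-injective (elements-unique S)
elements-unique (false Vec.∷ S) = Unique.map⁺ Fin.suc-injective (elements-unique S)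

∈-elements⁺ : ∀ {k} {S : Subset k} {e} → e ∈ˢ S → e ∈ elements S
∈-elements⁺ {S = true  Vec.∷ S} {fzero}  _           = here refl
∈-elements⁺ {S = true  Vec.∷ S} {fsuc e} (Vec.there e∈) = there (∈-map⁺ fsuc (∈-elements⁺ e∈))
∈-elements⁺ {S = false Vec.∷ S} {fsuc e} (Vec.there e∈) = ∈-map⁺ fsuc (∈-elements⁺ e∈)

∈-elements⁻ : ∀ {k} {S : Subset k} {e} → e ∈ elements S → e ∈ˢ S
∈-elements⁻ {S = true  Vec.∷ S} (here refl) = Vec.here
∈-elements⁻ {S = true  Vec.∷ S} (there e∈) with ∈-map⁻ fsuc e∈
... | _ , e′∈ , refl = Vec.there (∈-elements⁻ e′∈)
∈-elements⁻ {S = false Vec.∷ S} e∈ with ∈-map⁻ fsuc e∈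
... | _ , e′∈ , refl = Vec.there (∈-elements⁻ e′∈)

∣∣-≥ : ∀ {k} {S : Subset k} {es} → Unique es → (∀ {e} → e ∈ es → e ∈ˢ S) → length es ≤ ∣ S ∣
∣∣-≥ {S = S} u es⊆ = subst (_ ≤_) (length-elements S) (length-⊆ u (∈-elements⁺ ∘ es⊆))

∣∣-≤ : ∀ {k} {S : Subset k} {es} → (∀ {e} → e ∈ˢ S → e ∈ es) → ∣ S ∣ ≤ length es
∣∣-≤ {S = S} ⊆es = subst (_≤ _) (length-elements S) (length-⊆ (elements-unique S) (⊆es ∘ ∈-elements⁻))

∈-take : ∀ {A : Set} {x : A} k xs → x ∈ take k xs → x ∈ xs
∈-take (suc k) (y ∷ ys) (here refl) = here refl
∈-take (suc k) (y ∷ ys) (there x∈)  = there (∈-take k ys x∈)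

length-take-≤ : ∀ {A : Set} k (xs : List A) → k ≤ length xs → length (take k xs) ≡ k
length-take-≤ zero    xs       _        = refl
length-take-≤ (suc k) (x ∷ xs) (s≤s k≤) = cong suc (length-take-≤ k xs k≤)

module _ (I : Instance) where
  open Instance I
  open import Data.List.Membership.DecPropositional (Fin._≟_ {m}) using (_∈?_)

  -- Sets to be removed appear as lists without repetition, because the search enumerates tuples.
  Removal : List (Fin m) → Set
  Removal es = Unique es × (∀ {e} → e ∈ es → Detour I (_∈ es) e)

  removal-⊆ : ∀ {es fs} → Unique es → (∀ {e} → e ∈ es → e ∈ fs) →
              (∀ {e} → e ∈ es → Detour I (_∈ fs) e) → Removal es
  removal-⊆ u es⊆ detour = u , λ e∈ → detour-mono I es⊆ (detour e∈)

  removal-removable : ∀ {es} → Removal es → ∀ {e} → e ∈ es → Removable I e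
  removal-removable (_ , detour) e∈ = detour-mono I (λ { refl → e∈ }) (detour e∈)

  witness : ∀ {F} → (∀ e → e ∉ˢ F → Detour I (_∉ˢ F) e) → ϱ ≤ ∣ ∁ F ∣ → IsWitness I F
  witness {F} detour ϱ≤ = detours⇒spanner I detour ,
    (λ e e∈∁ → removable⇒nontrivial I
      (detour-mono I (λ { refl → Subset.x∈∁p⇒x∉p e∈∁ }) (detour e (Subset.x∈∁p⇒x∉p e∈∁)))) , ϱ≤

  removal⇒witness : ∀ {es F} → Removal es → length es ≡ ϱ → (∀ e → e ∉ˢ F ⇔ e ∈ es) → IsWitness I F
  removal⇒witness {es} {F} (u , detour) len≡ F⇔ = witness
    (λ e e∉ → detour-mono I (λ {f} f∉ → Equivalence.to (F⇔ f) f∉) (detour (Equivalence.to (F⇔ e) e∉)))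
    (subst (_≤ ∣ ∁ F ∣) len≡ (∣∣-≥ u λ {e} e∈ → Subset.x∉p⇒x∈∁p (Equivalence.from (F⇔ e) e∈)))

  -- Some alternative short path for e has at most τ nontrivial edges.
  Sparse : ℕ → Fin m → Set
  Sparse τ e = ∃[ P ] Short I {src e} {tgt e} P × e ∉ edges P ×
    (∀ es → Unique es → (∀ {f} → f ∈ es → f ∈ edges P × Removable I f) → length es ≤ τ)

  module _ {cands : List (Fin m)} (cands-unique : Unique cands)
           (cands⇔ : ∀ e → e ∈ cands ⇔ Removable I e) where

    -- Keeping more edges never destroys a detour, so any ϱ of the removed edges form a removal.
    -- They are taken in the order of the candidate list, which makes them a sublist and hence a
    -- tuple of the search.
    feasible⇒removal : Feasible I → ∃[ es ] es ⊆ cands × Removal es × length es ≡ ϱ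
    feasible⇒removal (F , spanner , _ , ϱ≤) =
      take ϱ removed , ⊆-trans (Sublist.take-⊆ ϱ removed) (Sublist.filter-⊆ (Subset._∈? ∁ F) cands) ,
      removal-⊆ (Unique.take⁺ ϱ removed-unique) (∈-take ϱ removed) (λ e∈ → detour-mono I removed⊆ (spanner⇒detour I spanner _)) ,
      length-take-≤ ϱ removed (≤-trans ϱ≤ (∣∣-≤ ⊆removed))
      where
      removed = filter (Subset._∈? ∁ F) cands
      removed-unique = Unique.filter⁺ (Subset._∈? ∁ F) cands-unique
      removed⊆ : ∀ {e} → e ∈ removed → e ∉ˢ F
      removed⊆ e∈ = Subset.x∈∁p⇒x∉p (proj₂ (∈-filter⁻ (Subset._∈? ∁ F) {xs = cands} e∈))
      ⊆removed : ∀ {e} → e ∈ˢ ∁ F → e ∈ removed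
      ⊆removed {e} e∈ = ∈-filter⁺ (Subset._∈? ∁ F)
        (Equivalence.from (cands⇔ e) (detour-mono I (λ { refl → Subset.x∈∁p⇒x∉p e∈ }) (spanner⇒detour I spanner e))) e∈

    -- Let each candidate conflict with the candidates on its sparse path. At most τ conflicts leave
    -- each candidate, so the first ϱ(2τ+1) of them contain ϱ independent ones, whose paths are
    -- detours around the whole set. The sparse paths are given only up to double negation, and so
    -- is the conclusion.
    small-removal : ∀ τ → (∀ e → Removable I e → ¬ ¬ Sparse τ e) → ϱ * (τ + τ + 1) ≤ length cands →
      ¬ ¬ (∃[ es ] es ⊆ take (ϱ * (τ + τ + 1)) cands × Removal es × length es ≡ ϱ)
    small-removal τ sparse J≤ ¬found = ¬¬-all path (¬found ∘ build)
      where
      Path : Fin m → Set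
      Path e = ∃[ E ] e ∉ E × (∀ es → Unique es → (∀ {f} → f ∈ es → f ∈ E × Removable I f) → length es ≤ τ) ×
               (Removable I e → ∃[ P ] Short I {src e} {tgt e} P × edges P ≡ E)
      path : ∀ e → ¬ ¬ Path e
      path e ¬path = ¬¬-em λ where
        -- Edges that are not removable get an empty list, so that the choice of paths is a total
        -- function on edges and the conflict relation is decidable.
        (inj₂ ¬r) → ¬path ([] , (λ ()) , (λ { [] _ _ → z≤n ; (x ∷ _) _ ⊆[] → contradiction (proj₁ (⊆[] (here refl))) λ () }) ,
                           λ r → contradiction r ¬r)
        (inj₁ r)  → sparse e r λ { (P , short , e∉ , few) → ¬path (edges P , e∉ , few , λ _ → P , short , refl) }

      prefix′ = take (ϱ * (τ + τ + 1)) cands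
      prefix-unique = Unique.take⁺ (ϱ * (τ + τ + 1)) cands-unique

      build : (∀ e → Path e) → ∃[ es ] es ⊆ prefix′ × Removal es × length es ≡ ϱ
      build paths = finish (independent-set Fin._≟_ conflict conflict-irrefl τ ϱ prefix′ prefix-unique
          (≤-reflexive (sym (length-take-≤ _ cands J≤))) out≤)
        where
        conflict : Fin m → Fin m → Bool
        conflict e f = Dec.does (f ∈? proj₁ (paths e))
        conflict-irrefl : ∀ e → conflict e e ≡ false
        conflict-irrefl e with e ∈? proj₁ (paths e)
        ... | yes e∈ = contradiction e∈ (proj₁ (proj₂ (paths e)))
        ... | no  _  = refl
        out≤ : ∀ {e} → e ∈ prefix′ → sum (map (λ f → bit (conflict e f)) prefix′) ≤ τ
        out≤ {e} _ = ≤-trans (≤-reflexive (sum-bits (_∈? proj₁ (paths e)) prefix′))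
          (proj₁ (proj₂ (proj₂ (paths e))) _ (Unique.filter⁺ (_∈? proj₁ (paths e)) prefix-unique)
            λ {f} f∈ → case ∈-filter⁻ (_∈? proj₁ (paths e)) {xs = prefix′} f∈ of λ where
              (f∈′ , f∈E) → f∈E , Equivalence.to (cands⇔ f) (∈-take _ cands f∈′))
        avoided : ∀ {e f} → conflict e f ≡ false → f ∉ proj₁ (paths e)
        avoided {e} {f} eq f∈ with f ∈? proj₁ (paths e)
        ... | no f∉ = f∉ f∈
        finish : ∃[ ys ] Unique ys × (∀ {y} → y ∈ ys → y ∈ prefix′) × length ys ≡ ϱ ×
                   (∀ {y z} → y ∈ ys → z ∈ ys → conflict y z ≡ false) →
                 ∃[ es ] es ⊆ prefix′ × Removal es × length es ≡ ϱ
        finish (ys , u , ys⊆ , len≡ , indep) = take ϱ sorted ,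
          ⊆-trans (Sublist.take-⊆ ϱ sorted) (Sublist.filter-⊆ (_∈? ys) prefix′) ,
          removal-⊆ (Unique.take⁺ ϱ (Unique.filter⁺ (_∈? ys) prefix-unique)) sorted⊆ detour ,
          length-take-≤ ϱ sorted (subst (_≤ length sorted) len≡
            (length-⊆ u λ y∈ → ∈-filter⁺ (_∈? ys) (ys⊆ y∈) y∈))
          where
          -- The independent set comes in the order of selection; filtering the prefix by it
          -- restores the candidate order.
          sorted = filter (_∈? ys) prefix′
          sorted⊆ : ∀ {e} → e ∈ take ϱ sorted → e ∈ ys
          sorted⊆ e∈ = proj₂ (∈-filter⁻ (_∈? ys) {xs = prefix′} (∈-take ϱ sorted e∈))
          detour : ∀ {e} → e ∈ take ϱ sorted → Detour I (_∈ ys) e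
          detour {e} e∈ with proj₂ (proj₂ (proj₂ (paths e))) (Equivalence.to (cands⇔ e) (∈-take _ cands (ys⊆ (sorted⊆ e∈))))
          ... | P , short , eq = P , All.tabulate (λ {f} f∈ f∈ys →
                avoided (indep (sorted⊆ e∈) f∈ys) (subst (f ∈_) eq f∈)) , short

-- Encodings of instances and edge sets in memory.

⊒-update : ∀ {f xs i x} → f ⊒ xs → length xs ≤ i → update f i x ⊒ xs
⊒-update {f} {xs} {i} {x} (prefix p) l≤ = ⊒-pointwise xs λ j j< →
  trans (update-≢ f {i} x (λ { refl → 1+n≰n (≤-trans j< l≤) })) (at j j<)
  where
  at : ∀ j → j < length xs → f j ≡ cell xs j
  at j j< = trans (sym (go (length xs) f j j<)) (cong (λ ys → cell ys j) p)
    where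
    go : ∀ k f j → j < k → cell (applyUpTo f k) j ≡ f j
    go (suc k) f zero    _        = refl
    go (suc k) f (suc j) (s≤s j<) = go k (f ∘ suc) j j<

module _ {A : Set} (f g h : A → ℕ) where
  triples : List A → List ℕ
  triples = concatMap λ x → f x ∷ g x ∷ h x ∷ []

  length-triples : ∀ {k} (φ : Fin k → A) → length (triples (tabulate φ)) ≡ k * 3
  length-triples {zero}  φ = refl
  length-triples {suc k} φ = cong (3 +_) (length-triples (φ ∘ fsuc))

  triples-at : ∀ {k} (φ : Fin k → A) {z} e → let a = overlay (triples (tabulate φ)) z in
    a (toℕ e * 3) ≡ f (φ e) × a (1 + toℕ e * 3) ≡ g (φ e) × a (2 + toℕ e * 3) ≡ h (φ e)
  triples-at φ fzero    = refl , refl , refl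
  triples-at φ (fsuc e) = triples-at (φ ∘ fsuc) e

  triples-⊒ : ∀ {k} (φ : Fin k → A) {a} →
    (∀ e → a (toℕ e * 3) ≡ f (φ e) × a (1 + toℕ e * 3) ≡ g (φ e) × a (2 + toℕ e * 3) ≡ h (φ e)) →
    a ⊒ triples (tabulate φ)
  triples-⊒ {zero}  φ p = ⊒-[]
  triples-⊒ {suc k} φ p = ⊒-∷ (proj₁ (p fzero)) (⊒-∷ (proj₁ (proj₂ (p fzero))) (⊒-∷ (proj₂ (proj₂ (p fzero)))
    (triples-⊒ (φ ∘ fsuc) (p ∘ fsuc))))

bits-at : ∀ {k} (F : Subset k) {z} e → overlay (bits F) z (toℕ e) ≡ bit (Vec.lookup F e)
bits-at (b Vec.∷ F) fzero    = refl
bits-at (b Vec.∷ F) (fsuc e) = bits-at F e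

bits-⊒ : ∀ {k} (F : Subset k) {a} → (∀ e → a (toℕ e) ≡ bit (Vec.lookup F e)) → a ⊒ bits F
bits-⊒ Vec.[]      p = ⊒-[]
bits-⊒ (b Vec.∷ F) p = ⊒-∷ (p fzero) (bits-⊒ F (p ∘ fsuc))

to-subset : ∀ {k} {P : Fin k → Set} {a : ℕ → ℕ} → (∀ f → ∃[ b ] a (toℕ f) ≡ bit b × (b ≡ true ⇔ P f)) →
  ∃[ X ] (∀ f → a (toℕ f) ≡ bit (Vec.lookup X f)) × (∀ f → Vec.lookup X f ≡ true ⇔ P f)
to-subset flagged = Vec.tabulate (proj₁ ∘ flagged) ,
  (λ f → trans (proj₁ (proj₂ (flagged f))) (cong bit (sym (look f)))) ,
  λ f → mk⇔ (Equivalence.to (proj₂ (proj₂ (flagged f))) ∘ trans (sym (look f))) (trans (look f) ∘ Equivalence.from (proj₂ (proj₂ (flagged f))))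
  where look = Vec.lookup∘tabulate (proj₁ ∘ flagged)

length-bits : ∀ {k} (F : Subset k) → length (bits F) ≡ k
length-bits Vec.[]      = refl
length-bits (b Vec.∷ F) = cong suc (length-bits F)

bits≤1 : ∀ {k} (F : Subset k) → All (_≤ 1) (bits F)
bits≤1 Vec.[]          = []
bits≤1 (true Vec.∷ F)  = ≤-refl ∷ bits≤1 F
bits≤1 (false Vec.∷ F) = z≤n ∷ bits≤1 F

bit≤1 : ∀ b → bit b ≤ 1
bit≤1 true  = ≤-refl
bit≤1 false = z≤n

take-suc : ∀ {k} j (es : List (Fin k)) → j < length es →
  ∃[ e ] take (suc j) es ≡ take j es ++ e ∷ [] × cell (map toℕ es) j ≡ toℕ e × e ∈ es
take-suc zero    (e ∷ es) _        = e , refl , refl , here refl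
take-suc (suc j) (x ∷ es) (s≤s j<) with take-suc j es j<
... | e , eq , at , e∈ = e , cong (x ∷_) eq , at , there e∈

unique-snoc⁺ : ∀ {A : Set} {xs : List A} {x} → Unique xs → x ∉ xs → Unique (xs ++ x ∷ [])
unique-snoc⁺ {xs = []}     []      x∉ = [] ∷ []
unique-snoc⁺ {xs = y ∷ xs} (p ∷ u) x∉ =
  All.++⁺ p ((λ { refl → x∉ (here refl) }) ∷ []) ∷ unique-snoc⁺ u (x∉ ∘ there)

unique-snoc⁻ : ∀ {A : Set} {xs : List A} {x} → Unique (xs ++ x ∷ []) → Unique xs × x ∉ xs
unique-snoc⁻ {xs = []}     u       = [] , λ ()
unique-snoc⁻ {xs = y ∷ xs} (p ∷ u) with unique-snoc⁻ u | All.++⁻ xs p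
... | u′ , x∉ | p′ , (y≢x ∷ []) = (p′ ∷ u′) , λ { (here refl) → y≢x refl ; (there x∈) → x∉ x∈ }

All-sum : ∀ xs → All (_≤ sum xs) xs
All-sum []       = []
All-sum (x ∷ xs) = m≤m+n x (sum xs) ∷ All.map (λ le → ≤-trans le (m≤n+m (sum xs) x)) (All-sum xs)

sum-bound : ∀ {R xs} → All (_≤ R) xs → sum xs ≤ length xs * R
sum-bound []       = z≤n
sum-bound (p ∷ ps) = +-mono-≤ p (sum-bound ps)

Verdict : Set → List ℕ → Set
Verdict P ys = (ys ≡ 1 ∷ [] × P) ⊎ (ys ≡ 0 ∷ [] × ¬ P)

verdict-≤ : ∀ {P ys R} → 1 ≤ R → Verdict P ys → All (_≤ R) ys
verdict-≤ 1≤ (inj₁ (refl , _)) = 1≤ ∷ []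
verdict-≤ 1≤ (inj₂ (refl , _)) = z≤n ∷ []

module _ (I : Instance) where
  open Instance I

  enc : List ℕ
  enc = encodeInstance I

  base : ℕ
  base = 5 + m * 3

  length-enc : length enc ≡ base
  length-enc = cong (5 +_) (length-triples (toℕ ∘ src) (toℕ ∘ tgt) ℓ id)

  record Layout (a : ℕ → ℕ) : Set where
    field
      at-n    : a 0 ≡ n
      at-m    : a 1 ≡ m
      at-num  : a 2 ≡ num I
      at-den  : a 3 ≡ den I
      at-ϱ    : a 4 ≡ ϱ
      at-src  : ∀ e → a (5 + toℕ e * 3) ≡ toℕ (src e)
      at-tgt  : ∀ e → a (6 + toℕ e * 3) ≡ toℕ (tgt e)
      at-ℓ    : ∀ e → a (7 + toℕ e * 3) ≡ ℓ e

  edge-index-< : ∀ (e : Fin m) j → j < 3 → j + toℕ e * 3 < m * 3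
  edge-index-< e j j< = ≤-trans (+-monoˡ-< (toℕ e * 3) j<) (*-monoˡ-≤ 3 (Fin.toℕ<n e))

  layout : ∀ ys → Layout (cell (enc ++ ys))
  layout ys = record
    { at-n = refl ; at-m = refl ; at-num = refl ; at-den = refl ; at-ϱ = refl
    ; at-src = λ e → trans (skip-ys e 0 (s≤s z≤n)) (proj₁ (at e))
    ; at-tgt = λ e → trans (skip-ys e 1 (s≤s (s≤s z≤n))) (proj₁ (proj₂ (at e)))
    ; at-ℓ   = λ e → trans (skip-ys e 2 (s≤s (s≤s (s≤s z≤n)))) (proj₂ (proj₂ (at e))) }
    where
    at = triples-at (toℕ ∘ src) (toℕ ∘ tgt) ℓ id {const 0}
    skip-ys : ∀ e j → j < 3 → overlay (encodeEdges graph ++ ys) (const 0) (j + toℕ e * 3) ≡ cell (encodeEdges graph) (j + toℕ e * 3)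
    skip-ys e j j< = overlay-++ˡ (encodeEdges graph) ys
      (subst (j + toℕ e * 3 <_) (sym (length-triples (toℕ ∘ src) (toℕ ∘ tgt) ℓ id)) (edge-index-< e j j<))

  layout₀ : Layout (cell enc)
  layout₀ = subst (Layout ∘ cell) (++-identityʳ enc) (layout [])

  extra : ∀ ys i → cell (enc ++ ys) (base + i) ≡ cell ys i
  extra ys i = subst (λ b → cell (enc ++ ys) (b + i) ≡ cell ys i) length-enc (overlay-++ʳ enc ys (const 0) i)

  enc-⊒ : ∀ {ys} → cell (enc ++ ys) ⊒ enc
  enc-⊒ {ys} = ⊒-pointwise enc λ i i< → overlay-++ˡ enc ys i<

  -- `r` bounds the length and the entries of the input. Its fourth power leaves room for the
  -- largest intermediate quantities, such as a position in the table of all pairs, or 1 plus the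
  -- numerator of α times the total edge length. Both are opaque so that type checking never unfolds
  -- these powers.
  opaque
    r limit : ℕ
    r = room enc
    limit = r ^ 4

    r≡ : r ≡ room enc
    r≡ = refl

    limit≡ : limit ≡ r ^ 4
    limit≡ = refl

  abstract
    7≤r : 7 ≤ r
    7≤r = subst (7 ≤_) (sym r≡) (s≤s (s≤s (≤-trans (≤-trans (m≤m+n 5 (m * 3)) (≤-reflexive (sym length-enc))) (m≤m+n (length enc) (sum enc)))))

  instance
    r≢0 : NonZero r
    r≢0 = >-nonZero (≤-trans (s≤s z≤n) 7≤r)

  r^≤ : ∀ {k} → k ≤ 4 → r ^ k ≤ limit
  r^≤ {k} k≤ = subst (r ^ k ≤_) (sym limit≡) (^-monoʳ-≤ r k≤)

  r≤limit : r ≤ limit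
  r≤limit = ≤-trans (≤-reflexive (sym (^-identityʳ r))) (r^≤ {1} (s≤s z≤n))

  abstract
    7≤limit : 7 ≤ limit
    7≤limit = ≤-trans 7≤r r≤limit

  entry≤ : All (_≤ r) enc
  entry≤ = All.map (λ le → subst (_ ≤_) (sym r≡) (≤-trans le (≤-trans (m≤n+m (sum enc) (length enc)) (m≤n+m _ 2)))) (All-sum enc)

  at≤ : ∀ i → cell enc i ≤ r
  at≤ = overlay-≤ entry≤ (λ _ → z≤n)

  base≤ : base ≤ r
  base≤ = subst₂ _≤_ length-enc (sym r≡) (≤-trans (m≤m+n (length enc) (sum enc)) (m≤n+m _ 2))

  n≤ : n ≤ r
  n≤ = at≤ 0
  m≤ : m ≤ r
  m≤ = at≤ 1
  num≤ : num I ≤ r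
  num≤ = at≤ 2
  den≤ : den I ≤ r
  den≤ = at≤ 3
  ϱ≤ : ϱ ≤ r
  ϱ≤ = at≤ 4
  ℓ≤ : ∀ e → ℓ e ≤ r
  ℓ≤ e = subst (_≤ r) (Layout.at-ℓ layout₀ e) (at≤ (7 + toℕ e * 3))

  prod≤ : ∀ {x y} → x ≤ r → y ≤ r → x * y ≤ r ^ 2
  prod≤ x≤ y≤ = ≤-trans (*-mono-≤ x≤ y≤) (≤-reflexive (cong (r *_) (sym (*-identityʳ r))))

  +≤^ : ∀ {x y j k} → 1 ≤ j → 1 ≤ k → x ≤ r ^ j → y ≤ r ^ k → x + y ≤ r ^ (j + k)
  +≤^ {j = j} {k} 1≤j 1≤k x≤ y≤ = ≤-trans (+-mono-≤ x≤ y≤) (≤-trans (+≤* (two 1≤j) (two 1≤k))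
    (≤-reflexive (sym (^-distribˡ-+-* r j k))))
    where
    two : ∀ {j} → 1 ≤ j → 2 ≤ r ^ j
    two 1≤j = ≤-trans (≤-trans (s≤s (s≤s z≤n)) 7≤r) (≤-trans (≤-reflexive (sym (^-identityʳ r))) (^-monoʳ-≤ r 1≤j))

  +≤limit : ∀ {x y} → x ≤ r → y ≤ r → x + y ≤ limit
  +≤limit x≤ y≤ = ≤-trans (+≤^ {j = 1} {1} ≤-refl ≤-refl (≤-trans x≤ r≤) (≤-trans y≤ r≤)) (r^≤ (s≤s (s≤s z≤n)))
    where r≤ = ≤-reflexive (sym (^-identityʳ r))

-- The candidates for removal, and either the fact that they can be removed
-- all at once or the certificate Hard.
Prepared : (I : Instance) → Set → List ℕ → Set
Prepared I Hard ys = ∃[ c ] ∃[ X ] ys ≡ c ∷ bits X × (∀ e → Vec.lookup X e ≡ true ⇔ Removable I e) ×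
  ((c ≡ 1 × (∀ e → Removable I e → Detour I (Removable I) e)) ⊎ (c ≡ 0 × Hard))

-- Testing whether the edges of a tuple can be removed together.

testProgram : Program → Program
testProgram chk =
  1 ≔ get 0 (lit 1) ⨟
  2 ≔ lit 5 ⊕ (var 1 ⊛ lit 3) ⨟
  3 ≔ get 0 (lit 4) ⨟
  6 ≔ lit 1 ⨟
  call 1 skip 0 (var 2) ⨟
  for 4 3 mark ⨟
  for 4 3 check ⨟
  put 0 (lit 0) (var 6) ⨟
  0 ≔ lit 1 ⨟
  skip
  module TestProgram where
  -- Array 1 is built up as an input for `chk`: the instance, the marks of the removed edges and one
  -- edge. Register 6 is a product of bits that drops to 0 when an edge repeats, which weakly
  -- increasing tuples allow, or when an edge has no detour around the marked ones.
  mark check : Program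
  mark =
    5 ≔ get 0 (var 2 ⊕ var 4) ⨟
    6 ≔ var 6 ⊛ (lit 1 ⊝ get 1 (var 2 ⊕ var 5)) ⨟
    put 1 (var 2 ⊕ var 5) (lit 1) ⨟
    skip
  check =
    5 ≔ get 0 (var 2 ⊕ var 4) ⨟
    put 1 (var 2 ⊕ var 1) (var 5) ⨟
    call 2 chk 1 (var 2 ⊕ var 1 ⊕ lit 1) ⨟
    6 ≔ var 6 ⊛ get 2 (lit 0) ⨟
    skip

copies : ∀ {W R xs} → All (_≤ R) xs → 1 ≤ W → Calls W skip xs (_≡ xs) (length xs + 1 + length xs)
copies {xs = xs} xs≤ 1≤W = xs , _ , (initial xs , 1 , skip , sym (prefix⁻ (⊒-overlay xs (const 0))) , refl) , refl , ≤-refl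

module Test (I : Instance) (W : ℕ) (capacity : limit I ^ 16 ≤ W) (chk : Program) (Tc : ℕ)
  (chk-spec : ∀ F e → Calls W chk (enc I ++ bits F ++ toℕ e ∷ []) (Verdict (Detour I (_∈ˢ F) e)) Tc) where

  open Instance I
  open Logic (limit I) W (7≤limit I) capacity
  open TestProgram chk

  Status : Set → ℕ → Set
  Status P b = (b ≡ 1 × P) ⊎ (b ≡ 0 × ¬ P)

  status≤1 : ∀ {P b} → Status P b → b ≤ 1
  status≤1 (inj₁ (refl , _)) = ≤-refl
  status≤1 (inj₂ (refl , _)) = z≤n

  1≤limit : 1 ≤ limit I
  1≤limit = ≤-trans (s≤s z≤n) (7≤limit I)

  module _ (es : List (Fin m)) (len≡ : length es ≡ ϱ) where

    input : List ℕ
    input = enc I ++ map toℕ es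

    record Marks (F : Subset m) (fs : List (Fin m)) (a : ℕ → ℕ) : Set where
      constructor marked
      field
        starts : a ⊒ enc I
        cells  : ∀ f → a (base I + toℕ f) ≡ bit (Vec.lookup F f)
        ⇔marks : ∀ f → Vec.lookup F f ≡ true ⇔ f ∈ fs
    open Marks

    marks-add : ∀ {F fs e a} → Marks F fs a →
                Marks (F Vec.[ e ]≔ true) (fs ++ e ∷ []) (update a (base I + toℕ e) 1)
    marks-add {F} {fs} {e} {a} (marked a⊒ old F⇔) = marked
      (⊒-update a⊒ (subst (_≤ base I + toℕ e) (sym (length-enc I)) (m≤m+n (base I) (toℕ e)))) cells′ F′⇔
      where
      cells′ : ∀ f → update a (base I + toℕ e) 1 (base I + toℕ f) ≡ bit (Vec.lookup (F Vec.[ e ]≔ true) f)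
      cells′ f with f Fin.≟ e
      ... | yes refl = trans (update-≡ a 1 refl) (cong bit (sym (Vec.lookup∘update e F true)))
      ... | no f≢e   = trans (update-≢ a 1 (λ eq → f≢e (Fin.toℕ-injective (sym (+-cancelˡ-≡ (base I) _ _ eq)))))
                         (trans (old f) (cong bit (sym (Vec.lookup∘update′ f≢e F true))))
      F′⇔ : ∀ f → Vec.lookup (F Vec.[ e ]≔ true) f ≡ true ⇔ f ∈ fs ++ e ∷ []
      F′⇔ f with f Fin.≟ e
      ... | yes refl = mk⇔ (λ _ → ∈-++⁺ʳ fs (here refl)) (λ _ → Vec.lookup∘update e F true)
      ... | no f≢e   = mk⇔ (λ eq → ∈-++⁺ˡ (Equivalence.to (F⇔ f) (trans (sym (Vec.lookup∘update′ f≢e F true)) eq)))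
        λ f∈ → trans (Vec.lookup∘update′ f≢e F true) (case ∈-++⁻ fs f∈ of λ where
          (inj₁ f∈fs)        → Equivalence.from (F⇔ f) f∈fs
          (inj₂ (here refl)) → contradiction refl f≢e)

    Inv₁ : ℕ → State → Set
    Inv₁ j s = (∃[ F ] Marks F (take j es) (arrays s 1)) × Status (Unique (take j es)) (regs s 6)

    Inv₂ : ℕ → State → Set
    Inv₂ j s = (∃[ F ] Marks F es (arrays s 1)) × 
               Status (Unique es × (∀ {e} → e ∈ take j es → Detour I (_∈ es) e)) (regs s 6)

    module _ {s₀ s₁ : State} {p : Program} (arr₀ : arrays s₀ 0 ≡ cell input) (reg₂ : regs s₀ 2 ≡ base I)
             (kept₂ : regs s₁ 2 ≡ regs s₀ 2) (kept₀ : arrays s₁ 0 ≡ arrays s₀ 0) where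

      read : ∀ {j v} → regs s₁ 4 ≡ j → cell (map toℕ es) j ≡ v → arrays s₁ 0 (regs s₁ 2 + regs s₁ 4) ≡ v
      read {j} r₄ at-j = trans (cong₂ (λ a i → a i) (trans kept₀ arr₀) (cong₂ _+_ (trans kept₂ reg₂) r₄))
                           (trans (extra I (map toℕ es) j) at-j)

    mark-step : ∀ {s₀} → arrays s₀ 0 ≡ cell input → regs s₀ 2 ≡ base I → ∀ j s₁ → j < ϱ → Small s₁ →
      Frame (for 4 3 mark) s₀ s₁ → regs s₁ 4 ≡ j → regs s₁ 3 ≡ ϱ → Inv₁ j s₁ →
      Exec mark s₁ (λ s₂ → Inv₁ (suc j) (setReg 4 (suc j) s₂)) 20
    mark-step {s₀} arr₀ reg₂ j s₁ j< S F r₄ _ ((X , marks) , status) with take-suc j es (subst (j <_) (sym len≡) j<)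
    ... | e , take≡ , at-j , _ =
      assign= S (read {s₀} {s₁} {mark} arr₀ reg₂ (reg F 2) (arr F 0) r₄ at-j) (≤-trans (<⇒≤ (Fin.toℕ<n e)) (≤-trans (m≤ I) (r≤limit I))) λ S →
      assign= S (cong (λ i → regs s₁ 6 * (1 ∸ arrays s₁ 1 (i + toℕ e))) (trans (reg F 2) reg₂))
        (≤-trans (*-mono-≤ (status≤1 status) (m∸n≤m 1 (arrays s₁ 1 (base I + toℕ e)))) 1≤limit) λ S →
      put= S (cong (_+ toℕ e) (trans (reg F 2) reg₂)) refl 1≤limit λ S →
      skipE S ((_ , subst (λ fs → Marks _ fs (update (arrays s₁ 1) (base I + toℕ e) 1)) (sym take≡) (marks-add {e = e} marks)) ,
        subst (λ fs → Status (Unique fs) (regs s₁ 6 * (1 ∸ arrays s₁ 1 (base I + toℕ e)))) (sym take≡) (new (Vec.lookup X e) refl status))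
      where
      new : ∀ b → Vec.lookup X e ≡ b → ∀ {k} → Status (Unique (take j es)) k →
            Status (Unique (take j es ++ e ∷ [])) (k * (1 ∸ arrays s₁ 1 (base I + toℕ e)))
      new b eq st rewrite trans (cells marks e) (cong bit eq) with b | st
      ... | true  | inj₁ (refl , _) = inj₂ (refl , λ u → proj₂ (unique-snoc⁻ u) (Equivalence.to (⇔marks marks e) eq))
      ... | false | inj₁ (refl , u) = inj₁ (refl , unique-snoc⁺ u λ e∈ → case trans (sym eq) (Equivalence.from (⇔marks marks e) e∈) of λ ())
      ... | _     | inj₂ (refl , ¬u) = inj₂ (refl , λ u → ¬u (proj₁ (unique-snoc⁻ u)))

    check-step : ∀ {s₀} → arrays s₀ 0 ≡ cell input → regs s₀ 2 ≡ base I → regs s₀ 1 ≡ m → ∀ j s₁ → j < ϱ → Small s₁ →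
      Frame (for 4 3 check) s₀ s₁ → regs s₁ 4 ≡ j → regs s₁ 3 ≡ ϱ → Inv₂ j s₁ →
      Exec check s₁ (λ s₂ → Inv₂ (suc j) (setReg 4 (suc j) s₂)) (16 + (Tc + 6))
    check-step {s₀} arr₀ reg₂ reg₁ j s₁ j< S F r₄ _ ((X , marked a⊒ old X⇔) , status) with take-suc j es (subst (j <_) (sym len≡) j<)
    ... | e , take≡ , at-j , _ =
      assign= S (read {s₀} {s₁} {check} arr₀ reg₂ (reg F 2) (arr F 0) r₄ at-j) (≤-trans (<⇒≤ (Fin.toℕ<n e)) (≤-trans (m≤ I) (r≤limit I))) λ S →
      put= S (cong₂ _+_ (trans (reg F 2) reg₂) (trans (reg F 1) reg₁)) refl (reg≤ S 5) λ S →
      call⨾ S query (chk-spec X e) (λ ys v _ → verdict-≤ 1≤limit v) λ ys v S →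
      assign= S refl (≤-trans (*-mono-≤ (status≤1 status) (verdict-cell v)) 1≤limit) λ S →
      skipE S ((X , marked array⊒ (λ f → trans (update-≢ (arrays s₁ 1) _ (λ eq → <-irrefl (sym (+-cancelˡ-≡ (base I) _ _ eq)) (Fin.toℕ<n f))) (old f)) X⇔) ,
        subst (λ fs → Status (Unique es × (∀ {e} → e ∈ fs → Detour I (_∈ es) e)) _) (sym take≡) (new v status))
      where
      array = update (arrays s₁ 1) (base I + m) (toℕ e)
      array⊒ : array ⊒ enc I
      array⊒ = ⊒-update a⊒ (subst (_≤ base I + m) (sym (length-enc I)) (m≤m+n (base I) m))
      query : slice (setCell 1 (base I + m) (toℕ e) (setReg 5 (toℕ e) s₁)) 1 (regs s₁ 2 + regs s₁ 1 + 1) ≡ enc I ++ bits X ++ toℕ e ∷ []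
      query = slice-⊒ _ (⊒-++ (enc I) array⊒ (⊒-++ (bits X) (bits-⊒ X bits′) (⊒-∷ last′ ⊒-[]))) lengths
        where
        bits′ : ∀ f → array (length (enc I) + toℕ f) ≡ bit (Vec.lookup X f)
        bits′ f = subst (λ b → array (b + toℕ f) ≡ bit (Vec.lookup X f)) (sym (length-enc I))
          (trans (update-≢ (arrays s₁ 1) _ (λ eq → <-irrefl (sym (+-cancelˡ-≡ (base I) _ _ eq)) (Fin.toℕ<n f))) (old f))
        last′ : array (length (enc I) + (length (bits X) + 0)) ≡ toℕ e
        last′ = update-≡ (arrays s₁ 1) _ (sym (cong₂ _+_ (length-enc I) (trans (+-identityʳ _) (length-bits X))))
        lengths : regs s₁ 2 + regs s₁ 1 + 1 ≡ length (enc I ++ bits X ++ toℕ e ∷ [])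
        lengths = begin
          regs s₁ 2 + regs s₁ 1 + 1                          ≡⟨ cong₂ (λ a b → a + b + 1) (trans (reg F 2) reg₂) (trans (reg F 1) reg₁) ⟩
          base I + m + 1                                     ≡⟨ +-assoc (base I) m 1 ⟩
          base I + (m + 1)                                   ≡⟨ cong₂ (λ a b → a + (b + 1)) (length-enc I) (length-bits X) ⟨
          length (enc I) + (length (bits X) + 1)             ≡⟨ cong (length (enc I) +_) (length-++ (bits X)) ⟨
          length (enc I) + length (bits X ++ toℕ e ∷ [])     ≡⟨ length-++ (enc I) ⟨
          length (enc I ++ bits X ++ toℕ e ∷ [])             ∎
          where open ≡-Reasoning
      lookup⇒∈ : ∀ {f} → Vec.lookup X f ≡ true → f ∈ˢ X
      lookup⇒∈ {f} = Vec.lookup⇒[]= f X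
      ∈⇒lookup : ∀ {f} → f ∈ˢ X → Vec.lookup X f ≡ true
      ∈⇒lookup = Vec.[]=⇒lookup
      verdict-cell : ∀ {P ys g} → Verdict P ys → overlay ys g 0 ≤ 1
      verdict-cell (inj₁ (refl , _)) = ≤-refl
      verdict-cell (inj₂ (refl , _)) = z≤n
      new : ∀ {ys g k} → Verdict (Detour I (_∈ˢ X) e) ys → Status (Unique es × (∀ {e} → e ∈ take j es → Detour I (_∈ es) e)) k →
            Status (Unique es × (∀ {f} → f ∈ take j es ++ e ∷ [] → Detour I (_∈ es) f)) (k * overlay ys g 0)
      new (inj₁ (refl , d)) (inj₁ (refl , u , ds)) = inj₁ (refl , u , λ f∈ → case ∈-++⁻ (take j es) f∈ of λ where
        (inj₁ f∈′)         → ds f∈′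
        (inj₂ (here refl)) → detour-mono I (λ {f} f∈ → lookup⇒∈ (Equivalence.from (X⇔ f) f∈)) d)
      new (inj₂ (refl , ¬d)) (inj₁ (refl , u , ds)) = inj₂ (refl , λ (_ , ds′) → ¬d
        (detour-mono I (λ {f} f∈ → Equivalence.to (X⇔ f) (∈⇒lookup f∈)) (ds′ (∈-++⁺ʳ (take j es) (here refl)))))
      new (inj₁ (refl , _)) (inj₂ (refl , ¬ok)) = inj₂ (refl , λ (u , ds) → ¬ok (u , ds ∘ ∈-++⁺ˡ))
      new (inj₂ (refl , _)) (inj₂ (refl , ¬ok)) = inj₂ (refl , λ (u , ds) → ¬ok (u , ds ∘ ∈-++⁺ˡ))

    verdict : ∀ {b} → Status (Removal I es) b → Verdict (Removal I es) (b ∷ [])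
    verdict (inj₁ (refl , r))  = inj₁ (refl , r)
    verdict (inj₂ (refl , ¬r)) = inj₂ (refl , ¬r)

    take-ϱ : take ϱ es ≡ es
    take-ϱ = take-all ϱ es (≤-reflexive len≡)

    input≤ : All (_≤ limit I) input
    input≤ = All.++⁺ (All.map (λ le → ≤-trans le (r≤limit I)) (entry≤ I))
      (All.map⁺ (All.tabulate λ {e} _ → ≤-trans (<⇒≤ (Fin.toℕ<n e)) (≤-trans (m≤ I) (r≤limit I))))

    length-input : length input ≡ base I + ϱ
    length-input = trans (length-++ (enc I)) (cong₂ _+_ (length-enc I) (trans (length-map toℕ es) len≡))

    empty-marks : ∀ s → Marks Subset.⊥ [] (overlay (enc I) (arrays (initial s) 1))
    empty-marks s = marked (⊒-overlay (enc I) (const 0))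
      (λ f → trans (overlay-≥ (enc I) {const 0} (subst (_≤ base I + toℕ f) (sym (length-enc I)) (m≤m+n (base I) (toℕ f))))
               (cong bit (sym (Vec.lookup-replicate f false))))
      λ f → mk⇔ (λ eq → case trans (sym (Vec.lookup-replicate f false)) eq of λ ()) (λ ())

    test-exec : Exec (testProgram chk) (initial input) (λ s → Verdict (Removal I es) (output s) × regs s 0 ≤ 1)
                  (16 + (length (enc I) + 1 + length (enc I) +
                    (2 + (ϱ * (20 + 8) + 4) + (2 + (ϱ * (16 + (Tc + 6) + 8) + 4) + 6))))
    test-exec =
      assign= (initial-small input≤ (subst (_≤ limit I) (sym length-input) (+≤limit I (base≤ I) (ϱ≤ I)))) refl (≤-trans (m≤ I) (r≤limit I)) λ S →
      assign= S refl (≤-trans (base≤ I) (r≤limit I)) λ S →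
      assign= S refl (≤-trans (ϱ≤ I) (r≤limit I)) λ S →
      assign= S refl 1≤limit λ S →
      call⨾ S (slice-⊒ _ (enc-⊒ I {map toℕ es}) (sym (length-enc I)))
        (copies (All.map (λ le → ≤-trans le (r≤limit I)) (entry≤ I)) (≤-trans 1≤limit (≤-trans (R≤R^ {16} (s≤s z≤n)) capacity)))
        (λ { _ refl _ → All.map (λ le → ≤-trans le (r≤limit I)) (entry≤ I) }) λ { _ refl S →
      seq⨾ (forE Inv₁ S refl ((_ , empty-marks input) , inj₁ (refl , [])) (mark-step refl refl)) λ {s₁} S₁ F₁ ((X , marks) , status) →
      seq⨾ (forE Inv₂ S₁ (reg F₁ 3) ((X , subst (λ fs → Marks X fs (arrays s₁ 1)) take-ϱ marks) , start status)
              (check-step (arr F₁ 0) (reg F₁ 2) (reg F₁ 1))) λ {s₂} S₂ F₂ (_ , status₂) →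
      put= S₂ refl refl (reg≤ S₂ 6) λ S →
      assign= S refl 1≤limit λ S →
      skipE S (verdict (finish status₂) , ≤-refl) }
      where
      start : ∀ {b} → Status (Unique (take ϱ es)) b → Status (Unique es × (∀ {e} → e ∈ [] → Detour I (_∈ es) e)) b
      start (inj₁ (refl , u))  = inj₁ (refl , subst Unique take-ϱ u , λ ())
      start (inj₂ (refl , ¬u)) = inj₂ (refl , λ (u , _) → ¬u (subst Unique (sym take-ϱ) u))
      finish : ∀ {b} → Status (Unique es × (∀ {e} → e ∈ take ϱ es → Detour I (_∈ es) e)) b → Status (Removal I es) b
      finish (inj₁ (refl , u , ds)) = inj₁ (refl , u , λ {e} e∈ → ds (subst (e ∈_) (sym take-ϱ) e∈))
      finish (inj₂ (refl , ¬r))     = inj₂ (refl , λ (u , ds) → ¬r (u , λ {e} e∈ → ds (subst (e ∈_) take-ϱ e∈)))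

    test-calls : Calls W (testProgram chk) input (Verdict (Removal I es)) (ϱ * (Tc + 59) + m * 9 + 51)
    test-calls with toCalls test-exec
    ... | ys , t , run , v , t≤ = ys , t , run , v , ≤-trans t≤ (≤-reflexive
      (trans (cong₂ (λ a b → a + (16 + (b + 1 + b + rest)) + 1) length-input (length-enc I)) (total ϱ m Tc)))
      where
      rest = 2 + (ϱ * (20 + 8) + 4) + (2 + (ϱ * (16 + (Tc + 6) + 8) + 4) + 6)
      total : ∀ ϱ m Tc → 5 + m * 3 + ϱ + (16 + (5 + m * 3 + 1 + (5 + m * 3) + (2 + (ϱ * (20 + 8) + 4) +
                (2 + (ϱ * (16 + (Tc + 6) + 8) + 4) + 6)))) + 1 ≡ ϱ * (Tc + 59) + m * 9 + 51
      total = solve-∀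

-- The search through the tuples.

module MainProgram (prep chk : Program) where

  -- Register 1 holds m, register 2 the length of the encoded instance, register 3 ϱ and register 6
  -- the number k of candidates. Register 7 says whether to go on and register 8 whether a solution
  -- was found. Array 2 lists the candidates, array 3 the current tuple of positions in that list.
  refuse collect fill advance round search locate main : Program

  -- The flags in array `a` mark the removed edges, while the output lists the edges kept; hence the
  -- complement.
  write : ℕ → Program
  write a =
    for 4 1 (put 0 (lit 1 ⊕ var 4) (lit 1 ⊝ get a (lit 1 ⊕ var 4)) ⨟ skip) ⨟
    put 0 (lit 0) (lit 1) ⨟
    0 ≔ lit 1 ⊕ var 1 ⨟
    skip

  refuse = put 0 (lit 0) (lit 0) ⨟ 0 ≔ lit 1 ⨟ skip

  collect = ite (get 1 (lit 1 ⊕ var 4)) (put 2 (var 6) (var 4) ⨟ 6 ≔ var 6 ⊕ lit 1 ⨟ skip) skip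

  locate =
    1 ≔ get 0 (lit 1) ⨟
    2 ≔ lit 5 ⊕ (var 1 ⊛ lit 3) ⨟
    3 ≔ get 0 (lit 4) ⨟
    call 1 prep 0 (var 2) ⨟
    6 ≔ lit 0 ⨟
    for 4 1 collect ⨟
    skip

  fill = put 0 (var 2 ⊕ var 4) (get 2 (get 3 (var 4))) ⨟ skip

  -- The successor of a weakly increasing tuple in colexicographic order.  The
  -- cells behind the tuple hold k − 1 and k, which stops the carry.
  advance =
    put 3 (lit 0) (get 3 (lit 0) ⊕ lit 1) ⨟
    9 ≔ lit 0 ⨟
    loop (get 3 (var 9) ⊝ get 3 (var 9 ⊕ lit 1))
      (put 3 (var 9) (lit 0) ⨟
       9 ≔ var 9 ⊕ lit 1 ⨟
       put 3 (var 9) (get 3 (var 9) ⊕ lit 1) ⨟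
       skip) ⨟
    ite (var 3 ⊝ var 9) skip (7 ≔ lit 0 ⨟ skip)

  round =
    for 4 3 fill ⨟
    call 4 (testProgram chk) 0 (var 2 ⊕ var 3) ⨟
    ite (get 4 (lit 0)) (8 ≔ lit 1 ⨟ 7 ≔ lit 0 ⨟ skip) advance

  search =
    put 3 (var 3) (var 6 ⊝ lit 1) ⨟
    put 3 (var 3 ⊕ lit 1) (var 6) ⨟
    7 ≔ lit 1 ⨟
    8 ≔ lit 0 ⨟
    skip

  main =
    locate ⨟
    ite (var 3 ⊝ var 6) refuse
      (ite (get 1 (lit 0)) (write 1)
        (search ⨟ (loop (var 7) round ⨟
          ite (var 8)
            (for 4 3 (put 5 (lit 1 ⊕ get 2 (get 3 (var 4))) (lit 1) ⨟ skip) ⨟ write 5)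
            refuse)))

⊒-snoc : ∀ {f xs x} → f ⊒ xs → update f (length xs) x ⊒ xs ++ x ∷ []
⊒-snoc {f} {xs} {x} f⊒ = ⊒-++ xs (⊒-update f⊒ ≤-refl)
  (⊒-∷ (update-≡ f x (sym (+-identityʳ (length xs)))) ⊒-[])

⊒-cell : ∀ {f} xs {i} → f ⊒ xs → i < length xs → f i ≡ cell xs i
⊒-cell (x ∷ xs) {zero}  (prefix p) _        = ∷-injectiveˡ p
⊒-cell (x ∷ xs) {suc i} (prefix p) (s≤s i<) = ⊒-cell xs (prefix (∷-injectiveʳ p)) i<

select : ∀ {k} (cs : List (Fin k)) ϱ (d : ℕ → ℕ) → (∀ i → i < ϱ → d i < length cs) →
  Σ (List (Fin k)) λ es → length es ≡ ϱ × (∀ i → i < ϱ → cell (map toℕ es) i ≡ cell (map toℕ cs) (d i))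
select cs zero    d d< = [] , refl , λ _ ()
select {k} cs (suc ϱ) d d< with select cs ϱ (d ∘ suc) (λ i i< → d< (suc i) (s≤s i<)) | pick cs (d 0) (d< 0 (s≤s z≤n))
  where
  pick : ∀ (cs : List (Fin k)) i → i < length cs → ∃[ e ] toℕ {k} e ≡ cell (map toℕ cs) i
  pick (c ∷ cs) zero    _        = c , refl
  pick (c ∷ cs) (suc i) (s≤s i<) = pick cs i i<
... | es , len≡ , at | e , eq = e ∷ es , cong suc len≡ , λ { zero _ → eq ; (suc i) (s≤s i<) → at i i< }

module Main (I : Instance) (W : ℕ) (capacity : limit I ^ 16 ≤ W) (prep chk : Program) (Tp Tc : ℕ) (Hard : Set)
  (prep-spec : Calls W prep (enc I) (Prepared I Hard) Tp)
  (chk-spec : ∀ F e → Calls W chk (enc I ++ bits F ++ toℕ e ∷ []) (Verdict (Detour I (_∈ˢ F) e)) Tc) where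

  open Instance I
  open Logic (limit I) W (7≤limit I) capacity
  open Test I W capacity chk Tc chk-spec using (1≤limit; test-calls)
  open MainProgram prep chk

  ∈∁⇔ : ∀ (X : Subset m) e → e ∉ˢ ∁ X ⇔ Vec.lookup X e ≡ true
  ∈∁⇔ X e = mk⇔ (λ e∉ → Vec.[]=⇒lookup (decidable-stable (e Subset.∈? X) (e∉ ∘ Subset.x∉p⇒x∈∁p)))
    λ eq e∈ → Subset.x∈∁p⇒x∉p e∈ (Vec.lookup⇒[]= e X eq)

  fin-< : ∀ {j} → j < m → ∃[ e ] toℕ {m} e ≡ j
  fin-< j< = Fin.fromℕ< j< , Fin.toℕ-fromℕ< j<

  <suc : ∀ {i j} → i < suc j → i ≢ j → i < j
  <suc (s≤s i≤) i≢j = ≤∧≢⇒< i≤ i≢j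

  refuse-exec : ∀ {s} → Small s → Exec refuse s (λ s → output s ≡ 0 ∷ [] × regs s 0 ≤ suc m) 6
  refuse-exec S = put= S refl refl z≤n λ S → assign= S refl 1≤limit λ S → skipE S (refl , s≤s z≤n)

  write-exec : ∀ a {safe₀ : ∀ s → Safe (lit 1 ⊝ get a (lit 1 ⊕ var 4)) s}
    {kept : T (keepsArr a (for 4 1 (put 0 (lit 1 ⊕ var 4) (lit 1 ⊝ get a (lit 1 ⊕ var 4)) ⨟ skip)))} {s} {X : Subset m} → Small s → regs s 1 ≡ m →
    (∀ e → arrays s a (suc (toℕ e)) ≡ bit (Vec.lookup X e)) →
    Exec (write a) s (λ s → output s ≡ 1 ∷ bits (∁ X) × regs s 0 ≤ suc m) (2 + (m * (11 + 8) + 4) + 8)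
  write-exec a {safe₀} {kept} {s} {X} S r₁ flags =
    seq⨾ (forE Inv S r₁ (λ _ ()) body) λ {s₁} S₁ F₁ inv →
    put= S₁ refl refl 1≤limit λ S →
    assign= S (cong suc (trans (reg F₁ 1) r₁)) (+≤limit I (≤-trans (s≤s z≤n) (7≤r I)) (m≤ I)) λ S →
    skipE S (slice-⊒ (suc m) (⊒-∷ {update (arrays s₁ 0) 0 1} refl (bits-⊒ (∁ X) λ e → inv e (Fin.toℕ<n e))) (cong suc (sym (length-bits (∁ X)))) , ≤-refl)
    where
    Inv : ℕ → State → Set
    Inv j s = ∀ e → toℕ e < j → arrays s 0 (suc (toℕ e)) ≡ bit (Vec.lookup (∁ X) e)
    not-bit : ∀ b → 1 ∸ bit b ≡ bit (not b)
    not-bit true  = refl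
    not-bit false = refl
    body : ∀ j s₁ → j < m → Small s₁ → Frame _ s s₁ → regs s₁ 4 ≡ j → regs s₁ 1 ≡ m → Inv j s₁ →
           Exec _ s₁ (λ s₂ → Inv (suc j) (setReg 4 (suc j) s₂)) 11
    body j s₁ j< S F r₄ _ inv with fin-< j<
    ... | e , refl = put= S {_} {safe₀ _} (cong suc r₄) value′ (bit≤ (not (Vec.lookup X e))) λ S → skipE S inv′
      where
      bit≤ : ∀ b → bit b ≤ limit I
      bit≤ b = ≤-trans (bit≤1 b) 1≤limit
      value′ : 1 ∸ arrays s₁ a (1 + regs s₁ 4) ≡ bit (not (Vec.lookup X e))
      value′ = trans (cong₂ (λ f i → 1 ∸ f (suc i)) (arr F a {kept}) r₄) (trans (cong (1 ∸_) (flags e)) (not-bit _))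
      inv′ : ∀ f → toℕ f < suc (toℕ e) → update (arrays s₁ 0) (suc (toℕ e)) (bit (not (Vec.lookup X e))) (suc (toℕ f)) ≡ bit (Vec.lookup (∁ X) f)
      inv′ f f< with f Fin.≟ e
      ... | yes refl = trans (update-≡ (arrays s₁ 0) {suc (toℕ e)} _ refl) (cong bit (sym (Vec.lookup-map f not X)))
      ... | no f≢e = trans (update-≢ (arrays s₁ 0) _ (f≢e ∘ sym ∘ Fin.toℕ-injective ∘ suc-injective)) (inv f (<suc f< (f≢e ∘ Fin.toℕ-injective)))

  -- The candidates found among the first j edges, with their positions.
  Found : Subset m → ℕ → (ℕ → ℕ) → ℕ → Set
  Found X j a k = ∃[ cs ] Unique cs × (∀ e → e ∈ cs ⇔ (Vec.lookup X e ≡ true × toℕ e < j)) × a ⊒ map toℕ cs × k ≡ length cs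

  collect-exec : ∀ {X s} → Small s → regs s 1 ≡ m → regs s 6 ≡ 0 →
    (∀ e → arrays s 1 (suc (toℕ e)) ≡ bit (Vec.lookup X e)) →
    Exec (for 4 1 collect) s (λ s → Found X m (arrays s 2) (regs s 6)) (2 + (m * (13 + 8) + 4))
  collect-exec {X} {s} S r₁ r₆ flags = forE (λ j s → Found X j (arrays s 2) (regs s 6)) S r₁
    ([] , [] , (λ e → mk⇔ (λ ()) λ { (_ , ()) }) , ⊒-[] , r₆) body
    where
    body : ∀ j s₁ → j < m → Small s₁ → Frame (for 4 1 collect) s s₁ → regs s₁ 4 ≡ j → regs s₁ 1 ≡ m →
           Found X j (arrays s₁ 2) (regs s₁ 6) →
           Exec collect s₁ (λ s₂ → Found X (suc j) (arrays s₂ 2) (regs s₂ 6)) 13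
    body j s₁ j< S F r₄ _ (cs , u , cs⇔ , a⊒ , k≡) with fin-< j<
    ... | e , refl = choose (Vec.lookup X e) refl
      where
      flag : arrays s₁ 1 (suc (regs s₁ 4)) ≡ bit (Vec.lookup X e)
      flag = trans (cong₂ (λ f i → f (suc i)) (arr F 1) r₄) (flags e)
      k≤m : length cs ≤ toℕ e
      k≤m = subst (length cs ≤_) (length-upTo (toℕ e)) (subst (_≤ length (upTo (toℕ e))) (length-map toℕ cs)
        (length-⊆ (Unique.map⁺ Fin.toℕ-injective u) λ i∈ → case ∈-map⁻ toℕ i∈ of λ where
          (f , f∈ , refl) → ∈-upTo⁺ (proj₂ (Equivalence.to (cs⇔ f) f∈))))
      choose : ∀ b → Vec.lookup X e ≡ b → Exec collect s₁ (λ s₂ → Found X (suc (toℕ e)) (arrays s₂ 2) (regs s₂ 6)) 13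
      choose false eq = weaken (λ _ _ q → q) (m≤m+n 6 7) (iteElse S (trans flag (cong bit eq))
        (skipE S (cs , u , (λ f → mk⇔
          (λ f∈ → case Equivalence.to (cs⇔ f) f∈ of λ (x , f<) → x , m≤n⇒m≤1+n f<)
          (λ (x , f<) → Equivalence.from (cs⇔ f) (x , <suc f< λ f≡e →
             case trans (sym eq) (trans (cong (Vec.lookup X) (sym (Fin.toℕ-injective f≡e))) x) of λ ()))) , a⊒ , k≡)))
      choose true eq = iteThen S (λ z → case trans (sym (trans flag (cong bit eq))) z of λ ())
        (put= S k≡ r₄ (≤-trans (<⇒≤ j<) (≤-trans (m≤ I) (r≤limit I))) λ S →
         assign= S (trans (cong (_+ 1) k≡) (+-comm (length cs) 1)) (≤-trans (s≤s k≤m) (≤-trans j< (≤-trans (m≤ I) (r≤limit I)))) λ S →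
         skipE S (cs ++ e ∷ [] , unique-snoc⁺ u (λ e∈ → <-irrefl refl (proj₂ (Equivalence.to (cs⇔ e) e∈))) , new⇔ ,
           subst₂ (λ l xs → update (arrays s₁ 2) l (toℕ e) ⊒ xs) (length-map toℕ cs) (sym (map-++ toℕ cs (e ∷ []))) (⊒-snoc a⊒) ,
           sym (trans (length-++ cs) (+-comm (length cs) 1))))
        where
        new⇔ : ∀ f → f ∈ cs ++ e ∷ [] ⇔ (Vec.lookup X f ≡ true × toℕ f < suc (toℕ e))
        new⇔ f = mk⇔
          (λ f∈ → case ∈-++⁻ cs f∈ of λ where
            (inj₁ f∈cs)        → case Equivalence.to (cs⇔ f) f∈cs of λ (x , f<) → x , m≤n⇒m≤1+n f<
            (inj₂ (here refl)) → eq , ≤-refl)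
          λ (x , f<) → case f Fin.≟ e of λ where
            (yes refl) → ∈-++⁺ʳ cs (here refl)
            (no f≢e)   → ∈-++⁺ˡ (Equivalence.from (cs⇔ f) (x , <suc f< (f≢e ∘ Fin.toℕ-injective)))

  Located : State → Set
  Located s = regs s 1 ≡ m × regs s 2 ≡ base I × regs s 3 ≡ ϱ ×
    arrays s 0 ⊒ enc I × (∀ i → arrays s 3 i ≡ 0) × (∀ i → arrays s 5 i ≡ 0) ×
    ∃[ c ] ∃[ X ] arrays s 1 0 ≡ c × (∀ e → arrays s 1 (suc (toℕ e)) ≡ bit (Vec.lookup X e)) ×
      (∀ e → Vec.lookup X e ≡ true ⇔ Removable I e) ×
      ((c ≡ 1 × (∀ e → Removable I e → Detour I (Removable I) e)) ⊎ (c ≡ 0 × Hard)) ×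
      Found X m (arrays s 2) (regs s 6)

  locate-exec : Exec locate (initial (enc I)) Located (14 + (Tp + (2 + ((2 + (m * (13 + 8) + 4)) + 1))))
  locate-exec =
    assign= (initial-small (All.map (λ le → ≤-trans le (r≤limit I)) (entry≤ I))
      (subst (_≤ limit I) (sym (length-enc I)) (≤-trans (base≤ I) (r≤limit I)))) refl (≤-trans (m≤ I) (r≤limit I)) λ S →
    assign= S refl (≤-trans (base≤ I) (r≤limit I)) λ S →
    assign= S refl (≤-trans (ϱ≤ I) (r≤limit I)) λ S →
    call⨾ S (slice-⊒ _ (⊒-overlay (enc I) (const 0)) (sym (length-enc I))) prep-spec
      (λ { _ (c , X , refl , _ , cc) _ → c≤ cc ∷ All.map (λ le → ≤-trans le 1≤limit) (bits≤1 X) })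
      λ { _ (c , X , refl , X⇔ , cc) S →
    assign= S refl z≤n λ S →
    seq⨾ (collect-exec {X} S refl refl (bits-at X)) λ S F found →
    skipE S (reg F 1 , reg F 2 , reg F 3 , subst (_⊒ enc I) (sym (arr F 0)) (⊒-overlay (enc I) (const 0)) ,
      (λ i → cong (_$ i) (arr F 3)) , (λ i → cong (_$ i) (arr F 5)) ,
      c , X , cong (_$ 0) (arr F 1) , (λ e → trans (cong (_$ suc (toℕ e)) (arr F 1)) (bits-at X e)) , X⇔ , cc , found) }
    where
    c≤ : ∀ {A B : Set} {c} → (c ≡ 1 × A) ⊎ (c ≡ 0 × B) → c ≤ limit I
    c≤ (inj₁ (refl , _)) = 1≤limit
    c≤ (inj₂ (refl , _)) = z≤n

  module Search {cs : List (Fin m)} (cs-unique : Unique cs) (cs⇔ : ∀ e → e ∈ cs ⇔ Removable I e) (ϱ≤k : ϱ ≤ length cs) where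

    k : ℕ
    k = length cs

    ν : ℕ → ℕ
    ν = cell (map toℕ cs)

    Selects : (ℕ → ℕ) → List (Fin m) → Set
    Selects d es = length es ≡ ϱ × (∀ i → i < ϱ → cell (map toℕ es) i ≡ ν (d i))

    Solution : (ℕ → ℕ) → Set
    Solution e = Tuple k ϱ e × ∃[ es ] Selects e es × Removal I es

    -- The state of the search before a test. `minimal` expresses that no solution has been passed;
    -- `top` and `end` are the two sentinels behind the tuple.
    record Head (d : ℕ → ℕ) : Set where
      field
        tuple   : Tuple k ϱ d
        top     : d ϱ ≡ k ∸ 1
        end     : d (suc ϱ) ≡ k
        minimal : ∀ e → Solution e → Same ϱ d e ⊎ Before ϱ d e
    open Head

    k≤m : k ≤ m
    k≤m = subst (k ≤_) (length-tabulate id) (length-⊆ cs-unique λ _ → ∈-allFin _)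

    <⇒≤∸1 : ∀ {a b} → a < b → a ≤ b ∸ 1
    <⇒≤∸1 (s≤s a≤) = a≤

    increase : ∀ {d i} → Head d → i < ϱ → d i ≤ d (suc i)
    increase {d} {i} h i< with m≤n⇒m<n∨m≡n i<
    ... | inj₁ i+1< = increasing (tuple h) i i+1<
    ... | inj₂ refl = subst (d i ≤_) (sym (top h)) (<⇒≤∸1 (digits (tuple h) i i<))

    digit≤ : ∀ {d i} → Head d → i ≤ ϱ → d i ≤ k ∸ 1
    digit≤ h i≤ with m≤n⇒m<n∨m≡n i≤
    ... | inj₁ i<   = <⇒≤∸1 (digits (tuple h) _ i<)
    ... | inj₂ refl = ≤-reflexive (top h)

    bump-carry : ∀ {i d d′} → Bump i d d′ → Bump (suc i) d (update (update d′ i 0) (suc i) (suc (d (suc i))))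
    bump-carry {i} {d} {d′} b = record
      { low   = λ l l< → trans (update-≢ (update d′ i 0) _ (<⇒≢ l< ∘ sym)) (case m≤n⇒m<n∨m≡n (≤-pred l<) of λ where
          (inj₁ l<i)  → trans (update-≢ d′ _ (<⇒≢ l<i ∘ sym)) (low b l l<i)
          (inj₂ refl) → update-≡ d′ {i} _ refl)
      ; peakᵇ = update-≡ (update d′ i 0) {suc i} _ refl
      ; high  = λ l i< → trans (update-≢ (update d′ i 0) _ (<⇒≢ i<)) (trans (update-≢ d′ _ (<⇒≢ (<-trans ≤-refl i<))) (high b l (<-trans ≤-refl i<))) }

    Carried : (ℕ → ℕ) → ℕ → State → Set
    Carried d i s = i ≤ ϱ × regs s 9 ≡ i × Bump i d (arrays s 3) × (∀ l → l < i → d l ≡ d i)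

    carry-exec : ∀ {d s} → Head d → 1 ≤ k → Small s → regs s 9 ≡ 0 → Bump 0 d (arrays s 3) →
      Exec (loop (get 3 (var 9) ⊝ get 3 (var 9 ⊕ lit 1))
             (put 3 (var 9) (lit 0) ⨟ 9 ≔ var 9 ⊕ lit 1 ⨟ put 3 (var 9) (get 3 (var 9) ⊕ lit 1) ⨟ skip)) s
        (λ s′ → ∃[ i ] Carried d i s′ × suc (d i) ≤ d (suc i)) (ϱ * 22 + 8)
    carry-exec {d} {s₀} h 1≤k S₀ r₉ b₀ = whileE Inv body S₀ frame-refl (0 , refl , z≤n , r₉ , b₀ , λ _ ())
      where
      Inv : ℕ → State → Set
      Inv φ s = ∃[ i ] φ ≡ (ϱ ∸ i) * 22 × Carried d i s
      body : ∀ φ s → Small s → Frame _ s₀ s → Inv φ s → Safe _ s × _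
      body φ s S F (i , refl , i≤ , r₉ , b , same) = _ , decide (suc (d i) ≤? d (suc i))
        where
        cond : eval (get 3 (var 9) ⊝ get 3 (var 9 ⊕ lit 1)) s ≡ suc (d i) ∸ d (suc i)
        cond = trans (cong (λ i → arrays s 3 i ∸ arrays s 3 (i + 1)) r₉)
          (cong₂ _∸_ (peakᵇ b) (trans (cong (arrays s 3) (+-comm i 1)) (high b (suc i) ≤-refl)))
        decide : Dec (suc (d i) ≤ d (suc i)) → _
        decide (yes le) = inj₁ (trans cond (m≤n⇒m∸n≡0 le) , i , (i≤ , r₉ , b , same) , le)
        decide (no nle) with m≤n⇒m<n∨m≡n i≤
        -- At `i = ϱ` the sentinel k - 1, raised by one, equals the sentinel k behind it, so the
        -- carry cannot run further.
        ... | inj₂ refl = contradiction (≤-reflexive (trans (cong suc (top h)) (trans (m+[n∸m]≡n 1≤k) (sym (end h))))) nle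
        ... | inj₁ i<   = inj₂ ((λ z → nle (m∸n≡0⇒m≤n (trans (sym cond) z))) , (ϱ ∸ suc i) * 22 , 14 ,
            ≤-reflexive (cong (_* 22) (sym (+-∸-assoc 1 i<))) ,
            (put= S r₉ refl z≤n λ S →
             assign= S (trans (cong (_+ 1) r₉) (+-comm i 1)) (≤-trans i< (≤-trans (ϱ≤ I) (r≤limit I))) λ S →
             put= S refl (trans (cong (λ j → update (arrays s 3) i 0 (suc i) + 1) r₉)
                (trans (cong (_+ 1) (trans (update-≢ (arrays s 3) _ (<⇒≢ ≤-refl)) (high b (suc i) ≤-refl))) (+-comm _ 1)))
               (≤-trans (s≤s (digit≤ h i<)) (≤-trans (≤-reflexive (m+[n∸m]≡n 1≤k)) (≤-trans k≤m (≤-trans (m≤ I) (r≤limit I))))) λ S →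
             skipE S (suc i , refl , i< , refl , bump-carry b , λ l l< → case m≤n⇒m<n∨m≡n (≤-pred l<) of λ where
               (inj₁ l<i)  → trans (same l l<i) d≡
               (inj₂ refl) → d≡)))
          where
          d≡ : d i ≡ d (suc i)
          d≡ = ≤-antisym (increase h i<) (≤-pred (≰⇒> nle))

    data Outcome (d : ℕ → ℕ) (s : State) : Set where
      found : regs s 7 ≡ 0 → regs s 8 ≡ 1 → Tuple k ϱ (arrays s 3) → ∀ es → Selects (arrays s 3) es → Removal I es → Outcome d s
      none  : regs s 7 ≡ 0 → regs s 8 ≡ 0 → (∀ e → ¬ Solution e) → Outcome d s
      next  : regs s 7 ≡ 1 → regs s 8 ≡ 0 → arrays s 0 ⊒ enc I → Head (arrays s 3) →
              (∀ J → (∀ i → i < ϱ → d i < J) → value J ϱ d < value J ϱ (arrays s 3)) → Outcome d s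

    -- The carry stops at the first digit that may grow. If it runs out of the tuple, all digits
    -- equal k - 1 and no later tuple exists, so no solution is left.
    advance-exec : ∀ {s} → Small s → Head (arrays s 3) → 1 ≤ k → regs s 3 ≡ ϱ → regs s 7 ≡ 1 → regs s 8 ≡ 0 →
      arrays s 0 ⊒ enc I → (∀ e → Solution e → Before ϱ (arrays s 3) e) →
      Exec advance s (Outcome (arrays s 3)) (8 + (ϱ * 22 + 8 + 7))
    advance-exec {s} S h 1≤k r₃ r₇ r₈ enc⊒ later =
      put= S refl (+-comm _ 1) (≤-trans (s≤s (digit≤ h z≤n)) (≤-trans (≤-reflexive (m+[n∸m]≡n 1≤k)) (≤-trans k≤m (≤-trans (m≤ I) (r≤limit I))))) λ S →
      assign= S refl z≤n λ S →
      seq⨾ (carry-exec h 1≤k S refl first) λ {s₁} S₁ F (i , (i≤ , r₉ , b , same) , le) → decide S₁ F i≤ r₉ b same le (m≤n⇒m<n∨m≡n i≤)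
      where
      d = arrays s 3
      first : Bump 0 d (update d 0 (suc (d 0)))
      first = record { low = λ _ () ; peakᵇ = refl ; high = λ { (suc l) _ → refl } }
      decide : ∀ {s₁ i} → Small s₁ → Frame _ _ s₁ → i ≤ ϱ → regs s₁ 9 ≡ i → Bump i d (arrays s₁ 3) →
        (∀ l → l < i → d l ≡ d i) → suc (d i) ≤ d (suc i) → i < ϱ ⊎ i ≡ ϱ →
        Exec (ite (var 3 ⊝ var 9) skip (7 ≔ lit 0 ⨟ skip)) s₁ (Outcome d) 7
      decide {s₁} {i} S₁ F i≤ r₉ b same le (inj₂ refl) =
        iteElse S₁ (trans (cong₂ _∸_ (trans (reg F 3) r₃) r₉) (n∸n≡0 ϱ))
          (assign= S₁ refl z≤n λ S → skipE S (none refl (trans (reg F 8) r₈) impossible))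
        where
        impossible : ∀ e → ¬ Solution e
        impossible e sol with later e sol
        ... | p , p< , lt , _ = <-irrefl refl (≤-trans (s≤s (≤-trans (≤-reflexive (trans (sym (top h)) (sym (same p p<)))) ≤-refl))
                                  (≤-trans lt (<⇒≤∸1 (digits (proj₁ sol) p p<))))
      decide {s₁} {i} S₁ F i≤ r₉ b same le (inj₁ i<) =
        weaken (λ _ _ q → q) (m≤m+n 5 2) (iteThen S₁ (λ z → m>n⇒m∸n≢0 i< (trans (sym (cong₂ _∸_ (trans (reg F 3) r₃) r₉)) z))
          (skipE S₁ (next (trans (reg F 7) r₇) (trans (reg F 8) r₈) (subst (_⊒ enc I) (sym (arr F 0)) enc⊒)
            (record
              { tuple   = record { increasing = inc ; digits = λ l l< → ≤-<-trans (d′≤ l l<) (≤-reflexive (m+[n∸m]≡n 1≤k)) }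
              ; top     = trans (high b ϱ i<) (top h)
              ; end     = trans (high b (suc ϱ) (m≤n⇒m≤1+n i<)) (end h)
              ; minimal = λ e sol → bump-next (proj₁ sol) (later e sol) b i< same })
            λ J d<J → value-bump J ϱ b i< λ l l<i → d<J l (<-trans l<i i<))))
        where
        d′ = arrays s₁ 3
        d′≤ : ∀ l → l < ϱ → d′ l ≤ k ∸ 1
        d′≤ l l< with <-cmp l i
        ... | tri< l<i _ _  = ≤-trans (≤-reflexive (low b l l<i)) z≤n
        ... | tri≈ _ refl _ = ≤-trans (≤-reflexive (peakᵇ b)) (≤-trans le (digit≤ h i<))
        ... | tri> _ _ i<l  = ≤-trans (≤-reflexive (high b l i<l)) (digit≤ h (<⇒≤ l<))
        inc : ∀ l → suc l < ϱ → d′ l ≤ d′ (suc l)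
        inc l l< with <-cmp l i
        ... | tri< l<i _ _  = ≤-trans (≤-reflexive (low b l l<i)) z≤n
        ... | tri≈ _ refl _ = ≤-trans (≤-reflexive (peakᵇ b)) (≤-trans le (≤-reflexive (sym (high b (suc l) ≤-refl))))
        ... | tri> _ _ i<l  = subst₂ _≤_ (sym (high b l i<l)) (sym (high b (suc l) (m≤n⇒m≤1+n i<l))) (increasing (tuple h) l l<)

    fill-exec : ∀ {s} → Small s → Tuple k ϱ (arrays s 3) → regs s 2 ≡ base I → regs s 3 ≡ ϱ → arrays s 0 ⊒ enc I →
      arrays s 2 ⊒ map toℕ cs →
      Exec (for 4 3 fill) s (λ s′ → arrays s′ 0 ⊒ enc I × (∀ i → i < ϱ → arrays s′ 0 (base I + i) ≡ ν (arrays s 3 i)))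
        (2 + (ϱ * (8 + 8) + 4))
    fill-exec {s} S t r₂ r₃ enc⊒ cs⊒ = forE Inv S r₃ (enc⊒ , λ _ ()) body
      where
      d = arrays s 3
      Inv : ℕ → State → Set
      Inv j s′ = arrays s′ 0 ⊒ enc I × (∀ i → i < j → arrays s′ 0 (base I + i) ≡ ν (d i))
      body : ∀ j s₁ → j < ϱ → Small s₁ → Frame (for 4 3 fill) s s₁ → regs s₁ 4 ≡ j → regs s₁ 3 ≡ ϱ → Inv j s₁ →
             Exec fill s₁ (λ s₂ → Inv (suc j) (setReg 4 (suc j) s₂)) 8
      body j s₁ j< S₁ F r₄ _ (enc⊒ , filled) =
        put= S₁ (cong₂ _+_ (trans (reg F 2) r₂) r₄) refl (arr≤ S₁ 2 (arrays s₁ 3 (regs s₁ 4)) _) λ S →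
        skipE S (⊒-update enc⊒ (subst (_≤ base I + j) (sym (length-enc I)) (m≤m+n (base I) j)) , filled′)
        where
        x = arrays s₁ 2 (arrays s₁ 3 (regs s₁ 4))
        x≡ : x ≡ ν (d j)
        x≡ = trans (cong₂ _$_ (arr F 2) (cong₂ _$_ (arr F 3) r₄))
               (⊒-cell (map toℕ cs) cs⊒ (subst (d j <_) (sym (length-map toℕ cs)) (digits t j j<)))
        filled′ : ∀ i → i < suc j → update (arrays s₁ 0) (base I + j) x (base I + i) ≡ ν (d i)
        filled′ i i< with i ≟ j
        ... | yes refl = trans (update-≡ (arrays s₁ 0) {base I + i} x refl) x≡
        ... | no i≢j   = trans (update-≢ (arrays s₁ 0) x (i≢j ∘ sym ∘ +-cancelˡ-≡ (base I) _ _)) (filled i (<suc i< i≢j))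

    round-time : ℕ
    round-time = 2 + (ϱ * (8 + 8) + 4) + (4 + (ϱ * (Tc + 59) + m * 9 + 51) + (3 + (8 + (ϱ * 22 + 8 + 7))))

    round-exec : ∀ {s} → Small s → Head (arrays s 3) → regs s 2 ≡ base I → regs s 3 ≡ ϱ → regs s 7 ≡ 1 → regs s 8 ≡ 0 →
      arrays s 0 ⊒ enc I → arrays s 2 ⊒ map toℕ cs → Exec round s (Outcome (arrays s 3)) round-time
    round-exec {s} S h r₂ r₃ r₇ r₈ enc⊒ cs⊒ with select cs ϱ (arrays s 3) (digits (tuple h))
    ... | es , len≡ , sel =
      seq⨾ (fill-exec S (tuple h) r₂ r₃ enc⊒ cs⊒) λ {s₁} S₁ F (enc⊒₁ , filled) →
      call⨾ S₁ (slice-⊒ _ (⊒-++ (enc I) enc⊒₁ (⊒-pointwise (map toℕ es) (tuple⊒ {arrays s₁ 0} filled))) (query-length F))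
        (test-calls es len≡) (λ _ v _ → verdict-≤ 1≤limit v) λ where
          _ (inj₁ (refl , ok)) S → weaken (λ _ _ q → q) (m≤m+n 8 (3 + (ϱ * 22 + 8 + 7))) (iteThen S (λ ())
            (assign= S refl 1≤limit λ S → assign= S refl z≤n λ S → skipE S
              (found refl refl (subst (Tuple k ϱ) (sym (arr F 3)) (tuple h)) es (subst (λ d → Selects d es) (sym (arr F 3)) (len≡ , sel)) ok)))
          _ (inj₂ (refl , ¬ok)) S → iteElse S refl (subst (λ d → Exec advance _ (Outcome d) (8 + (ϱ * 22 + 8 + 7))) (arr F 3)
            (advance-exec S (subst Head (sym (arr F 3)) h) (1≤k ¬ok) (trans (reg F 3) r₃) (trans (reg F 7) r₇) (trans (reg F 8) r₈) enc⊒₁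
              (subst (λ d → ∀ e → Solution e → Before ϱ d e) (sym (arr F 3)) (later ¬ok))))
      where
      tuple⊒ : ∀ {a : ℕ → ℕ} → (∀ i → i < ϱ → a (base I + i) ≡ ν (arrays s 3 i)) → ∀ i → i < length (map toℕ es) →
               a (length (enc I) + i) ≡ cell (map toℕ es) i
      tuple⊒ {a} filled i i< = trans (cong (λ b → a (b + i)) (length-enc I)) (trans (filled i i<ϱ) (sym (sel i i<ϱ)))
        where i<ϱ = subst (i <_) (trans (length-map toℕ es) len≡) i<
      query-length : ∀ {s₁} → Frame (for 4 3 fill) s s₁ → regs s₁ 2 + regs s₁ 3 ≡ length (enc I ++ map toℕ es)
      query-length F = sym (trans (length-++ (enc I)) (cong₂ _+_ (trans (length-enc I) (sym (trans (reg F 2) r₂)))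
        (trans (trans (length-map toℕ es) len≡) (sym (trans (reg F 3) r₃)))))
      -- The empty tuple always passes the test, so a failure means ϱ ≥ 1 and hence a candidate
      -- exists.
      1≤k : ¬ Removal I es → 1 ≤ k
      1≤k ¬ok = ≤-trans (subst (1 ≤_) len≡ (nonempty ¬ok)) ϱ≤k
        where
        nonempty : ∀ {fs} → ¬ Removal I fs → 1 ≤ length fs
        nonempty {[]}    ¬ok = contradiction ([] , λ ()) ¬ok
        nonempty {_ ∷ _} ¬ok = s≤s z≤n
      later : ¬ Removal I es → ∀ e → Solution e → Before ϱ (arrays s 3) e
      later ¬ok e sol@(_ , fs , (lenf , self) , ok) with minimal h e sol
      ... | inj₂ before = before
      ... | inj₁ same   = contradiction (subst (Removal I) (sym (cells-injective len≡ lenf λ i i< →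
              trans (sel i i<) (trans (cong ν (same i i<)) (sym (self i i<))))) ok) ¬ok
        where
        cells-injective : ∀ {n} {xs ys : List (Fin m)} → length xs ≡ n → length ys ≡ n →
          (∀ i → i < n → cell (map toℕ xs) i ≡ cell (map toℕ ys) i) → xs ≡ ys
        cells-injective {xs = []}     {[]}     _    _    _  = refl
        cells-injective {xs = x ∷ xs} {y ∷ ys} refl len at = cong₂ _∷_ (Fin.toℕ-injective (at 0 (s≤s z≤n)))
          (cells-injective refl (suc-injective len) λ i i< → at (suc i) (s≤s i<))
        cells-injective {xs = []}     {y ∷ ys} refl ()
        cells-injective {xs = x ∷ xs} {[]}     refl ()

    Result : State → Set
    Result s = (regs s 8 ≡ 1 × Tuple k ϱ (arrays s 3) × ∃[ es ] Selects (arrays s 3) es × Removal I es) ⊎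
               (regs s 8 ≡ 0 × (∀ e → ¬ Solution e))

    -- The bounds `J` below which the digits of all tested tuples stay: the number of candidates, or
    -- any bound on the digits of a solution, as the search stops no later than there.
    Reach : ℕ → Set
    Reach J = J ≡ k ⊎ ∃[ e ] Solution e × (∀ i → i < ϱ → e i < J)

    -- The current tuple does not come after the solution `e`, so its last digit is at most the last
    -- digit of `e`; the last digit is the largest.
    reach-digits : ∀ {J d} → Head d → Reach J → ∀ i → i < ϱ → d i < J
    reach-digits h (inj₁ refl) = digits (tuple h)
    reach-digits {J} {d} h (inj₂ (e , sol , e<)) i i< = go ϱ refl
      where
      go : ∀ n → n ≡ ϱ → d i < J
      go zero    refl = contradiction i< λ ()
      go (suc p) refl with minimal h e sol
      ... | inj₁ same = ≤-<-trans (≤-reflexive (same i i<)) (e< i i<)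
      ... | inj₂ (q , q< , lt , above) = ≤-<-trans (increasing-≤ (tuple h) i p (≤-pred i<) ≤-refl)
              (case m≤n⇒m<n∨m≡n (≤-pred q<) of λ where
                (inj₁ q<p)  → ≤-<-trans (≤-reflexive (above p q<p ≤-refl)) (e< p ≤-refl)
                (inj₂ refl) → <-trans lt (e< p ≤-refl))

    -- Recursion is on the distance of the value in base k from k^ϱ. The number `it` of tests is
    -- bounded for all reachable bases simultaneously, which is how the search profits from an early
    -- solution without being told where it lies.
    search-loop : ∀ {C} →
      (∀ {s} → Small s → Head (arrays s 3) → regs s 2 ≡ base I → regs s 3 ≡ ϱ → regs s 7 ≡ 1 → regs s 8 ≡ 0 →
        arrays s 0 ⊒ enc I → arrays s 2 ⊒ map toℕ cs → Exec round s (Outcome (arrays s 3)) C) →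
      ∀ {s₀} → regs s₀ 2 ≡ base I → regs s₀ 3 ≡ ϱ → arrays s₀ 2 ⊒ map toℕ cs →
      ∀ gas {s} → k ^ ϱ ≤ value k ϱ (arrays s 3) + gas → Small s → Frame round s₀ s → Head (arrays s 3) →
      regs s 7 ≡ 1 → regs s 8 ≡ 0 → arrays s 0 ⊒ enc I →
      ∃[ it ] Exec (loop (var 7) round) s Result (it * (C + 2) + 2) ×
              1 ≤ it × (∀ J → Reach J → value J ϱ (arrays s 3) + it ≤ J ^ ϱ)
    search-loop step-exec r₂ r₃ cs⊒ zero {s} le S F h r₇ r₈ enc⊒ =
      contradiction (value-< k ϱ (arrays s 3) (digits (tuple h))) (≤⇒≯ (subst (k ^ ϱ ≤_) (+-identityʳ _) le))
    search-loop {C} step-exec r₂ r₃ cs⊒ (suc gas) {s} le S F h r₇ r₈ enc⊒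
      with step-exec S h (trans (reg F 2) r₂) (trans (reg F 3) r₃) r₇ r₈ enc⊒ (subst (_⊒ map toℕ cs) (sym (arr F 2)) cs⊒)
    ... | exec {s₁} {t} run S₁ outcome t≤ = conclude outcome
      where
      d = arrays s 3
      once : ∀ J → Reach J → value J ϱ d + 1 ≤ J ^ ϱ
      once J reach = ≤-trans (≤-reflexive (+-comm _ 1)) (value-< J ϱ d (reach-digits h reach))
      go≢0 : regs s 7 ≢ 0
      go≢0 z = case trans (sym r₇) z of λ ()
      stop′ : regs s₁ 7 ≡ 0 → Result s₁ → Exec (loop (var 7) round) s Result (1 * (C + 2) + 2)
      stop′ z res = exec (again (safe (var 7) S _) go≢0 run (done (safe (var 7) S₁ _) z)) S₁ res
        (subst (2 + t + 2 ≤_) (cong (_+ 2) (trans (+-comm 2 C) (sym (+-identityʳ (C + 2))))) (+-monoˡ-≤ 2 (+-monoʳ-≤ 2 t≤)))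
      conclude : Outcome d s₁ → _
      conclude (found z r₈′ t es sel ok) = 1 , stop′ z (inj₁ (r₈′ , t , es , sel , ok)) , ≤-refl , once
      conclude (none z r₈′ no-solution)  = 1 , stop′ z (inj₂ (r₈′ , no-solution)) , ≤-refl , once
      conclude (next r₇′ r₈′ enc⊒′ h′ grows)
        with search-loop step-exec r₂ r₃ cs⊒ gas (≤-trans le (≤-trans (≤-reflexive (+-suc _ gas)) (+-monoˡ-≤ gas (grows k (digits (tuple h))))))
               S₁ (frame-trans F (frame run)) h′ r₇′ r₈′ enc⊒′
      ... | it , exec {time = t′} run′ S′ res t′≤ , 1≤it , its≤ = suc it ,
            exec (again (safe (var 7) S _) go≢0 run run′) S′ res
              (≤-trans (+-mono-≤ (+-monoʳ-≤ 2 t≤) t′≤) (≤-reflexive (trans (sym (+-assoc (2 + C) (it * (C + 2)) 2))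
                (cong (λ x → x + it * (C + 2) + 2) (+-comm 2 C))))) ,
            s≤s z≤n , λ J reach → ≤-trans (≤-reflexive (+-suc _ it))
              (≤-trans (+-monoˡ-≤ it (grows J (reach-digits h reach))) (its≤ J reach))

-- Correctness and running time of the search.

cell-take : ∀ {k} J (cs : List (Fin k)) i → i < J → cell (map toℕ (take J cs)) i ≡ cell (map toℕ cs) i
cell-take (suc J) []       i       _        = refl
cell-take (suc J) (c ∷ cs) zero    _        = refl
cell-take (suc J) (c ∷ cs) (suc i) (s≤s i<) = cell-take J cs i i<

module MainRun (I : Instance) (W : ℕ) (capacity : limit I ^ 16 ≤ W) (prep chk : Program) (Tp Tc : ℕ) (Hard : Set)
  (prep-spec : Calls W prep (enc I) (Prepared I Hard) Tp)
  (chk-spec : ∀ F e → Calls W chk (enc I ++ bits F ++ toℕ e ∷ []) (Verdict (Detour I (_∈ˢ F) e)) Tc) where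

  open Instance I
  open Logic (limit I) W (7≤limit I) capacity
  open Test I W capacity chk Tc chk-spec using (1≤limit; test-calls)
  open MainProgram prep chk
  open Main I W capacity prep chk Tp Tc Hard prep-spec chk-spec

  -- The bound holds for every τ that admits sparse paths, so the program receives no τ: it is the
  -- tightness in general and ⌊α⌋ in basic instances.
  Few : ℕ → Set
  Few it = ∀ τ → (∀ e → Removable I e → ¬ ¬ Sparse I τ e) → it ≤ (ϱ * (τ + τ + 1)) ^ ϱ

  module _ {cs : List (Fin m)} (cs-unique : Unique cs) (cs⇔ : ∀ e → e ∈ cs ⇔ Removable I e) (ϱ≤k : ϱ ≤ length cs) where
    open Search cs-unique cs⇔ ϱ≤k

    solution : ∀ {es} J → J ≤ k → es ⊆ take J cs → Removal I es → length es ≡ ϱ →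
               ∃[ e ] Solution e × (∀ i → i < ϱ → e i < J)
    solution {es} J J≤ es⊆ ok len≡ with sublist-positions (Sublist.map⁺ toℕ es⊆)
    ... | e , mono , at = e , (record { increasing = λ i i< → mono i (subst (suc i <_) (sym len′) i<)
                                     ; digits = λ i i< → ≤-trans (e<J i i<) J≤ } ,
                              es , (len≡ , λ i i< → trans (sym (proj₂ (at i (subst (i <_) (sym len′) i<)))) (cell-take J cs (e i) (e<J i i<))) , ok) , e<J
      where
      len′ : length (map toℕ es) ≡ ϱ
      len′ = trans (length-map toℕ es) len≡
      e<J : ∀ i → i < ϱ → e i < J
      e<J i i< = subst (e i <_) (trans (length-map toℕ (take J cs)) (length-take-≤ J cs J≤)) (proj₁ (at i (subst (i <_) (sym len′) i<)))

    -- With fewer than ϱ(2τ+1) candidates the base k already suffices. Otherwise `small-removal`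
    -- gives, up to double negation, a solution with digits below ϱ(2τ+1), and the inequality
    -- follows because it is decidable.
    few : ∀ {it} → (∀ J → Reach J → it ≤ J ^ ϱ) → Few it
    few {it} reach τ sparse with ϱ * (τ + τ + 1) ≤? k
    ... | no k≱  = ≤-trans (reach k (inj₁ refl)) (^-monoˡ-≤ ϱ (<⇒≤ (≰⇒> k≱)))
    ... | yes J≤ = decidable-stable (it ≤? _) λ ¬le → small-removal I cs-unique cs⇔ τ sparse J≤ λ (es , es⊆ , ok , len≡) →
          ¬le (reach (ϱ * (τ + τ + 1)) (inj₂ (solution (ϱ * (τ + τ + 1)) J≤ es⊆ ok len≡)))

    infeasible : (∀ e → ¬ Solution e) → ¬ Feasible I
    infeasible impossible feasible with feasible⇒removal I cs-unique cs⇔ feasible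
    ... | es , es⊆ , ok , len≡ = impossible _ (proj₁ (proj₂ (solution k ≤-refl (subst (es ⊆_) (sym (take-all k cs ≤-refl)) es⊆) ok len≡)))

    Flags : List (Fin m) → (ℕ → ℕ) → Set
    Flags es a = ∃[ Y ] (∀ e → a (suc (toℕ e)) ≡ bit (Vec.lookup Y e)) × (∀ e → Vec.lookup Y e ≡ true ⇔ e ∈ es)

    flags-add : ∀ {es a} e → Flags es a → Flags (es ++ e ∷ []) (update a (suc (toℕ e)) 1)
    flags-add {es} {a} e (Y , cells , Y⇔) = Y Vec.[ e ]≔ true , cells′ , Y′⇔
      where
      cells′ : ∀ f → update a (suc (toℕ e)) 1 (suc (toℕ f)) ≡ bit (Vec.lookup (Y Vec.[ e ]≔ true) f)
      cells′ f with f Fin.≟ e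
      ... | yes refl = trans (update-≡ a {suc (toℕ e)} 1 refl) (cong bit (sym (Vec.lookup∘update e Y true)))
      ... | no f≢e   = trans (update-≢ a 1 (f≢e ∘ sym ∘ Fin.toℕ-injective ∘ suc-injective)) (trans (cells f) (cong bit (sym (Vec.lookup∘update′ f≢e Y true))))
      Y′⇔ : ∀ f → Vec.lookup (Y Vec.[ e ]≔ true) f ≡ true ⇔ f ∈ es ++ e ∷ []
      Y′⇔ f with f Fin.≟ e
      ... | yes refl = mk⇔ (λ _ → ∈-++⁺ʳ es (here refl)) (λ _ → Vec.lookup∘update e Y true)
      ... | no f≢e   = mk⇔ (λ eq → ∈-++⁺ˡ (Equivalence.to (Y⇔ f) (trans (sym (Vec.lookup∘update′ f≢e Y true)) eq)))
        λ f∈ → trans (Vec.lookup∘update′ f≢e Y true) (case ∈-++⁻ es f∈ of λ where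
          (inj₁ f∈es)        → Equivalence.from (Y⇔ f) f∈es
          (inj₂ (here refl)) → contradiction refl f≢e)

    flag-exec : ∀ {s es} → Small s → regs s 3 ≡ ϱ → arrays s 2 ⊒ map toℕ cs → (∀ i → arrays s 5 i ≡ 0) →
      Tuple k ϱ (arrays s 3) → Selects (arrays s 3) es →
      Exec (for 4 3 (put 5 (lit 1 ⊕ get 2 (get 3 (var 4))) (lit 1) ⨟ skip)) s (λ s → Flags es (arrays s 5)) (2 + (ϱ * (8 + 8) + 4))
    flag-exec {s} {es} S r₃ cs⊒ zeros t (len≡ , sel) = weaken (λ {s′} _ _ → subst (λ fs → Flags fs (arrays s′ 5)) take-ϱ) ≤-refl
      (forE (λ j s → Flags (take j es) (arrays s 5)) S r₃
        (Subset.⊥ , (λ e → trans (zeros _) (cong bit (sym (Vec.lookup-replicate e false)))) ,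
          λ e → mk⇔ (λ eq → case trans (sym (Vec.lookup-replicate e false)) eq of λ ()) (λ ())) body)
      where
      take-ϱ : take ϱ es ≡ es
      take-ϱ = take-all ϱ es (≤-reflexive len≡)
      body : ∀ j s₁ → j < ϱ → Small s₁ → Frame _ s s₁ → regs s₁ 4 ≡ j → regs s₁ 3 ≡ ϱ → Flags (take j es) (arrays s₁ 5) →
             Exec _ s₁ (λ s₂ → Flags (take (suc j) es) (arrays s₂ 5)) 8
      body j s₁ j< S₁ F r₄ _ flags with take-suc j es (subst (j <_) (sym len≡) j<)
      ... | e , take≡ , at-j , _ = put= S₁ (cong suc index) refl 1≤limit λ S →
            skipE S (subst (λ fs → Flags fs (update (arrays s₁ 5) (suc (toℕ e)) 1)) (sym take≡) (flags-add {a = arrays s₁ 5} e flags))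
        where
        index : arrays s₁ 2 (arrays s₁ 3 (regs s₁ 4)) ≡ toℕ e
        index = trans (cong₂ _$_ (arr F 2) (cong₂ _$_ (arr F 3) r₄))
          (trans (⊒-cell (map toℕ cs) cs⊒ (subst (_ <_) (sym (length-map toℕ cs)) (digits t j j<))) (trans (sym (sel j j<)) at-j))

  head₀ : ∀ {cs} (cs-unique : Unique cs) (cs⇔ : ∀ e → e ∈ cs ⇔ Removable I e) (ϱ≤k : ϱ ≤ length cs) {d : ℕ → ℕ} →
    (∀ i → i < ϱ → d i ≡ 0) → d ϱ ≡ length cs ∸ 1 → d (suc ϱ) ≡ length cs → Search.Head cs-unique cs⇔ ϱ≤k d
  head₀ u c⇔ ϱ≤k d≡0 top end = record
    { tuple = record { increasing = λ i i< → ≤-reflexive (trans (d≡0 i (<⇒≤ i<)) (sym (d≡0 (suc i) i<)))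
                     ; digits = λ i i< → subst (_< _) (sym (d≡0 i i<)) (≤-trans (≤-trans (s≤s z≤n) i<) ϱ≤k) }
    ; top = top ; end = end ; minimal = λ e _ → zeros-first ϱ e d≡0 }

  Started : ℕ → State → Set
  Started k s = regs s 7 ≡ 1 × regs s 8 ≡ 0 × (∀ i → i < ϱ → arrays s 3 i ≡ 0) ×
                arrays s 3 ϱ ≡ k ∸ 1 × arrays s 3 (suc ϱ) ≡ k

  search-exec : ∀ {s k} → Small s → regs s 3 ≡ ϱ → regs s 6 ≡ k → (∀ i → arrays s 3 i ≡ 0) →
    Exec search s (Started k) 15
  search-exec {s} {k} S r₃ refl zeros =
    put= S r₃ refl (≤-trans (m∸n≤m _ 1) (reg≤ S 6)) λ S →
    put= S (trans (+-comm _ 1) (cong suc r₃)) refl (reg≤ S 6) λ S →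
    assign= S refl 1≤limit λ S →
    assign= S refl z≤n λ S →
    skipE S (refl , refl ,
      (λ i i< → trans (update-≢ (update (arrays s 3) ϱ (k ∸ 1)) k (<⇒≢ (m≤n⇒m≤1+n i<) ∘ sym)) (trans (update-≢ (arrays s 3) (k ∸ 1) (<⇒≢ i< ∘ sym)) (zeros i))) ,
      trans (update-≢ (update (arrays s 3) ϱ (k ∸ 1)) k (<⇒≢ ≤-refl ∘ sym)) (update-≡ (arrays s 3) {ϱ} (k ∸ 1) refl) ,
      update-≡ (update (arrays s 3) ϱ (k ∸ 1)) {suc ϱ} k refl)

  main-time : ℕ → ℕ
  main-time it = Tp + it * (ϱ * (Tc + 97) + m * 9 + 89) + m * 60 + 100

  -- `it` counts the tested tuples. It is 0 if the answer comes before the search: too few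
  -- candidates, or all candidates removable together. If the search takes place, the certificate
  -- `Hard` is kept for the analysis of its running time.
  MainResult : Set
  MainResult = ∃[ it ] Calls W main (enc I) (FindsCorrectly I) (main-time it) × (it ≡ 0 ⊎ (ϱ ≤ m × Hard × Few it))

  private
    deliver : ∀ {T} it → base I + T + suc m ≤ main-time it →
      Exec main (initial (enc I)) (λ s → FindsCorrectly I (output s) × regs s 0 ≤ suc m) T →
      Calls W main (enc I) (FindsCorrectly I) (main-time it)
    deliver {T} it le ex with toCalls ex
    ... | ys , t , run , ok , t≤ = ys , t , run , ok , ≤-trans t≤ (subst (λ l → l + T + suc m ≤ main-time it) (sym (length-enc I)) le)

    arith₁ : ∀ Tp m → 5 + m * 3 + (14 + (Tp + (2 + ((2 + (m * (13 + 8) + 4)) + 1))) + (4 + 6)) + suc m + (m * 35 + 61) ≡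
             Tp + 0 + m * 60 + 100
    arith₁ = solve-∀

    arith₂ : ∀ Tp m → 5 + m * 3 + (14 + (Tp + (2 + ((2 + (m * (13 + 8) + 4)) + 1))) + (4 + (3 + (2 + (m * (11 + 8) + 4) + 8)))) + suc m +
             (m * 16 + 50) ≡ Tp + 0 + m * 60 + 100
    arith₂ = solve-∀

    arith₃ : ∀ Tp Tc m ϱ it → 5 + m * 3 + (14 + (Tp + (2 + ((2 + (m * (13 + 8) + 4)) + 1))) + (4 + (3 + (15 + (
             it * (2 + (ϱ * (8 + 8) + 4) + (4 + (ϱ * (Tc + 59) + m * 9 + 51) + (3 + (8 + (ϱ * 22 + 8 + 7)))) + 2) + 2 +
               (2 + ((2 + (ϱ * (8 + 8) + 4)) + (2 + (m * (11 + 8) + 4) + 8)))))))) + suc m ≡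
             Tp + it * (ϱ * (Tc + 97) + m * 9 + 89) + m * 44 + 75 + ϱ * 16
    arith₃ = solve-∀

    arith₄ : ∀ x m → x + m * 44 + 75 + m * 16 + 25 ≡ x + m * 60 + 100
    arith₄ = solve-∀

    L = 14 + (Tp + (2 + ((2 + (m * (13 + 8) + 4)) + 1)))

  main-result : MainResult
  main-result = conclude locate-exec (holds locate-exec)
    where
    conclude : (ex : Exec locate (initial (enc I)) Located L) → Located (post ex) → MainResult
    conclude ex (r₁ , r₂ , r₃ , enc⊒ , zeros₃ , zeros₅ , c , X , c≡ , flags , X⇔ , cc , cs , u , cs⇔X , cs⊒ , k≡) = split (ϱ ≤? length cs) cc
      where
      cs⇔ : ∀ e → e ∈ cs ⇔ Removable I e
      cs⇔ e = mk⇔ (λ e∈ → Equivalence.to (X⇔ e) (proj₁ (Equivalence.to (cs⇔X e) e∈)))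
                  (λ r → Equivalence.from (cs⇔X e) (Equivalence.from (X⇔ e) r , Fin.toℕ<n e))
      split : Dec (ϱ ≤ length cs) → (c ≡ 1 × (∀ e → Removable I e → Detour I (Removable I) e)) ⊎ (c ≡ 0 × Hard) → MainResult
      split (no ϱ≰k) _ = 0 , deliver 0 (≤-trans (m≤m+n _ (m * 35 + 61)) (≤-reflexive (arith₁ Tp m))) (seqE ex (iteThen (small ex)
          (λ z → m>n⇒m∸n≢0 (≰⇒> ϱ≰k) (trans (sym (cong₂ _∸_ r₃ k≡)) z))
          (weaken (λ _ _ (out , l) → inj₂ (out , infeasible′) , l) ≤-refl (refuse-exec (small ex))))) , inj₁ refl
        where
        infeasible′ : ¬ Feasible I
        infeasible′ feasible with feasible⇒removal I u cs⇔ feasible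
        ... | es , es⊆ , _ , len≡ = ϱ≰k (subst (_≤ length cs) len≡ (Sublist.length-mono-≤ es⊆))
      split (yes ϱ≤k) (inj₁ (refl , detour)) = 0 , deliver 0 (≤-trans (m≤m+n _ (m * 16 + 50)) (≤-reflexive (arith₂ Tp m))) (seqE ex (iteElse (small ex)
          (trans (cong₂ _∸_ r₃ k≡) (m≤n⇒m∸n≡0 ϱ≤k)) (iteThen (small ex) (λ z → case trans (sym c≡) z of λ ())
          (weaken (λ _ _ (out , l) → inj₁ (∁ X , ok , out) , l) ≤-refl (write-exec 1 (small ex) r₁ flags))))) , inj₁ refl
        where
        ok : IsWitness I (∁ X)
        ok = witness I (λ e e∉ → detour-mono I (λ {f} f∉ → Equivalence.to (X⇔ f) (Equivalence.to (∈∁⇔ X f) f∉))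
               (detour e (Equivalence.to (X⇔ e) (Equivalence.to (∈∁⇔ X e) e∉))))
             (≤-trans ϱ≤k (∣∣-≥ u λ {e} e∈ → Subset.x∉p⇒x∈∁p (Equivalence.from (∈∁⇔ X e) (Equivalence.from (X⇔ e) (Equivalence.to (cs⇔ e) e∈)))))
      split (yes ϱ≤k) (inj₂ (refl , hard)) = find sx₀ (holds sx₀)
        where
        sx₀ = search-exec (small ex) r₃ k≡ zeros₃
        Looped : Exec search (post ex) (Started (length cs)) 15 → Set
        Looped sx = ∃[ it ] Exec (loop (var 7) round) (post sx) (Search.Result u cs⇔ ϱ≤k) (it * (Search.round-time u cs⇔ ϱ≤k + 2) + 2) ×
          1 ≤ it × (∀ J → Search.Reach u cs⇔ ϱ≤k J → value J ϱ (arrays (post sx) 3) + it ≤ J ^ ϱ)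
        find : (sx : Exec search (post ex) (Started (length cs)) 15) → Started (length cs) (post sx) → MainResult
        find sx (r₇ , r₈ , low₀ , top , end) = looped (Search.search-loop u cs⇔ ϱ≤k (Search.round-exec u cs⇔ ϱ≤k) {post sx}
              (trans (reg (frame (run sx)) 2) r₂) (trans (reg (frame (run sx)) 3) r₃) (subst (_⊒ map toℕ cs) (sym (arr (frame (run sx)) 2)) cs⊒)
              (length cs ^ ϱ) (m≤n+m _ _) (small sx) frame-refl (head₀ u cs⇔ ϱ≤k low₀ top end) r₇ r₈
              (subst (_⊒ enc I) (sym (arr (frame (run sx)) 0)) enc⊒))
          where
          looped : Looped sx → MainResult
          looped (it , lx , 1≤it , reach) = it , deliver it (≤-trans (≤-reflexive (arith₃ Tp Tc m ϱ it))
                (≤-trans (+-monoʳ-≤ (Tp + it * (ϱ * (Tc + 97) + m * 9 + 89) + m * 44 + 75) (*-monoˡ-≤ 16 (≤-trans ϱ≤k (Search.k≤m u cs⇔ ϱ≤k))))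
                (≤-trans (m≤m+n _ 25) (≤-reflexive (arith₄ (Tp + it * (ϱ * (Tc + 97) + m * 9 + 89)) m))))) (seqE ex (iteElse (small ex)
                (trans (cong₂ _∸_ r₃ k≡) (m≤n⇒m∸n≡0 ϱ≤k)) (iteElse (small ex) c≡ (seqE sx (seqE lx (finish (holds lx))))))) ,
                inj₂ (≤-trans ϱ≤k (Search.k≤m u cs⇔ ϱ≤k) , hard , few u cs⇔ ϱ≤k λ J r → ≤-trans (m≤n+m it _) (reach J r))
            where
            F₁ = frame (run sx)
            F₂ = frame (run lx)
            finish : Search.Result u cs⇔ ϱ≤k (post lx) → Exec _ (post lx) (λ s → FindsCorrectly I (output s) × regs s 0 ≤ suc m)
                       (2 + ((2 + (ϱ * (8 + 8) + 4)) + (2 + (m * (11 + 8) + 4) + 8)))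
            finish (inj₁ (r₈ , t , es , sel , ok)) = iteThen (small lx) (λ z → case trans (sym r₈) z of λ ())
              (seq⨾ (flag-exec u cs⇔ ϱ≤k (small lx) (trans (reg F₂ 3) (trans (reg F₁ 3) r₃))
                       (subst (_⊒ map toℕ cs) (sym (trans (arr F₂ 2) (arr F₁ 2))) cs⊒)
                       (λ i → trans (cong (_$ i) (trans (arr F₂ 5) (arr F₁ 5))) (zeros₅ i)) t sel)
                λ S F (Y , cells , Y⇔) → weaken (λ _ _ (out , l) → inj₁ (∁ Y , removal⇒witness I ok (proj₁ sel)
                    (λ e → mk⇔ (Equivalence.to (Y⇔ e) ∘ Equivalence.to (∈∁⇔ Y e)) (Equivalence.from (∈∁⇔ Y e) ∘ Equivalence.from (Y⇔ e))) , out) , l)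
                  ≤-refl (write-exec 5 S (trans (reg F 1) (trans (reg F₂ 1) (trans (reg F₁ 1) r₁))) cells))
            finish (inj₂ (r₈ , impossible)) = weaken (λ _ _ (out , l) → inj₂ (out , infeasible u cs⇔ ϱ≤k impossible) , l)
              (+-monoʳ-≤ 2 (≤-trans (m≤m+n 6 2) (≤-trans (m≤n+m 8 (2 + (m * (11 + 8) + 4))) (m≤n+m _ (2 + (ϱ * (8 + 8) + 4)))))) (iteElse (small lx) r₈ (refuse-exec (small lx)))

-- Lengthening edges instead of deleting them.

-- Uniqueness of quotient and remainder. It separates the addresses in tables with rows of fixed
-- width, namely the edge triples and the adjacency lists.
quotient-unique : ∀ {d} a b {i j} → i < d → j < d → i + a * d ≡ j + b * d → i ≡ j × a ≡ b
quotient-unique zero zero _ _ eq = trans (sym (+-identityʳ _)) (trans eq (+-identityʳ _)) , refl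
quotient-unique {d} zero (suc b) {i} {j} i< _ eq = contradiction i< (≤⇒≯ (≤-trans (≤-trans (m≤m+n d (b * d)) (m≤n+m _ j))
  (≤-reflexive (trans (sym eq) (+-identityʳ i)))))
quotient-unique {d} (suc a) zero {i} {j} _ j< eq = contradiction j< (≤⇒≯ (≤-trans (≤-trans (m≤m+n d (a * d)) (m≤n+m _ i))
  (≤-reflexive (trans eq (+-identityʳ j)))))
quotient-unique {d} (suc a) (suc b) {i} {j} i< j< eq
  with quotient-unique a b i< j< (+-cancelˡ-≡ d _ _ (trans (shift d i (a * d)) (trans eq (sym (shift d j (b * d))))))
  where
  shift : ∀ d i x → d + (i + x) ≡ i + (d + x)
  shift = solve-∀
... | i≡j , refl = i≡j , refl

reweight : (G : Graph) (w : Fin (Graph.m G) → ℕ) → (∀ e → 1 ≤ w e) → Graph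
reweight G w pos = record
  { n = n ; m = m ; ends = ends ; ℓ = w ; positive = pos ; loopless = loopless ; noParallel = noParallel }
  where open Graph G

module Reweighted (G : Graph) (w : Fin (Graph.m G) → ℕ) (pos : ∀ e → 1 ≤ w e) where
  open Graph G

  G′ : Graph
  G′ = reweight G w pos

  to′ : ∀ {u v} → Walk G u v → Walk G′ u v
  to′ stop         = stop
  to′ (step e j P) = step e j (to′ P)

  from′ : ∀ {u v} → Walk G′ u v → Walk G u v
  from′ stop         = stop
  from′ (step e j P) = step e j (from′ P)

  edges-to′ : ∀ {u v} (P : Walk G u v) → edges (to′ P) ≡ edges P
  edges-to′ stop         = refl
  edges-to′ (step e j P) = cong (e ∷_) (edges-to′ P)

  edges-from′ : ∀ {u v} (P : Walk G′ u v) → edges (from′ P) ≡ edges P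
  edges-from′ stop         = refl
  edges-from′ (step e j P) = cong (e ∷_) (edges-from′ P)

  len-to′ : ∀ {X : Fin m → Set} {u v} (P : Walk G u v) → (∀ e → ¬ X e → w e ≡ ℓ e) → All (¬_ ∘ X) (edges P) → len (to′ P) ≡ len P
  len-to′ stop         same _            = refl
  len-to′ (step e j P) same (e∉ ∷ avoid) = cong₂ _+_ (same e e∉) (len-to′ P same avoid)

  len-from′ : ∀ {X : Fin m → Set} {u v} (P : Walk G′ u v) → (∀ e → ¬ X e → w e ≡ ℓ e) → All (¬_ ∘ X) (edges P) → len (from′ P) ≡ len P
  len-from′ stop         same _            = refl
  len-from′ (step e j P) same (e∉ ∷ avoid) = cong₂ _+_ (sym (same e e∉)) (len-from′ P same avoid)

  edge≤len : ∀ {u v e} (P : Walk G′ u v) → e ∈ edges P → w e ≤ len P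
  edge≤len (step e j P) (here refl) = m≤m+n (w e) (len P)
  edge≤len (step f j P) (there e∈)  = ≤-trans (edge≤len P e∈) (m≤n+m (len P) (w f))

module _ (I : Instance) where
  open Instance I
  open Walks graph

  -- Lengthening the edges in X beyond num · ℓ e is as good as deleting them.
  reweighted-fits : ∀ w pos {X : Fin m → Set} {e} → (∀ f → ¬ X f → w f ≡ ℓ f) → (∀ {f} → X f → num I * ℓ e < w f) →
    ∀ {d d′} → IsDist graph ⊤ (src e) (tgt e) d → IsDist (reweight graph w pos) ⊤ (src e) (tgt e) d′ → Fits I d′ d ⇔ Detour I X e
  reweighted-fits w pos {X} {e} w-same w-big {d} {d′} dist@(_ , d≤) ((P′ , _ , refl) , d′≤) = mk⇔ to from
    where
    module R = Reweighted graph w pos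
    to : Fits I (len P′) d → Detour I X e
    to fits = R.from′ P′ , subst (All (¬_ ∘ X)) (sym (R.edges-from′ P′)) avoids ,
      short-dist I {P = R.from′ P′} dist (subst (λ x → Fits I x d) (sym (R.len-from′ P′ w-same avoids)) fits)
      where
      avoids : All (¬_ ∘ X) (edges P′)
      avoids = All.tabulate λ {f} f∈ f∈X → <-irrefl refl (begin-strict
        num I * d            ≤⟨ *-monoʳ-≤ (num I) (subst (d ≤_) (len-edgeʷ e) (d≤ (edgeʷ e) (within-⊤ (edgeʷ e)))) ⟩
        num I * ℓ e          <⟨ w-big f∈X ⟩
        w f                  ≤⟨ R.edge≤len P′ f∈ ⟩
        len P′               ≡⟨ +-identityʳ _ ⟨
        1 * len P′           ≤⟨ *-monoˡ-≤ (len P′) {1} {den I} (s≤s z≤n) ⟩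
        den I * len P′       ≤⟨ fits ⟩
        num I * d            ∎)
        where open ≤-Reasoning
    from : Detour I X e → Fits I (len P′) d
    from (P , avoids , short) = fits-mono I (subst (len P′ ≤_) (R.len-to′ P w-same avoids)
      (d′≤ (R.to′ P) (Walks.within-⊤ R.G′ (R.to′ P)))) ≤-refl (dist-short I {P = P} dist short)

  fits-bit : ∀ d′ d → (1 ∸ (den I * d′ ∸ num I * d) ≡ 1 × Fits I d′ d) ⊎ (1 ∸ (den I * d′ ∸ num I * d) ≡ 0 × ¬ Fits I d′ d)
  fits-bit d′ d with den I * d′ ≤? num I * d
  ... | yes fits = inj₁ (cong (1 ∸_) (m≤n⇒m∸n≡0 fits) , fits)
  ... | no ¬fits = inj₂ (m≤n⇒m∸n≡0 (m<n⇒0<n∸m (≰⇒> ¬fits)) , ¬fits)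


-- Building queries for the shortest path programs.

-- `o` is the length of the header in front of the edges of a query: 4 for a single pair, 2 for all
-- pairs.
copyEdges : ℕ → Program
copyEdges o = for 4 3 (put 1 (lit o ⊕ var 4) (get 0 (lit 5 ⊕ var 4)) ⨟ skip)

setLengths : ℕ → Exp → Program
setLengths o E = for 4 1 (put 1 (lit o ⊕ (lit 2 ⊕ (var 4 ⊛ lit 3))) E ⨟ skip)

module Edges (I : Instance) (W : ℕ) (capacity : limit I ^ 16 ≤ W) (o : ℕ) (o≤7 : T (o ≤ᵇ 7)) where
  open Instance I
  open Logic (limit I) W (7≤limit I) capacity

  copy-exec : ∀ {s} → Small s → regs s 3 ≡ m * 3 → Exec (copyEdges o) s (λ s′ → (∀ i → i < o → arrays s′ 1 i ≡ arrays s 1 i) ×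
    (∀ i → i < m * 3 → arrays s′ 1 (o + i) ≡ arrays s 0 (5 + i))) (2 + (m * 3 * (9 + 8) + 4))
  copy-exec {s} S r₃ = forE Inv S r₃ ((λ _ _ → refl) , λ _ ()) body
    where
    Inv : ℕ → State → Set
    Inv j s′ = (∀ i → i < o → arrays s′ 1 i ≡ arrays s 1 i) × (∀ i → i < j → arrays s′ 1 (o + i) ≡ arrays s 0 (5 + i))
    body : ∀ j s₁ → j < m * 3 → Small s₁ → Frame _ s s₁ → regs s₁ 4 ≡ j → regs s₁ 3 ≡ m * 3 → Inv j s₁ →
           Exec _ s₁ (λ s₂ → Inv (suc j) (setReg 4 (suc j) s₂)) 9
    body j s₁ j< S₁ F r₄ _ (header , copied) = put= S₁ {_ , (o≤7 , _)} (cong (o +_) r₄) refl (arr≤ S₁ 0 (5 + regs s₁ 4) _) λ S →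
      skipE S ((λ i i< → trans (update-≢ (arrays s₁ 1) _ (λ eq → <-irrefl (sym eq) (≤-trans i< (m≤m+n o j)))) (header i i<)) , copied′)
      where
      copied′ : ∀ i → i < suc j → update (arrays s₁ 1) (o + j) (arrays s₁ 0 (5 + regs s₁ 4)) (o + i) ≡ arrays s 0 (5 + i)
      copied′ i i< with i ≟ j
      ... | yes refl = trans (update-≡ (arrays s₁ 1) {o + i} _ refl) (cong₂ (λ f k → f (5 + k)) (arr F 0) r₄)
      ... | no i≢j   = trans (update-≢ (arrays s₁ 1) _ (i≢j ∘ sym ∘ +-cancelˡ-≡ o _ _)) (copied i (≤∧≢⇒< (≤-pred i<) i≢j))

  Lengths : (Fin m → ℕ) → (ℕ → ℕ) → Set
  Lengths w a = ∀ f → a (o + toℕ f * 3) ≡ toℕ (src f) × a (o + (1 + toℕ f * 3)) ≡ toℕ (tgt f) × a (o + (2 + toℕ f * 3)) ≡ w f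

  copied-lengths : ∀ {a ys} → (∀ i → i < m * 3 → a (o + i) ≡ cell (enc I ++ ys) (5 + i)) → Lengths ℓ a
  copied-lengths {a} {ys} copied f =
    trans (copied _ (edge-index-< I f 0 (s≤s z≤n))) (Layout.at-src (layout I ys) f) ,
    trans (copied _ (edge-index-< I f 1 (s≤s (s≤s z≤n)))) (Layout.at-tgt (layout I ys) f) ,
    trans (copied _ (edge-index-< I f 2 (s≤s (s≤s (s≤s z≤n))))) (Layout.at-ℓ (layout I ys) f)

  lengths-⊒ : ∀ {w pos a} hs → length hs ≡ o → (∀ i → i < o → a i ≡ cell hs i) → Lengths w a →
              a ⊒ hs ++ encodeEdges (reweight graph w pos)
  lengths-⊒ {w} {a = a} hs refl header lengths = ⊒-++ hs (⊒-pointwise hs header) (triples-⊒ (toℕ ∘ src) (toℕ ∘ tgt) w id lengths)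

  length-query : ∀ {w pos} hs → length hs ≡ o → length (hs ++ encodeEdges (reweight graph w pos)) ≡ o + m * 3
  length-query {w} hs refl = trans (length-++ hs) (cong (length hs +_) (length-triples (toℕ ∘ src) (toℕ ∘ tgt) w id))

  set-exec : ∀ {s E w} → Small s → regs s 1 ≡ m → Lengths ℓ (arrays s 1) →
    (∀ f {s₁} → Small s₁ → Frame (setLengths o E) s s₁ → regs s₁ 4 ≡ toℕ f → Safe E s₁ × eval E s₁ ≡ w f) → (∀ f → w f ≤ limit I) →
    Exec (setLengths o E) s (λ s′ → (∀ i → i < o → arrays s′ 1 i ≡ arrays s 1 i) × Lengths w (arrays s′ 1)) (2 + (m * (9 + cost E + 8) + 4))
  set-exec {s} {E} {w} S r₁ old value′ w≤ = weaken (λ _ _ (header , ends , lengths) → header , λ f → proj₁ (ends f) , proj₂ (ends f) , lengths f (Fin.toℕ<n f)) ≤-refl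
    (forE Inv S r₁ ((λ _ _ → refl) , (λ f → proj₁ (old f) , proj₁ (proj₂ (old f))) , λ _ ()) body)
    where
    Inv : ℕ → State → Set
    Inv j s′ = (∀ i → i < o → arrays s′ 1 i ≡ arrays s 1 i) ×
               (∀ f → arrays s′ 1 (o + toℕ f * 3) ≡ toℕ (src f) × arrays s′ 1 (o + (1 + toℕ f * 3)) ≡ toℕ (tgt f)) ×
               (∀ f → toℕ f < j → arrays s′ 1 (o + (2 + toℕ f * 3)) ≡ w f)
    body : ∀ j s₁ → j < m → Small s₁ → Frame _ s s₁ → regs s₁ 4 ≡ j → regs s₁ 1 ≡ m → Inv j s₁ →
           Exec _ s₁ (λ s₂ → Inv (suc j) (setReg 4 (suc j) s₂)) (9 + cost E)
    body j s₁ j< S₁ F r₄ _ (header , ends , lengths) = weaken (λ _ _ q → q) (≤-reflexive (+-comm (8 + cost E) 1))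
      (put= S₁ {_ , (o≤7 , _)} {proj₁ v} (cong (λ k → o + (2 + k * 3)) (trans r₄ (sym e≡))) (proj₂ v) (w≤ e) λ S → skipE S
      ((λ i i< → trans (update-≢ a _ (λ eq → <-irrefl (sym eq) (≤-trans i< (m≤m+n o _)))) (header i i<)) ,
       (λ f → trans (apart f 0 (s≤s z≤n) (λ ())) (proj₁ (ends f)) , trans (apart f 1 (s≤s (s≤s z≤n)) (λ ())) (proj₂ (ends f))) , lengths′))
      where
      a = arrays s₁ 1
      e = Fin.fromℕ< j<
      e≡ : toℕ e ≡ j
      e≡ = Fin.toℕ-fromℕ< j<
      v = value′ e S₁ F (trans r₄ (sym e≡))
      at-e = o + (2 + toℕ e * 3)
      apart : ∀ f i → i < 3 → i ≢ 2 → update a at-e (w e) (o + (i + toℕ f * 3)) ≡ a (o + (i + toℕ f * 3))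
      apart f i i< i≢2 = update-≢ a {at-e} (w e) λ eq → i≢2 (sym (proj₁ (quotient-unique (toℕ e) (toℕ f) (s≤s (s≤s (s≤s z≤n))) i< (+-cancelˡ-≡ o _ _ eq))))
      lengths′ : ∀ f → toℕ f < suc j → update a at-e (w e) (o + (2 + toℕ f * 3)) ≡ w f
      lengths′ f f< with f Fin.≟ e
      ... | yes refl = update-≡ a {at-e} (w e) refl
      ... | no f≢e   = trans (update-≢ a {at-e} (w e) λ eq → f≢e (sym (Fin.toℕ-injective (proj₂ (quotient-unique (toℕ e) (toℕ f) (s≤s (s≤s (s≤s z≤n))) (s≤s (s≤s (s≤s z≤n))) (+-cancelˡ-≡ o _ _ eq))))))
          (lengths f (≤∧≢⇒< (≤-pred f<) λ f≡j → f≢e (Fin.toℕ-injective (trans f≡j (sym e≡)))))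

emit : Program
emit = put 0 (lit 1 ⊕ var 4) (get 2 (var 4)) ⨟ skip

module Emission (I : Instance) (W : ℕ) (capacity : limit I ^ 16 ≤ W) where
  open Instance I
  open Logic (limit I) W (7≤limit I) capacity

  emit-exec : ∀ {X : Subset m} {s} → Small s → regs s 1 ≡ m → (∀ f → arrays s 2 (toℕ f) ≡ bit (Vec.lookup X f)) →
    Exec (for 4 1 emit) s (λ s′ → arrays s′ 0 0 ≡ arrays s 0 0 × (∀ f → arrays s′ 0 (suc (toℕ f)) ≡ bit (Vec.lookup X f))) (2 + (m * (7 + 8) + 4))
  emit-exec {X} {s} S r₁ flags = weaken (λ _ _ (z , cells) → z , λ f → cells f (Fin.toℕ<n f)) ≤-refl (forE Inv S r₁ (refl , λ _ ()) body)
    where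
    Inv : ℕ → State → Set
    Inv j s′ = arrays s′ 0 0 ≡ arrays s 0 0 × (∀ f → toℕ f < j → arrays s′ 0 (suc (toℕ f)) ≡ bit (Vec.lookup X f))
    body : ∀ j s₁ → j < m → Small s₁ → Frame (for 4 1 emit) s s₁ → regs s₁ 4 ≡ j → regs s₁ 1 ≡ m → Inv j s₁ →
           Exec emit s₁ (λ s₂ → Inv (suc j) (setReg 4 (suc j) s₂)) 7
    body j s₁ j< S₁ F r₄ _ (z , cells) = put= S₁ (cong suc (trans r₄ (sym e≡))) (trans (cong₂ _$_ (arr F 2) (trans r₄ (sym e≡))) (flags e))
        (≤-trans (bit≤1 (Vec.lookup X e)) (≤-trans (s≤s z≤n) (7≤limit I))) λ S → skipE S (z , cells′)
      where
      e = Fin.fromℕ< j<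
      e≡ = Fin.toℕ-fromℕ< j<
      cells′ : ∀ f → toℕ f < suc j → update (arrays s₁ 0) (suc (toℕ e)) (bit (Vec.lookup X e)) (suc (toℕ f)) ≡ bit (Vec.lookup X f)
      cells′ f f< with f Fin.≟ e
      ... | yes refl = update-≡ (arrays s₁ 0) {suc (toℕ f)} _ refl
      ... | no f≢e   = trans (update-≢ (arrays s₁ 0) {suc (toℕ e)} _ (f≢e ∘ sym ∘ Fin.toℕ-injective ∘ suc-injective))
          (cells f (≤∧≢⇒< (≤-pred f<) λ f≡j → f≢e (Fin.toℕ-injective (trans f≡j (sym e≡)))))

triples-≤ : ∀ {A : Set} (f g h : A → ℕ) {R k} (φ : Fin k → A) → (∀ x → f x ≤ R) → (∀ x → g x ≤ R) → (∀ x → h x ≤ R) →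
            All (_≤ R) (triples f g h (tabulate φ))
triples-≤ f g h {k = zero}  φ p q r = []
triples-≤ f g h {k = suc k} φ p q r = p _ ∷ q _ ∷ r _ ∷ triples-≤ f g h (φ ∘ fsuc) p q r

-- A shortest path program may append output of unknown size. Shortening the output to its first
-- cell leaves a number that is known to be small.
first-cell : ∀ {W p xs d rest t} → 1 ≤ W → Runs W p xs (d ∷ rest) t → Calls W (p ⨟ 0 ≔ lit 1) xs (_≡ d ∷ []) (t + 2)
first-cell {W} {p} {xs} {d} {rest} 1≤W (s , t₀ , run , out , refl) =
  _ , _ , (_ , _ , seq run (assign 1≤W) , refl , refl) , cong (_∷ []) (first-of (regs s 0) out) , bound
  where
  first-of : ∀ k {f : ℕ → ℕ} → d ∷ rest ≡ applyUpTo f k → f 0 ≡ d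
  first-of (suc k) refl = refl
  bound : length xs + (t₀ + 2) + 1 ≤ length xs + t₀ + suc (length rest) + 2
  bound = subst₂ _≤_ (eq₁ (length xs) t₀) (eq₂ (length xs) t₀ (length rest)) (m≤m+n (length xs + t₀ + 3) (length rest))
    where
    eq₁ : ∀ a b → a + b + 3 ≡ a + (b + 2) + 1
    eq₁ = solve-∀
    eq₂ : ∀ a b c → a + b + 3 + c ≡ a + b + suc c + 2
    eq₂ = solve-∀

module EdgeInput (I : Instance) (F : Subset (Instance.m I)) (e : Fin (Instance.m I)) where
  open Instance I

  input : List ℕ
  input = enc I ++ bits F ++ toℕ e ∷ []

  fin≤ : ∀ {k} (x : Fin k) → k ≤ r I → toℕ x ≤ limit I
  fin≤ x k≤ = ≤-trans (<⇒≤ (Fin.toℕ<n x)) (≤-trans k≤ (r≤limit I))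

  at-e : cell input (base I + m) ≡ toℕ e
  at-e = trans (extra I _ m) (trans (cong (cell (bits F ++ toℕ e ∷ [])) (sym (trans (+-identityʳ _) (length-bits F))))
    (overlay-++ʳ (bits F) (toℕ e ∷ []) (const 0) 0))

  at-mark : ∀ f → cell input (base I + toℕ f) ≡ bit (Vec.lookup F f)
  at-mark f = trans (extra I _ (toℕ f)) (trans (overlay-++ˡ (bits F) (toℕ e ∷ []) {h = const 0} (subst (toℕ f <_) (sym (length-bits F)) (Fin.toℕ<n f)))
    (bits-at F f))

  length-input : length input ≡ base I + (m + 1)
  length-input = trans (length-++ (enc I)) (cong₂ _+_ (length-enc I) (trans (length-++ (bits F)) (cong (_+ 1) (length-bits F))))

  input≤ : All (_≤ limit I) input
  input≤ = All.++⁺ (All.map (λ le → ≤-trans le (r≤limit I)) (entry≤ I))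
    (All.++⁺ (All.map (λ le → ≤-trans le (≤-trans (s≤s z≤n) (7≤limit I))) (bits≤1 F)) (fin≤ e (m≤ I) ∷ []))

  length≤ : length input ≤ limit I
  length≤ = ≤-trans (≤-reflexive length-input)
    (+≤limit I (base≤ I) (≤-trans (≤-reflexive (+-comm m 1)) (≤-trans (s≤s (≤-trans (m≤m*n m 3) (m≤n+m (m * 3) 4))) (base≤ I))))

-- The detour test by two single-pair queries.

module DetourProgram (spsp : Program) where
  mark newLength : Exp
  mark = get 0 (var 2 ⊕ var 4)
  newLength = (get 0 (lit 7 ⊕ (var 4 ⊛ lit 3)) ⊛ (lit 1 ⊝ mark)) ⊕ (var 6 ⊛ mark)

  -- Marked edges are not deleted, which could disconnect the graph, but get a
  -- length that no short path can afford.
  detour : Program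
  detour =
    1 ≔ get 0 (lit 1) ⨟
    2 ≔ lit 5 ⊕ (var 1 ⊛ lit 3) ⨟
    3 ≔ var 1 ⊛ lit 3 ⨟
    5 ≔ get 0 (var 2 ⊕ var 1) ⨟
    6 ≔ lit 1 ⊕ (get 0 (lit 2) ⊛ get 0 (lit 7 ⊕ (var 5 ⊛ lit 3))) ⨟
    put 1 (lit 0) (get 0 (lit 0)) ⨟
    put 1 (lit 1) (var 1) ⨟
    put 1 (lit 2) (get 0 (lit 5 ⊕ (var 5 ⊛ lit 3))) ⨟
    put 1 (lit 3) (get 0 (lit 6 ⊕ (var 5 ⊛ lit 3))) ⨟
    copyEdges 4 ⨟
    call 2 (spsp ⨟ 0 ≔ lit 1) 1 (lit 4 ⊕ var 3) ⨟
    setLengths 4 newLength ⨟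
    call 3 (spsp ⨟ 0 ≔ lit 1) 1 (lit 4 ⊕ var 3) ⨟
    put 0 (lit 0) (lit 1 ⊝ ((get 0 (lit 3) ⊛ get 3 (lit 0)) ⊝ (get 0 (lit 2) ⊛ get 2 (lit 0)))) ⨟
    0 ≔ lit 1 ⨟
    skip

module DetourSpec (I : Instance) (W : ℕ) (capacity : limit I ^ 16 ≤ W) (spsp : Program) (S : ℕ → ℕ → ℕ) (K : ℕ)
  (solves : ∀ Q W → room (Problem.encode SinglePairShortestPath Q) ^ K ≤ W →
     ∃[ ys ] ∃[ t ] Runs W spsp (Problem.encode SinglePairShortestPath Q) ys t ×
       Problem.Correct SinglePairShortestPath Q ys × t ≤ S (PairQuery.n Q) (PairQuery.m Q))
  (roomy : ∀ {xs} → length xs ≤ limit I → All (_≤ limit I) xs → room xs ^ K ≤ W)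
  (F : Subset (Instance.m I)) (e : Fin (Instance.m I)) where

  open Instance I
  open Logic (limit I) W (7≤limit I) capacity
  open DetourProgram spsp
  open Edges I W capacity 4 _
  open Walks graph
  open EdgeInput I F e

  big : ℕ
  big = 1 + num I * ℓ e

  big≤ : big ≤ limit I
  big≤ = ≤-trans (+≤^ I {1} {num I * ℓ e} {1} {2} ≤-refl (s≤s z≤n)
    (≤-trans (≤-trans (s≤s z≤n) (7≤r I)) (≤-reflexive (sym (^-identityʳ (r I))))) (prod≤ I (num≤ I) (ℓ≤ I e))) (r^≤ I {3} (s≤s (s≤s (s≤s z≤n))))

  w : Fin m → ℕ
  w f = if Vec.lookup F f then big else ℓ f

  w-pos : ∀ f → 1 ≤ w f
  w-pos f with Vec.lookup F f
  ... | true  = s≤s z≤n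
  ... | false = positive f

  w≤ : ∀ f → w f ≤ limit I
  w≤ f with Vec.lookup F f
  ... | true  = big≤
  ... | false = ≤-trans (ℓ≤ I f) (r≤limit I)

  w-same : ∀ f → ¬ (f ∈ˢ F) → w f ≡ ℓ f
  w-same f f∉ with Vec.lookup F f in eq
  ... | true  = contradiction (Vec.lookup⇒[]= f F eq) f∉
  ... | false = refl

  w-big : ∀ f → f ∈ˢ F → w f ≡ big
  w-big f f∈ = cong (λ b → if b then big else ℓ f) (Vec.[]=⇒lookup f∈)

  module R = Reweighted graph w w-pos

  header : List ℕ
  header = n ∷ m ∷ toℕ (src e) ∷ toℕ (tgt e) ∷ []

  query : (w : Fin m → ℕ) → (∀ e → 1 ≤ w e) → PairQuery
  query w pos = record { graph = reweight graph w pos ; connected = λ u v → Reweighted.to′ graph w pos (connected u v)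
                       ; source = src e ; target = tgt e }

  call-spsp : ∀ w (pos : ∀ e → 1 ≤ w e) → (∀ f → w f ≤ limit I) →
    ∃[ d ] IsDist (reweight graph w pos) ⊤ (src e) (tgt e) d ×
      Calls W (spsp ⨟ 0 ≔ lit 1) (header ++ encodeEdges (reweight graph w pos)) (_≡ d ∷ []) (S n m + 2)
  call-spsp w pos w≤ with solves (query w pos) W (roomy
    (≤-trans (≤-reflexive (length-query {w} {pos} header refl)) (≤-trans (n≤1+n _) (≤-trans (base≤ I) (r≤limit I))))
    (≤-trans (n≤ I) (r≤limit I) ∷ ≤-trans (m≤ I) (r≤limit I) ∷ fin≤ (src e) (n≤ I) ∷ fin≤ (tgt e) (n≤ I) ∷
      triples-≤ (toℕ ∘ src) (toℕ ∘ tgt) w id (λ f → fin≤ (src f) (n≤ I)) (λ f → fin≤ (tgt f) (n≤ I)) w≤))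
  ... | ys , t , runs , (d , rest , refl , dist) , t≤ with first-cell (≤-trans (≤-trans (s≤s z≤n) (7≤limit I)) (≤-trans (R≤R^ {16} (s≤s z≤n)) capacity)) runs
  ...   | zs , t′ , runs′ , out , t′≤ = d , dist , (zs , t′ , runs′ , out , ≤-trans t′≤ (+-monoˡ-≤ 2 t≤))

  fits⇔detour : ∀ {d d′} → IsDist graph ⊤ (src e) (tgt e) d → IsDist R.G′ ⊤ (src e) (tgt e) d′ →
    Fits I d′ d ⇔ Detour I (_∈ˢ F) e
  fits⇔detour = reweighted-fits I w w-pos w-same λ {f} f∈F → ≤-reflexive (sym (w-big f f∈F))

  open Layout (layout I (bits F ++ toℕ e ∷ []))

  module _ {d d′ : ℕ} (dist : IsDist graph ⊤ (src e) (tgt e) d) (dist′ : IsDist R.G′ ⊤ (src e) (tgt e) d′)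
    (c : Calls W (spsp ⨟ 0 ≔ lit 1) (header ++ encodeEdges graph) (_≡ d ∷ []) (S n m + 2))
    (c′ : Calls W (spsp ⨟ 0 ≔ lit 1) (header ++ encodeEdges R.G′) (_≡ d′ ∷ []) (S n m + 2)) where

    d≤ : d ≤ limit I
    d≤ = ≤-trans (subst (d ≤_) (len-edgeʷ e) (proj₂ dist (edgeʷ e) (within-⊤ (edgeʷ e)))) (≤-trans (ℓ≤ I e) (r≤limit I))

    d′≤ : d′ ≤ limit I
    d′≤ = ≤-trans (proj₂ dist′ (Walks.edgeʷ R.G′ e) (Walks.within-⊤ R.G′ (Walks.edgeʷ R.G′ e)))
      (≤-trans (≤-reflexive (Walks.len-edgeʷ R.G′ e)) (w≤ e))

    new-length : ∀ f {s₁} → arrays s₁ 0 ≡ cell input → regs s₁ 2 ≡ base I → regs s₁ 6 ≡ big → regs s₁ 4 ≡ toℕ f →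
                 eval newLength s₁ ≡ w f
    new-length f a₀ r₂ r₆ r₄ rewrite a₀ | r₂ | r₆ | r₄ | at-mark f | at-ℓ f with Vec.lookup F f
    ... | true  = cong₂ _+_ (*-zeroʳ (ℓ f)) (*-identityʳ big)
    ... | false = trans (cong₂ _+_ (*-identityʳ (ℓ f)) (*-zeroʳ big)) (+-identityʳ (ℓ f))

    detour-time : ℕ
    detour-time = 53 + ((2 + (m * 3 * (9 + 8) + 4)) + (4 + (S n m + 2) + ((2 + (m * (9 + 20 + 8) + 4)) + (4 + (S n m + 2) + 18))))

    detour-exec : Exec detour (initial input) (λ s → Verdict (Detour I (_∈ˢ F) e) (output s) × regs s 0 ≤ 1) detour-time
    detour-exec =
      assign= (initial-small input≤ length≤) refl (≤-trans (m≤ I) (r≤limit I)) λ S →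
      assign= S refl (≤-trans (base≤ I) (r≤limit I)) λ S →
      assign= S refl (≤-trans (≤-trans (m≤n+m (m * 3) 5) (base≤ I)) (r≤limit I)) λ S →
      assign= S at-e (fin≤ e (m≤ I)) λ S →
      assign= S (cong (λ x → 1 + num I * x) (at-ℓ e)) big≤ λ S →
      put= S refl refl (≤-trans (n≤ I) (r≤limit I)) λ S →
      put= S refl refl (≤-trans (m≤ I) (r≤limit I)) λ S →
      put= S refl (at-src e) (fin≤ (src e) (n≤ I)) λ S →
      put= S refl (at-tgt e) (fin≤ (tgt e) (n≤ I)) λ S →
      seq⨾ (copy-exec S refl) λ {s₁} S₁ F₁ (header₁ , copied) →
      call⨾ S₁ (slice-⊒ _ (lengths-⊒ {ℓ} {positive} header refl (λ i i< → trans (header₁ i i<) (headers i i<)) (copied-lengths {arrays s₁ 1} {ys = bits F ++ toℕ e ∷ []} copied))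
          (trans (cong (4 +_) (reg F₁ 3)) (sym (length-query {ℓ} {positive} header refl))))
        c (λ { _ refl _ → d≤ ∷ [] }) λ { _ refl S →
      seq⨾ (set-exec {w = w} S (reg F₁ 1) (copied-lengths {arrays s₁ 1} {ys = bits F ++ toℕ e ∷ []} copied)
              (λ f {s₂} S₂ F₂ r₄ → _ , new-length f {s₂} (trans (arr F₂ 0) (arr F₁ 0)) (trans (reg F₂ 2) (reg F₁ 2)) (trans (reg F₂ 6) (reg F₁ 6)) r₄) w≤)
        λ {s₂} S₂ F₂ (header₂ , lengths) →
      call⨾ S₂ (slice-⊒ _ (lengths-⊒ {w} {w-pos} header refl (λ i i< → trans (header₂ i i<) (trans (header₁ i i<) (headers i i<))) lengths)
          (trans (cong (4 +_) (trans (reg F₂ 3) (reg F₁ 3))) (sym (length-query {w} {w-pos} header refl))))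
        c′ (λ { _ refl _ → d′≤ ∷ [] }) λ { _ refl S →
      put= S refl (cong₂ (λ a b → 1 ∸ (a 3 * d′ ∸ a 2 * b 0)) (trans (arr F₂ 0) (arr F₁ 0)) (arr F₂ 2)) (≤-trans (m∸n≤m 1 (den I * d′ ∸ num I * d)) (≤-trans (s≤s z≤n) (7≤limit I))) λ S →
      assign= S refl (≤-trans (s≤s z≤n) (7≤limit I)) λ S →
      skipE S (verdict (fits-bit I d′ d) , ≤-refl) } }
      where
      headers : ∀ {a : ℕ → ℕ} i → i < 4 → update (update (update (update a 0 n) 1 m) 2 (toℕ (src e))) 3 (toℕ (tgt e)) i ≡ cell header i
      headers 0 _ = refl
      headers 1 _ = refl
      headers 2 _ = refl
      headers 3 _ = refl
      headers (suc (suc (suc (suc i)))) (s≤s (s≤s (s≤s (s≤s ()))))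
      verdict : ∀ {b} → (b ≡ 1 × Fits I d′ d) ⊎ (b ≡ 0 × ¬ Fits I d′ d) → Verdict (Detour I (_∈ˢ F) e) (b ∷ [])
      verdict (inj₁ (refl , fits)) = inj₁ (refl , Equivalence.to (fits⇔detour dist dist′) fits)
      verdict (inj₂ (refl , ¬fits)) = inj₂ (refl , ¬fits ∘ Equivalence.from (fits⇔detour dist dist′))

  detour-calls : Calls W detour input (Verdict (Detour I (_∈ˢ F) e)) (S n m + S n m + m * 92 + 102)
  detour-calls with call-spsp ℓ positive (λ f → ≤-trans (ℓ≤ I f) (r≤limit I)) | call-spsp w w-pos w≤
  ... | d , dist , c | d′ , dist′ , c′ with toCalls (detour-exec dist dist′ c c′)
  ...   | ys , t , run , v , t≤ = ys , t , run , v , ≤-trans t≤ (≤-reflexive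
      (trans (cong (λ l → l + detour-time dist dist′ c c′ + 1) length-input) (total (S n m) m)))
    where
    total : ∀ x m → 5 + m * 3 + (m + 1) + (53 + ((2 + (m * 3 * (9 + 8) + 4)) + (4 + (x + 2) + ((2 + (m * (9 + 20 + 8) + 4)) +
              (4 + (x + 2) + 18))))) + 1 ≡ x + x + m * 92 + 102
    total = solve-∀

-- Nontrivial edges from second shortest paths.

-- Erasing loops never lengthens a walk, so the minimum over simple walks is the distance.
two-shortest-dist : ∀ G {u v d₁ d₂} → IsTwoShortest G u v d₁ d₂ → IsDist G ⊤ u v d₁
two-shortest-dist G (P , _ , refl , min , _) = (P , Walks.within-⊤ G P , refl) , λ Q _ → case Walks.erase-loops G Q of λ where
  (Q′ , s , _ , le) → ≤-trans (min Q′ s) le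

module SecondPaths (I : Instance) where
  open Instance I
  open Walks graph

  start∈ : ∀ {u v} (P : Walk graph u v) → u ∈ vertices P
  start∈ stop         = here refl
  start∈ (step _ _ _) = here refl

  end∈ : ∀ {u v} (P : Walk graph u v) → v ∈ vertices P
  end∈ stop         = here refl
  end∈ (step _ _ P) = there (end∈ P)

  other-end : ∀ {e u v w} → Joins e u v → Joins e u w → v ≡ w
  other-end {e} (inj₁ p) (inj₁ q) = cong proj₂ (trans (sym p) q)
  other-end {e} (inj₂ p) (inj₂ q) = cong proj₁ (trans (sym p) q)
  other-end {e} (inj₁ p) (inj₂ q) = contradiction (trans (cong proj₁ p) (sym (cong proj₂ q))) (loopless e)
  other-end {e} (inj₂ p) (inj₁ q) = contradiction (trans (cong proj₁ q) (sym (cong proj₂ p))) (loopless e)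

  joins-either : ∀ {e u v a b} → Joins e u v → Joins e a b → u ≡ a ⊎ u ≡ b
  joins-either (inj₁ p) (inj₁ q) = inj₁ (cong proj₁ (trans (sym p) q))
  joins-either (inj₁ p) (inj₂ q) = inj₂ (cong proj₁ (trans (sym p) q))
  joins-either (inj₂ p) (inj₁ q) = inj₂ (cong proj₂ (trans (sym p) q))
  joins-either (inj₂ p) (inj₂ q) = inj₁ (cong proj₂ (trans (sym p) q))

  ends∈ : ∀ {u v e a b} (P : Walk graph u v) → e ∈ edges P → Joins e a b → a ∈ vertices P
  ends∈ (step e j P) (here refl) ab = case joins-either ab j of λ where
    (inj₁ refl) → here refl
    (inj₂ refl) → there (start∈ P)
  ends∈ (step e j P) (there e∈) ab = there (ends∈ P e∈ ab)

  -- If the edge came later, the walk would return to its start; if the walk went on after it, it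
  -- would return to its end.
  simple-edge : ∀ {u v e} (P : Walk graph u v) → Simple P → Joins e u v → e ∈ edges P → edges P ≡ e ∷ []
  simple-edge (step e j P) (u∉ ∷ s) uv (there e∈) = contradiction refl (All.lookup u∉ (ends∈ P e∈ uv))
  simple-edge (step e j P) (u∉ ∷ s) uv (here refl) with other-end uv j | P | s
  ... | refl | stop         | _        = refl
  ... | refl | step _ _ P′  | v∉ ∷ _   = contradiction refl (All.lookup v∉ (end∈ P′))

  edge-simple : ∀ e → Simple (edgeʷ e)
  edge-simple e = (loopless e ∷ []) ∷ [] ∷ []

  nonempty : ∀ {u v} → u ≢ v → (P : Walk graph u v) → 1 ≤ len P
  nonempty u≢v stop         = contradiction refl u≢v
  nonempty u≢v (step e j P) = ≤-trans (positive e) (m≤m+n (ℓ e) (len P))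

  -- A simple walk visits each vertex at most once. This bounds the reported second length, for
  -- which no edge offers a comparison.
  simple-len : ∀ {u v} (P : Walk graph u v) → Simple P → len P ≤ n * r I
  simple-len P s = ≤-trans (go P) (*-monoˡ-≤ (r I) vertices≤)
    where
    vertices≤ : length (vertices P) ≤ n
    vertices≤ = subst (length (vertices P) ≤_) (length-tabulate {A = Fin n} id) (length-⊆ {ys = allFin n} s λ _ → ∈-allFin _)
    go : ∀ {u v} (P : Walk graph u v) → len P ≤ length (vertices P) * r I
    go stop         = z≤n
    go (step e j P) = +-mono-≤ (ℓ≤ I e) (go P)

  edge≤ : ∀ {u v e} (P : Walk graph u v) → e ∈ edges P → ℓ e ≤ len P
  edge≤ (step e j P) (here refl) = m≤m+n (ℓ e) (len P)
  edge≤ (step f j P) (there e∈)  = ≤-trans (edge≤ P e∈) (m≤n+m (len P) (ℓ f))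

  d₁≤ℓ : ∀ {e d₁ d₂} → IsTwoShortest graph (src e) (tgt e) d₁ d₂ → d₁ ≤ ℓ e
  d₁≤ℓ {e} {d₁} two = subst (d₁ ≤_) (len-edgeʷ e) (proj₂ (two-shortest-dist graph two) (edgeʷ e) (within-⊤ (edgeʷ e)))

  d₂≤ : ∀ {e d₁ d₂} → IsTwoShortest graph (src e) (tgt e) d₁ d₂ → d₂ ≤ n * r I
  d₂≤ two with two
  ... | _ , _ , _ , _ , inj₁ (refl , _)              = z≤n
  ... | _ , _ , _ , _ , inj₂ (Q , s , _ , refl , _) = simple-len Q s

  -- The length of a shortest alternative path, or 0 if there is none.
  Second : Fin m → ℕ → ℕ → ℕ → Set
  Second e d₁ d₂ a = (d₁ < ℓ e × a ≡ d₁) ⊎ (ℓ e ≤ d₁ × a ≡ d₂)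

  -- If the distance is below the length of e, a shortest path cannot contain e. Otherwise e is
  -- itself a shortest path. If there is no second path, e is the only simple path. If there is one,
  -- any alternative is at least as long as the second path or, if it coincides with the first,
  -- shows that the second is no longer than e. Conversely, by `simple-edge` at most one of the two
  -- paths uses e. The condition 1 ≤ a excludes the value 0 that signals a missing second path.
  removable⇔ : ∀ {e d₁ d₂ a} → IsTwoShortest graph (src e) (tgt e) d₁ d₂ → Second e d₁ d₂ a →
    Removable I e ⇔ (1 ≤ a × Fits I a d₁)
  removable⇔ {e} two@(P , sP , refl , _) (inj₁ (d₁< , refl)) = mk⇔ (λ _ → nonempty (loopless e) P , fits-refl I (len P))
    λ _ → P , All.tabulate (λ { f∈ refl → <⇒≱ d₁< (edge≤ P f∈) }) , short-dist I {P = P} (two-shortest-dist graph two) (fits-refl I (len P))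
  removable⇔ {e} (P , sP , refl , min , inj₁ (refl , unique)) (inj₂ (_ , refl)) = mk⇔ (λ (Q , avoids , _) → case erase-loops Q of λ where
      (Q′ , s , sub , _) → contradiction (All.lookup avoids (sub (subst (e ∈_) (trans (unique (edgeʷ e) (edge-simple e)) (sym (unique Q′ s))) (here refl)))) (λ e≢e → e≢e refl))
    λ { (() , _) }
  removable⇔ {e} two@(P , sP , refl , min , inj₂ (Q , sQ , Q≢P , refl , min₂)) (inj₂ (ℓ≤d₁ , refl)) = mk⇔
    (λ r → nonempty (loopless e) Q , to r) (λ (_ , fits) → from fits)
    where
    to : Removable I e → Fits I (len Q) (len P)
    to (R , avoids , short) with erase-loops R
    ... | R′ , s , sub , le with ≡-dec Fin._≟_ (edges R′) (edges P)
      where open import Data.List.Properties using (≡-dec)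
    ...   | no R≢P = fits-mono I (≤-trans (min₂ R′ s R≢P) le) ≤-refl (dist-short I {P = R} (two-shortest-dist graph two) short)
    ...   | yes R≡P = fits-mono I (≤-trans (min₂ (edgeʷ e) (edge-simple e) edge≢P) (≤-trans (≤-reflexive (len-edgeʷ e)) ℓ≤d₁)) ≤-refl (fits-refl I (len P))
      where
      edge≢P : edges (edgeʷ e) ≢ edges P
      edge≢P eq = All.lookup avoids (sub (subst (e ∈_) (trans eq (sym R≡P)) (here refl))) refl
    from : Fits I (len Q) (len P) → Removable I e
    from fits with Any.any? (e Fin.≟_) (edges Q)
    ... | no e∉Q = Q , All.tabulate (λ { f∈ refl → e∉Q f∈ }) , short-dist I {P = Q} (two-shortest-dist graph two) fits
    ... | yes e∈Q = P , All.tabulate (λ { f∈ refl → Q≢P (trans (simple-edge Q sQ (joins-ends e) e∈Q) (sym (simple-edge P sP (joins-ends e) f∈))) }) ,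
                    short-dist I {P = P} (two-shortest-dist graph two) (fits-refl I (len P))

module PrepareProgram (apsp : Program) where
  position newLength : Exp
  position = lit 2 ⊛ ((get 0 (lit 5 ⊕ (var 4 ⊛ lit 3)) ⊛ get 0 (lit 0)) ⊕ get 0 (lit 6 ⊕ (var 4 ⊛ lit 3)))
  newLength = (get 0 (lit 7 ⊕ (var 4 ⊛ lit 3)) ⊛ (lit 1 ⊝ get 2 (var 4))) ⊕ (var 6 ⊛ get 2 (var 4))

  -- A first all-pairs query yields the candidates. A second one, with all candidates made
  -- unaffordably long, tells whether they can be removed together. The answers go to arrays 8 and
  -- 9, since the size of their entries is not controlled; only the entries for pairs joined by an
  -- edge are read.
  total flag contrast judge prepare : Program
  total = 6 ≔ var 6 ⊕ get 0 (lit 7 ⊕ (var 4 ⊛ lit 3)) ⨟ skip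

  flag =
    7 ≔ position ⨟
    8 ≔ get 8 (var 7) ⨟
    ite (get 0 (lit 7 ⊕ (var 4 ⊛ lit 3)) ⊝ var 8) (9 ≔ var 8 ⨟ skip) (9 ≔ get 8 (lit 1 ⊕ var 7) ⨟ skip) ⨟
    put 2 (var 4) ((lit 1 ⊝ (lit 1 ⊝ var 9)) ⊛ (lit 1 ⊝ ((get 0 (lit 3) ⊛ var 9) ⊝ (get 0 (lit 2) ⊛ var 8)))) ⨟
    skip

  contrast =
    7 ≔ position ⨟
    5 ≔ var 5 ⊛ (lit 1 ⊝ ((get 0 (lit 3) ⊛ get 9 (var 7)) ⊝ (get 0 (lit 2) ⊛ get 8 (var 7)))) ⨟
    skip

  prepare =
    1 ≔ get 0 (lit 1) ⨟
    3 ≔ var 1 ⊛ lit 3 ⨟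
    put 1 (lit 0) (get 0 (lit 0)) ⨟
    put 1 (lit 1) (var 1) ⨟
    copyEdges 2 ⨟
    call 8 apsp 1 (lit 2 ⊕ var 3) ⨟
    6 ≔ lit 0 ⨟
    for 4 1 total ⨟
    6 ≔ lit 1 ⊕ (get 0 (lit 2) ⊛ var 6) ⨟
    for 4 1 flag ⨟
    judge

  judge =
    setLengths 2 newLength ⨟
    call 9 apsp 1 (lit 2 ⊕ var 3) ⨟
    5 ≔ lit 1 ⨟
    for 4 1 contrast ⨟
    put 0 (lit 0) (var 5) ⨟
    for 4 1 emit ⨟
    0 ≔ lit 1 ⊕ var 1 ⨟
    skip

module PrepareSpec (I : Instance) (W : ℕ) (capacity : limit I ^ 16 ≤ W) (apsp : Program) (A : ℕ → ℕ → ℕ) (K : ℕ)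
  (solves : ∀ x W → room (Problem.encode AllPairsTwoShortestPaths x) ^ K ≤ W →
     ∃[ ys ] ∃[ t ] Runs W apsp (Problem.encode AllPairsTwoShortestPaths x) ys t ×
       Problem.Correct AllPairsTwoShortestPaths x ys × t ≤ A (Graph.n (proj₁ x)) (Graph.m (proj₁ x)))
  (roomy : ∀ {xs} → length xs ≤ limit I → All (_≤ limit I) xs → room xs ^ K ≤ W) where

  open Instance I
  open Logic (limit I) W (7≤limit I) capacity
  open PrepareProgram apsp
  open Edges I W capacity 2 _
  open Emission I W capacity
  open Walks graph
  open SecondPaths I
  open Layout (layout₀ I)

  fin≤ : ∀ {k} (x : Fin k) → k ≤ r I → toℕ x ≤ limit I
  fin≤ x k≤ = ≤-trans (<⇒≤ (Fin.toℕ<n x)) (≤-trans k≤ (r≤limit I))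

  header : List ℕ
  header = n ∷ m ∷ []

  record Two (w : Fin m → ℕ) (pos : ∀ e → 1 ≤ w e) (ys : List ℕ) : Set where
    field
      pairs : ∀ (u v : Fin n) → u ≢ v → IsTwoShortest (reweight graph w pos) u v
                (cell ys (2 * (toℕ u * n + toℕ v))) (cell ys (1 + 2 * (toℕ u * n + toℕ v)))
  open Two

  call-apsp : ∀ w (pos : ∀ e → 1 ≤ w e) → (∀ f → w f ≤ limit I) →
    Calls W apsp (header ++ encodeEdges (reweight graph w pos)) (Two w pos) (A n m)
  call-apsp w pos w≤ with solves (reweight graph w pos , λ u v → Reweighted.to′ graph w pos (connected u v)) W (roomy
    (≤-trans (≤-reflexive (length-query {w} {pos} header refl)) (≤-trans (≤-trans (+-monoˡ-≤ (m * 3) (s≤s (s≤s z≤n))) (base≤ I)) (r≤limit I)))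
    (≤-trans (n≤ I) (r≤limit I) ∷ ≤-trans (m≤ I) (r≤limit I) ∷
      triples-≤ (toℕ ∘ src) (toℕ ∘ tgt) w id (λ f → fin≤ (src f) (n≤ I)) (λ f → fin≤ (tgt f) (n≤ I)) w≤))
  ... | ys , t , runs , ok , t≤ = ys , t , runs , record { pairs = ok } , t≤

  pos-of : Fin m → ℕ
  pos-of f = 2 * (toℕ (src f) * n + toℕ (tgt f))

  pos-of≤ : ∀ f → pos-of f ≤ limit I
  pos-of≤ f = ≤-trans (*-mono-≤ (≤-trans (s≤s (s≤s z≤n)) (7≤r I))
    (+≤^ I {_} {_} {2} {1} (s≤s z≤n) ≤-refl (prod≤ I (≤-trans (<⇒≤ (Fin.toℕ<n (src f))) (n≤ I)) (n≤ I))
      (≤-trans (≤-trans (<⇒≤ (Fin.toℕ<n (tgt f))) (n≤ I)) (≤-reflexive (sym (^-identityʳ (r I))))))) (r^≤ I {4} ≤-refl)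

  position-eval : ∀ f {s} → arrays s 0 ≡ cell (enc I) → regs s 4 ≡ toℕ f → eval position s ≡ pos-of f
  position-eval f a₀ r₄ rewrite a₀ | r₄ = cong₂ (λ a b → 2 * (a * n + b)) (at-src f) (at-tgt f)

  total-exec : ∀ {s} → Small s → regs s 1 ≡ m → regs s 6 ≡ 0 → arrays s 0 ≡ cell (enc I) →
    Exec (for 4 1 total) s (λ s′ → regs s′ 6 ≤ r I * r I × (∀ f → ℓ f ≤ regs s′ 6)) (2 + (m * (10 + 8) + 4))
  total-exec {s} S r₁ r₆ a₀ = weaken (λ _ _ (le , ge) → ≤-trans le (*-monoˡ-≤ (r I) (m≤ I)) , λ f → ge f (Fin.toℕ<n f)) ≤-refl
    (forE Inv S r₁ (≤-reflexive r₆ , λ _ ()) body)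
    where
    Inv : ℕ → State → Set
    Inv j s = regs s 6 ≤ j * r I × (∀ f → toℕ f < j → ℓ f ≤ regs s 6)
    body : ∀ j s₁ → j < m → Small s₁ → Frame _ s s₁ → regs s₁ 4 ≡ j → regs s₁ 1 ≡ m → Inv j s₁ →
           Exec total s₁ (λ s₂ → Inv (suc j) (setReg 4 (suc j) s₂)) 10
    body j s₁ j< S₁ F r₄ _ (le , ge) = assign= S₁ refl (≤-trans next≤ (≤-trans (prod≤ I (≤-trans j< (m≤ I)) ≤-refl) (r^≤ I {2} (s≤s (s≤s z≤n))))) λ S →
      skipE S (next≤ , ge′)
      where
      e = Fin.fromℕ< j<
      e≡ = Fin.toℕ-fromℕ< j<
      x≡ : arrays s₁ 0 (7 + regs s₁ 4 * 3) ≡ ℓ e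
      x≡ = trans (cong₂ (λ a k → a (7 + k * 3)) (trans (arr F 0) a₀) (trans r₄ (sym e≡))) (at-ℓ e)
      next≤ : regs s₁ 6 + arrays s₁ 0 (7 + regs s₁ 4 * 3) ≤ suc j * r I
      next≤ = ≤-trans (+-mono-≤ le (≤-trans (≤-reflexive x≡) (ℓ≤ I e))) (≤-reflexive (+-comm (j * r I) (r I)))
      ge′ : ∀ f → toℕ f < suc j → ℓ f ≤ regs s₁ 6 + arrays s₁ 0 (7 + regs s₁ 4 * 3)
      ge′ f f< with f Fin.≟ e
      ... | yes refl = ≤-trans (≤-reflexive (sym x≡)) (m≤n+m _ (regs s₁ 6))
      ... | no f≢e   = ≤-trans (ge f (≤∧≢⇒< (≤-pred f<) λ f≡j → f≢e (Fin.toℕ-injective (trans f≡j (sym e≡))))) (m≤m+n _ _)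

  -- One length that is unaffordable for all pairs at once: σ is the total edge length and bounds
  -- every single edge.
  big : ℕ → ℕ
  big σ = 1 + num I * σ

  big≤ : ∀ {σ} → σ ≤ r I * r I → big σ ≤ limit I
  big≤ {σ} σ≤ = ≤-trans (+≤^ I {1} {num I * σ} {1} {3} ≤-refl (s≤s z≤n) (≤-trans (≤-trans (s≤s z≤n) (7≤r I)) (≤-reflexive (sym (^-identityʳ (r I)))))
    (≤-trans (*-mono-≤ (num≤ I) σ≤) (≤-reflexive (cong (λ x → r I * (r I * x)) (sym (*-identityʳ (r I))))))) (r^≤ I {4} ≤-refl)

  module _ {ys : List ℕ} (two : Two ℓ positive ys) where

    D₁ D₂ : Fin m → ℕ
    D₁ f = cell ys (pos-of f)
    D₂ f = cell ys (1 + pos-of f)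

    two-at : ∀ f → IsTwoShortest graph (src f) (tgt f) (D₁ f) (D₂ f)
    two-at f = pairs two (src f) (tgt f) (loopless f)

    D₁≤ : ∀ f → D₁ f ≤ limit I
    D₁≤ f = ≤-trans (d₁≤ℓ (two-at f)) (≤-trans (ℓ≤ I f) (r≤limit I))

    D₂≤ : ∀ f → D₂ f ≤ limit I
    D₂≤ f = ≤-trans (d₂≤ (two-at f)) (≤-trans (prod≤ I (n≤ I) ≤-refl) (r^≤ I {2} (s≤s (s≤s z≤n))))

    flag-bit : ∀ {a d} → ∃[ b ] (1 ∸ (1 ∸ a)) * (1 ∸ (den I * a ∸ num I * d)) ≡ bit b × (b ≡ true ⇔ (1 ≤ a × Fits I a d))
    flag-bit {zero} = false , refl , mk⇔ (λ ()) λ { (() , _) }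
    flag-bit {suc a} {d} with fits-bit I (suc a) d
    ... | inj₁ (eq , fits)  rewrite eq | 0∸n≡0 a = true , refl , mk⇔ (λ _ → s≤s z≤n , fits) λ _ → refl
    ... | inj₂ (eq , ¬fits) rewrite eq | 0∸n≡0 a = false , refl , mk⇔ (λ ()) λ (_ , fits) → contradiction fits ¬fits

    Flagged : ℕ → State → Set
    Flagged j s = ∀ f → toℕ f < j → ∃[ b ] arrays s 2 (toℕ f) ≡ bit b × (b ≡ true ⇔ Removable I f)

    flag-exec : ∀ {s} → Small s → regs s 1 ≡ m → arrays s 0 ≡ cell (enc I) → arrays s 8 ≡ cell ys →
      Exec (for 4 1 flag) s (Flagged m) (2 + (m * (57 + 8) + 4))
    flag-exec {s} S r₁ a₀ a₈ = forE Flagged S r₁ (λ _ ()) body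
      where
      body : ∀ j s₁ → j < m → Small s₁ → Frame (for 4 1 flag) s s₁ → regs s₁ 4 ≡ j → regs s₁ 1 ≡ m → Flagged j s₁ →
             Exec flag s₁ (λ s₂ → Flagged (suc j) (setReg 4 (suc j) s₂)) 57
      body j s₁ j< S₁ F r₄ _ flagged =
        assign= S₁ (position-eval e {s₁} a₀′ r₄′) (pos-of≤ e) λ S →
        assign= S {_ , (_ , subst (_≤ limit I) (sym d₁≡) (D₁≤ e))} d₁≡ (D₁≤ e) λ S →
        seq⨾ (choose S refl refl r₄′ a₀′ (trans (arr F 8) a₈) (D₁ e <? ℓ e)) λ {s₂} S F₂ second → record-bit S (reg F₂ 8) (trans (reg F₂ 4) r₄′)
          (trans (arr F₂ 0) a₀′) (λ i → cong (_$ i) (arr F₂ 2)) second flag-bit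
        where
        e = Fin.fromℕ< j<
        e≡ = Fin.toℕ-fromℕ< j<
        r₄′ = trans r₄ (sym e≡)
        a₀′ = trans (arr F 0) a₀
        d₁≡ : arrays s₁ 8 (pos-of e) ≡ D₁ e
        d₁≡ = cong (_$ pos-of e) (trans (arr F 8) a₈)
        choose : ∀ {s₂} → Small s₂ → regs s₂ 8 ≡ D₁ e → regs s₂ 7 ≡ pos-of e → regs s₂ 4 ≡ toℕ e → arrays s₂ 0 ≡ cell (enc I) →
          arrays s₂ 8 ≡ cell ys → Dec (D₁ e < ℓ e) →
          Exec (ite (get 0 (lit 7 ⊕ (var 4 ⊛ lit 3)) ⊝ var 8) (9 ≔ var 8 ⨟ skip) (9 ≔ get 8 (lit 1 ⊕ var 7) ⨟ skip)) s₂
            (λ s → Second e (D₁ e) (D₂ e) (regs s 9)) 15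
        choose {s₂} S₂ r₈ r₇ r₄ a₀ a₈ dec = decide dec
          where
          gap : arrays s₂ 0 (7 + regs s₂ 4 * 3) ∸ regs s₂ 8 ≡ ℓ e ∸ D₁ e
          gap = cong₂ _∸_ (trans (cong₂ (λ a k → a (7 + k * 3)) a₀ r₄) (at-ℓ e)) r₈
          d₂≡ : arrays s₂ 8 (1 + regs s₂ 7) ≡ D₂ e
          d₂≡ = cong₂ (λ a k → a (1 + k)) a₈ r₇
          decide : Dec (D₁ e < ℓ e) → _
          decide (yes d<) = weaken (λ _ _ q → q) (m≤m+n 12 3) (iteThen S₂ (λ z → m>n⇒m∸n≢0 d< (trans (sym gap) z))
            (assign= S₂ r₈ (D₁≤ e) λ S → skipE S (inj₁ (d< , refl))))
          decide (no d≮)  = iteElse S₂ (trans gap (m≤n⇒m∸n≡0 (≮⇒≥ d≮)))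
            (assign= S₂ {_ , (_ , subst (_≤ limit I) (sym d₂≡) (D₂≤ e))} d₂≡ (D₂≤ e) λ S → skipE S (inj₂ (≮⇒≥ d≮ , refl)))
        record-bit : ∀ {s₂} → Small s₂ → regs s₂ 8 ≡ D₁ e → regs s₂ 4 ≡ toℕ e → arrays s₂ 0 ≡ cell (enc I) → (∀ i → arrays s₂ 2 i ≡ arrays s₁ 2 i) →
          Second e (D₁ e) (D₂ e) (regs s₂ 9) →
          ∃[ b ] (1 ∸ (1 ∸ regs s₂ 9)) * (1 ∸ (den I * regs s₂ 9 ∸ num I * D₁ e)) ≡ bit b × (b ≡ true ⇔ (1 ≤ regs s₂ 9 × Fits I (regs s₂ 9) (D₁ e))) →
          Exec _ s₂ (λ s₂ → Flagged (suc j) (setReg 4 (suc j) s₂)) 20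
        record-bit {s₂} S r₈ r₄ a₀ a₂ second (b , b≡ , b⇔) =
          put= S r₄ (trans (cong₂ (λ a d → (1 ∸ (1 ∸ regs s₂ 9)) * (1 ∸ (a 3 * regs s₂ 9 ∸ a 2 * d))) a₀ r₈) b≡)
            (≤-trans (bit≤1 b) (≤-trans (s≤s z≤n) (7≤limit I))) λ S → skipE S flagged′
          where
          flagged′ : ∀ f → toℕ f < suc j → ∃[ c ] update (arrays s₂ 2) (toℕ e) (bit b) (toℕ f) ≡ bit c × (c ≡ true ⇔ Removable I f)
          flagged′ f f< with f Fin.≟ e
          ... | yes refl = b , update-≡ (arrays s₂ 2) {toℕ f} (bit b) refl ,
                mk⇔ (Equivalence.from (removable⇔ (two-at f) second) ∘ Equivalence.to b⇔) (Equivalence.from b⇔ ∘ Equivalence.to (removable⇔ (two-at f) second))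
          ... | no f≢e with flagged f (≤∧≢⇒< (≤-pred f<) λ f≡j → f≢e (Fin.toℕ-injective (trans f≡j (sym e≡))))
          ...   | c , c≡ , c⇔ = c , trans (update-≢ (arrays s₂ 2) (bit b) (f≢e ∘ sym ∘ Fin.toℕ-injective)) (trans (a₂ _) c≡) , c⇔

    module _ {σ : ℕ} (σ≤ : σ ≤ r I * r I) (ℓ≤σ : ∀ f → ℓ f ≤ σ) {X : Subset m} (X⇔ : ∀ f → Vec.lookup X f ≡ true ⇔ Removable I f) where

      w : Fin m → ℕ
      w f = if Vec.lookup X f then big σ else ℓ f

      w-pos : ∀ f → 1 ≤ w f
      w-pos f with Vec.lookup X f
      ... | true  = s≤s z≤n
      ... | false = positive f

      w≤ : ∀ f → w f ≤ limit I
      w≤ f with Vec.lookup X f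
      ... | true  = big≤ σ≤
      ... | false = ≤-trans (ℓ≤ I f) (r≤limit I)

      w-same : ∀ f → ¬ Removable I f → w f ≡ ℓ f
      w-same f ¬r with Vec.lookup X f in eq
      ... | true  = contradiction (Equivalence.to (X⇔ f) eq) ¬r
      ... | false = refl

      w-big : ∀ e {f} → Removable I f → num I * ℓ e < w f
      w-big e {f} r = ≤-trans (s≤s (*-monoʳ-≤ (num I) (ℓ≤σ e))) (≤-reflexive (sym (cong (λ b → if b then big σ else ℓ f) (Equivalence.from (X⇔ f) r))))

      new-length : ∀ f {s₁} → arrays s₁ 0 ≡ cell (enc I) → arrays s₁ 2 (toℕ f) ≡ bit (Vec.lookup X f) → regs s₁ 6 ≡ big σ → regs s₁ 4 ≡ toℕ f →
                   eval newLength s₁ ≡ w f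
      new-length f a₀ a₂ r₆ r₄ rewrite a₀ | r₆ | r₄ | a₂ | at-ℓ f with Vec.lookup X f
      ... | true  = cong₂ _+_ (*-zeroʳ (ℓ f)) (*-identityʳ (big σ))
      ... | false = trans (cong₂ _+_ (*-identityʳ (ℓ f)) (*-zeroʳ (big σ))) (+-identityʳ (ℓ f))

      module _ {zs : List ℕ} (two′ : Two w w-pos zs) where

        D′ : Fin m → ℕ
        D′ f = cell zs (pos-of f)

        dist′ : ∀ f → IsDist (reweight graph w w-pos) ⊤ (src f) (tgt f) (D′ f)
        dist′ f = two-shortest-dist (reweight graph w w-pos) (pairs two′ (src f) (tgt f) (loopless f))

        D′≤ : ∀ f → D′ f ≤ limit I
        D′≤ f = ≤-trans (proj₂ (dist′ f) (Walks.edgeʷ (reweight graph w w-pos) f) (Walks.within-⊤ (reweight graph w w-pos) (Walks.edgeʷ (reweight graph w w-pos) f)))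
          (≤-trans (≤-reflexive (Walks.len-edgeʷ (reweight graph w w-pos) f)) (w≤ f))

        fits⇔ : ∀ f → Fits I (D′ f) (D₁ f) ⇔ Detour I (Removable I) f
        fits⇔ f = reweighted-fits I w w-pos w-same (w-big f) (two-shortest-dist graph (two-at f)) (dist′ f)

        Judged : ℕ → State → Set
        Judged j s = (regs s 5 ≡ 1 × (∀ f → toℕ f < j → Detour I (Removable I) f)) ⊎ (regs s 5 ≡ 0 × ∃[ f ] ¬ Detour I (Removable I) f)

        contrast-exec : ∀ {s} → Small s → regs s 1 ≡ m → regs s 5 ≡ 1 → arrays s 0 ≡ cell (enc I) → arrays s 8 ≡ cell ys → arrays s 9 ≡ cell zs →
          Exec (for 4 1 contrast) s (Judged m) (2 + (m * (36 + 8) + 4))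
        contrast-exec {s} S r₁ r₅ a₀ a₈ a₉ = forE Judged S r₁ (inj₁ (r₅ , λ _ ())) body
          where
          body : ∀ j s₁ → j < m → Small s₁ → Frame (for 4 1 contrast) s s₁ → regs s₁ 4 ≡ j → regs s₁ 1 ≡ m → Judged j s₁ →
                 Exec contrast s₁ (λ s₂ → Judged (suc j) (setReg 4 (suc j) s₂)) 36
          body j s₁ j< S₁ F r₄ _ judged =
            assign= S₁ (position-eval e {s₁} (trans (arr F 0) a₀) (trans r₄ (sym e≡))) (pos-of≤ e) λ S →
            assign= S {_ , (_ , (_ , ((_ , (_ , subst (_≤ limit I) (sym d′≡) (D′≤ e))) , (_ , (_ , subst (_≤ limit I) (sym d≡) (D₁≤ e))))))}
              (cong₂ (λ a k → regs s₁ 5 * (1 ∸ (a 3 * proj₁ k ∸ a 2 * proj₂ k))) (trans (arr F 0) a₀) (cong₂ _,_ d′≡ d≡))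
              (≤-trans (*-mono-≤ (judged≤ judged) (m∸n≤m 1 (den I * D′ e ∸ num I * D₁ e))) (≤-trans (s≤s z≤n) (7≤limit I))) λ S →
            skipE S (conclude judged (fits-bit I (D′ e) (D₁ e)))
            where
            e = Fin.fromℕ< j<
            e≡ = Fin.toℕ-fromℕ< j<
            d′≡ : arrays s₁ 9 (pos-of e) ≡ D′ e
            d′≡ = cong (_$ pos-of e) (trans (arr F 9) a₉)
            d≡ : arrays s₁ 8 (pos-of e) ≡ D₁ e
            d≡ = cong (_$ pos-of e) (trans (arr F 8) a₈)
            judged≤ : ∀ {A B : Set} {b} → (b ≡ 1 × A) ⊎ (b ≡ 0 × B) → b ≤ 1
            judged≤ (inj₁ (refl , _)) = ≤-refl
            judged≤ (inj₂ (refl , _)) = z≤n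
            conclude : ∀ {a b} → (a ≡ 1 × (∀ f → toℕ f < j → Detour I (Removable I) f)) ⊎ (a ≡ 0 × ∃[ f ] ¬ Detour I (Removable I) f) →
              (b ≡ 1 × Fits I (D′ e) (D₁ e)) ⊎ (b ≡ 0 × ¬ Fits I (D′ e) (D₁ e)) →
              (a * b ≡ 1 × (∀ f → toℕ f < suc j → Detour I (Removable I) f)) ⊎ (a * b ≡ 0 × ∃[ f ] ¬ Detour I (Removable I) f)
            conclude (inj₂ (refl , bad)) _ = inj₂ (refl , bad)
            conclude (inj₁ (refl , _)) (inj₂ (refl , ¬fits)) = inj₂ (refl , e , ¬fits ∘ Equivalence.from (fits⇔ e))
            conclude (inj₁ (refl , good)) (inj₁ (refl , fits)) = inj₁ (refl , λ f f< → case f Fin.≟ e of λ where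
              (yes refl) → Equivalence.to (fits⇔ f) fits
              (no f≢e)   → good f (≤∧≢⇒< (≤-pred f<) λ f≡j → f≢e (Fin.toℕ-injective (trans f≡j (sym e≡)))))

  Hard : Set
  Hard = ∃[ f ] ¬ Detour I (Removable I) f

  input-small : Small (initial (enc I))
  input-small = initial-small (All.map (λ le → ≤-trans le (r≤limit I)) (entry≤ I))
    (subst (_≤ limit I) (sym (length-enc I)) (≤-trans (base≤ I) (r≤limit I)))

  judge-exec : ∀ {ys} (two : Two ℓ positive ys) {σ} (σ≤ : σ ≤ r I * r I) (ℓ≤σ : ∀ f → ℓ f ≤ σ) {s} → Small s → regs s 1 ≡ m → regs s 3 ≡ m * 3 →
    regs s 6 ≡ big σ → arrays s 0 ≡ cell (enc I) → arrays s 8 ≡ cell ys → arrays s 9 ≡ const 0 →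
    (∀ i → i < 2 → arrays s 1 i ≡ cell header i) → Lengths ℓ (arrays s 1) →
    ∃[ X ] (∀ f → arrays s 2 (toℕ f) ≡ bit (Vec.lookup X f)) × (∀ f → Vec.lookup X f ≡ true ⇔ Removable I f) →
    Exec judge s (λ s → Prepared I Hard (output s) × regs s 0 ≤ suc m)
      ((2 + (m * (9 + 16 + 8) + 4)) + (4 + A n m + (2 + ((2 + (m * (36 + 8) + 4)) + (3 + ((2 + (m * (7 + 8) + 4)) + 5))))))
  judge-exec {ys} two {σ} σ≤ ℓ≤σ {s} S r₁ r₃ r₆ a₀ a₈ a₉ headers lengths (X , flags , X⇔) =
    seq⨾ (set-exec {w = w′} S r₁ lengths (λ f {s₁} S₁ F r₄ → _ , new-length two σ≤ ℓ≤σ {X} X⇔ f {s₁} (trans (arr F 0) a₀)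
        (trans (cong (_$ toℕ f) (arr F 2)) (flags f)) (trans (reg F 6) r₆) r₄) (w≤ two σ≤ ℓ≤σ {X} X⇔)) λ {s₁} S₁ F₁ (header₁ , lengths₁) →
    call⨾ S₁ (slice-⊒ _ (lengths-⊒ {w′} {pos′} header refl (λ i i< → trans (header₁ i i<) (headers i i<)) lengths₁)
        (trans (cong (2 +_) (trans (reg F₁ 3) r₃)) (sym (length-query {w′} {pos′} header refl))))
      (call-apsp w′ pos′ (w≤ two σ≤ ℓ≤σ {X} X⇔)) (λ _ _ ()) λ zs two′ S →
    assign= S refl (≤-trans (s≤s z≤n) (7≤limit I)) λ S →
    seq⨾ (contrast-exec two σ≤ ℓ≤σ {X} X⇔ {zs} two′ S (trans (reg F₁ 1) r₁) refl (trans (arr F₁ 0) a₀) (trans (arr F₁ 8) a₈)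
      (cong (overlay zs) (trans (arr F₁ 9) a₉))) λ {s₂} S₂ F₂ judged →
    put= S₂ refl refl (reg≤ S₂ 5) λ S →
    seq⨾ (emit-exec {X} S (trans (reg F₂ 1) (trans (reg F₁ 1) r₁)) (λ f → trans (cong (_$ toℕ f) (trans (arr F₂ 2) (arr F₁ 2))) (flags f)))
      λ {s₃} S₃ F₃ (c≡ , cells) →
    assign= S₃ (cong suc (trans (reg F₃ 1) (trans (reg F₂ 1) (trans (reg F₁ 1) r₁)))) (+≤limit I (≤-trans (s≤s z≤n) (7≤r I)) (m≤ I)) λ S →
    skipE S ((regs s₂ 5 , X , slice-⊒ (suc m) (⊒-∷ {arrays s₃ 0} c≡ (bits-⊒ X cells)) (cong suc (sym (length-bits X))) , X⇔ , verdict judged) , ≤-refl)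
    where
    w′ = w two σ≤ ℓ≤σ {X} X⇔
    pos′ = w-pos two σ≤ ℓ≤σ {X} X⇔
    verdict : ∀ {b} → (b ≡ 1 × (∀ f → toℕ f < m → Detour I (Removable I) f)) ⊎ (b ≡ 0 × Hard) →
              (b ≡ 1 × (∀ f → Removable I f → Detour I (Removable I) f)) ⊎ (b ≡ 0 × Hard)
    verdict (inj₁ (b≡ , good)) = inj₁ (b≡ , λ f _ → good f (Fin.toℕ<n f))
    verdict (inj₂ hard)        = inj₂ hard

  prepare-time : ℕ
  prepare-time = 14 + ((2 + (m * 3 * (9 + 8) + 4)) + (4 + A n m + (2 + ((2 + (m * (10 + 8) + 4)) + (7 + ((2 + (m * (57 + 8) + 4)) +
      ((2 + (m * (9 + 16 + 8) + 4)) + (4 + A n m + (2 + ((2 + (m * (36 + 8) + 4)) + (3 + ((2 + (m * (7 + 8) + 4)) + 5))))))))))))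

  prepare-exec : Exec prepare (initial (enc I)) (λ s → Prepared I Hard (output s) × regs s 0 ≤ suc m) prepare-time
  prepare-exec =
    assign= input-small refl (≤-trans (m≤ I) (r≤limit I)) λ S →
    assign= S refl (≤-trans (≤-trans (m≤n+m (m * 3) 5) (base≤ I)) (r≤limit I)) λ S →
    put= S refl refl (≤-trans (n≤ I) (r≤limit I)) λ S →
    put= S refl refl (≤-trans (m≤ I) (r≤limit I)) λ S →
    seq⨾ (copy-exec S refl) λ {s₁} S₁ F₁ (header₁ , copied) →
    call⨾ S₁ (slice-⊒ _ (lengths-⊒ {ℓ} {positive} header refl (λ i i< → trans (header₁ i i<) (headers i i<)) (lengths₁ {arrays s₁ 1} copied))
        (trans (cong (2 +_) (reg F₁ 3)) (sym (length-query {ℓ} {positive} header refl))))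
      (call-apsp ℓ positive (λ f → ≤-trans (ℓ≤ I f) (r≤limit I))) (λ _ _ ()) λ ys two S →
    assign= S refl z≤n λ S →
    seq⨾ (total-exec S (reg F₁ 1) refl (arr F₁ 0)) λ {s₂} S₂ F₂ (σ≤ , ℓ≤σ) →
    assign= S₂ (cong (λ a → 1 + a 2 * regs s₂ 6) (trans (arr F₂ 0) (arr F₁ 0))) (big≤ σ≤) λ S →
    seq⨾ (flag-exec {ys} two S (trans (reg F₂ 1) (reg F₁ 1)) (trans (arr F₂ 0) (arr F₁ 0)) (trans (arr F₂ 8) (cong (overlay ys) (arr F₁ 8)))) λ {s₃} S₃ F₃ flagged →
    judge-exec {ys} two σ≤ ℓ≤σ S₃ (trans (reg F₃ 1) (trans (reg F₂ 1) (reg F₁ 1))) (trans (reg F₃ 3) (trans (reg F₂ 3) (reg F₁ 3))) (reg F₃ 6)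
      (trans (arr F₃ 0) (trans (arr F₂ 0) (arr F₁ 0))) (trans (arr F₃ 8) (trans (arr F₂ 8) (cong (overlay ys) (arr F₁ 8))))
      (trans (arr F₃ 9) (trans (arr F₂ 9) (arr F₁ 9)))
      (λ i i< → trans (cong (_$ i) (trans (arr F₃ 1) (arr F₂ 1))) (trans (header₁ i i<) (headers i i<)))
      (subst (Lengths ℓ) (sym (trans (arr F₃ 1) (arr F₂ 1))) (lengths₁ {arrays s₁ 1} copied))
      (to-subset {P = Removable I} {arrays s₃ 2} (λ f → flagged f (Fin.toℕ<n f)))
    where
    headers : ∀ {a : ℕ → ℕ} i → i < 2 → update (update a 0 n) 1 m i ≡ cell header i
    headers 0 _ = refl
    headers 1 _ = refl
    headers (suc (suc i)) (s≤s (s≤s ()))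
    lengths₁ : ∀ {a : ℕ → ℕ} → (∀ i → i < m * 3 → a (2 + i) ≡ cell (enc I) (5 + i)) → Lengths ℓ a
    lengths₁ {a} copied = copied-lengths {a} {ys = []} λ i i< → trans (copied i i<) (cong (λ xs → cell xs (5 + i)) (sym (++-identityʳ (enc I))))

  prepare-calls : Calls W prepare (enc I) (Prepared I Hard) (A n m + A n m + m * 230 + 83)
  prepare-calls with toCalls prepare-exec
  ... | ys , t , run , ok , t≤ = ys , t , run , ok , ≤-trans t≤ (≤-reflexive
      (trans (cong (λ l → l + prepare-time + suc m) (length-enc I)) (bound (A n m) m)))
    where
    bound : ∀ x m → 5 + m * 3 + (14 + ((2 + (m * 3 * (9 + 8) + 4)) + (4 + x + (2 + ((2 + (m * (10 + 8) + 4)) + (7 + ((2 + (m * (57 + 8) + 4)) +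
      ((2 + (m * (9 + 16 + 8) + 4)) + (4 + x + (2 + ((2 + (m * (36 + 8) + 4)) + (3 + ((2 + (m * (7 + 8) + 4)) + 5))))))))))))) + suc m
      ≡ x + x + m * 230 + 83
    bound = solve-∀

-- The detour test for unit lengths by Bellman-Ford.

module BasicDetourProgram where
  relax basicDetour : Program

  pull : ℕ → ℕ → Program
  pull x y = put 1 (var x) (get 1 (var x) ⊕ (var 10 ⊛ ((get 1 (var y) ⊝ lit 1) ⊝ get 1 (var x)))) ⨟ skip

  relax =
    8 ≔ get 0 (lit 5 ⊕ (var 4 ⊛ lit 3)) ⨟
    9 ≔ get 0 (lit 6 ⊕ (var 4 ⊛ lit 3)) ⨟
    10 ≔ lit 1 ⊝ get 0 (var 2 ⊕ var 4) ⨟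
    pull 8 9 ⨟
    pull 9 8

  -- Bellman–Ford with ⌊α⌋ rounds.  The entry of a vertex is ⌊α⌋ + 1 minus its
  -- distance to the target, so that 0 means unreached.
  basicDetour =
    1 ≔ get 0 (lit 1) ⨟
    2 ≔ lit 5 ⊕ (var 1 ⊛ lit 3) ⨟
    5 ≔ get 0 (var 2 ⊕ var 1) ⨟
    6 ≔ lit 0 ⨟
    loop ((get 0 (lit 2) ⊕ lit 1) ⊝ (get 0 (lit 3) ⊛ (var 6 ⊕ lit 1))) (6 ≔ var 6 ⊕ lit 1 ⨟ skip) ⨟
    put 1 (get 0 (lit 6 ⊕ (var 5 ⊛ lit 3))) (var 6 ⊕ lit 1) ⨟
    for 7 6 (for 4 1 relax) ⨟
    put 0 (lit 0) (lit 1 ⊝ (lit 1 ⊝ get 1 (get 0 (lit 5 ⊕ (var 5 ⊛ lit 3))))) ⨟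
    0 ≔ lit 1 ⨟
    skip

module BasicDetourSpec (I : Instance) (basic : IsBasic I) (W : ℕ) (capacity : limit I ^ 16 ≤ W)
  (F : Subset (Instance.m I)) (e : Fin (Instance.m I)) where

  open Instance I
  open Logic (limit I) W (7≤limit I) capacity
  open BasicDetourProgram
  open Walks graph
  open EdgeInput I F e
  open import Data.Nat.DivMod using (m/n*n≤m; m≡m%n+[m/n]*n; m%n<n)

  κ : ℕ
  κ = num I / den I

  κ-fits : den I * κ ≤ num I
  κ-fits = subst (_≤ num I) (*-comm κ (den I)) (m/n*n≤m (num I) (den I))

  κ-max : num I < den I * suc κ
  κ-max = subst₂ _<_ (sym (m≡m%n+[m/n]*n (num I) (den I))) (*-comm (suc κ) (den I)) (+-monoˡ-< (κ * den I) (m%n<n (num I) (den I)))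

  κ≤ : κ ≤ r I
  κ≤ = ≤-trans (≤-trans (≤-reflexive (sym (+-identityʳ κ))) (≤-trans (*-monoˡ-≤ κ {1} {den I} (s≤s z≤n)) κ-fits)) (num≤ I)

  t : Fin n
  t = tgt e

  Avoids : ∀ {u v} → Walk graph u v → Set
  Avoids P = All (_∉ˢ F) (edges P)

  Sound : (ℕ → ℕ) → Set
  Sound a = ∀ x → 1 ≤ a (toℕ x) → ∃[ P ] Avoids {x} {t} P × len P + a (toℕ x) ≤ suc κ

  -- Every avoiding walk of at most ρ edges to the target is reflected in the entry of its start,
  -- and so is its extension by an unmarked edge of `X`, the edges relaxed so far in the current
  -- round. A round begins with `X` empty and ends with all edges.
  Complete : (Fin m → Set) → ℕ → (ℕ → ℕ) → Set
  Complete X ρ a = (∀ {x} (P : Walk graph x t) → Avoids P → len P ≤ ρ → suc κ ≤ a (toℕ x) + len P) ×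
    (∀ {x y} f (j : Joins f x y) (P : Walk graph y t) → X f → f ∉ˢ F → Avoids P → len P ≤ ρ → suc κ ≤ a (toℕ x) + suc (len P))

  _⊑_ : (a b : ℕ → ℕ) → Set
  a ⊑ b = ∀ i → a i ≤ b i

  complete-⊑ : ∀ {X ρ a b} → a ⊑ b → Complete X ρ a → Complete X ρ b
  complete-⊑ a⊑b (c , c′) = (λ P av le → ≤-trans (c P av le) (+-monoˡ-≤ _ (a⊑b _))) ,
    λ f j P Xf f∉ av le → ≤-trans (c′ f j P Xf f∉ av le) (+-monoˡ-≤ _ (a⊑b _))

  -- The maximum of `a` and `c` for an unmarked edge and `a` for a marked one, computed without a
  -- branch.
  join : ℕ → Bool → ℕ → ℕ
  join a b c = a + (1 ∸ bit b) * (c ∸ a)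

  join-cases : ∀ a b c → join a b c ≡ a ⊎ (b ≡ false × join a b c ≡ c)
  join-cases a true  c = inj₁ (+-identityʳ a)
  join-cases a false c with ≤-total a c
  ... | inj₁ a≤c = inj₂ (refl , trans (cong (a +_) (+-identityʳ (c ∸ a))) (m+[n∸m]≡n a≤c))
  ... | inj₂ c≤a = inj₁ (trans (cong (a +_) (trans (+-identityʳ (c ∸ a)) (m≤n⇒m∸n≡0 c≤a))) (+-identityʳ a))

  join-≥ : ∀ a c → c ≤ join a false c
  join-≥ a c = ≤-trans (m≤n+m∸n c a) (≤-reflexive (cong (a +_) (sym (+-identityʳ (c ∸ a)))))

  pulled : (ℕ → ℕ) → Fin m → Fin n → Fin n → ℕ → ℕ
  pulled a f x y = update a (toℕ x) (join (a (toℕ x)) (Vec.lookup F f) (a (toℕ y) ∸ 1))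

  pulled-⊑ : ∀ a f x y → a ⊑ pulled a f x y
  pulled-⊑ a f x y i with update-cases a (toℕ x) (join (a (toℕ x)) (Vec.lookup F f) (a (toℕ y) ∸ 1)) i
  ... | inj₁ (refl , eq) = ≤-trans (m≤m+n (a (toℕ x)) _) (≤-reflexive (sym eq))
  ... | inj₂ (_ , eq)    = ≤-reflexive (sym eq)

  pulled-sound : ∀ {a f x y} → Joins f x y → Sound a → Sound (pulled a f x y)
  pulled-sound {a} {f} {x} {y} j sound z 1≤ with z Fin.≟ x
  ... | no z≢x = subst (λ b → ∃[ P ] Avoids {z} {t} P × len P + b ≤ suc κ) (sym at-z) (sound z (subst (1 ≤_) at-z 1≤))
    where
    at-z : pulled a f x y (toℕ z) ≡ a (toℕ z)
    at-z = update-≢ a _ (z≢x ∘ sym ∘ Fin.toℕ-injective)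
  ... | yes refl = use (join-cases (a (toℕ x)) (Vec.lookup F f) (a (toℕ y) ∸ 1))
    where
    at-z : pulled a f x y (toℕ x) ≡ join (a (toℕ x)) (Vec.lookup F f) (a (toℕ y) ∸ 1)
    at-z = update-≡ a {toℕ x} _ refl
    use : _ → ∃[ P ] Avoids {x} {t} P × len P + pulled a f x y (toℕ x) ≤ suc κ
    use (inj₁ old) = subst (λ b → ∃[ P ] Avoids {x} {t} P × len P + b ≤ suc κ) (sym (trans at-z old)) (sound x (subst (1 ≤_) (trans at-z old) 1≤))
    use (inj₂ (unmarked , new)) with sound y (≤-trans (subst (1 ≤_) (trans at-z new) 1≤) (m∸n≤m (a (toℕ y)) 1))
    ... | P , avoids , le = step f j P , ((λ f∈ → case trans (sym unmarked) (Vec.[]=⇒lookup f∈) of λ ()) ∷ avoids) ,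
          ≤-trans (≤-reflexive (trans (cong₂ (λ l b → l + len P + b) (basic f) (trans at-z new)) (trans (sym (+-suc (len P) _)) (cong (len P +_) (m+[n∸m]≡n positive-y))))) le
      where
      positive-y : 1 ≤ a (toℕ y)
      positive-y = ≤-trans (subst (1 ≤_) (trans at-z new) 1≤) (m∸n≤m (a (toℕ y)) 1)

  pulled-reaches : ∀ {a f x y} → f ∉ˢ F → a (toℕ y) ≤ suc (pulled a f x y (toℕ x))
  pulled-reaches {a} {f} {x} {y} f∉ with Vec.lookup F f in eq
  ... | true  = contradiction (Vec.lookup⇒[]= f F eq) f∉
  ... | false = ≤-trans (m≤n+m∸n (a (toℕ y)) 1) (s≤s (≤-trans (join-≥ (a (toℕ x)) (a (toℕ y) ∸ 1)) (≤-reflexive (sym (update-≡ a {toℕ x} _ refl)))))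

  relaxed : (ℕ → ℕ) → Fin m → ℕ → ℕ
  relaxed a f = pulled (pulled a f (src f) (tgt f)) f (tgt f) (src f)

  relaxed-sound : ∀ {a f} → Sound a → Sound (relaxed a f)
  relaxed-sound {a} {f} sound = pulled-sound {pulled a f (src f) (tgt f)} (joins-sym (joins-ends f)) (pulled-sound {a} (joins-ends f) sound)

  -- Relaxing in place only raises entries, so what earlier edges achieved is kept; both directions
  -- of the edge are handled by the two pulls.
  relaxed-complete : ∀ {a f X Y ρ} → (∀ g → Y g → X g ⊎ g ≡ f) → Complete X ρ a → Complete Y ρ (relaxed a f)
  relaxed-complete {a} {f} {X} {Y} {ρ} Y⊆ c = proj₁ c₂ , new
    where
    a₁ = pulled a f (src f) (tgt f)
    c₁ : Complete X ρ a₁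
    c₁ = complete-⊑ {X} {ρ} {a} {a₁} (pulled-⊑ a f (src f) (tgt f)) c
    c₂ : Complete X ρ (relaxed a f)
    c₂ = complete-⊑ {X} {ρ} {a₁} {relaxed a f} (pulled-⊑ a₁ f (tgt f) (src f)) c₁
    extend : ∀ {b x y} l → suc κ ≤ b (toℕ y) + l → b (toℕ y) ≤ suc (relaxed a f (toℕ x)) → suc κ ≤ relaxed a f (toℕ {n} x) + suc l
    extend {b} {x} {y} l le le′ = ≤-trans le (≤-trans (+-monoˡ-≤ l le′) (≤-reflexive (sym (+-suc (relaxed a f (toℕ x)) l))))
    new : ∀ {x y} g (j : Joins g x y) (P : Walk graph y t) → Y g → g ∉ˢ F → Avoids P → len P ≤ ρ → suc κ ≤ relaxed a f (toℕ x) + suc (len P)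
    new g j P Yg g∉ av le with Y⊆ g Yg | j
    ... | inj₁ Xg   | _         = proj₂ c₂ g j P Xg g∉ av le
    ... | inj₂ refl | inj₁ refl = extend {a} {src f} {tgt f} (len P) (proj₁ c P av le)
          (≤-trans (pulled-reaches {a} {f} {src f} {tgt f} g∉) (s≤s (pulled-⊑ a₁ f (tgt f) (src f) (toℕ (src f)))))
    ... | inj₂ refl | inj₂ refl = extend {a₁} {tgt f} {src f} (len P) (proj₁ c₁ P av le) (pulled-reaches {a₁} {f} {tgt f} {src f} g∉)

  next-round : ∀ {a ρ} → Complete (λ _ → Unit.⊤) ρ a → Complete (λ _ → ⊥) (suc ρ) a
  next-round {a} {ρ} (c , c′) = all , λ _ _ _ ()
    where
    all : ∀ {x} (P : Walk graph x t) → Avoids P → len P ≤ suc ρ → suc κ ≤ a (toℕ x) + len P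
    all stop         av        le = c stop av z≤n
    all {x} (step f j P) (f∉ ∷ av) le = subst (λ l → suc κ ≤ a (toℕ x) + (l + len P)) (sym (basic f))
      (c′ f j P _ f∉ av (≤-pred (subst (λ l → l + len P ≤ suc ρ) (basic f) le)))

  first-round : ∀ {a} → (∀ i → a i ≡ 0) → Sound (update a (toℕ t) (suc κ)) × Complete (λ _ → ⊥) 0 (update a (toℕ t) (suc κ))
  first-round {a} zeros = sound , complete , λ _ _ _ ()
    where
    sound : Sound (update a (toℕ t) (suc κ))
    sound x 1≤ with x Fin.≟ t
    ... | yes refl = stop , [] , ≤-reflexive (update-≡ a {toℕ t} (suc κ) refl)
    ... | no x≢t   = contradiction (subst (1 ≤_) (trans (update-≢ a _ (x≢t ∘ sym ∘ Fin.toℕ-injective)) (zeros (toℕ x))) 1≤) λ ()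
    complete : ∀ {x} (P : Walk graph x t) → Avoids P → len P ≤ 0 → suc κ ≤ update a (toℕ t) (suc κ) (toℕ x) + len P
    complete stop         _ _  = ≤-trans (≤-reflexive (sym (update-≡ a {toℕ t} (suc κ) refl))) (m≤m+n _ 0)
    complete (step f j P) _ le = contradiction (≤-trans (≤-trans (positive f) (m≤m+n (ℓ f) (len P))) le) λ ()

  -- With unit lengths the ends of e are at distance 1, so a walk is short exactly if it has at most
  -- κ = ⌊α⌋ edges, and κ rounds find all of these.
  reached⇔detour : ∀ {a} → Sound a → Complete (λ _ → ⊥) κ a → (1 ≤ a (toℕ (src e))) ⇔ Detour I (_∈ˢ F) e
  reached⇔detour {a} sound (complete , _) = mk⇔ to from
    where
    to : 1 ≤ a (toℕ (src e)) → Detour I (_∈ˢ F) e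
    to 1≤ with sound (src e) 1≤
    ... | P , avoids , le = P , avoids , λ Q → ≤-trans (*-monoʳ-≤ (den I) (≤-pred (≤-trans (≤-reflexive (+-comm 1 (len P))) (≤-trans (+-monoʳ-≤ (len P) 1≤) le))))
          (≤-trans κ-fits (≤-trans (≤-reflexive (sym (*-identityʳ (num I)))) (*-monoʳ-≤ (num I) (far Q))))
      where
      far : ∀ (Q : Walk graph (src e) (tgt e)) → 1 ≤ len Q
      far Q = SecondPaths.nonempty I (loopless e) Q
    from : Detour I (_∈ˢ F) e → 1 ≤ a (toℕ (src e))
    from (P , avoids , short) = +-cancelʳ-≤ (len P) 1 _ (≤-trans (s≤s len≤) (complete P avoids len≤))
      where
      len≤ : len P ≤ κ
      len≤ = ≤-pred (*-cancelˡ-< (den I) (len P) (suc κ) (≤-<-trans (≤-trans (short (edgeʷ e))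
        (≤-reflexive (trans (cong (num I *_) (trans (len-edgeʷ e) (basic e))) (*-identityʳ (num I))))) κ-max))

  -- ⌊α⌋ is found by counting, which costs no more than the κ rounds that follow. The condition is
  -- nonzero as long as den · (i + 1) ≤ num.
  divide-exec : ∀ {s} → Small s → regs s 6 ≡ 0 → arrays s 0 ≡ cell input →
    Exec (loop ((get 0 (lit 2) ⊕ lit 1) ⊝ (get 0 (lit 3) ⊛ (var 6 ⊕ lit 1))) (6 ≔ var 6 ⊕ lit 1 ⨟ skip)) s
      (λ s′ → regs s′ 6 ≡ κ) (κ * 17 + 12)
  divide-exec {s₀} S r₆ a₀ = whileE Inv body S frame-refl (0 , refl , z≤n , r₆)
    where
    Inv : ℕ → State → Set
    Inv φ s = ∃[ i ] φ ≡ (κ ∸ i) * 17 × i ≤ κ × regs s 6 ≡ i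
    body : ∀ φ s → Small s → Frame _ s₀ s → Inv φ s → Safe _ s × _
    body φ s S F (i , refl , i≤ , r₆) = _ , decide (m≤n⇒m<n∨m≡n i≤)
      where
      cond : eval ((get 0 (lit 2) ⊕ lit 1) ⊝ (get 0 (lit 3) ⊛ (var 6 ⊕ lit 1))) s ≡ suc (num I) ∸ den I * suc i
      cond = cong₂ (λ a k → a 2 + 1 ∸ a 3 * k) (trans (arr F 0) a₀) (trans (cong (_+ 1) r₆) (+-comm i 1)) ⟨ trans ⟩
        cong (_∸ den I * suc i) (+-comm (num I) 1)
        where open import Function.Base using (_⟨_⟩_)
      decide : i < κ ⊎ i ≡ κ → _
      decide (inj₂ refl) = inj₁ (trans cond (m≤n⇒m∸n≡0 κ-max) , r₆)
      decide (inj₁ i<)   = inj₂ ((λ z → m>n⇒m∸n≢0 (s≤s (≤-trans (*-monoʳ-≤ (den I) i<) κ-fits)) (trans (sym cond) z)) ,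
        (κ ∸ suc i) * 17 , 5 , ≤-reflexive (cong (_* 17) (sym (+-∸-assoc 1 i<))) ,
        (assign= S (trans (cong (_+ 1) r₆) (+-comm i 1)) (≤-trans i< (≤-trans κ≤ (r≤limit I))) λ S → skipE S (suc i , refl , i< , refl)))

  pull-exec : ∀ x y {s f u v} → Small s → regs s x ≡ toℕ u → regs s y ≡ toℕ v → regs s 10 ≡ 1 ∸ bit (Vec.lookup F f) →
    Exec (pull x y) s (λ s′ → arrays s′ 1 ≡ pulled (arrays s 1) f u v) 15
  pull-exec x y {s} {f} {u} {v} S r₁ r₂ r₃ =
    put= S r₁ (trans (cong₂ (λ i j → arrays s 1 i + regs s 10 * (arrays s 1 j ∸ 1 ∸ arrays s 1 i)) r₁ r₂) (cong (λ b → a u + b * (a v ∸ 1 ∸ a u)) r₃)) bounded′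
      λ S → skipE S refl
    where
    a : Fin n → ℕ
    a z = arrays s 1 (toℕ z)
    bounded′ : join (a u) (Vec.lookup F f) (a v ∸ 1) ≤ limit I
    bounded′ with join-cases (a u) (Vec.lookup F f) (a v ∸ 1)
    ... | inj₁ eq       = ≤-trans (≤-reflexive eq) (arr≤ S 1 (toℕ u) _)
    ... | inj₂ (_ , eq) = ≤-trans (≤-reflexive eq) (≤-trans (m∸n≤m _ 1) (arr≤ S 1 (toℕ v) _))

  open Layout (layout I (bits F ++ toℕ e ∷ []))

  record Round (X : Fin m → Set) (ρ : ℕ) (s : State) : Set where
    constructor _,_
    field
      sound    : Sound (arrays s 1)
      complete : Complete X ρ (arrays s 1)

  round-exec : ∀ {s ρ} → Small s → regs s 1 ≡ m → regs s 2 ≡ base I → arrays s 0 ≡ cell input → Round (λ _ → ⊥) ρ s →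
    Exec (for 4 1 relax) s (Round (λ _ → ⊥) (suc ρ)) (2 + (m * (51 + 8) + 4))
  round-exec {s} {ρ} S r₁ r₂ a₀ (sound , complete) = weaken (λ {s′} _ _ (sound , c , c′) → sound , next-round {arrays s′ 1}
      (c , λ f j P _ → c′ f j P (Fin.toℕ<n f))) ≤-refl
    (forE (λ j → Round (λ f → toℕ f < j) ρ) S r₁ (sound , proj₁ complete , λ _ _ _ ()) body)
    where
    body : ∀ j s₁ → j < m → Small s₁ → Frame (for 4 1 relax) s s₁ → regs s₁ 4 ≡ j → regs s₁ 1 ≡ m → Round (λ f → toℕ f < j) ρ s₁ →
           Exec relax s₁ (λ s₂ → Round (λ f → toℕ f < suc j) ρ (setReg 4 (suc j) s₂)) 51
    body j s₁ j< S₁ F′ r₄ _ (sound , complete) =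
      assign= S₁ (trans (cong₂ (λ a k → a (5 + k * 3)) a₀′ r₄′) (at-src f)) (fin≤ (src f) (n≤ I)) λ S →
      assign= S (trans (cong₂ (λ a k → a (6 + k * 3)) a₀′ r₄′) (at-tgt f)) (fin≤ (tgt f) (n≤ I)) λ S →
      assign= S (cong (1 ∸_) (trans (cong₂ _$_ a₀′ (cong₂ _+_ (trans (reg F′ 2) r₂) r₄′)) (at-mark f))) (≤-trans (m∸n≤m 1 (bit (Vec.lookup F f))) (≤-trans (s≤s z≤n) (7≤limit I))) λ S →
      seq⨾ (pull-exec 8 9 {f = f} {src f} {tgt f} S refl refl refl) λ {s₂} S₂ F₂ eq₂ →
      weaken (λ {s₃} _ _ eq₃ → finish (trans eq₃ (cong (λ a → pulled a f (tgt f) (src f)) eq₂))) ≤-refl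
        (pull-exec 9 8 {f = f} {tgt f} {src f} S₂ (reg F₂ 9) (reg F₂ 8) (reg F₂ 10))
      where
      f = Fin.fromℕ< j<
      f≡ = Fin.toℕ-fromℕ< j<
      r₄′ = trans r₄ (sym f≡)
      a₀′ = trans (arr F′ 0) a₀
      finish : ∀ {s₃} → arrays s₃ 1 ≡ relaxed (arrays s₁ 1) f → Round (λ f → toℕ f < suc j) ρ (setReg 4 (suc j) s₃)
      finish eq₃ = subst Sound (sym eq₃) (relaxed-sound {arrays s₁ 1} {f} sound) , subst (Complete (λ f → toℕ f < suc j) ρ) (sym eq₃)
        (relaxed-complete {arrays s₁ 1} {f} {λ f → toℕ f < j} (λ g g< → case g Fin.≟ f of λ where
          (yes g≡f) → inj₂ g≡f
          (no g≢f)  → inj₁ (≤∧≢⇒< (≤-pred g<) λ g≡j → g≢f (Fin.toℕ-injective (trans g≡j (sym f≡))))) complete)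

  basic-exec : Exec basicDetour (initial input) (λ s → Verdict (Detour I (_∈ˢ F) e) (output s) × regs s 0 ≤ 1)
    (16 + (κ * 17 + 12 + (10 + (2 + (κ * ((2 + (m * (51 + 8) + 4)) + 8) + 4) + 16))))
  basic-exec =
    assign= (initial-small input≤ length≤) refl (≤-trans (m≤ I) (r≤limit I)) λ S →
    assign= S refl (≤-trans (base≤ I) (r≤limit I)) λ S →
    assign= S at-e (fin≤ e (m≤ I)) λ S →
    assign= S refl z≤n λ S →
    seq⨾ (divide-exec S refl refl) λ {s₁} S₁ F₁ r₆ →
    put= S₁ (trans (cong₂ (λ a k → a (6 + k * 3)) (arr F₁ 0) (reg F₁ 5)) (at-tgt e)) (trans (cong (_+ 1) r₆) (+-comm κ 1))
      (≤-trans (≤-reflexive (+-comm 1 κ)) (+≤limit I κ≤ (≤-trans (s≤s z≤n) (7≤r I)))) λ S →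
    seq⨾ (forE (Round (λ _ → ⊥)) S r₆ (start {s₁} (λ i → cong (_$ i) (arr F₁ 1)))
      (λ j s₂ j< S₂ F₂ _ _ round → weaken (λ _ _ (sound , complete) → sound , complete) ≤-refl (round-exec {s₂} S₂ (trans (reg F₂ 1) (reg F₁ 1)) (trans (reg F₂ 2) (reg F₁ 2)) (trans (arr F₂ 0) (arr F₁ 0)) round)))
      λ {s₂} S₂ F₂ (sound , complete) →
    put= S₂ refl (cong (λ i → 1 ∸ (1 ∸ arrays s₂ 1 i)) (trans (cong₂ (λ a k → a (5 + k * 3)) (trans (arr F₂ 0) (arr F₁ 0)) (trans (reg F₂ 5) (reg F₁ 5))) (at-src e)))
      (≤-trans (m∸n≤m 1 (1 ∸ arrays s₂ 1 (toℕ (src e)))) (≤-trans (s≤s z≤n) (7≤limit I))) λ S →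
    assign= S refl (≤-trans (s≤s z≤n) (7≤limit I)) λ S →
    skipE S (verdict (arrays s₂ 1 (toℕ (src e))) refl (reached⇔detour {arrays s₂ 1} sound complete) , ≤-refl)
    where
    start : ∀ {s} → (∀ i → arrays s 1 i ≡ 0) → Round (λ _ → ⊥) 0 (setReg 7 0 (setCell 1 (toℕ t) (suc κ) s))
    start {s} zeros = proj₁ (first-round {arrays s 1} zeros) , proj₂ (first-round {arrays s 1} zeros)
    verdict : ∀ a {b} → b ≡ a → (1 ≤ b ⇔ Detour I (_∈ˢ F) e) → Verdict (Detour I (_∈ˢ F) e) (1 ∸ (1 ∸ a) ∷ [])
    verdict zero    refl ⇔d = inj₂ (refl , λ d → contradiction (Equivalence.from ⇔d d) λ ())
    verdict (suc a) refl ⇔d = inj₁ (cong (λ x → 1 ∸ x ∷ []) (0∸n≡0 a) , Equivalence.to ⇔d (s≤s z≤n))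

  basic-calls : Calls W basicDetour input (Verdict (Detour I (_∈ˢ F) e)) (κ * (m * 59 + 31) + m * 4 + 67)
  basic-calls with toCalls basic-exec
  ... | ys , t , run , v , t≤ = ys , t , run , v , ≤-trans t≤ (≤-reflexive
      (trans (cong (λ l → l + (16 + (κ * 17 + 12 + (10 + (2 + (κ * ((2 + (m * (51 + 8) + 4)) + 8) + 4) + 16)))) + 1) length-input) (total κ m)))
    where
    total : ∀ κ m → 5 + m * 3 + (m + 1) + (16 + (κ * 17 + 12 + (10 + (2 + (κ * ((2 + (m * (51 + 8) + 4)) + 8) + 4) + 16)))) + 1 ≡
            κ * (m * 59 + 31) + m * 4 + 67
    total = solve-∀

-- Nontrivial edges for unit lengths from breadth-first search trees.

⊒-cong : ∀ {f g xs} → f ⊒ xs → (∀ i → i < length xs → g i ≡ f i) → g ⊒ xs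
⊒-cong {xs = xs} f⊒ eq = ⊒-pointwise xs λ i i< → trans (eq i i<) (⊒-cell xs f⊒ i<)

module Breadth (I : Instance) (basic : IsBasic I) (u : Fin (Instance.n I)) where
  open Instance I
  open Walks graph
  open SecondPaths I using (other-end; joins-either)

  -- a is the neighbour of u through which a shortest walk from u reaches x.
  Branch : (L B : ℕ → ℕ) → Fin n → Set
  Branch L B x = ∃[ a ] B (toℕ x) ≡ toℕ a × ∃[ e ] Joins e u a ×
    ∃[ P ] All (λ f → ∀ y → ¬ Joins f u y) (edges {graph} {a} {x} P) × len P + 2 ≡ L (toℕ x)

  -- `ps` are the expanded vertices and `qs` is the queue, whose head stays in place while it is
  -- expanded. Labels are distances plus 1, so that 0 means unseen. `within₁` keeps the queue sorted
  -- when a vertex is appended, and `bounded` keeps labels within a word.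
  record Wave (ps qs : List (Fin n)) (L B : ℕ → ℕ) : Set where
    field
      unique  : Unique (ps ++ qs)
      seen    : ∀ x → x ∈ ps ++ qs ⇔ 1 ≤ L (toℕ x)
      root    : L (toℕ u) ≡ 1
      closed  : ∀ {x y} f → x ∈ ps → Joins f x y → 1 ≤ L (toℕ y) × L (toℕ y) ≤ suc (L (toℕ x))
      sorted  : AllPairs (λ a b → L (toℕ a) ≤ L (toℕ b)) qs
      within₁ : ∀ {q qs′} → qs ≡ q ∷ qs′ → ∀ (y : Fin n) → L (toℕ y) ≤ suc (L (toℕ q))
      branch  : ∀ x → x ≢ u → 1 ≤ L (toℕ x) → Branch L B x
      bounded : ∀ (x : Fin n) → L (toℕ x) ≤ length (ps ++ qs)
  open Wave

  wave₀ : ∀ {L B} → (∀ i → L i ≡ 0) → Wave [] (u ∷ []) (update L (toℕ u) 1) B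
  wave₀ {L} zeros = record
    { unique  = [] ∷ []
    ; seen    = λ x → mk⇔ (λ { (here refl) → ≤-reflexive (sym (update-≡ L {toℕ x} 1 refl)) }) (only x)
    ; root    = update-≡ L {toℕ u} 1 refl
    ; closed  = λ _ ()
    ; sorted  = [] ∷ []
    ; within₁ = λ { refl y → ≤-trans (at-most y) (s≤s z≤n) }
    ; branch  = λ x x≢u 1≤ → contradiction (only x 1≤) λ { (here refl) → x≢u refl }
    ; bounded = at-most }
    where
    only : ∀ x → 1 ≤ update L (toℕ u) 1 (toℕ x) → x ∈ u ∷ []
    only x 1≤ with x Fin.≟ u
    ... | yes refl = here refl
    ... | no x≢u   = contradiction (subst (1 ≤_) (trans (update-≢ L 1 (x≢u ∘ sym ∘ Fin.toℕ-injective)) (zeros (toℕ x))) 1≤) λ ()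
    at-most : ∀ (x : Fin n) → update L (toℕ u) 1 (toℕ x) ≤ 1
    at-most x with update-cases L (toℕ u) 1 (toℕ x)
    ... | inj₁ (_ , eq) = ≤-reflexive eq
    ... | inj₂ (_ , eq) = ≤-trans (≤-reflexive (trans eq (zeros (toℕ x)))) z≤n

  pop : ∀ {ps x qs L B} → Wave ps (x ∷ qs) L B → (∀ {y} f → Joins f x y → 1 ≤ L (toℕ y) × L (toℕ y) ≤ suc (L (toℕ x))) →
        Wave (ps ++ x ∷ []) qs L B
  pop {ps} {x} {qs} {L} w covered = record
    { unique  = subst Unique shift (unique w)
    ; seen    = λ y → subst (λ zs → y ∈ zs ⇔ 1 ≤ L (toℕ y)) shift (seen w y)
    ; root    = root w
    ; closed  = λ f y∈ j → case ∈-++⁻ ps y∈ of λ where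
        (inj₁ y∈ps)        → closed w f y∈ps j
        (inj₂ (here refl)) → covered f j
    ; sorted  = AllPairs.tail (sorted w)
    ; within₁ = λ { refl y → ≤-trans (within₁ w refl y) (s≤s (All.head (AllPairs.head (sorted w)))) }
    ; branch  = branch w
    ; bounded = λ y → subst (λ zs → L (toℕ y) ≤ length zs) shift (bounded w y) }
    where
    shift : ps ++ x ∷ qs ≡ (ps ++ x ∷ []) ++ qs
    shift = sym (++-assoc ps (x ∷ []) qs)

  -- No label exceeds that of the queue head by more than one, so appending the new vertex keeps the
  -- labels of the queue in order. Its branch is its own if it was found from the root, and
  -- otherwise inherited.
  discover : ∀ {ps x qs L B y b} f → Wave ps (x ∷ qs) L B → Joins f x y → L (toℕ y) ≡ 0 →
    (x ≡ u × b ≡ toℕ y) ⊎ (x ≢ u × b ≡ B (toℕ x)) →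
    Wave ps (x ∷ (qs ++ y ∷ [])) (update L (toℕ y) (suc (L (toℕ x)))) (update B (toℕ y) b)
  discover {ps} {x} {qs} {L} {B} {y} {b} f w j Ly≡0 which = record
    { unique  = subst Unique shift (unique-snoc⁺ (unique w) y∉)
    ; seen    = λ z → subst (λ zs → z ∈ zs ⇔ 1 ≤ L′ (toℕ z)) shift (seen′ z)
    ; root    = trans (old u (λ { refl → y∉ u∈ })) (root w)
    ; closed  = closed′
    ; sorted  = sorted′
    ; within₁ = λ { refl z → ≤-trans (top z) (s≤s (≤-reflexive (sym (oldx)))) }
    ; branch  = branch′
    ; bounded = λ z → subst (λ zs → L′ (toℕ z) ≤ length zs) shift (≤-trans (bounded′ z) (≤-reflexive (sym (trans (length-++ (ps ++ x ∷ qs)) (+-comm _ 1))))) }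
    where
    L′ = update L (toℕ y) (suc (L (toℕ x)))
    B′ = update B (toℕ y) b
    shift : (ps ++ x ∷ qs) ++ y ∷ [] ≡ ps ++ x ∷ (qs ++ y ∷ [])
    shift = ++-assoc ps (x ∷ qs) (y ∷ [])
    y∉ : y ∉ ps ++ x ∷ qs
    y∉ y∈ = contradiction (≤-trans (Equivalence.to (seen w y) y∈) (≤-reflexive Ly≡0)) λ ()
    u∈ : u ∈ ps ++ x ∷ qs
    u∈ = Equivalence.from (seen w u) (≤-reflexive (sym (root w)))
    x∈ : x ∈ ps ++ x ∷ qs
    x∈ = ∈-++⁺ʳ ps (here refl)
    at-y : L′ (toℕ y) ≡ suc (L (toℕ x))
    at-y = update-≡ L {toℕ y} _ refl
    old : ∀ z → y ≢ z → L′ (toℕ z) ≡ L (toℕ z)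
    old z y≢z = update-≢ L _ (y≢z ∘ Fin.toℕ-injective)
    oldx : L′ (toℕ x) ≡ L (toℕ x)
    oldx = old x λ { refl → y∉ x∈ }
    old∈ : ∀ {z} → z ∈ ps ++ x ∷ qs → L′ (toℕ z) ≡ L (toℕ z)
    old∈ z∈ = old _ λ { refl → y∉ z∈ }
    seen′ : ∀ z → z ∈ (ps ++ x ∷ qs) ++ y ∷ [] ⇔ 1 ≤ L′ (toℕ z)
    seen′ z = mk⇔
      (λ z∈ → case ∈-++⁻ (ps ++ x ∷ qs) z∈ of λ where
        (inj₁ z∈′)         → subst (1 ≤_) (sym (old∈ z∈′)) (Equivalence.to (seen w z) z∈′)
        (inj₂ (here refl)) → ≤-trans (s≤s z≤n) (≤-reflexive (sym at-y)))
      λ 1≤ → case y Fin.≟ z of λ where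
        (yes refl) → ∈-++⁺ʳ (ps ++ x ∷ qs) (here refl)
        (no y≢z)   → ∈-++⁺ˡ (Equivalence.from (seen w z) (subst (1 ≤_) (old z y≢z) 1≤))
    top : ∀ (z : Fin n) → L′ (toℕ z) ≤ suc (L (toℕ x))
    top z with y Fin.≟ z
    ... | yes refl = ≤-reflexive at-y
    ... | no y≢z   = ≤-trans (≤-reflexive (old z y≢z)) (within₁ w refl z)
    closed′ : ∀ {p z} g → p ∈ ps → Joins g p z → 1 ≤ L′ (toℕ z) × L′ (toℕ z) ≤ suc (L′ (toℕ p))
    closed′ {p} {z} g p∈ k with closed w g p∈ k
    ... | 1≤ , le with Equivalence.from (seen w z) 1≤
    ...   | z∈ rewrite old∈ z∈ | old∈ (∈-++⁺ˡ {ys = x ∷ qs} p∈) = 1≤ , le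
    sorted′ : AllPairs (λ a b → L′ (toℕ a) ≤ L′ (toℕ b)) (x ∷ (qs ++ y ∷ []))
    sorted′ = snoc (x ∷ qs) (sorted w) (∈-++⁺ʳ ps)
      where
      snoc : ∀ rs → AllPairs (λ a b → L (toℕ a) ≤ L (toℕ b)) rs → (∀ {z} → z ∈ rs → z ∈ ps ++ x ∷ qs) →
             AllPairs (λ a b → L′ (toℕ a) ≤ L′ (toℕ b)) (rs ++ y ∷ [])
      snoc []       []       sub = [] ∷ []
      snoc (r ∷ rs) (a ∷ ap) sub = All.++⁺
        (All.tabulate λ z∈ → subst₂ _≤_ (sym (old∈ (sub (here refl)))) (sym (old∈ (sub (there z∈)))) (All.lookup a z∈))
        (≤-trans (≤-reflexive (old∈ (sub (here refl)))) (≤-trans (within₁ w refl r) (≤-reflexive (sym at-y))) ∷ []) ∷ snoc rs ap (sub ∘ there)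
    bounded′ : ∀ (z : Fin n) → L′ (toℕ z) ≤ suc (length (ps ++ x ∷ qs))
    bounded′ z = ≤-trans (top z) (s≤s (bounded w x))
    not-u : ∀ {a c} → Joins f a c → a ≢ u → c ≢ u → ∀ z → ¬ Joins f u z
    not-u k a≢u c≢u z k′ = case joins-either k′ k of λ where
      (inj₁ refl) → a≢u refl
      (inj₂ refl) → c≢u refl
    branch′ : ∀ z → z ≢ u → 1 ≤ L′ (toℕ z) → Branch L′ B′ z
    branch′ z z≢u 1≤ with y Fin.≟ z
    ... | no y≢z with branch w z z≢u (subst (1 ≤_) (old z y≢z) 1≤)
    ...   | a , B≡ , e , k , P , off , l≡ = a , trans (update-≢ B b (y≢z ∘ Fin.toℕ-injective)) B≡ , e , k , P , off , trans l≡ (sym (old z y≢z))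
    branch′ z z≢u 1≤ | yes refl = grow z≢u which
      where
      arith : ∀ p → p + 1 + 2 ≡ suc (p + 2)
      arith = solve-∀
      grow : y ≢ u → (x ≡ u × b ≡ toℕ y) ⊎ (x ≢ u × b ≡ B (toℕ x)) → Branch L′ B′ y
      grow _ (inj₁ (x≡u , b≡)) = y , trans (update-≡ B {toℕ y} b refl) b≡ , f , subst (λ v → Joins f v y) x≡u j , stop , [] ,
        sym (trans at-y (cong suc (trans (cong (L ∘ toℕ) x≡u) (root w))))
      grow y≢u (inj₂ (x≢u , b≡)) with branch w x x≢u (Equivalence.to (seen w x) x∈)
      ... | a , B≡ , e , k , P , off , l≡ = a , trans (update-≡ B {toℕ y} b refl) (trans b≡ B≡) , e , k , append P (step f j stop) ,
            all-append P off (not-u j x≢u y≢u ∷ []) ,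
            trans (cong (_+ 2) (trans (len-append P (step f j stop)) (cong (len P +_) (trans (+-identityʳ (ℓ f)) (basic f)))))
              (trans (arith (len P)) (trans (cong suc l≡) (sym at-y)))

  -- The outcome of the search: L x − 1 is the distance from u to x.
  record Levels (L B : ℕ → ℕ) : Set where
    field
      reached : ∀ (x : Fin n) → 1 ≤ L (toℕ x)
      start   : L (toℕ u) ≡ 1
      steps   : ∀ {x y : Fin n} f → Joins f x y → L (toℕ y) ≤ suc (L (toℕ x))
      via     : ∀ x → x ≢ u → Branch L B x

  -- With an empty queue the seen vertices are closed under taking neighbours, so connectedness
  -- makes them all vertices.
  finished : ∀ {ps L B} → Wave ps [] L B → Levels L B
  finished {ps} {L} {B} w = record
    { reached = reach ; start = root w
    ; steps = λ f j → proj₂ (closed w f (member (reach _)) j)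
    ; via = λ x x≢u → branch w x x≢u (reach x) }
    where
    member : ∀ {x} → 1 ≤ L (toℕ x) → x ∈ ps
    member {x} 1≤ = subst (x ∈_) (++-identityʳ ps) (Equivalence.from (seen w x) 1≤)
    spread : ∀ {x y} → Walk graph x y → 1 ≤ L (toℕ x) → 1 ≤ L (toℕ y)
    spread stop         1≤ = 1≤
    spread (step f j P) 1≤ = spread P (proj₁ (closed w f (member 1≤) j))
    reach : ∀ (x : Fin n) → 1 ≤ L (toℕ x)
    reach x = spread (connected u x) (≤-reflexive (sym (root w)))

module Crossings (I : Instance) (basic : IsBasic I) (e : Fin (Instance.m I)) {L B : ℕ → ℕ}
  (levels : Breadth.Levels I basic (Instance.src I e) L B) where
  open Instance I
  open Walks graph
  open SecondPaths I using (other-end; nonempty)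
  open Breadth I basic (src e) using (Branch; Levels)
  open Levels levels

  u a : Fin n
  u = src e
  a = tgt e

  -- The number of edges of the closed walk through u that follows shortest
  -- walks to both ends of f; it has a chance to be a cycle if the ends lie in
  -- different branches, and it then avoids u in between.
  around : Fin m → ℕ
  around f = (L (toℕ (src f)) ∸ 1) + (L (toℕ (tgt f)) ∸ 1)

  Crossing : Fin m → Set
  Crossing f = src f ≢ u × tgt f ≢ u × B (toℕ (src f)) ≢ B (toℕ (tgt f)) × den I * around f ≤ num I

  Hit : Fin m → Set
  Hit f = Crossing f × (B (toℕ (src f)) ≡ toℕ a ⊎ B (toℕ (tgt f)) ≡ toℕ a)

  level-≤ : ∀ {x y} (P : Walk graph x y) → L (toℕ y) ≤ len P + L (toℕ x)
  level-≤ stop = ≤-refl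
  level-≤ {x} (step f j P) = ≤-trans (level-≤ P) (≤-trans (+-monoʳ-≤ (len P) (steps f j))
    (≤-reflexive (trans (+-suc (len P) (L (toℕ x))) (cong (λ l → l + len P + L (toℕ x)) (sym (basic f))))))

  -- A neighbour of u has a label of at most 2, which leaves no room for a proper walk inside its
  -- branch.
  own-branch : ∀ {b} f → Joins f u b → b ≢ u → B (toℕ b) ≡ toℕ b
  own-branch {b} f j b≢u with via b b≢u
  ... | c , B≡ , _ , _ , stop , _ , _ = B≡
  ... | c , B≡ , _ , _ , step g k P , _ , l≡ = contradiction
        (≤-trans (≤-reflexive l≡) (≤-trans (steps f j) (s≤s (≤-reflexive start))))
        (<⇒≱ (+-monoˡ-≤ 2 (≤-trans (positive g) (m≤m+n (ℓ g) (len P)))))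

  pred+2 : ∀ {l k} → l + 2 ≡ k → l + 1 ≡ k ∸ 1
  pred+2 {l} refl = trans (sym (m+n∸n≡m (l + 1) 1)) (cong (_∸ 1) (+-assoc l 1 1))

  -- The detour goes from u through the branch of y, crosses f and runs back through the branch of x
  -- to a. The first edge leads to a neighbour other than a, and all later edges do not touch u, so
  -- none of them is e.
  detour-around : ∀ {x y} f → Joins f x y → x ≢ u → y ≢ u → B (toℕ x) ≡ toℕ a → B (toℕ y) ≢ toℕ a →
    den I * ((L (toℕ x) ∸ 1) + (L (toℕ y) ∸ 1)) ≤ num I → Removable I e
  detour-around {x} {y} f j x≢u y≢u Bx By fits with via x x≢u | via y y≢u
  ... | c , Bx′ , g , k , P , offP , lP | d , By′ , h , i , Q , offQ , lQ with Fin.toℕ-injective (trans (sym Bx) Bx′)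
  ...   | refl = R , avoids , λ S → ≤-trans (≤-reflexive (cong (den I *_) length-R)) (≤-trans fits
            (≤-trans (≤-reflexive (sym (*-identityʳ (num I)))) (*-monoʳ-≤ (num I) (nonempty (loopless e) S))))
    where
    R = step h i (append Q (step f (joins-sym j) (reverse P)))
    length-R : len R ≡ (L (toℕ x) ∸ 1) + (L (toℕ y) ∸ 1)
    length-R = trans (cong₂ _+_ (basic h) (trans (len-append Q _) (cong₂ (λ p q → len Q + (p + q)) (basic f) (len-reverse P))))
      (trans (arith (len P) (len Q)) (cong₂ _+_ (pred+2 lP) (pred+2 lQ)))
      where
      arith : ∀ p q → 1 + (q + (1 + p)) ≡ (p + 1) + (q + 1)
      arith = solve-∀
    off : ∀ {g} → (∀ z → ¬ Joins g u z) → g ≢ e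
    off none refl = none a (joins-ends e)
    avoids : All (_≢ e) (edges R)
    avoids = (λ { refl → By (trans By′ (cong toℕ (other-end i (joins-ends e)))) }) ∷
      all-append Q (All.map off offQ) ((λ { refl → case j of λ where
        (inj₁ eq) → x≢u (sym (cong proj₁ eq))
        (inj₂ eq) → y≢u (sym (cong proj₁ eq)) }) ∷ all-reverse P (All.map off offP))

  hit⇒removable : ∀ {f} → Hit f → Removable I e
  hit⇒removable {f} ((s≢u , t≢u , B≢ , fits) , inj₁ Bs) =
    detour-around f (joins-ends f) s≢u t≢u Bs (λ Bt → B≢ (trans Bs (sym Bt))) fits
  hit⇒removable {f} ((s≢u , t≢u , B≢ , fits) , inj₂ Bt) =
    detour-around f (joins-sym (joins-ends f)) t≢u s≢u Bt (λ Bs → B≢ (trans Bs (sym Bt)))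
      (≤-trans (≤-reflexive (cong (den I *_) (+-comm (L (toℕ (tgt f)) ∸ 1) _))) fits)

  pred-≤ : ∀ x → L (toℕ {n} x) ≡ suc (L (toℕ x) ∸ 1)
  pred-≤ x = sym (m+[n∸m]≡n (reached x))

  outside? : ∀ z → Dec (z ≡ u ⊎ B (toℕ z) ≢ toℕ a)
  outside? z = (z Fin.≟ u) ⊎-dec ¬? (B (toℕ z) ≟ toℕ a)

  -- A walk to a that starts outside the branch of a has to enter it.
  enters : ∀ {z} (P : Walk graph z a) → All (_≢ e) (edges P) → z ≡ u ⊎ B (toℕ z) ≢ toℕ a →
    den I * (L (toℕ z) ∸ 1 + len P) ≤ num I → ∃ Hit
  enters stop _ (inj₁ a≡u) _ = contradiction (sym a≡u) (loopless e)
  enters stop _ (inj₂ Ba≢) _ = contradiction (own-branch e (joins-ends e) (loopless e ∘ sym)) Ba≢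
  enters {z} (step {v = z′} f j P) (f≢e ∷ avoids) out fits with outside? z′
  ... | yes out′ = enters P avoids out′ (≤-trans (*-monoʳ-≤ (den I) (begin
      L (toℕ z′) ∸ 1 + len P            ≤⟨ +-monoˡ-≤ (len P) (≤-pred (≤-trans (≤-reflexive (sym (pred-≤ z′))) (≤-trans (steps f j) (s≤s (≤-reflexive (pred-≤ z)))))) ⟩
      suc (L (toℕ z) ∸ 1) + len P       ≡⟨ +-suc (L (toℕ z) ∸ 1) (len P) ⟨
      L (toℕ z) ∸ 1 + (1 + len P)       ≡⟨ cong (λ l → L (toℕ z) ∸ 1 + (l + len P)) (basic f) ⟨
      L (toℕ z) ∸ 1 + (ℓ f + len P)     ∎)) fits)
      where open ≤-Reasoning
  ... | no inside = f , cross z≢u Bz j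
    where
    z′≢u : z′ ≢ u
    z′≢u eq = inside (inj₁ eq)
    Bz′ : B (toℕ z′) ≡ toℕ a
    Bz′ = decidable-stable (B (toℕ z′) ≟ toℕ a) (inside ∘ inj₂)
    -- An edge from u into the branch of a leads to a itself and, without parallel edges, is e,
    -- which the walk avoids.
    z≢u : z ≢ u
    z≢u refl = f≢e (noParallel (subst (Joins f u) (Fin.toℕ-injective (trans (sym (own-branch f j z′≢u)) Bz′)) j) (joins-ends e))
    Bz : B (toℕ z) ≢ toℕ a
    Bz = [ (λ eq → contradiction eq z≢u) , id ]′ out
    -- The vertex z′ is reached from u through e and the rest of the walk backwards, so its distance
    -- is at most one more than that rest.
    short : L (toℕ z′) ∸ 1 ≤ 1 + len P
    short = ≤-pred (≤-trans (≤-reflexive (sym (pred-≤ z′))) (≤-trans (level-≤ (reverse P))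
      (≤-trans (+-mono-≤ (≤-reflexive (len-reverse P)) (≤-trans (steps e (joins-ends e)) (s≤s (≤-reflexive start)))) (≤-reflexive (+-comm (len P) 2)))))
    total : den I * (L (toℕ z) ∸ 1 + (L (toℕ z′) ∸ 1)) ≤ num I
    total = ≤-trans (*-monoʳ-≤ (den I) (+-monoʳ-≤ (L (toℕ z) ∸ 1) (≤-trans short (≤-reflexive (cong (_+ len P) (sym (basic f))))))) fits
    cross : z ≢ u → B (toℕ z) ≢ toℕ a → Joins f z z′ → Hit f
    cross z≢u Bz (inj₁ refl) = (z≢u , z′≢u , (λ eq → Bz (trans eq Bz′)) , total) , inj₂ Bz′
    cross z≢u Bz (inj₂ refl) = (z′≢u , z≢u , (λ eq → Bz (trans (sym eq) Bz′)) ,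
      ≤-trans (≤-reflexive (cong (den I *_) (+-comm (L (toℕ z′) ∸ 1) _))) total) , inj₁ Bz′

  removable⇔hit : Removable I e ⇔ ∃ Hit
  removable⇔hit = mk⇔
    (λ (P , avoids , short) → enters P avoids (inj₁ refl) (≤-trans (≤-reflexive (cong (λ l → den I * (l ∸ 1 + len P)) start))
      (≤-trans (short (edgeʷ e)) (≤-reflexive (trans (cong (num I *_) (trans (len-edgeʷ e) (basic e))) (*-identityʳ (num I)))))))
    λ (f , hit) → hit⇒removable hit

module Touching (I : Instance) (u : Fin (Instance.n I)) (L B : ℕ → ℕ) where
  open Instance I

  -- These are `Crossing` and `Hit` with the root u in place of a fixed edge: one search from u
  -- decides about all edges with source u.
  Cross : Fin m → Set
  Cross f = src f ≢ u × tgt f ≢ u × B (toℕ (src f)) ≢ B (toℕ (tgt f)) ×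
            den I * ((L (toℕ (src f)) ∸ 1) + (L (toℕ (tgt f)) ∸ 1)) ≤ num I

  Touch : Fin m → Fin n → Set
  Touch f a = Cross f × (B (toℕ (src f)) ≡ toℕ a ⊎ B (toℕ (tgt f)) ≡ toℕ a)

touch⇔removable : ∀ I (basic : IsBasic I) {u e L B} → Instance.src I e ≡ u → Breadth.Levels I basic u L B →
  (∃[ f ] Touching.Touch I u L B f (Instance.tgt I e)) ⇔ Removable I e
touch⇔removable I basic refl levels = mk⇔ (Equivalence.from hit) (Equivalence.to hit)
  where hit = Crossings.removable⇔hit I basic _ levels

-- Adjacency lists: row x of the array is a list of the neighbours of x.
module Adjacency (G : Graph) where
  open Graph G

  -- The state after the first `j` edges. By `short` a row is never longer than the number of edges,
  -- so rows of width m do not overlap. `total` is the handshake identity, which later pays for the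
  -- search.
  record Rows (j : ℕ) (deg adj : ℕ → ℕ) : Set where
    field
      row      : Fin n → List (Fin n)
      deg≡     : ∀ x → deg (toℕ x) ≡ length (row x)
      stored   : ∀ x → (λ i → adj (i + toℕ x * m)) ⊒ map toℕ (row x)
      joined   : ∀ {x y} → y ∈ row x → ∃[ f ] Joins f x y
      complete : ∀ {x y} f → toℕ f < j → Joins f x y → y ∈ row x
      short    : ∀ x → length (row x) ≤ j
      total    : sum (map (length ∘ row) (allFin n)) ≡ j + j
  open Rows

  rows₀ : ∀ {deg adj} → (∀ i → deg i ≡ 0) → Rows 0 deg adj
  rows₀ zeros = record
    { row = λ _ → [] ; deg≡ = λ x → zeros (toℕ x) ; stored = λ _ → ⊒-[] ; joined = λ () ; complete = λ _ () ; short = λ _ → z≤n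
    ; total = sum-map-0 (allFin n) }

  module _ (f : Fin m) {deg adj : ℕ → ℕ} (rows : Rows (toℕ f) deg adj) where
    s t : Fin n
    s = src f
    t = tgt f

    deg₁ adj₁ deg₂ adj₂ : ℕ → ℕ
    adj₁ = update adj (deg (toℕ s) + toℕ s * m) (toℕ t)
    deg₁ = update deg (toℕ s) (suc (deg (toℕ s)))
    adj₂ = update adj₁ (deg₁ (toℕ t) + toℕ t * m) (toℕ s)
    deg₂ = update deg₁ (toℕ t) (suc (deg₁ (toℕ t)))

    deg₁-t : deg₁ (toℕ t) ≡ deg (toℕ t)
    deg₁-t = update-≢ deg _ (loopless f ∘ Fin.toℕ-injective)

    new-row : Fin n → List (Fin n)
    new-row x with x Fin.≟ s | x Fin.≟ t
    ... | yes _ | _     = row rows x ++ t ∷ []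
    ... | no _  | yes _ = row rows x ++ s ∷ []
    ... | no _  | no _  = row rows x

    row-fits : ∀ x → length (row rows x) < m
    row-fits x = ≤-<-trans (short rows x) (Fin.toℕ<n f)

    cell-≢ : ∀ {x y} i → x ≢ y → i < m → length (row rows y) + toℕ y * m ≢ i + toℕ x * m
    cell-≢ {x} {y} i x≢y i< eq = x≢y (sym (Fin.toℕ-injective (proj₂ (quotient-unique (toℕ y) (toℕ x) (row-fits y) i< eq))))

    add-row : Rows (suc (toℕ f)) deg₂ adj₂
    add-row = record
      { row = new-row ; deg≡ = degs ; stored = cells ; joined = sound ; complete = covers ; short = shorter ; total = sums }
      where
      at-s : deg (toℕ s) ≡ length (row rows s)
      at-s = deg≡ rows s
      at-t : deg₁ (toℕ t) ≡ length (row rows t)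
      at-t = trans deg₁-t (deg≡ rows t)
      degs : ∀ x → deg₂ (toℕ x) ≡ length (new-row x)
      degs x with x Fin.≟ s | x Fin.≟ t
      ... | yes refl | _ = trans (update-≢ deg₁ _ (loopless f ∘ sym ∘ Fin.toℕ-injective)) (trans (update-≡ deg {toℕ s} _ refl)
            (trans (cong suc at-s) (sym (trans (length-++ (row rows s)) (+-comm _ 1)))))
      ... | no _ | yes refl = trans (update-≡ deg₁ {toℕ t} _ refl) (trans (cong suc at-t) (sym (trans (length-++ (row rows t)) (+-comm _ 1))))
      ... | no x≢s | no x≢t = trans (update-≢ deg₁ _ (x≢t ∘ sym ∘ Fin.toℕ-injective)) (trans (update-≢ deg _ (x≢s ∘ sym ∘ Fin.toℕ-injective)) (deg≡ rows x))
      kept₁ : ∀ x i → x ≢ s → i < m → adj₁ (i + toℕ x * m) ≡ adj (i + toℕ x * m)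
      kept₁ x i x≢s i< = update-≢ adj _ λ eq → cell-≢ i x≢s i< (trans (cong (_+ toℕ s * m) (sym at-s)) eq)
      kept₂ : ∀ x i → x ≢ t → i < m → adj₂ (i + toℕ x * m) ≡ adj₁ (i + toℕ x * m)
      kept₂ x i x≢t i< = update-≢ adj₁ _ λ eq → cell-≢ i x≢t i< (trans (cong (_+ toℕ t * m) (sym at-t)) eq)
      grown : ∀ {g h : ℕ → ℕ} x y → (λ i → g (i + toℕ x * m)) ⊒ map toℕ (row rows x) → h (length (row rows x) + toℕ x * m) ≡ toℕ {n} y →
        (∀ i → i < length (row rows x) → h (i + toℕ x * m) ≡ g (i + toℕ x * m)) → (λ i → h (i + toℕ x * m)) ⊒ map toℕ (row rows x ++ y ∷ [])
      grown {g} {h} x y g⊒ new old = subst ((λ i → h (i + toℕ x * m)) ⊒_) (sym (map-++ toℕ (row rows x) (y ∷ [])))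
        (⊒-++ (map toℕ (row rows x)) (⊒-cong g⊒ λ i i< → old i (subst (i <_) (length-map toℕ (row rows x)) i<))
          (⊒-∷ (trans (cong (λ l → h (l + toℕ x * m)) (trans (+-identityʳ _) (length-map toℕ (row rows x)))) new) ⊒-[]))
      cells : ∀ x → (λ i → adj₂ (i + toℕ x * m)) ⊒ map toℕ (new-row x)
      cells x with x Fin.≟ s | x Fin.≟ t
      ... | yes refl | _ = grown {adj} {adj₂} s t (stored rows s)
            (trans (kept₂ s _ (loopless f) (row-fits s)) (update-≡ adj _ (cong (_+ toℕ s * m) at-s)))
            λ i i< → trans (kept₂ s i (loopless f) (<-trans i< (row-fits s)))
              (update-≢ adj _ λ eq → <-irrefl (sym (trans (sym at-s) (+-cancelʳ-≡ (toℕ s * m) _ _ eq))) i<)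
      ... | no t≢s | yes refl = grown {adj} {adj₂} t s (stored rows t) (update-≡ adj₁ _ (cong (_+ toℕ t * m) at-t))
            λ i i< → trans (update-≢ adj₁ _ λ eq → <-irrefl (sym (trans (sym at-t) (+-cancelʳ-≡ (toℕ t * m) _ _ eq))) i<)
              (kept₁ t i t≢s (<-trans i< (row-fits t)))
      ... | no x≢s | no x≢t = ⊒-cong (stored rows x) λ i i< →
            let i<m = <-trans (subst (i <_) (length-map toℕ (row rows x)) i<) (row-fits x)
            in trans (kept₂ x i x≢t i<m) (kept₁ x i x≢s i<m)
      sound : ∀ {x y} → y ∈ new-row x → ∃[ g ] Joins g x y
      sound {x} y∈ with x Fin.≟ s | x Fin.≟ t
      ... | yes refl | _ = case ∈-++⁻ (row rows s) y∈ of λ where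
            (inj₁ y∈′)         → joined rows y∈′
            (inj₂ (here refl)) → f , inj₁ refl
      ... | no _ | yes refl = case ∈-++⁻ (row rows t) y∈ of λ where
            (inj₁ y∈′)         → joined rows y∈′
            (inj₂ (here refl)) → f , inj₂ refl
      ... | no _ | no _ = joined rows y∈
      older : ∀ {x y} → y ∈ row rows x → y ∈ new-row x
      older {x} y∈ with x Fin.≟ s | x Fin.≟ t
      ... | yes _ | _     = ∈-++⁺ˡ y∈
      ... | no _  | yes _ = ∈-++⁺ˡ y∈
      ... | no _  | no _  = y∈
      newer : ∀ {x y} → Joins f x y → y ∈ new-row x
      newer {x} j with x Fin.≟ s | x Fin.≟ t | j
      ... | yes _   | _       | inj₁ refl = ∈-++⁺ʳ (row rows x) (here refl)
      ... | yes x≡s | _       | inj₂ refl = contradiction (sym x≡s) (loopless f)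
      ... | no x≢s  | _       | inj₁ refl = contradiction refl x≢s
      ... | no _    | yes _   | inj₂ refl = ∈-++⁺ʳ (row rows x) (here refl)
      ... | no _    | no x≢t  | inj₂ refl = contradiction refl x≢t
      covers : ∀ {x y} g → toℕ g < suc (toℕ f) → Joins g x y → y ∈ new-row x
      covers g g< j with g Fin.≟ f
      ... | yes refl = newer j
      ... | no g≢f   = older (complete rows g (≤∧≢⇒< (≤-pred g<) (g≢f ∘ Fin.toℕ-injective)) j)
      lengths : ∀ x → length (new-row x) ≡ length (row rows x) + (bit (Dec.does (x Fin.≟ s)) + bit (Dec.does (x Fin.≟ t)))
      lengths x with x Fin.≟ s | x Fin.≟ t
      ... | yes refl | yes x≡t = contradiction x≡t (loopless f)
      ... | yes _ | no _  = length-++ (row rows x)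
      ... | no _  | yes _ = length-++ (row rows x)
      ... | no _  | no _  = sym (+-identityʳ _)
      shorter : ∀ x → length (new-row x) ≤ suc (toℕ f)
      shorter x with x Fin.≟ s | x Fin.≟ t
      ... | yes _ | _     = ≤-trans (≤-reflexive (trans (length-++ (row rows x)) (+-comm _ 1))) (s≤s (short rows x))
      ... | no _  | yes _ = ≤-trans (≤-reflexive (trans (length-++ (row rows x)) (+-comm _ 1))) (s≤s (short rows x))
      ... | no _  | no _  = m≤n⇒m≤1+n (short rows x)
      sums : sum (map (length ∘ new-row) (allFin n)) ≡ suc (toℕ f) + suc (toℕ f)
      sums = begin
        sum (map (length ∘ new-row) (allFin n))
          ≡⟨ cong sum (map-cong lengths (allFin n)) ⟩
        sum (map (λ x → length (row rows x) + (bit (Dec.does (x Fin.≟ s)) + bit (Dec.does (x Fin.≟ t)))) (allFin n))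
          ≡⟨ sum-map-+ (length ∘ row rows) _ (allFin n) ⟩
        sum (map (length ∘ row rows) (allFin n)) + sum (map (λ x → bit (Dec.does (x Fin.≟ s)) + bit (Dec.does (x Fin.≟ t))) (allFin n))
          ≡⟨ cong₂ _+_ (total rows) (trans (sum-map-+ _ _ (allFin n)) (cong₂ _+_ (single s) (single t))) ⟩
        toℕ f + toℕ f + 2
          ≡⟨ arith (toℕ f) ⟩
        suc (toℕ f) + suc (toℕ f) ∎
        where
        open ≡-Reasoning
        open import Data.List.Properties using (map-cong)
        arith : ∀ j → j + j + 2 ≡ suc j + suc j
        arith = solve-∀
        single : ∀ s → sum (map (λ x → bit (Dec.does (x Fin.≟ s))) (allFin n)) ≡ 1
        single s = ≤-antisym (≤-trans (≤-reflexive (sum-bits (Fin._≟ s) (allFin n))) (length-⊆ {ys = s ∷ []} (Unique.filter⁺ (Fin._≟ s) (Unique.allFin⁺ n))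
            λ x∈ → here (proj₂ (∈-filter⁻ (Fin._≟ s) {xs = allFin n} x∈))))
          (≤-trans (length-⊆ {xs = s ∷ []} ([] ∷ []) λ { (here refl) → ∈-filter⁺ (Fin._≟ s) (∈-allFin s) refl }) (≤-reflexive (sym (sum-bits (Fin._≟ s) (allFin n)))))

-- The breadth-first search program.

module BreadthProgram where
  unequal : Exp → Exp → Exp
  unequal x y = (x ⊝ y) ⊕ (y ⊝ x)

  affordable : Exp
  affordable = lit 1 ⊝ ((get 0 (lit 3) ⊛ ((get 3 (var 8) ⊝ lit 1) ⊕ (get 3 (var 9) ⊝ lit 1))) ⊝ get 0 (lit 2))

  link visit expand scan touch report breadth : Program

  link =
    8 ≔ get 0 (lit 5 ⊕ (var 4 ⊛ lit 3)) ⨟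
    9 ≔ get 0 (lit 6 ⊕ (var 4 ⊛ lit 3)) ⨟
    put 2 (get 1 (var 8) ⊕ (var 8 ⊛ var 1)) (var 9) ⨟
    put 1 (var 8) (get 1 (var 8) ⊕ lit 1) ⨟
    put 2 (get 1 (var 9) ⊕ (var 9 ⊛ var 1)) (var 8) ⨟
    put 1 (var 9) (get 1 (var 9) ⊕ lit 1) ⨟
    skip

  visit =
    11 ≔ get 2 (var 9 ⊕ (var 8 ⊛ var 1)) ⨟
    ite (get 3 (var 11)) skip
      (put 3 (var 11) (get 3 (var 8) ⊕ lit 1) ⨟
       ite (unequal (var 8) (var 5)) (put 4 (var 11) (get 4 (var 8)) ⨟ skip) (put 4 (var 11) (var 11) ⨟ skip) ⨟
       put 5 (var 7) (var 11) ⨟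
       7 ≔ var 7 ⊕ lit 1 ⨟
       skip)

  expand =
    8 ≔ get 5 (var 6) ⨟
    10 ≔ get 1 (var 8) ⨟
    for 9 10 visit ⨟
    6 ≔ var 6 ⊕ lit 1 ⨟
    skip

  scan =
    8 ≔ get 0 (lit 5 ⊕ (var 4 ⊛ lit 3)) ⨟
    9 ≔ get 0 (lit 6 ⊕ (var 4 ⊛ lit 3)) ⨟
    touch

  touch =
    ite (unequal (var 8) (var 5) ⊛ unequal (var 9) (var 5))
      (ite (unequal (get 4 (var 8)) (get 4 (var 9)))
        (ite affordable (put 6 (get 4 (var 8)) (lit 1) ⨟ put 6 (get 4 (var 9)) (lit 1) ⨟ skip) skip)
        skip)
      skip

  report = put 0 (var 4) ((lit 1 ⊝ unequal (get 0 (lit 5 ⊕ (var 4 ⊛ lit 3))) (var 5)) ⊛ get 6 (get 0 (lit 6 ⊕ (var 4 ⊛ lit 3)))) ⨟ skip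

  -- Breadth-first search from one vertex, with the first step of the shortest
  -- walks recorded, followed by one pass over the edges.
  breadth =
    1 ≔ get 0 (lit 1) ⨟
    2 ≔ lit 5 ⊕ (var 1 ⊛ lit 3) ⨟
    5 ≔ get 0 (var 2) ⨟
    for 4 1 link ⨟
    put 3 (var 5) (lit 1) ⨟
    put 5 (lit 0) (var 5) ⨟
    6 ≔ lit 0 ⨟
    7 ≔ lit 1 ⨟
    loop (var 7 ⊝ var 6) expand ⨟
    for 4 1 scan ⨟
    for 4 1 report ⨟
    0 ≔ var 1 ⨟
    skip

module BreadthSpec (I : Instance) (basic : IsBasic I) (W : ℕ) (capacity : limit I ^ 16 ≤ W) (u : Fin (Instance.n I)) where
  open Instance I
  open Logic (limit I) W (7≤limit I) capacity
  open BreadthProgram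
  open Breadth I basic u
  open Wave
  open Adjacency graph
  open Rows

  input : List ℕ
  input = enc I ++ toℕ u ∷ []

  open Layout (layout I (toℕ u ∷ []))

  fin≤ : ∀ {k} (x : Fin k) → k ≤ r I → toℕ x ≤ limit I
  fin≤ x k≤ = ≤-trans (<⇒≤ (Fin.toℕ<n x)) (≤-trans k≤ (r≤limit I))

  1≤limit : 1 ≤ limit I
  1≤limit = ≤-trans (s≤s z≤n) (7≤limit I)

  at-u : cell input (base I) ≡ toℕ u
  at-u = trans (cong (cell input) (sym (+-identityʳ (base I)))) (extra I (toℕ u ∷ []) 0)

  fin-< : ∀ {j} → j < m → ∃[ f ] toℕ {m} f ≡ j
  fin-< j< = Fin.fromℕ< j< , Fin.toℕ-fromℕ< j<

  deg≤limit : ∀ {j deg adj} (R : Rows j deg adj) x → j < m → suc (deg (toℕ x)) ≤ limit I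
  deg≤limit R x j< = ≤-trans (s≤s (≤-trans (≤-reflexive (deg≡ R x)) (short R x))) (≤-trans j< (≤-trans (m≤ I) (r≤limit I)))

  link-exec : ∀ {s} → Small s → regs s 1 ≡ m → arrays s 0 ≡ cell input → (∀ i → arrays s 1 i ≡ 0) →
    Exec (for 4 1 link) s (λ s′ → Rows m (arrays s′ 1) (arrays s′ 2)) (2 + (m * (43 + 8) + 4))
  link-exec {s} S r₁ a₀ zeros = forE (λ j s → Rows j (arrays s 1) (arrays s 2)) S r₁ (rows₀ {arrays s 1} {arrays s 2} zeros) body
    where
    body : ∀ j s₁ → j < m → Small s₁ → Frame (for 4 1 link) s s₁ → regs s₁ 4 ≡ j → regs s₁ 1 ≡ m → Rows j (arrays s₁ 1) (arrays s₁ 2) →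
           Exec link s₁ (λ s₂ → Rows (suc j) (arrays s₂ 1) (arrays s₂ 2)) 43
    body j s₁ j< S₁ F r₄ r₁ R with fin-< j<
    ... | f , refl =
      assign= S₁ (trans (cong₂ (λ a k → a (5 + k * 3)) (trans (arr F 0) a₀) r₄) (at-src f)) (fin≤ (src f) (n≤ I)) λ S →
      assign= S (trans (cong₂ (λ a k → a (6 + k * 3)) (trans (arr F 0) a₀) r₄) (at-tgt f)) (fin≤ (tgt f) (n≤ I)) λ S →
      put= S (cong (λ k → arrays s₁ 1 (toℕ (src f)) + toℕ (src f) * k) r₁) refl (fin≤ (tgt f) (n≤ I)) λ S →
      put= S refl (+-comm _ 1) (deg≤limit R (src f) j<) λ S →
      put= S (cong (λ k → deg₁ f R (toℕ (tgt f)) + toℕ (tgt f) * k) r₁) refl (fin≤ (src f) (n≤ I)) λ S →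
      put= S refl (+-comm _ 1) (subst (λ d → suc d ≤ limit I) (sym (deg₁-t f R)) (deg≤limit R (tgt f) j<)) λ S →
      skipE S (add-row f R)

  record Front (ps qs : List (Fin n)) (s : State) : Set where
    field
      wave   : Wave ps qs (arrays s 3) (arrays s 4)
      queue  : arrays s 5 ⊒ map toℕ (ps ++ qs)
      head≡  : regs s 6 ≡ length ps
      tail≡  : regs s 7 ≡ length (ps ++ qs)
  open Front

  unequal-0 : ∀ {a b} → a ≡ b → (a ∸ b) + (b ∸ a) ≡ 0
  unequal-0 {a} refl = cong₂ _+_ (n∸n≡0 a) (n∸n≡0 a)

  unequal-≢0 : ∀ {a b} → a ≢ b → (a ∸ b) + (b ∸ a) ≢ 0
  unequal-≢0 {a} {b} a≢b z = a≢b (≤-antisym (m∸n≡0⇒m≤n (m+n≡0⇒m≡0 (a ∸ b) z)) (m∸n≡0⇒m≤n (m+n≡0⇒n≡0 (a ∸ b) z)))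

  length≤n : ∀ {ps qs L B} → Wave ps qs L B → length (ps ++ qs) ≤ n
  length≤n {ps} {qs} w = subst (length (ps ++ qs) ≤_) (length-tabulate {A = Fin n} id) (length-⊆ {ys = allFin n} (unique w) λ _ → ∈-allFin _)

  Covered : List (Fin n) → Fin n → State → Set
  Covered ys x s = ∀ {y} → y ∈ ys → 1 ≤ arrays s 3 (toℕ y) × arrays s 3 (toℕ y) ≤ suc (arrays s 3 (toℕ x))

  enqueue-exec : ∀ {ps x qs y ys s} f → Small s → Front ps (x ∷ qs) s → Joins f x y → arrays s 3 (toℕ y) ≡ 0 → Covered ys x s →
    regs s 8 ≡ toℕ x → regs s 5 ≡ toℕ u → regs s 11 ≡ toℕ y →
    Exec (put 3 (var 11) (get 3 (var 8) ⊕ lit 1) ⨟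
          ite (unequal (var 8) (var 5)) (put 4 (var 11) (get 4 (var 8)) ⨟ skip) (put 4 (var 11) (var 11) ⨟ skip) ⨟
          put 5 (var 7) (var 11) ⨟ 7 ≔ var 7 ⊕ lit 1 ⨟ skip) s
      (λ s′ → Front ps (x ∷ (qs ++ y ∷ [])) s′ × Covered (ys ++ y ∷ []) x s′) 27
  enqueue-exec {ps} {x} {qs} {y} {ys} {s} f S F j Ly≡0 covered r₈ r₅ r₁₁ =
    put= S r₁₁ (trans (cong (λ k → arrays s 3 k + 1) r₈) (+-comm _ 1)) label≤ λ S →
    seq⨾ {Q = λ s′ → ∃[ b ] ((x ≡ u × b ≡ toℕ y) ⊎ (x ≢ u × b ≡ arrays s 4 (toℕ x))) × arrays s′ 4 ≡ update (arrays s 4) (toℕ y) b}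
      (choose S r₈ r₅ r₁₁ refl (x Fin.≟ u)) λ {s₁} S₁ F₁ (b , which , B≡) →
    put= S₁ (trans (reg F₁ 7) (tail≡ F)) (trans (reg F₁ 11) r₁₁) (fin≤ y (n≤ I)) λ S →
    assign= S (trans (cong (_+ 1) (trans (reg F₁ 7) (tail≡ F))) (+-comm _ 1)) size≤ λ S →
    skipE S (record
      { wave  = subst₂ (Wave ps (x ∷ (qs ++ y ∷ []))) (sym (arr F₁ 3)) (sym B≡) (discover f (wave F) j Ly≡0 which)
      ; queue = queue′ {arrays s₁ 5} (subst (_⊒ map toℕ (ps ++ x ∷ qs)) (sym (arr F₁ 5)) (queue F))
      ; head≡ = trans (reg F₁ 6) (head≡ F)
      ; tail≡ = sym (trans (cong length (sym shift)) (trans (length-++ (ps ++ x ∷ qs)) (+-comm _ 1))) } ,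
      λ z∈ → subst (λ L → 1 ≤ L (toℕ _) × L (toℕ _) ≤ suc (L (toℕ x))) (sym (arr F₁ 3)) (covered′ z∈))
    where
    L = arrays s 3
    L′ = update L (toℕ y) (suc (L (toℕ x)))
    shift : (ps ++ x ∷ qs) ++ y ∷ [] ≡ ps ++ x ∷ (qs ++ y ∷ [])
    shift = ++-assoc ps (x ∷ qs) (y ∷ [])
    x-seen : 1 ≤ L (toℕ x)
    x-seen = Equivalence.to (seen (wave F) x) (∈-++⁺ʳ ps (here refl))
    fresh : ∀ {z} → 1 ≤ L (toℕ z) → L′ (toℕ z) ≡ L (toℕ z)
    fresh {z} 1≤ = update-≢ L _ λ eq → contradiction (≤-trans 1≤ (≤-reflexive (trans (cong L (sym eq)) Ly≡0))) λ ()
    covered′ : ∀ {z} → z ∈ ys ++ y ∷ [] → 1 ≤ L′ (toℕ z) × L′ (toℕ z) ≤ suc (L′ (toℕ x))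
    covered′ {z} z∈ with ∈-++⁻ ys z∈
    ... | inj₁ z∈ys with covered z∈ys
    ...   | 1≤ , le = ≤-trans 1≤ (≤-reflexive (sym (fresh {z} 1≤))) , ≤-trans (≤-reflexive (fresh {z} 1≤)) (≤-trans le (s≤s (≤-reflexive (sym (fresh {x} x-seen)))))
    covered′ {z} z∈ | inj₂ (here refl) = ≤-trans (s≤s z≤n) (≤-reflexive (sym at-y)) , ≤-trans (≤-reflexive at-y) (s≤s (≤-reflexive (sym (fresh {x} x-seen))))
      where
      at-y : L′ (toℕ y) ≡ suc (L (toℕ x))
      at-y = update-≡ L {toℕ y} _ refl
    label≤ : suc (L (toℕ x)) ≤ limit I
    label≤ = ≤-trans (s≤s (≤-trans (bounded (wave F) x) (≤-trans (length≤n (wave F)) (n≤ I)))) (≤-trans (≤-reflexive (+-comm 1 (r I))) (+≤limit I ≤-refl (≤-trans (s≤s z≤n) (7≤r I))))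
    size≤ : suc (length (ps ++ x ∷ qs)) ≤ limit I
    size≤ = ≤-trans (s≤s (≤-trans (length≤n (wave F)) (n≤ I))) (≤-trans (≤-reflexive (+-comm 1 (r I))) (+≤limit I ≤-refl (≤-trans (s≤s z≤n) (7≤r I))))
    queue′ : ∀ {a : ℕ → ℕ} → a ⊒ map toℕ (ps ++ x ∷ qs) → update a (length (ps ++ x ∷ qs)) (toℕ y) ⊒ map toℕ (ps ++ x ∷ (qs ++ y ∷ []))
    queue′ {a} a⊒ = subst (update a (length (ps ++ x ∷ qs)) (toℕ y) ⊒_) (trans (sym (map-++ toℕ (ps ++ x ∷ qs) (y ∷ []))) (cong (map toℕ) shift))
      (subst (λ k → update a k (toℕ y) ⊒ map toℕ (ps ++ x ∷ qs) ++ toℕ y ∷ []) (length-map toℕ (ps ++ x ∷ qs)) (⊒-snoc a⊒))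
    choose : ∀ {s₁} → Small s₁ → regs s₁ 8 ≡ toℕ x → regs s₁ 5 ≡ toℕ u → regs s₁ 11 ≡ toℕ y → arrays s₁ 4 ≡ arrays s 4 → Dec (x ≡ u) →
      Exec (ite (unequal (var 8) (var 5)) (put 4 (var 11) (get 4 (var 8)) ⨟ skip) (put 4 (var 11) (var 11) ⨟ skip)) s₁
        (λ s′ → ∃[ b ] ((x ≡ u × b ≡ toℕ y) ⊎ (x ≢ u × b ≡ arrays s 4 (toℕ x))) × arrays s′ 4 ≡ update (arrays s 4) (toℕ y) b) 13
    choose S r₈ r₅ r₁₁ a₄ (yes x≡u) = weaken (λ _ _ q → q) (m≤m+n 12 1) (iteElse S (unequal-0 (trans r₈ (trans (cong toℕ x≡u) (sym r₅))))
      (put= S r₁₁ r₁₁ (fin≤ y (n≤ I)) λ S → skipE S (toℕ y , inj₁ (x≡u , refl) , cong (λ a → update a (toℕ y) (toℕ y)) a₄)))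
    choose {s₁} S r₈ r₅ r₁₁ a₄ (no x≢u) = iteThen S (unequal-≢0 λ eq → x≢u (Fin.toℕ-injective (trans (sym r₈) (trans eq r₅))))
      (put= S r₁₁ (cong₂ _$_ a₄ r₈) (≤-trans (≤-reflexive (sym (cong₂ _$_ a₄ r₈))) (arr≤ S 4 (regs s₁ 8) _)) λ S →
       skipE S (arrays s 4 (toℕ x) , inj₂ (x≢u , refl) , cong (λ a → update a (toℕ y) (arrays s 4 (toℕ x))) a₄))

  cell-middle : ∀ {k} (ps : List (Fin k)) x qs → cell (map toℕ (ps ++ x ∷ qs)) (length ps) ≡ toℕ x
  cell-middle []       x qs = refl
  cell-middle (_ ∷ ps) x qs = cell-middle ps x qs

  middle-< : ∀ {k} (ps : List (Fin k)) x qs → length ps < length (map toℕ (ps ++ x ∷ qs))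
  middle-< []       x qs = s≤s z≤n
  middle-< (_ ∷ ps) x qs = s≤s (middle-< ps x qs)

  visit-exec : ∀ {ps x qs s deg adj} (R : Rows m deg adj) i → Small s → arrays s 2 ≡ adj → regs s 1 ≡ m → regs s 5 ≡ toℕ u → regs s 8 ≡ toℕ x →
    regs s 9 ≡ i → i < length (row R x) → Front ps (x ∷ qs) s → Covered (take i (row R x)) x s →
    Exec visit s (λ s′ → ∃[ qs′ ] Front ps (x ∷ qs′) s′ × Covered (take (suc i) (row R x)) x s′) 37
  visit-exec {ps} {x} {qs} {s} {deg} {adj} R i S a₂ r₁ r₅ r₈ r₉ i< F covered with take-suc i (row R x) i<
  ... | y , take≡ , at-i , y∈ =
    assign= S (trans (cong₂ _$_ a₂ (cong₂ _+_ r₉ (cong₂ _*_ r₈ r₁)))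
        (trans (⊒-cell (map toℕ (row R x)) (stored R x) (subst (i <_) (sym (length-map toℕ (row R x))) i<)) at-i)) (fin≤ y (n≤ I)) λ S →
    decide S (arrays s 3 (toℕ y)) refl
    where
    front′ : Front ps (x ∷ qs) (setReg 11 (toℕ y) s)
    front′ = record { wave = wave F ; queue = queue F ; head≡ = head≡ F ; tail≡ = tail≡ F }
    decide : Small (setReg 11 (toℕ y) s) → ∀ l → arrays s 3 (toℕ y) ≡ l → Exec (ite (get 3 (var 11)) skip _) (setReg 11 (toℕ y) s)
      (λ s′ → ∃[ qs′ ] Front ps (x ∷ qs′) s′ × Covered (take (suc i) (row R x)) x s′) 30
    decide S (suc l) eq = weaken (λ _ _ q → q) (m≤m+n 4 26) (iteThen S (λ z → case trans (sym eq) z of λ ())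
      (skipE S (qs , front′ , subst (λ ys → Covered ys x (setReg 11 (toℕ y) s)) (sym take≡) λ {z} z∈ → case ∈-++⁻ (take i (row R x)) z∈ of λ where
        (inj₁ z∈′)         → covered z∈′
        (inj₂ (here refl)) → ≤-trans (s≤s z≤n) (≤-reflexive (sym eq)) , within₁ (wave F) refl y)))
    decide S zero eq = iteElse S eq (weaken (λ {s′} _ _ (F′ , c) → _ , F′ , subst (λ ys → Covered ys x s′) (sym take≡) c) ≤-refl
      (enqueue-exec {ys = take i (row R x)} (proj₁ (joined R y∈)) S front′ (proj₂ (joined R y∈)) eq covered r₈ r₅ refl))

  expand-exec : ∀ {ps x qs s deg adj} (R : Rows m deg adj) → Small s → arrays s 1 ≡ deg → arrays s 2 ≡ adj → regs s 1 ≡ m → regs s 5 ≡ toℕ u →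
    Front ps (x ∷ qs) s → Exec expand s (λ s′ → ∃[ qs′ ] Front (ps ++ x ∷ []) qs′ s′) (6 + ((2 + (length (row R x) * (37 + 8) + 4)) + 5))
  expand-exec {ps} {x} {qs} {s} R S a₁ a₂ r₁ r₅ F =
    assign= S (trans (cong (arrays s 5) (head≡ F)) (trans (⊒-cell _ (queue F) (middle-< ps x qs)) (cell-middle ps x qs))) (fin≤ x (n≤ I)) λ S →
    assign= S (trans (cong (_$ toℕ x) a₁) (deg≡ R x)) (≤-trans (short R x) (≤-trans (m≤ I) (r≤limit I))) λ S →
    seq⨾ (forE (λ i s → ∃[ qs ] Front ps (x ∷ qs) s × Covered (take i (row R x)) x s) S refl
        (qs , record { wave = wave F ; queue = queue F ; head≡ = head≡ F ; tail≡ = tail≡ F } , λ ())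
        λ i s₁ i< S₁ F₁ r₉ _ (qs′ , front , covered) → weaken
          (λ _ _ (qs″ , F″ , c) → qs″ , record { wave = wave F″ ; queue = queue F″ ; head≡ = head≡ F″ ; tail≡ = tail≡ F″ } , c) ≤-refl
          (visit-exec R i S₁ (trans (arr F₁ 2) a₂) (trans (reg F₁ 1) r₁) (trans (reg F₁ 5) r₅) (reg F₁ 8) r₉ i< front covered))
      λ {s₂} S₂ F₂ (qs′ , front , covered) →
    assign= S₂ (cong (_+ 1) (head≡ front)) (size≤ qs′ front) λ S →
    skipE S (qs′ , record
      { wave  = pop (wave front) (λ {y} f j → covered (subst (y ∈_) (sym (take-all _ (row R x) ≤-refl)) (complete R f (Fin.toℕ<n f) j)))
      ; queue = subst (λ zs → arrays s₂ 5 ⊒ map toℕ zs) (sym (++-assoc ps (x ∷ []) qs′)) (queue front)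
      ; head≡ = sym (length-++ ps)
      ; tail≡ = trans (tail≡ front) (cong length (sym (++-assoc ps (x ∷ []) qs′))) })
    where
    size≤ : ∀ {s₂} qs′ → Front ps (x ∷ qs′) s₂ → length ps + 1 ≤ limit I
    size≤ qs′ front = ≤-trans (≤-trans (+-monoʳ-≤ (length ps) (s≤s z≤n)) (≤-reflexive (sym (length-++ ps))))
      (≤-trans (length≤n (wave front)) (≤-trans (n≤ I) (r≤limit I)))

  price : ∀ {deg adj} → Rows m deg adj → Fin n → ℕ
  price R x = 21 + length (row R x) * 45

  -- The time left is the sum of the prices of the vertices not yet expanded. Each vertex is
  -- expanded once, so the handshake identity turns the total into 21 per vertex and 45 per end of
  -- an edge.
  search-exec : ∀ {s deg adj} (R : Rows m deg adj) → Small s → arrays s 1 ≡ deg → arrays s 2 ≡ adj → regs s 1 ≡ m → regs s 5 ≡ toℕ u →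
    Front [] (u ∷ []) s → Exec (loop (var 7 ⊝ var 6) expand) s (λ s′ → Levels (arrays s′ 3) (arrays s′ 4)) (n * 21 + (m + m) * 45 + 4)
  search-exec {s₀} R S a₁ a₂ r₁ r₅ F₀ = weaken (λ _ _ q → q) (≤-reflexive (cong (_+ 4) budget)) (whileE Inv body S frame-refl ([] , u ∷ [] , refl , F₀))
    where
    w = price R
    whole = sum (map w (allFin n))
    budget : whole ≡ n * 21 + (m + m) * 45
    budget = trans (sum-map-+ (const 21) (λ x → length (row R x) * 45) (allFin n)) (cong₂ _+_
      (trans (constants (allFin n)) (cong (_* 21) (length-tabulate {A = Fin n} id)))
      (trans (scaled (allFin n)) (cong (_* 45) (total R))))
      where
      constants : ∀ (xs : List (Fin n)) → sum (map (const 21) xs) ≡ length xs * 21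
      constants []       = refl
      constants (x ∷ xs) = cong (21 +_) (constants xs)
      scaled : ∀ xs → sum (map (λ x → length (row R x) * 45) xs) ≡ sum (map (length ∘ row R) xs) * 45
      scaled []       = refl
      scaled (x ∷ xs) = trans (cong (length (row R x) * 45 +_) (scaled xs)) (sym (*-distribʳ-+ 45 (length (row R x)) _))
    Inv : ℕ → State → Set
    Inv φ s = ∃[ ps ] ∃[ qs ] φ ≡ whole ∸ sum (map w ps) × Front ps qs s
    body : ∀ φ s → Small s → Frame expand s₀ s → Inv φ s → Safe (var 7 ⊝ var 6) s × _
    body φ s S F (ps , [] , refl , front) = _ , inj₁ (trans (cong₂ _∸_ (tail≡ front) (head≡ front)) (trans (cong (λ l → length l ∸ length ps) (++-identityʳ ps)) (n∸n≡0 (length ps))) ,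
      finished (wave front))
    body φ s S F (ps , x ∷ qs , refl , front) = _ , inj₂
      ((λ z → m>n⇒m∸n≢0 (subst (length ps <_) (length-map toℕ (ps ++ x ∷ qs)) (middle-< ps x qs)) (trans (sym (cong₂ _∸_ (tail≡ front) (head≡ front))) z)) ,
       whole ∸ sum (map w (ps ++ x ∷ [])) , _ , pay ,
       weaken (λ _ _ (qs′ , F′) → _ , qs′ , refl , F′) ≤-refl
         (expand-exec R S (trans (arr F 1) a₁) (trans (arr F 2) a₂) (trans (reg F 1) r₁) (trans (reg F 5) r₅) front))
      where
      spent : sum (map w (ps ++ x ∷ [])) ≡ w x + sum (map w ps)
      spent = trans (sum-split w ps) (cong (λ l → w x + sum (map w l)) (++-identityʳ ps))
      fits : w x + sum (map w ps) ≤ whole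
      fits = ≤-trans (≤-trans (+-monoʳ-≤ (w x) (≤-trans (m≤m+n _ (sum (map w qs))) (≤-reflexive (sym (sum-++-map ps)))))
        (≤-reflexive (sym (sum-split w ps)))) (sum-⊆ w {ps ++ x ∷ qs} {allFin n} (unique (wave front)) λ _ → ∈-allFin _)
        where
        sum-++-map : ∀ ps → sum (map w (ps ++ qs)) ≡ sum (map w ps) + sum (map w qs)
        sum-++-map []       = refl
        sum-++-map (p ∷ ps) = trans (cong (w p +_) (sum-++-map ps)) (sym (+-assoc (w p) _ _))
      cost≡ : ∀ d → 4 + (6 + ((2 + (d * 45 + 4)) + 5)) ≡ 21 + d * 45
      cost≡ = solve-∀
      pay : 4 + (6 + ((2 + (length (row R x) * 45 + 4)) + 5)) + (whole ∸ sum (map w (ps ++ x ∷ []))) ≤ whole ∸ sum (map w ps)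
      pay = ≤-reflexive (begin
        4 + (6 + ((2 + (length (row R x) * 45 + 4)) + 5)) + (whole ∸ sum (map w (ps ++ x ∷ [])))
          ≡⟨ cong₂ (λ a b → a + (whole ∸ b)) (cost≡ (length (row R x))) spent ⟩
        w x + (whole ∸ (w x + sum (map w ps)))   ≡⟨ cong (λ b → w x + (whole ∸ b)) (+-comm (w x) _) ⟩
        w x + (whole ∸ (sum (map w ps) + w x))   ≡⟨ cong (w x +_) (∸-+-assoc whole (sum (map w ps)) (w x)) ⟨
        w x + (whole ∸ sum (map w ps) ∸ w x)     ≡⟨ m+[n∸m]≡n (m+n≤o⇒m≤o∸n (w x) fits) ⟩
        whole ∸ sum (map w ps)                   ∎)
        where open ≡-Reasoning

  module _ {L B : ℕ → ℕ} where
    open Touching I u L B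

    Touched : ℕ → (ℕ → ℕ) → Set
    Touched j t = ∀ (a : Fin n) → ∃[ b ] t (toℕ a) ≡ bit b × (b ≡ true ⇔ (∃[ f ] toℕ f < j × Touch f a))

    touched-no : ∀ {f t} → ¬ Cross f → Touched (toℕ f) t → Touched (suc (toℕ f)) t
    touched-no {f} ¬cross touched a with touched a
    ... | b , b≡ , b⇔ = b , b≡ , mk⇔
      (λ eq → case Equivalence.to b⇔ eq of λ (g , g< , touch) → g , m≤n⇒m≤1+n g< , touch)
      λ (g , g< , touch) → Equivalence.from b⇔ (g , ≤∧≢⇒< (≤-pred g<) (λ g≡f → ¬cross (subst Cross (Fin.toℕ-injective g≡f) (proj₁ touch))) , touch)

    touched-yes : ∀ {f t} → Cross f → Touched (toℕ f) t →
                  Touched (suc (toℕ f)) (update (update t (B (toℕ (src f))) 1) (B (toℕ (tgt f))) 1)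
    touched-yes {f} {t} cross touched a with B (toℕ (src f)) ≟ toℕ a | B (toℕ (tgt f)) ≟ toℕ a
    ... | _      | yes Bt = true , update-≡ (update t (B (toℕ (src f))) 1) 1 Bt , mk⇔ (λ _ → f , ≤-refl , cross , inj₂ Bt) λ _ → refl
    ... | yes Bs | no ¬Bt = true , trans (update-≢ (update t (B (toℕ (src f))) 1) 1 ¬Bt) (update-≡ t 1 Bs) , mk⇔ (λ _ → f , ≤-refl , cross , inj₁ Bs) λ _ → refl
    ... | no ¬Bs | no ¬Bt with touched a
    ...   | b , b≡ , b⇔ = b , trans (update-≢ (update t (B (toℕ (src f))) 1) 1 ¬Bt) (trans (update-≢ t 1 ¬Bs) b≡) , mk⇔
            (λ eq → case Equivalence.to b⇔ eq of λ (g , g< , touch) → g , m≤n⇒m≤1+n g< , touch)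
            λ (g , g< , touch) → Equivalence.from b⇔ (g , ≤∧≢⇒< (≤-pred g<) (λ g≡f → untouched (Fin.toℕ-injective g≡f) (proj₂ touch)) , touch)
      where
      untouched : ∀ {g} → g ≡ f → ¬ (B (toℕ (src g)) ≡ toℕ a ⊎ B (toℕ (tgt g)) ≡ toℕ a)
      untouched refl (inj₁ Bs) = ¬Bs Bs
      untouched refl (inj₂ Bt) = ¬Bt Bt

    scan-exec : ∀ {s} → Small s → regs s 1 ≡ m → regs s 5 ≡ toℕ u → arrays s 0 ≡ cell input → arrays s 3 ≡ L → arrays s 4 ≡ B →
      (∀ i → arrays s 6 i ≡ 0) → Exec (for 4 1 scan) s (λ s′ → Touched m (arrays s′ 6)) (2 + (m * (69 + 8) + 4))
    scan-exec {s} S r₁ r₅ a₀ a₃ a₄ zeros = forE (λ j s → Touched j (arrays s 6)) S r₁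
        (λ a → false , zeros (toℕ a) , mk⇔ (λ ()) λ { (_ , () , _) }) body
      where
      body : ∀ j s₁ → j < m → Small s₁ → Frame (for 4 1 scan) s s₁ → regs s₁ 4 ≡ j → regs s₁ 1 ≡ m → Touched j (arrays s₁ 6) →
             Exec scan s₁ (λ s₂ → Touched (suc j) (arrays s₂ 6)) 69
      body j s₁ j< S₁ F r₄ _ touched with fin-< j<
      ... | f , refl =
        assign= S₁ (trans (cong₂ (λ a k → a (5 + k * 3)) (trans (arr F 0) a₀) r₄) (at-src f)) (fin≤ (src f) (n≤ I)) λ S →
        assign= S (trans (cong₂ (λ a k → a (6 + k * 3)) (trans (arr F 0) a₀) r₄) (at-tgt f)) (fin≤ (tgt f) (n≤ I)) λ S →
        examine S
        where
        s₂ = setReg 9 (toℕ (tgt f)) (setReg 8 (toℕ (src f)) s₁)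
        r₅′ : regs s₁ 5 ≡ toℕ u
        r₅′ = trans (reg F 5) r₅
        at₄ : ∀ i → arrays s₁ 4 i ≡ B i
        at₄ i = cong (_$ i) (trans (arr F 4) a₄)
        no-change : Small s₂ → ¬ Cross f → Exec skip s₂ (λ s → Touched (suc (toℕ f)) (arrays s 6)) 1
        no-change S ¬cross = skipE S (touched-no {t = arrays s₁ 6} ¬cross touched)
        product≢0 : ∀ {a b} → a ≢ 0 → b ≢ 0 → a * b ≢ 0
        product≢0 {a} {b} a≢ b≢ z = [ a≢ , b≢ ]′ (m*n≡0⇒m≡0∨n≡0 a z)
        ends-test : src f ≢ u → tgt f ≢ u → eval (unequal (var 8) (var 5) ⊛ unequal (var 9) (var 5)) s₂ ≢ 0
        ends-test s≢u t≢u = product≢0 (unequal-≢0 λ eq → s≢u (Fin.toℕ-injective (trans eq r₅′))) (unequal-≢0 λ eq → t≢u (Fin.toℕ-injective (trans eq r₅′)))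
        cost-test : eval affordable s₂ ≡ 1 ∸ (den I * ((L (toℕ (src f)) ∸ 1) + (L (toℕ (tgt f)) ∸ 1)) ∸ num I)
        cost-test = cong₂ (λ a l → 1 ∸ (a 3 * ((l (toℕ (src f)) ∸ 1) + (l (toℕ (tgt f)) ∸ 1)) ∸ a 2)) (trans (arr F 0) a₀) (trans (arr F 3) a₃)
        apart = (toℕ (src f) ∸ regs s₁ 5) + (regs s₁ 5 ∸ toℕ (src f))
        examine : Small s₂ → Exec touch s₂ (λ s → Touched (suc (toℕ f)) (arrays s 6)) 55
        examine S with src f Fin.≟ u | tgt f Fin.≟ u
        ... | yes s≡u | _ = weaken (λ _ _ q → q) (m≤m+n 17 38) (iteElse S (cong (_* ((toℕ (tgt f) ∸ regs s₁ 5) + (regs s₁ 5 ∸ toℕ (tgt f)))) (unequal-0 (trans (cong toℕ s≡u) (sym r₅′)))) (no-change S λ c → proj₁ c s≡u))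
        ... | no _ | yes t≡u = weaken (λ _ _ q → q) (m≤m+n 17 38) (iteElse S (trans (cong (λ z → apart * z) {x = (toℕ (tgt f) ∸ regs s₁ 5) + (regs s₁ 5 ∸ toℕ (tgt f))}
                (unequal-0 (trans (cong toℕ t≡u) (sym r₅′)))) (*-zeroʳ apart)) (no-change S λ c → proj₁ (proj₂ c) t≡u))
        ... | no s≢u | no t≢u with B (toℕ (src f)) ≟ B (toℕ (tgt f))
        ...   | yes B≡ = weaken (λ _ _ q → q) (m≤m+n 29 26) (iteThen S (ends-test s≢u t≢u)
                (iteElse S (unequal-0 (trans (at₄ _) (trans B≡ (sym (at₄ _))))) (no-change S λ c → proj₁ (proj₂ (proj₂ c)) B≡)))
        ...   | no B≢ with den I * ((L (toℕ (src f)) ∸ 1) + (L (toℕ (tgt f)) ∸ 1)) ≤? num I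
        ...     | no ¬fits = weaken (λ _ _ q → q) (m≤m+n 47 8) (iteThen S (ends-test s≢u t≢u)
                  (iteThen S (unequal-≢0 λ eq → B≢ (trans (sym (at₄ _)) (trans eq (at₄ _))))
                  (iteElse S (trans cost-test (m≤n⇒m∸n≡0 (m<n⇒0<n∸m (≰⇒> ¬fits)))) (no-change S λ c → ¬fits (proj₂ (proj₂ (proj₂ c)))))))
        ...     | yes fits = iteThen S (ends-test s≢u t≢u)
                  (iteThen S (unequal-≢0 λ eq → B≢ (trans (sym (at₄ _)) (trans eq (at₄ _))))
                  (iteThen S (λ z → case trans (sym (cong (1 ∸_) (m≤n⇒m∸n≡0 fits))) (trans (sym cost-test) z) of λ ())
                  (put= S (at₄ _) refl 1≤limit λ S → put= S (at₄ _) refl 1≤limit λ S →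
                   skipE S (touched-yes {t = arrays s₁ 6} (s≢u , t≢u , B≢ , fits) touched))))

    report-exec : ∀ {s} → Small s → regs s 1 ≡ m → regs s 5 ≡ toℕ u → arrays s 0 ≡ cell input → Touched m (arrays s 6) →
      Exec (for 4 1 report) s (λ s′ → ∀ f → ∃[ b ] arrays s′ 0 (toℕ f) ≡ bit b × (b ≡ true ⇔ (src f ≡ u × (∃[ g ] Touch g (tgt f))))) (2 + (m * (30 + 8) + 4))
    report-exec {s} S r₁ r₅ a₀ touched = weaken (λ _ _ (_ , emitted) f → emitted f (Fin.toℕ<n f)) ≤-refl (forE Inv S r₁ ((λ k _ → cong (_$ k) a₀) , λ _ ()) body)
      where
      Inv : ℕ → State → Set
      Inv j s = (∀ k → j ≤ k → arrays s 0 k ≡ cell input k) ×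
        (∀ f → toℕ f < j → ∃[ b ] arrays s 0 (toℕ f) ≡ bit b × (b ≡ true ⇔ (src f ≡ u × (∃[ g ] Touch g (tgt f)))))
      body : ∀ j s₁ → j < m → Small s₁ → Frame (for 4 1 report) s s₁ → regs s₁ 4 ≡ j → regs s₁ 1 ≡ m → Inv j s₁ →
             Exec report s₁ (λ s₂ → Inv (suc j) (setReg 4 (suc j) s₂)) 30
      body j s₁ j< S₁ F r₄ _ (rest , emitted) with fin-< j<
      ... | f , refl = output-bit (result (touched (tgt f)))
        where
        -- The output overwrites the input from the front; cell f lies before the triple of edge f,
        -- which is therefore still intact when it is read.
        late : ∀ i → toℕ f ≤ i + toℕ f * 3
        late i = ≤-trans (m≤m*n (toℕ f) 3) (m≤n+m (toℕ f * 3) i)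
        value′ : eval ((lit 1 ⊝ unequal (get 0 (lit 5 ⊕ (var 4 ⊛ lit 3))) (var 5)) ⊛ get 6 (get 0 (lit 6 ⊕ (var 4 ⊛ lit 3)))) s₁ ≡
                 (1 ∸ ((toℕ (src f) ∸ toℕ u) + (toℕ u ∸ toℕ (src f)))) * arrays s 6 (toℕ (tgt f))
        value′ = cong₂ _*_
          (cong₂ (λ a b → 1 ∸ ((a ∸ b) + (b ∸ a))) (trans (cong (λ k → arrays s₁ 0 (5 + k * 3)) r₄) (trans (rest _ (late 5)) (at-src f))) (trans (reg F 5) r₅))
          (cong₂ _$_ (arr F 6) (trans (cong (λ k → arrays s₁ 0 (6 + k * 3)) r₄) (trans (rest _ (late 6)) (at-tgt f))))
        result : ∃[ b ] arrays s 6 (toℕ (tgt f)) ≡ bit b × (b ≡ true ⇔ (∃[ g ] toℕ g < m × Touch g (tgt f))) →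
          ∃[ b ] (1 ∸ ((toℕ (src f) ∸ toℕ u) + (toℕ u ∸ toℕ (src f)))) * arrays s 6 (toℕ (tgt f)) ≡ bit b × (b ≡ true ⇔ (src f ≡ u × (∃[ g ] Touch g (tgt f))))
        result (b , b≡ , b⇔) with src f Fin.≟ u
        ... | yes s≡u = b , trans (cong₂ (λ x y → (1 ∸ x) * y) (unequal-0 (cong toℕ s≡u)) b≡) (+-identityʳ (bit b)) ,
              mk⇔ (λ eq → s≡u , (case Equivalence.to b⇔ eq of λ (g , _ , touch) → g , touch)) λ (_ , g , touch) → Equivalence.from b⇔ (g , Fin.toℕ<n g , touch)
        ... | no s≢u = false , cong (_* arrays s 6 (toℕ (tgt f))) (m≤n⇒m∸n≡0 (n≢0⇒n>0 (unequal-≢0 (s≢u ∘ Fin.toℕ-injective)))) , mk⇔ (λ ()) λ (s≡u , _) → contradiction s≡u s≢u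
        output-bit : _ → Exec report s₁ (λ s₂ → Inv (suc (toℕ f)) (setReg 4 (suc (toℕ f)) s₂)) 30
        output-bit (b , b≡ , b⇔) = put= S₁ r₄ (trans value′ b≡) (≤-trans (bit≤1 b) 1≤limit) λ S → skipE S
          ((λ k k> → trans (update-≢ (arrays s₁ 0) (bit b) (<⇒≢ k>)) (rest k (<⇒≤ k>))) ,
           λ g g< → case g Fin.≟ f of λ where
             (yes refl) → b , update-≡ (arrays s₁ 0) {toℕ g} (bit b) refl , b⇔
             (no g≢f)   → case emitted g (≤∧≢⇒< (≤-pred g<) (g≢f ∘ Fin.toℕ-injective)) of λ (c , c≡ , c⇔) →
                            c , trans (update-≢ (arrays s₁ 0) (bit b) (g≢f ∘ sym ∘ Fin.toℕ-injective)) c≡ , c⇔)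

  length-input : length input ≡ base I + 1
  length-input = trans (length-++ (enc I)) (cong (_+ 1) (length-enc I))

  input-small : Small (initial input)
  input-small = initial-small (All.++⁺ (All.map (λ le → ≤-trans le (r≤limit I)) (entry≤ I)) (fin≤ u (n≤ I) ∷ []))
    (≤-trans (≤-reflexive length-input) (+≤limit I (base≤ I) (≤-trans (s≤s z≤n) (7≤r I))))

  Selected : List ℕ → Set
  Selected ys = ∃[ X ] ys ≡ bits X × (∀ e → Vec.lookup X e ≡ true ⇔ (src e ≡ u × Removable I e))

  breadth-time : ℕ
  breadth-time = 12 + ((2 + (m * (43 + 8) + 4)) + (10 + ((n * 21 + (m + m) * 45 + 4) + ((2 + (m * (69 + 8) + 4)) + ((2 + (m * (30 + 8) + 4)) + 3)))))

  breadth-exec : Exec breadth (initial input) (λ s → Selected (output s) × regs s 0 ≤ m) breadth-time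
  breadth-exec =
    assign= input-small refl (≤-trans (m≤ I) (r≤limit I)) λ S →
    assign= S refl (≤-trans (base≤ I) (r≤limit I)) λ S →
    assign= S at-u (fin≤ u (n≤ I)) λ S →
    seq⨾ (link-exec S refl refl (λ _ → refl)) λ {s₁} S₁ F₁ R →
    put= S₁ (reg F₁ 5) refl 1≤limit λ S →
    put= S refl (reg F₁ 5) (fin≤ u (n≤ I)) λ S →
    assign= S refl z≤n λ S →
    assign= S refl 1≤limit λ S →
    seq⨾ (search-exec R S refl refl (reg F₁ 1) (reg F₁ 5) (front₀ {s₁} (λ i → cong (_$ i) (arr F₁ 3)))) λ {s₂} S₂ F₂ levels →
    seq⨾ (scan-exec {arrays s₂ 3} {arrays s₂ 4} S₂ (trans (reg F₂ 1) (reg F₁ 1)) (trans (reg F₂ 5) (reg F₁ 5)) (trans (arr F₂ 0) (arr F₁ 0)) refl refl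
        (λ i → cong (_$ i) (trans (arr F₂ 6) (arr F₁ 6)))) λ {s₃} S₃ F₃ touched →
    seq⨾ (report-exec {arrays s₂ 3} {arrays s₂ 4} S₃ (trans (reg F₃ 1) (trans (reg F₂ 1) (reg F₁ 1))) (trans (reg F₃ 5) (trans (reg F₂ 5) (reg F₁ 5)))
        (trans (arr F₃ 0) (trans (arr F₂ 0) (arr F₁ 0))) touched) λ {s₄} S₄ F₄ reported →
    assign= S₄ (trans (reg F₄ 1) (trans (reg F₃ 1) (trans (reg F₂ 1) (reg F₁ 1)))) (≤-trans (m≤ I) (r≤limit I)) λ S →
    skipE S (selected levels (to-subset {a = arrays s₄ 0} reported) , ≤-refl)
    where
    front₀ : ∀ {s} → (∀ i → arrays s 3 i ≡ 0) →
      Front [] (u ∷ []) (setReg 7 1 (setReg 6 0 (setCell 5 0 (toℕ u) (setCell 3 (toℕ u) 1 s))))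
    front₀ {s} zeros = record { wave = wave₀ {arrays s 3} zeros ; queue = ⊒-∷ {update (arrays s 5) 0 (toℕ u)} refl ⊒-[] ; head≡ = refl ; tail≡ = refl }
    selected : ∀ {L B a} → Levels L B →
      ∃[ X ] (∀ f → a (toℕ f) ≡ bit (Vec.lookup X f)) × (∀ f → Vec.lookup X f ≡ true ⇔ (src f ≡ u × (∃[ g ] Touching.Touch I u L B g (tgt f)))) →
      Selected (applyUpTo a m)
    selected {a = a} levels (X , cells , X⇔) = X , slice-⊒ {a} m (bits-⊒ X cells) (sym (length-bits X)) , λ e → mk⇔
      (λ eq → case Equivalence.to (X⇔ e) eq of λ (s≡u , touch) → s≡u , Equivalence.to (touch⇔removable I basic s≡u levels) touch)
      λ (s≡u , r) → Equivalence.from (X⇔ e) (s≡u , Equivalence.from (touch⇔removable I basic s≡u levels) r)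

  breadth-calls : Calls W breadth input Selected (m * 260 + n * 21 + 53)
  breadth-calls with toCalls breadth-exec
  ... | ys , t , run , ok , t≤ = ys , t , run , ok , ≤-trans t≤ (≤-reflexive (trans (cong (λ l → l + breadth-time + m) length-input) (total′ n m)))
    where
    total′ : ∀ n m → 5 + m * 3 + 1 + (12 + ((2 + (m * (43 + 8) + 4)) + (10 + ((n * 21 + (m + m) * 45 + 4) + ((2 + (m * (69 + 8) + 4)) +
             ((2 + (m * (30 + 8) + 4)) + 3)))))) + m ≡ m * 260 + n * 21 + 53
    total′ = solve-∀

-- Nontrivial edges of a basic instance, vertex by vertex.

-- One search per vertex finds the removable edges with that source. The leading flag is always 0
-- with the trivial certificate, as the bound on the number of tests rests on ⌊α⌋ ≥ 1 here.
merge gather basicPrepare : Program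

merge = put 2 (var 4) (get 2 (var 4) ⊕ get 1 (var 4)) ⨟ skip

gather =
  put 0 (var 2) (var 5) ⨟
  call 1 BreadthProgram.breadth 0 (var 2 ⊕ lit 1) ⨟
  for 4 1 merge ⨟
  skip

basicPrepare =
  1 ≔ get 0 (lit 1) ⨟
  2 ≔ lit 5 ⊕ (var 1 ⊛ lit 3) ⨟
  3 ≔ get 0 (lit 0) ⨟
  for 5 3 gather ⨟
  put 0 (lit 0) (lit 0) ⨟
  for 4 1 emit ⨟
  0 ≔ lit 1 ⊕ var 1 ⨟
  skip

module BasicPrepareSpec (I : Instance) (basic : IsBasic I) (W : ℕ) (capacity : limit I ^ 16 ≤ W) where
  open Instance I
  open Logic (limit I) W (7≤limit I) capacity
  open Emission I W capacity

  1≤limit : 1 ≤ limit I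
  1≤limit = ≤-trans (s≤s z≤n) (7≤limit I)

  merge-exec : ∀ {s} → Small s → regs s 1 ≡ m → (∀ (e : Fin m) → arrays s 2 (toℕ e) + arrays s 1 (toℕ e) ≤ limit I) →
    Exec (for 4 1 merge) s (λ s′ → ∀ (e : Fin m) → arrays s′ 2 (toℕ e) ≡ arrays s 2 (toℕ e) + arrays s 1 (toℕ e)) (2 + (m * (8 + 8) + 4))
  merge-exec {s} S r₁ sum≤ = weaken (λ _ _ (merged , _) e → merged e (Fin.toℕ<n e)) ≤-refl (forE Inv S r₁ ((λ _ ()) , λ _ _ → refl) body)
    where
    Inv : ℕ → State → Set
    Inv j s′ = (∀ (e : Fin m) → toℕ e < j → arrays s′ 2 (toℕ e) ≡ arrays s 2 (toℕ e) + arrays s 1 (toℕ e)) ×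
               (∀ k → j ≤ k → arrays s′ 2 k ≡ arrays s 2 k)
    body : ∀ j s₁ → j < m → Small s₁ → Frame (for 4 1 merge) s s₁ → regs s₁ 4 ≡ j → regs s₁ 1 ≡ m → Inv j s₁ →
           Exec merge s₁ (λ s₂ → Inv (suc j) (setReg 4 (suc j) s₂)) 8
    body j s₁ j< S₁ F r₄ _ (merged , rest) =
      put= S₁ (trans r₄ (sym e≡)) value′ (sum≤ e) λ S → skipE S (merged′ , λ k k> → trans (update-≢ (arrays s₁ 2) _ (<⇒≢ (subst (_< k) (sym e≡) k>))) (rest k (<⇒≤ k>)))
      where
      e = Fin.fromℕ< j<
      e≡ = Fin.toℕ-fromℕ< j<
      value′ : arrays s₁ 2 (regs s₁ 4) + arrays s₁ 1 (regs s₁ 4) ≡ arrays s 2 (toℕ e) + arrays s 1 (toℕ e)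
      value′ = cong₂ _+_ (trans (cong (arrays s₁ 2) (trans r₄ (sym e≡))) (rest (toℕ e) (≤-reflexive (sym e≡)))) (cong₂ _$_ (arr F 1) (trans r₄ (sym e≡)))
      merged′ : ∀ (f : Fin m) → toℕ f < suc j → update (arrays s₁ 2) (toℕ e) (arrays s 2 (toℕ e) + arrays s 1 (toℕ e)) (toℕ f) ≡ arrays s 2 (toℕ f) + arrays s 1 (toℕ f)
      merged′ f f< with f Fin.≟ e
      ... | yes refl = update-≡ (arrays s₁ 2) {toℕ f} _ refl
      ... | no f≢e   = trans (update-≢ (arrays s₁ 2) _ (f≢e ∘ sym ∘ Fin.toℕ-injective))
            (merged f (≤∧≢⇒< (≤-pred f<) λ f≡j → f≢e (Fin.toℕ-injective (trans f≡j (sym e≡)))))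

  Gathered : ℕ → State → Set
  Gathered j s = arrays s 0 ⊒ enc I × (∀ e → ∃[ b ] arrays s 2 (toℕ e) ≡ bit b × (b ≡ true ⇔ (toℕ (src e) < j × Removable I e)))

  gather-time : ℕ
  gather-time = 3 + (4 + (m * 260 + n * 21 + 53) + ((2 + (m * (8 + 8) + 4)) + 1))

  gather-exec : ∀ {s} j → j < n → Small s → regs s 1 ≡ m → regs s 2 ≡ base I → regs s 5 ≡ j → Gathered j s →
    Exec gather s (Gathered (suc j)) gather-time
  gather-exec {s} j j< S r₁ r₂ r₅ (enc⊒ , flags) =
    put= S r₂ (trans r₅ (sym u≡)) (≤-trans (<⇒≤ (Fin.toℕ<n u)) (≤-trans (n≤ I) (r≤limit I))) λ S →
    call⨾ S (slice-⊒ _ (⊒-++ (enc I) (enc⊒′ {arrays s 0} enc⊒) (⊒-∷ (update-≡ (arrays s 0) (toℕ u) (trans (sym (length-enc I)) (sym (+-identityʳ _)))) ⊒-[])) lengths)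
      (BreadthSpec.breadth-calls I basic W capacity u) (λ { _ (X , refl , _) _ → All.map (λ le → ≤-trans le 1≤limit) (bits≤1 X) })
      λ { _ (X , refl , X⇔) S →
    seq⨾ (merge-exec S r₁ (λ e → ≤-trans (≤-reflexive (proj₁ (proj₂ (combine X X⇔ e)))) (≤-trans (bit≤1 (proj₁ (combine X X⇔ e))) 1≤limit))) λ S₁ F₁ merged →
    skipE S₁ (subst (_⊒ enc I) (sym (arr F₁ 0)) (enc⊒′ {arrays s 0} enc⊒) ,
      λ e → proj₁ (combine X X⇔ e) , trans (merged e) (proj₁ (proj₂ (combine X X⇔ e))) , proj₂ (proj₂ (combine X X⇔ e))) }
    where
    u = Fin.fromℕ< j<
    u≡ = Fin.toℕ-fromℕ< j<
    enc⊒′ : ∀ {a : ℕ → ℕ} → a ⊒ enc I → update a (base I) (toℕ u) ⊒ enc I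
    enc⊒′ a⊒ = ⊒-update a⊒ (≤-reflexive (length-enc I))
    lengths : regs s 2 + 1 ≡ length (enc I ++ toℕ u ∷ [])
    lengths = trans (cong (_+ 1) (trans r₂ (sym (length-enc I)))) (sym (length-++ (enc I)))
    -- An edge is reported only by the search from its source, so the two flags are never both 1 and
    -- their sum is a bit.
    combine : ∀ X → (∀ e → Vec.lookup X e ≡ true ⇔ (src e ≡ u × Removable I e)) → ∀ e →
      ∃[ b ] arrays s 2 (toℕ e) + overlay (bits X) (arrays s 1) (toℕ e) ≡ bit b × (b ≡ true ⇔ (toℕ (src e) < suc j × Removable I e))
    combine X X⇔ e with flags e | Vec.lookup X e in eq
    ... | true , a≡ , b⇔ | true = contradiction (proj₁ (Equivalence.to b⇔ refl)) (≤⇒≯ (≤-reflexive (trans (sym u≡) (cong toℕ (sym (proj₁ (Equivalence.to (X⇔ e) eq)))))))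
    ... | true , a≡ , b⇔ | false = true , cong₂ _+_ a≡ (trans (bits-at X e) (cong bit eq)) ,
          mk⇔ (λ _ → case Equivalence.to b⇔ refl of λ (l , r) → m≤n⇒m≤1+n l , r) λ _ → refl
    ... | false , a≡ , b⇔ | true = true , cong₂ _+_ a≡ (trans (bits-at X e) (cong bit eq)) ,
          mk⇔ (λ _ → case Equivalence.to (X⇔ e) eq of λ (s≡u , r) → s≤s (≤-reflexive (trans (cong toℕ s≡u) u≡)) , r) λ _ → refl
    ... | false , a≡ , b⇔ | false = false , cong₂ _+_ a≡ (trans (bits-at X e) (cong bit eq)) , mk⇔ (λ ()) λ (l , r) →
          case m≤n⇒m<n∨m≡n (≤-pred l) of λ where
            (inj₁ l<) → Equivalence.from b⇔ (l< , r)
            (inj₂ l≡) → trans (sym eq) (Equivalence.from (X⇔ e) (Fin.toℕ-injective (trans l≡ (sym u≡)) , r))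

  prepare-time : ℕ
  prepare-time = 12 + ((2 + (n * (gather-time + 8) + 4)) + (3 + ((2 + (m * (7 + 8) + 4)) + 5)))

  basic-prepare-exec : Exec basicPrepare (initial (enc I)) (λ s → Prepared I Unit.⊤ (output s) × regs s 0 ≤ suc m) prepare-time
  basic-prepare-exec =
    assign= (initial-small (All.map (λ le → ≤-trans le (r≤limit I)) (entry≤ I)) (subst (_≤ limit I) (sym (length-enc I)) (≤-trans (base≤ I) (r≤limit I))))
      refl (≤-trans (m≤ I) (r≤limit I)) λ S →
    assign= S refl (≤-trans (base≤ I) (r≤limit I)) λ S →
    assign= S refl (≤-trans (n≤ I) (r≤limit I)) λ S →
    seq⨾ (forE Gathered S refl (⊒-overlay (enc I) (const 0) , λ _ → false , refl , mk⇔ (λ ()) λ { (() , _) })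
      λ j s₁ j< S₁ F r₅ _ gathered → gather-exec j j< S₁ (reg F 1) (reg F 2) r₅ gathered) λ {s₁} S₁ F₁ (_ , flags) →
    put= S₁ refl refl z≤n λ S →
    finish S (reg F₁ 1) (to-subset {P = Removable I} {arrays s₁ 2} λ e → case flags e of λ (b , b≡ , b⇔) →
      b , b≡ , mk⇔ (proj₂ ∘ Equivalence.to b⇔) λ r → Equivalence.from b⇔ (Fin.toℕ<n (src e) , r))
    where
    finish : ∀ {s} → Small (setCell 0 0 0 s) → regs s 1 ≡ m →
      ∃[ X ] (∀ f → arrays s 2 (toℕ f) ≡ bit (Vec.lookup X f)) × (∀ f → Vec.lookup X f ≡ true ⇔ Removable I f) →
      Exec (for 4 1 emit ⨟ 0 ≔ lit 1 ⊕ var 1 ⨟ skip) (setCell 0 0 0 s) (λ s → Prepared I Unit.⊤ (output s) × regs s 0 ≤ suc m) ((2 + (m * (7 + 8) + 4)) + 5)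
    finish S r₁ (X , cells , X⇔) =
      seq⨾ (emit-exec {X} S r₁ cells) λ {s₂} S₂ F₂ (zero≡ , emitted) →
      assign= S₂ (cong suc (trans (reg F₂ 1) r₁)) (+≤limit I (≤-trans (s≤s z≤n) (7≤r I)) (m≤ I)) λ S →
      skipE S ((0 , X , slice-⊒ (suc m) (⊒-∷ {arrays s₂ 0} zero≡ (bits-⊒ X emitted)) (cong suc (sym (length-bits X))) , X⇔ , inj₂ (refl , _)) , ≤-refl)

  basic-prepare-calls : Calls W basicPrepare (enc I) (Prepared I Unit.⊤) (n * (m * 276 + n * 21 + 75) + m * 19 + 38)
  basic-prepare-calls with toCalls basic-prepare-exec
  ... | ys , t , run , ok , t≤ = ys , t , run , ok , ≤-trans t≤ (≤-reflexive (trans (cong (λ l → l + prepare-time + suc m) (length-enc I)) (bound n m)))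
    where
    bound : ∀ n m → 5 + m * 3 + (12 + ((2 + (n * (3 + (4 + (m * 260 + n * 21 + 53) + ((2 + (m * (8 + 8) + 4)) + 1)) + 8) + 4)) +
              (3 + ((2 + (m * (7 + 8) + 4)) + 5)))) + suc m ≡ n * (m * 276 + n * 21 + 75) + m * 19 + 38
    bound = solve-∀

-- Arithmetic of the running times.

-- Absorbs the constant in 2τ + 1 ≤ 3τ into the second power ϱ^ϱ of the bound. From ϱ = 3 on the
-- base 3 is at most ϱ; the factor 9 covers the rest.
3^≤ : ∀ ϱ → 3 ^ ϱ ≤ 9 * ϱ ^ ϱ
3^≤ 0 = s≤s z≤n
3^≤ 1 = s≤s (s≤s (s≤s z≤n))
3^≤ 2 = m≤m+n 9 27
3^≤ ϱ@(suc (suc (suc k))) = ≤-trans (^-monoˡ-≤ ϱ {3} {ϱ} (s≤s (s≤s (s≤s z≤n)))) (m≤n*m (ϱ ^ ϱ) 9)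

^-double : ∀ x k → x ^ k * x ^ k ≡ x ^ (2 * k)
^-double x k = trans (sym (^-distribˡ-+-* x k k)) (cong (λ j → x ^ (k + j)) (sym (+-identityʳ k)))

^-distrib-* : ∀ x y k → (x * y) ^ k ≡ x ^ k * y ^ k
^-distrib-* x y zero    = refl
^-distrib-* x y (suc k) = trans (cong (x * y *_) (^-distrib-* x y k)) (arith x y (x ^ k) (y ^ k))
  where
  arith : ∀ a b c d → a * b * (c * d) ≡ a * c * (b * d)
  arith = solve-∀

few-≤ : ∀ ϱ τ {it} → 1 ≤ τ → it ≤ (ϱ * (τ + τ + 1)) ^ ϱ → it ≤ 9 * (ϱ ^ (2 * ϱ) * τ ^ ϱ)
few-≤ ϱ τ {it} 1≤τ it≤ = begin
  it                                  ≤⟨ it≤ ⟩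
  (ϱ * (τ + τ + 1)) ^ ϱ               ≤⟨ ^-monoˡ-≤ ϱ (≤-trans (*-monoʳ-≤ ϱ (+-monoʳ-≤ (τ + τ) 1≤τ)) (≤-reflexive (arith₁ ϱ τ))) ⟩
  (3 * (ϱ * τ)) ^ ϱ                   ≡⟨ ^-distrib-* 3 (ϱ * τ) ϱ ⟩
  3 ^ ϱ * (ϱ * τ) ^ ϱ                 ≡⟨ cong (3 ^ ϱ *_) (^-distrib-* ϱ τ ϱ) ⟩
  3 ^ ϱ * (ϱ ^ ϱ * τ ^ ϱ)             ≤⟨ *-monoˡ-≤ (ϱ ^ ϱ * τ ^ ϱ) (3^≤ ϱ) ⟩
  9 * ϱ ^ ϱ * (ϱ ^ ϱ * τ ^ ϱ)         ≡⟨ arith₂ (ϱ ^ ϱ) (τ ^ ϱ) ⟩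
  9 * (ϱ ^ ϱ * ϱ ^ ϱ * τ ^ ϱ)         ≡⟨ cong (λ x → 9 * (x * τ ^ ϱ)) (^-double ϱ ϱ) ⟩
  9 * (ϱ ^ (2 * ϱ) * τ ^ ϱ)           ∎
  where
  open ≤-Reasoning
  arith₁ : ∀ ϱ τ → ϱ * (τ + τ + τ) ≡ 3 * (ϱ * τ)
  arith₁ = solve-∀
  arith₂ : ∀ x y → 9 * x * (x * y) ≡ 9 * (x * x * y)
  arith₂ = solve-∀

≤-scale : ∀ {k a b} → a ≤ b → k * a ≤ k * b
≤-scale {k} = *-monoʳ-≤ k

1≤⇒scale : ∀ {x} k → 1 ≤ x → k ≤ k * x
1≤⇒scale k 1≤x = ≤-trans (≤-reflexive (sym (*-identityʳ k))) (*-monoʳ-≤ k 1≤x)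

-- A test costs at most 391 ϱS, the sum of all coefficients once m and 1 are estimated by S, and
-- 3519 is 9 times 391. For ϱ = 0 the main term vanishes, but at most one test takes place, and the
-- additive term pays for it.
decision-search : ∀ {S m} ϱ τ it → 1 ≤ τ → m ≤ S → 1 ≤ S → it ≤ (ϱ * (τ + τ + 1)) ^ ϱ →
  it * (ϱ * (S + S + m * 92 + 102 + 97) + m * 9 + 89) ≤ 3519 * (ϱ ^ (2 * ϱ + 1) * τ ^ (2 * ϱ) * S) + (m * 9 + 89)
decision-search {S} {m} zero τ it _ _ _ it≤1 = ≤-trans (*-monoˡ-≤ (m * 9 + 89) it≤1)
  (≤-trans (≤-reflexive (+-identityʳ (m * 9 + 89))) (m≤n+m _ (3519 * (0 * τ ^ 0 * S))))
decision-search {S} {m} ϱ@(suc _) τ it 1≤τ m≤S 1≤S it≤ = ≤-trans (begin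
  it * (ϱ * (S + S + m * 92 + 102 + 97) + m * 9 + 89)
    ≤⟨ *-mono-≤ (few-≤ ϱ τ 1≤τ it≤) inner ⟩
  9 * (ϱ ^ (2 * ϱ) * τ ^ ϱ) * (ϱ * (S * 391))
    ≤⟨ *-monoˡ-≤ (ϱ * (S * 391)) (≤-scale {9} (≤-scale {ϱ ^ (2 * ϱ)} (^-monoʳ-≤ τ {{>-nonZero 1≤τ}} (m≤n*m ϱ 2)))) ⟩
  9 * (ϱ ^ (2 * ϱ) * τ ^ (2 * ϱ)) * (ϱ * (S * 391))
    ≡⟨ arith (ϱ ^ (2 * ϱ)) (τ ^ (2 * ϱ)) ϱ S ⟩
  3519 * (ϱ ^ (2 * ϱ) * (ϱ * 1) * τ ^ (2 * ϱ) * S)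
    ≡⟨ cong (λ x → 3519 * (x * τ ^ (2 * ϱ) * S)) (^-distribˡ-+-* ϱ (2 * ϱ) 1) ⟨
  3519 * (ϱ ^ (2 * ϱ + 1) * τ ^ (2 * ϱ) * S) ∎) (m≤m+n _ (m * 9 + 89))
  where
  open ≤-Reasoning
  arith : ∀ x y ϱ S → 9 * (x * y) * (ϱ * (S * 391)) ≡ 3519 * (x * (ϱ * 1) * y * S)
  arith = solve-∀
  collect : ∀ ϱ S → ϱ * (S + S + S * 92 + 102 * S + 97 * S) + ϱ * (S * 9 + 89 * S) ≡ ϱ * (S * 391)
  collect = solve-∀
  inner : ϱ * (S + S + m * 92 + 102 + 97) + m * 9 + 89 ≤ ϱ * (S * 391)
  inner = begin
    ϱ * (S + S + m * 92 + 102 + 97) + m * 9 + 89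
      ≡⟨ +-assoc (ϱ * (S + S + m * 92 + 102 + 97)) (m * 9) 89 ⟩
    ϱ * (S + S + m * 92 + 102 + 97) + (m * 9 + 89)
      ≤⟨ +-mono-≤ (*-monoʳ-≤ ϱ (+-mono-≤ (+-mono-≤ (+-monoʳ-≤ (S + S) (*-monoˡ-≤ 92 m≤S)) (1≤⇒scale 102 1≤S)) (1≤⇒scale 97 1≤S)))
                  (≤-trans (+-mono-≤ (*-monoˡ-≤ 9 m≤S) (1≤⇒scale 89 1≤S)) (m≤n*m _ ϱ)) ⟩
    ϱ * (S + S + S * 92 + 102 * S + 97 * S) + ϱ * (S * 9 + 89 * S)
      ≡⟨ collect ϱ S ⟩
    ϱ * (S * 391) ∎

-- Opaque, so that conversion checking never unfolds a product with this constant.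
opaque
  scale : ℕ
  scale = 4000

  scale≡ : scale ≡ 4000
  scale≡ = refl

decision-total : ∀ {A m Y x} → m ≤ A → x ≤ 3519 * Y + (m * 9 + 89) →
  A + A + m * 230 + 83 + x + m * 60 + 100 + 2 ≤ scale * (Y + A + 1)
decision-total {A} {m} {Y} {x} m≤A x≤ = begin
  A + A + m * 230 + 83 + x + m * 60 + 100 + 2
    ≤⟨ +-monoˡ-≤ 2 (+-monoˡ-≤ 100 (+-mono-≤ (+-mono-≤ (+-monoˡ-≤ 83 (+-monoʳ-≤ (A + A) (*-monoˡ-≤ 230 m≤A)))
         (≤-trans x≤ (+-monoʳ-≤ (3519 * Y) (+-monoˡ-≤ 89 (*-monoˡ-≤ 9 m≤A))))) (*-monoˡ-≤ 60 m≤A))) ⟩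
  A + A + A * 230 + 83 + (3519 * Y + (A * 9 + 89)) + A * 60 + 100 + 2
    ≤⟨ m≤m+n _ (481 * Y + 3699 * A + 3726) ⟩
  A + A + A * 230 + 83 + (3519 * Y + (A * 9 + 89)) + A * 60 + 100 + 2 + (481 * Y + 3699 * A + 3726)
    ≡⟨ arith A Y ⟩
  4000 * (Y + A + 1)
    ≡⟨ cong (_* (Y + A + 1)) scale≡ ⟨
  scale * (Y + A + 1) ∎
  where
  open ≤-Reasoning
  arith : ∀ A Y → A + A + A * 230 + 83 + (3519 * Y + (A * 9 + 89)) + A * 60 + 100 + 2 + (481 * Y + 3699 * A + 3726) ≡ 4000 * (Y + A + 1)
  arith = solve-∀

-- As for `decision-search`, with κm in place of S. The extra factor κ of the Bellman-Ford rounds is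
-- covered by κ · κ^ϱ ≤ κ^(2ϱ), valid for ϱ ≥ 1.
basic-search : ∀ {m} ϱ κ it → 1 ≤ κ → ϱ ≤ m → it ≤ (ϱ * (κ + κ + 1)) ^ ϱ →
  it * (ϱ * (κ * (m * 59 + 31) + m * 4 + 67 + 97) + m * 9 + 89) ≤ 3204 * (ϱ ^ (2 * ϱ + 1) * κ ^ (2 * ϱ) * m) + (m * 9 + 89)
basic-search {m} zero κ it _ _ it≤1 = ≤-trans (*-monoˡ-≤ (m * 9 + 89) it≤1)
  (≤-trans (≤-reflexive (+-identityʳ (m * 9 + 89))) (m≤n+m _ (3204 * (0 * κ ^ 0 * m))))
basic-search {m} ϱ@(suc ϱ′) κ it 1≤κ ϱ≤m it≤ = ≤-trans (begin
  it * (ϱ * (κ * (m * 59 + 31) + m * 4 + 67 + 97) + m * 9 + 89)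
    ≤⟨ *-mono-≤ (few-≤ ϱ κ 1≤κ it≤) inner ⟩
  9 * (ϱ ^ (2 * ϱ) * κ ^ ϱ) * (ϱ * (κ * m * 356))
    ≡⟨ arith₁ (ϱ ^ (2 * ϱ)) (κ ^ ϱ) ϱ κ m ⟩
  3204 * (ϱ ^ (2 * ϱ) * (ϱ * 1) * (κ * κ ^ ϱ) * m)
    ≤⟨ ≤-scale {3204} (*-monoˡ-≤ m (≤-scale {ϱ ^ (2 * ϱ) * (ϱ * 1)} (^-monoʳ-≤ κ {{>-nonZero 1≤κ}} (s≤s (m≤n+m ϱ ϱ′))))) ⟩
  3204 * (ϱ ^ (2 * ϱ) * (ϱ * 1) * κ ^ (ϱ + ϱ) * m)
    ≡⟨ cong₂ (λ x y → 3204 * (x * κ ^ (ϱ + y) * m)) (sym (^-distribˡ-+-* ϱ (2 * ϱ) 1)) (sym (+-identityʳ ϱ)) ⟩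
  3204 * (ϱ ^ (2 * ϱ + 1) * κ ^ (2 * ϱ) * m) ∎) (m≤m+n _ (m * 9 + 89))
  where
  open ≤-Reasoning
  1≤m : 1 ≤ m
  1≤m = ≤-trans (s≤s z≤n) ϱ≤m
  1≤κm : 1 ≤ κ * m
  1≤κm = *-mono-≤ 1≤κ 1≤m
  arith₁ : ∀ x y ϱ κ m → 9 * (x * y) * (ϱ * (κ * m * 356)) ≡ 3204 * (x * (ϱ * 1) * (κ * y) * m)
  arith₁ = solve-∀
  m≤κm : m ≤ κ * m
  m≤κm = ≤-trans (≤-reflexive (sym (*-identityˡ m))) (*-monoˡ-≤ m 1≤κ)
  κ≤κm : κ ≤ κ * m
  κ≤κm = 1≤⇒scale κ 1≤m
  expand′ : ∀ κ m → κ * (m * 59 + 31) ≡ κ * m * 59 + κ * 31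
  expand′ = solve-∀
  collect : ∀ ϱ z → ϱ * (z * 59 + z * 31 + z * 4 + 67 * z + 97 * z) + ϱ * (z * 9 + 89 * z) ≡ ϱ * (z * 356)
  collect = solve-∀
  inner : ϱ * (κ * (m * 59 + 31) + m * 4 + 67 + 97) + m * 9 + 89 ≤ ϱ * (κ * m * 356)
  inner = begin
    ϱ * (κ * (m * 59 + 31) + m * 4 + 67 + 97) + m * 9 + 89
      ≡⟨ +-assoc (ϱ * (κ * (m * 59 + 31) + m * 4 + 67 + 97)) (m * 9) 89 ⟩
    ϱ * (κ * (m * 59 + 31) + m * 4 + 67 + 97) + (m * 9 + 89)
      ≤⟨ +-mono-≤ (*-monoʳ-≤ ϱ (+-mono-≤ (+-mono-≤ (+-mono-≤ (≤-trans (≤-reflexive (expand′ κ m)) (+-monoʳ-≤ (κ * m * 59) (*-monoˡ-≤ 31 κ≤κm)))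
                    (*-monoˡ-≤ 4 m≤κm)) (1≤⇒scale 67 1≤κm)) (1≤⇒scale 97 1≤κm)))
                  (≤-trans (+-mono-≤ (*-monoˡ-≤ 9 m≤κm) (1≤⇒scale 89 1≤κm)) (m≤n*m _ ϱ)) ⟩
    ϱ * (κ * m * 59 + κ * m * 31 + κ * m * 4 + 67 * (κ * m) + 97 * (κ * m)) + ϱ * (κ * m * 9 + 89 * (κ * m))
      ≡⟨ collect ϱ (κ * m) ⟩
    ϱ * (κ * m * 356) ∎

-- The n searches cost O(n(n + m)); connectedness, in the form n ≤ 2m + 1, turns this into O(nm +
-- 1).
basic-total : ∀ {n m Y x} → n ≤ m + m + 1 → n ≤ n * m + 1 → m ≤ n * m → x ≤ 3204 * Y + (m * 9 + 89) →
  n * (m * 276 + n * 21 + 75) + m * 19 + 38 + x + m * 60 + 100 ≤ scale * (Y + n * m + 1)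
basic-total {n} {m} {Y} {x} n≤ n≤nm m≤nm x≤ = begin
  n * (m * 276 + n * 21 + 75) + m * 19 + 38 + x + m * 60 + 100
    ≤⟨ +-monoˡ-≤ 100 (+-mono-≤ (+-mono-≤ (+-monoˡ-≤ 38 (+-mono-≤ (*-monoʳ-≤ n (+-monoˡ-≤ 75 (+-monoʳ-≤ (m * 276) (*-monoˡ-≤ 21 n≤)))) (*-monoˡ-≤ 19 m≤nm)))
         (≤-trans x≤ (+-monoʳ-≤ (3204 * Y) (+-monoˡ-≤ 89 (*-monoˡ-≤ 9 m≤nm))))) (*-monoˡ-≤ 60 m≤nm)) ⟩
  n * (m * 276 + (m + m + 1) * 21 + 75) + n * m * 19 + 38 + (3204 * Y + (n * m * 9 + 89)) + n * m * 60 + 100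
    ≡⟨ arith₁ n m Y ⟩
  n * 96 + (n * m * 406 + 3204 * Y + 227)
    ≤⟨ +-monoˡ-≤ _ (*-monoˡ-≤ 96 n≤nm) ⟩
  (n * m + 1) * 96 + (n * m * 406 + 3204 * Y + 227)
    ≤⟨ m≤m+n _ (n * m * 3498 + 796 * Y + 3677) ⟩
  (n * m + 1) * 96 + (n * m * 406 + 3204 * Y + 227) + (n * m * 3498 + 796 * Y + 3677)
    ≡⟨ arith₂ (n * m) Y ⟩
  4000 * (Y + n * m + 1)
    ≡⟨ cong (_* (Y + n * m + 1)) scale≡ ⟨
  scale * (Y + n * m + 1) ∎
  where
  open ≤-Reasoning
  arith₁ : ∀ n m Y → n * (m * 276 + (m + m + 1) * 21 + 75) + n * m * 19 + 38 + (3204 * Y + (n * m * 9 + 89)) + n * m * 60 + 100 ≡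
           n * 96 + (n * m * 406 + 3204 * Y + 227)
  arith₁ = solve-∀
  arith₂ : ∀ z Y → (z + 1) * 96 + (z * 406 + 3204 * Y + 227) + (z * 3498 + 796 * Y + 3677) ≡ 4000 * (Y + z + 1)
  arith₂ = solve-∀

⌈log₂⌉≤ : ∀ n → ⌈log₂ n ⌉ ≤ n
⌈log₂⌉≤ n = ≤-trans (⌈log₂⌉-mono-≤ (n≤2^n n)) (≤-reflexive (⌈log₂2^n⌉≡n n))
  where
  n≤2^n : ∀ n → n ≤ 2 ^ n
  n≤2^n zero    = z≤n
  n≤2^n (suc n) = +-mono-≤ (^-monoʳ-≤ 2 {0} {n} z≤n) (≤-trans (n≤2^n n) (≤-reflexive (sym (+-identityʳ (2 ^ n)))))

-- `E` bounds 1 + n + m, so S is at most a multiple of E^dS and A at most a multiple of E³; the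
-- exponent dS + 3 covers both.
decision-polynomial : ∀ c {T F S A n m E f} cS dS cA → 1 ≤ f → F ≤ f → 1 + n + m ≤ E → S ≤ cS * (1 + n + m) ^ dS →
  A ≤ cA * (n * m + n ^ 2 * ⌈log₂ n ⌉ + 1) → T ≤ c * (F * S + A + 1) → T ≤ f * (c * (cS + 3 * cA + 1) * E ^ (dS + 3))
decision-polynomial c {T} {F} {S} {A} {n} {m} {E} {f} cS dS cA 1≤f F≤f graph≤ S≤ A≤ T≤ = begin
  T
    ≤⟨ T≤ ⟩
  c * (F * S + A + 1)
    ≤⟨ *-monoʳ-≤ c (+-mono-≤ (+-mono-≤ (*-mono-≤ F≤f S-bound) (≤-trans A-bound (m≤n*m _ f))) (≤-trans 1≤Z (m≤n*m Z f))) ⟩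
  c * (f * (cS * Z) + f * (3 * cA * Z) + f * Z)
    ≡⟨ arith c f cS cA Z ⟩
  f * (c * (cS + 3 * cA + 1) * Z) ∎
  where
  open ≤-Reasoning
  Z : ℕ
  Z = E ^ (dS + 3)
  instance
    f≢0 : NonZero f
    f≢0 = >-nonZero 1≤f
    E≢0 : NonZero E
    E≢0 = >-nonZero (≤-trans (s≤s z≤n) graph≤)
  E^≤ : ∀ {j} → j ≤ dS + 3 → E ^ j ≤ Z
  E^≤ = ^-monoʳ-≤ E
  1≤Z : 1 ≤ Z
  1≤Z = E^≤ {0} z≤n
  n≤E : n ≤ E
  n≤E = ≤-trans (≤-trans (n≤1+n n) (m≤m+n (suc n) m)) graph≤
  S-bound : S ≤ cS * Z
  S-bound = ≤-trans S≤ (*-monoʳ-≤ cS (≤-trans (^-monoˡ-≤ dS graph≤) (E^≤ (m≤m+n dS 3))))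
  square : n * m ≤ Z
  square = ≤-trans (*-mono-≤ n≤E (≤-trans (m≤n+m m (suc n)) graph≤)) (≤-trans (≤-reflexive (cong (E *_) (sym (*-identityʳ E)))) (E^≤ {2} (≤-trans (s≤s (s≤s z≤n)) (m≤n+m 3 dS))))
  cube : n ^ 2 * ⌈log₂ n ⌉ ≤ Z
  cube = ≤-trans (*-mono-≤ (^-monoˡ-≤ 2 n≤E) (≤-trans (⌈log₂⌉≤ n) n≤E)) (≤-trans (≤-reflexive (*-comm (E ^ 2) E)) (E^≤ {3} (m≤n+m 3 dS)))
  three : ∀ c z → c * (z + z + z) ≡ 3 * c * z
  three = solve-∀
  A-bound : A ≤ 3 * cA * Z
  A-bound = ≤-trans A≤ (≤-trans (*-monoʳ-≤ cA (+-mono-≤ (+-mono-≤ square cube) 1≤Z)) (≤-reflexive (three cA Z)))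
  arith : ∀ c f a b z → c * (f * (a * z) + f * (3 * b * z) + f * z) ≡ f * (c * (a + 3 * b + 1) * z)
  arith = solve-∀

basic-polynomial : ∀ c {T F n m E f} → 1 ≤ f → F ≤ f → 1 + n + m ≤ E → m ≤ n * m → T ≤ c * (F * m + n * m + 1) → T ≤ f * (3 * c * E ^ 2)
basic-polynomial c {T} {F} {n} {m} {E} {f} 1≤f F≤f graph≤ m≤nm T≤ = begin
  T
    ≤⟨ T≤ ⟩
  c * (F * m + n * m + 1)
    ≤⟨ *-monoʳ-≤ c (+-mono-≤ (+-mono-≤ (*-mono-≤ F≤f (≤-trans m≤nm nm≤Z)) (≤-trans nm≤Z (m≤n*m Z f))) (≤-trans 1≤Z (m≤n*m Z f))) ⟩
  c * (f * Z + f * Z + f * Z)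
    ≡⟨ arith c f Z ⟩
  f * (3 * c * Z) ∎
  where
  open ≤-Reasoning
  Z : ℕ
  Z = E ^ 2
  instance
    f≢0 : NonZero f
    f≢0 = >-nonZero 1≤f
    E≢0 : NonZero E
    E≢0 = >-nonZero (≤-trans (s≤s z≤n) graph≤)
  1≤Z : 1 ≤ Z
  1≤Z = ^-monoʳ-≤ E {0} {2} z≤n
  nm≤Z : n * m ≤ Z
  nm≤Z = ≤-trans (*-mono-≤ (≤-trans (≤-trans (n≤1+n n) (m≤m+n (suc n) m)) graph≤) (≤-trans (m≤n+m m (suc n)) graph≤))
    (≤-reflexive (cong (E *_) (sym (*-identityʳ E))))
  arith : ∀ c f z → c * (f * z + f * z + f * z) ≡ f * (3 * c * z)
  arith = solve-∀

-- The factor depending on the parameters.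

-- One power that dominates ϱ^(2ϱ+1) τ^(2ϱ). The second entry is the tightness in one case and the
-- numerator of α, a bound on ⌊α⌋, in the other.
factor : List ℕ → ℕ
factor ks = (1 + cell ks 0 + cell ks 1) ^ (4 * cell ks 0 + 1)

1≤factor : ∀ ks → 1 ≤ factor ks
1≤factor ks = ≤-trans (≤-reflexive (sym (^-zeroˡ (4 * cell ks 0 + 1)))) (^-monoˡ-≤ (4 * cell ks 0 + 1) {1} (s≤s z≤n))

≤factor : ∀ ϱ τ {τ′ ks} → τ′ ≤ τ → ϱ ^ (2 * ϱ + 1) * τ′ ^ (2 * ϱ) ≤ factor (ϱ ∷ τ ∷ ks)
≤factor ϱ τ {τ′} τ′≤ = begin
  ϱ ^ (2 * ϱ + 1) * τ′ ^ (2 * ϱ)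
    ≤⟨ *-mono-≤ (^-monoˡ-≤ (2 * ϱ + 1) (≤-trans (n≤1+n ϱ) (m≤m+n (suc ϱ) τ))) (^-monoˡ-≤ (2 * ϱ) (≤-trans τ′≤ (m≤n+m τ (suc ϱ)))) ⟩
  (1 + ϱ + τ) ^ (2 * ϱ + 1) * (1 + ϱ + τ) ^ (2 * ϱ)
    ≡⟨ ^-distribˡ-+-* (1 + ϱ + τ) (2 * ϱ + 1) (2 * ϱ) ⟨
  (1 + ϱ + τ) ^ (2 * ϱ + 1 + 2 * ϱ)
    ≡⟨ cong ((1 + ϱ + τ) ^_) (arith ϱ) ⟩
  (1 + ϱ + τ) ^ (4 * ϱ + 1) ∎
  where
  open ≤-Reasoning
  arith : ∀ ϱ → 2 * ϱ + 1 + 2 * ϱ ≡ 4 * ϱ + 1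
  arith = solve-∀

power : Program
power =
  1 ≔ (lit 1 ⊕ get 0 (lit 0)) ⊕ get 0 (lit 1) ⨟
  3 ≔ (lit 4 ⊛ get 0 (lit 0)) ⊕ lit 1 ⨟
  4 ≔ lit 1 ⨟
  for 5 3 (4 ≔ var 1 ⊛ var 4 ⨟ skip) ⨟
  put 0 (lit 0) (var 4) ⨟
  0 ≔ lit 1 ⨟
  skip

module Power (R : ℕ) (7≤R : 7 ≤ R) (ks : List ℕ) (ks≤ : All (_≤ R) ks) (length≤ : length ks ≤ R) where
  open Logic R (R ^ 16) 7≤R ≤-refl

  b k : ℕ
  b = 1 + cell ks 0 + cell ks 1
  k = 4 * cell ks 0 + 1

  power-exec : b ≤ R → k ≤ R → b ^ k ≤ R →
    Exec power (initial ks) (λ s → output s ≡ factor ks ∷ [] × regs s 0 ≤ 1) (17 + (2 + (k * (5 + 8) + 4) + 6))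
  power-exec b≤ k≤ b^k≤ =
    assign= (initial-small ks≤ length≤) refl b≤ λ S →
    assign= S refl k≤ λ S →
    assign= S refl (≤-trans (s≤s z≤n) 7≤R) λ S →
    seq⨾ (forE (λ j s → regs s 4 ≡ b ^ j) S refl refl λ j s₁ j< S₁ F _ _ r₄ →
      assign= S₁ (cong₂ _*_ (reg F 1) r₄) (≤-trans (^-monoʳ-≤ b j<) b^k≤) λ S → skipE S refl) λ S₁ F₁ r₄ →
    put= S₁ refl r₄ b^k≤ λ S →
    assign= S refl (≤-trans (s≤s z≤n) 7≤R) λ S →
    skipE S (refl , ≤-refl)

  power-runs : b ≤ R → k ≤ R → b ^ k ≤ R → ∃[ W ] ∃[ t ] Runs W power ks (factor ks ∷ []) t
  power-runs b≤ k≤ b^k≤ with toCalls {xs = ks} {P = _≡ factor ks ∷ []} (power-exec b≤ k≤ b^k≤)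
  ... | _ , t , runs , refl , _ = R ^ 16 , t , runs

-- The capacity may depend on the input at will, so R is taken as the sum of all quantities that it
-- has to exceed.
factor-computable : Computable factor
factor-computable = power , λ ks → runs ks (All-sum (7 ∷ length ks ∷ sum ks ∷ 1 + cell ks 0 + cell ks 1 ∷ 4 * cell ks 0 + 1 ∷ factor ks ∷ []))
  where
  runs : ∀ ks {R} → All (_≤ R) (7 ∷ length ks ∷ sum ks ∷ 1 + cell ks 0 + cell ks 1 ∷ 4 * cell ks 0 + 1 ∷ factor ks ∷ []) →
         ∃[ W ] ∃[ t ] Runs W power ks (factor ks ∷ []) t
  runs ks {R} (7≤ ∷ l≤ ∷ s≤ ∷ b≤ ∷ k≤ ∷ b^k≤ ∷ []) =
    Power.power-runs R 7≤ ks (All.map (λ le → ≤-trans le s≤) (All-sum ks)) l≤ b≤ k≤ b^k≤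

-- Naturals inside the rationals.

fromℕ-mono : ∀ {a b} → a ≤ b → fromℕ a ℚ.≤ fromℕ b
fromℕ-mono {a} {b} a≤b = ℚ.toℚᵘ-cancel-≤ (ℚᵘ.≤-respʳ-≃ (ℚᵘ.≃-sym (toℚᵘ-fromℕ b)) (ℚᵘ.≤-respˡ-≃ (ℚᵘ.≃-sym (toℚᵘ-fromℕ a))
  (ℚᵘ.*≤* (ℤ.*-monoʳ-≤-nonNeg (ℤ.+ 1) (ℤ.+≤+ a≤b)))))

fromℕ-* : ∀ a b → fromℕ (a * b) ≡ fromℕ a ℚ.* fromℕ b
fromℕ-* a b = ℚ.toℚᵘ-injective (ℚᵘ.≃-trans (toℚᵘ-fromℕ (a * b)) (ℚᵘ.≃-sym (ℚᵘ.≃-trans (ℚ.toℚᵘ-homo-* (fromℕ a) (fromℕ b))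
  (ℚᵘ.≃-trans (ℚᵘ.*-cong (toℚᵘ-fromℕ a) (toℚᵘ-fromℕ b)) (ℚᵘ.*≡* (cong (ℤ._* ℤ.+ 1) (sym (ℤ.pos-* a b))))))))

fromℕ-+ : ∀ a b → fromℕ (a + b) ≡ fromℕ a ℚ.+ fromℕ b
fromℕ-+ a b = ℚ.toℚᵘ-injective (ℚᵘ.≃-trans (toℚᵘ-fromℕ (a + b)) (ℚᵘ.≃-sym (ℚᵘ.≃-trans (ℚ.toℚᵘ-homo-+ (fromℕ a) (fromℕ b))
  (ℚᵘ.≃-trans (ℚᵘ.+-cong (toℚᵘ-fromℕ a) (toℚᵘ-fromℕ b))
    (ℚᵘ.*≡* (cong (ℤ._* ℤ.+ 1) (cong₂ ℤ._+_ (ℤ.*-identityʳ (ℤ.+ a)) (ℤ.*-identityʳ (ℤ.+ b)))))))))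

fromℕ-nonNeg : ∀ k → ℚ.NonNegative (fromℕ k)
fromℕ-nonNeg k = ℚ.nonNegative (fromℕ-mono {0} {k} z≤n)

fromℕ-^ : ∀ {α κ} → fromℕ κ ℚ.≤ α → ∀ k → fromℕ (κ ^ k) ℚ.≤ α ^ℚ k
fromℕ-^ {α} {κ} κ≤α zero    = ℚ.≤-refl
fromℕ-^ {α} {κ} κ≤α (suc k) = ℚ.≤-trans (ℚ.≤-reflexive (fromℕ-* κ (κ ^ k)))
  (ℚ.≤-trans (ℚ.*-monoʳ-≤-nonNeg (fromℕ (κ ^ k)) {{fromℕ-nonNeg (κ ^ k)}} κ≤α)
    (ℚ.*-monoˡ-≤-nonNeg α {{ℚ.nonNegative (ℚ.≤-trans (fromℕ-mono {0} {κ} z≤n) κ≤α)}} (fromℕ-^ κ≤α k)))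

-- The size of the graph and the meaning of tightness.

-- The least number principle for an arbitrary predicate, hence only up to double negation. It
-- provides tightest alternative paths.
¬¬-least : ∀ {P : ℕ → Set} {k} → P k → ¬ ¬ (∃[ j ] P j × (∀ i → P i → j ≤ i))
¬¬-least {P} {k} Pk none = go (suc k) ≤-refl Pk
  where
  go : ∀ gas {j} → j < gas → ¬ P j
  go (suc gas) {j} (s≤s j≤) Pj = ¬¬-em {∃[ i ] P i × i < j} λ
    { (inj₁ (i , Pi , i<j)) → go gas (≤-trans i<j j≤) Pi
    ; (inj₂ minimal)        → none (j , Pj , λ i Pi → ≮⇒≥ λ i<j → minimal (i , Pi , i<j)) }

calls-mono : ∀ {W W′ p xs P T} → W ≤ W′ → Calls W p xs P T → Calls W′ p xs P T
calls-mono le (ys , t , (s , t₀ , d , out , t≡) , rest) = ys , t , (s , t₀ , mono-capacity le d , out , t≡) , rest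

encodingLength-≥ : ∀ xs → length xs ≤ encodingLength xs
encodingLength-≥ []       = z≤n
encodingLength-≥ (x ∷ xs) = s≤s (≤-trans (encodingLength-≥ xs) (m≤n+m _ ⌊log₂ x ⌋))

module _ (I : Instance) where
  open Instance I
  open Walks graph

  -- In a connected graph with at least two vertices, every vertex is an end of some edge, and there
  -- are 2m ends.
  vertices≤ : n ≤ m + m + 1
  vertices≤ with 2 ≤? n
  ... | no n≱2  = ≤-trans (≤-pred (≰⇒> n≱2)) (m≤n+m 1 (m + m))
  ... | yes 2≤n = ≤-trans (subst₂ _≤_ (length-tabulate {A = Fin n} id) ends-length
      (length-⊆ {ys = map src (allFin m) ++ map tgt (allFin m)} (Unique.allFin⁺ n) λ {x} _ → incident x)) (m≤m+n (m + m) 1)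
    where
    ends-length : length (map src (allFin m) ++ map tgt (allFin m)) ≡ m + m
    ends-length = trans (length-++ (map src (allFin m))) (cong₂ _+_ (trans (length-map src (allFin m)) (length-tabulate {A = Fin m} id))
      (trans (length-map tgt (allFin m)) (length-tabulate {A = Fin m} id)))
    other : ∀ (x : Fin n) → ∃[ y ] x ≢ y
    other x with toℕ x ≟ 0
    ... | yes x≡0 = Fin.fromℕ< 2≤n , λ x≡y → case trans (sym x≡0) (trans (cong toℕ x≡y) (Fin.toℕ-fromℕ< 2≤n)) of λ ()
    ... | no x≢0  = Fin.fromℕ< {0} (≤-trans (s≤s z≤n) 2≤n) , λ x≡y → x≢0 (trans (cong toℕ x≡y) (Fin.toℕ-fromℕ< _))
    incident : ∀ x → x ∈ map src (allFin m) ++ map tgt (allFin m)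
    incident x with other x
    ... | y , x≢y with connected x y
    ...   | stop = contradiction refl x≢y
    ...   | step e (inj₁ refl) _ = ∈-++⁺ˡ (∈-map⁺ src (∈-allFin e))
    ...   | step e (inj₂ refl) _ = ∈-++⁺ʳ (map src (allFin m)) (∈-map⁺ tgt (∈-allFin e))

  m≤nm : m ≤ n * m
  m≤nm with m in eq
  ... | zero  = z≤n
  ... | suc k = m≤n*m (suc k) n {{>-nonZero (≤-trans (s≤s z≤n) (Fin.toℕ<n (src (subst Fin (sym eq) fzero))))}}

  n≤nm : n ≤ n * m + 1
  n≤nm with m in eq
  ... | zero  = ≤-trans (≤-trans vertices≤ (≤-reflexive (cong (λ k → k + k + 1) eq))) (m≤n+m 1 (n * 0))
  ... | suc k = ≤-trans (m≤m*n n (suc k)) (m≤m+n (n * suc k) 1)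

  size : ℕ
  size = encodingLength (enc I)

  base≤size : base I ≤ size
  base≤size = subst (_≤ size) (length-enc I) (encodingLength-≥ (enc I))

  graph≤size : 1 + n + m ≤ size
  graph≤size = ≤-trans (≤-trans (+-monoˡ-≤ m (s≤s vertices≤)) (≤-trans (≤-reflexive (arith m)) (+-monoˡ-≤ (m * 3) (s≤s (s≤s z≤n))))) base≤size
    where
    arith : ∀ m → 1 + (m + m + 1) + m ≡ 2 + m * 3
    arith = solve-∀

  settling⇒short : ∀ {e P} → Settling I e P → Short I P
  settling⇒short {P = P} (_ , d , dist , le) = short-dist I {P = P} dist (to-fits I le)

  module Tight {τ : ℕ} (tight : IsTightness I τ) where
    N : Subset m
    N = proj₁ tight

    N⇔ : ∀ e → e ∈ˢ N ⇔ Nontrivial I e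
    N⇔ = proj₁ (proj₂ tight)

    count : ∀ {u v} → Walk graph u v → ℕ
    count P = length (filter (Subset._∈? N) (edges P))

    tightest : ∀ e → Critical I e → Removable I e → ¬ ¬ (∃[ k ] k ≤ τ × IsTightestCount I N e k)
    tightest e critical removable none with removable⇒alternative I removable
    ... | P , settling , alt = ¬¬-least {P = λ k → ∃[ P ] Settling I e P × Alternative I e P × count P ≡ k} (P , settling , alt , refl)
          λ (k , attained , minimal) → let tc = attained , λ Q sQ aQ → minimal _ (Q , sQ , aQ , refl) in
            none (k , proj₁ (proj₂ (proj₂ tight)) e k critical tc , tc)

    -- For a critical pair the tightest alternative path has at most τ nontrivial edges. For any
    -- other removable edge some settling path consists of trivial edges only; it contains no
    -- candidate, in particular not e itself.
    sparse : ∀ e → Removable I e → ¬ ¬ Sparse I τ e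
    sparse e removable none = ¬¬-em {Critical I e} λ where
      (inj₁ critical) → tightest e critical removable λ (k , k≤τ , (P , settling , alt , eq) , _) →
        none (P , settling⇒short {e} {P} settling , alt , λ es u es⊆ → ≤-trans (length-⊆ u λ {f} f∈ →
          ∈-filter⁺ (Subset._∈? N) (proj₁ (es⊆ f∈)) (Equivalence.from (N⇔ f) (removable⇒nontrivial I (proj₂ (es⊆ f∈)))))
          (≤-trans (≤-reflexive eq) k≤τ))
      (inj₂ ¬critical) → ¬critical λ (P , settling , trivial) →
        none (P , settling⇒short {e} {P} settling , (λ e∈ → removable⇒nontrivial I removable (All.lookup trivial e∈)) ,
          λ { [] _ _ → z≤n ; (f ∷ _) _ es⊆ → contradiction (All.lookup trivial (proj₁ (es⊆ (here refl))))
                (removable⇒nontrivial I (proj₂ (es⊆ (here refl)))) })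

    -- Without a detour around all nontrivial edges, f is critical. If f is itself trivial, it is
    -- its own detour; otherwise a tightness of 0 would give a settling path without nontrivial
    -- edges. Either way a detour would exist.
    positive-τ : ∃[ f ] ¬ Detour I (Removable I) f → 1 ≤ τ
    positive-τ (f , ¬detour) = decidable-stable (1 ≤? τ) λ τ≱1 → ¬¬-em {Removable I f} λ {
      (inj₂ ¬r) → ¬detour (edgeʷ f , (¬r ∷ []) , edge-short I f) ;
      (inj₁ r)  → tightest f critical r λ (k , k≤τ , (P , settling , alt , eq) , _) →
        ¬detour (P , All.tabulate (λ {g} g∈ rg → contradiction (∈-filter⁺ (Subset._∈? N) g∈ (Equivalence.from (N⇔ g) (removable⇒nontrivial I rg)))
          (empty (≤-trans (≤-reflexive eq) (≤-trans k≤τ (≤-pred (≰⇒> τ≱1)))))) , settling⇒short {f} {P} settling) }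
      where
      critical : Critical I f
      critical (P , settling , trivial) = ¬detour (P , All.map (λ t r → removable⇒nontrivial I r t) trivial , settling⇒short {f} {P} settling)
      empty : ∀ {xs : List (Fin m)} {x} → length xs ≤ 0 → x ∉ xs
      empty {[]} _ ()

-- Opaque, so that conversion checking never unfolds a power with this exponent.
opaque
  exponent : ℕ → ℕ
  exponent K = 4 * (16 + 3 * K)

  power-power : ∀ {a b c} K → b ≡ a → c ≡ b ^ 4 → a ^ exponent K ≡ c ^ (16 + 3 * K)
  power-power {a} K refl refl = sym (^-*-assoc a 4 (16 + 3 * K))

-- Sufficient word capacities.

module Words (I : Instance) (K : ℕ) where

  -- In the exponent, 16 serves the expressions of the programs themselves. The summand 3 · K serves
  -- the subroutines, whose inputs have length and entries at most `L` and therefore a room of at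
  -- most L³.
  L W₀ : ℕ
  L = limit I
  W₀ = L ^ (16 + 3 * K)

  instance
    L≢0 : NonZero L
    L≢0 = >-nonZero (≤-trans (s≤s z≤n) (7≤limit I))

  1≤W₀ : 1 ≤ W₀
  1≤W₀ = m^n>0 L (16 + 3 * K)

  capacity₀ : L ^ 16 ≤ W₀
  capacity₀ = ^-monoʳ-≤ L (m≤m+n 16 (3 * K))

  W₀≡ : room (enc I) ^ exponent K ≡ W₀
  W₀≡ = power-power {room (enc I)} {r I} {limit I} K (r≡ I) (limit≡ I)

  roomy : ∀ {k} → k ≤ K → ∀ {xs} → length xs ≤ L → All (_≤ L) xs → room xs ^ k ≤ W₀
  roomy {k} k≤ {xs} l≤ xs≤ = begin
    room xs ^ k        ≤⟨ ^-monoˡ-≤ k cube ⟩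
    (L ^ 3) ^ k        ≡⟨ ^-*-assoc L 3 k ⟩
    L ^ (3 * k)        ≤⟨ ^-monoʳ-≤ L (≤-trans (*-monoʳ-≤ 3 k≤) (m≤n+m (3 * K) 16)) ⟩
    W₀                 ∎
    where
    open ≤-Reasoning
    2≤L : 2 ≤ L
    2≤L = ≤-trans (s≤s (s≤s z≤n)) (7≤limit I)
    cube : room xs ≤ L ^ 3
    cube = begin
      2 + length xs + sum xs     ≤⟨ +-mono-≤ (+-monoʳ-≤ 2 l≤) (≤-trans (sum-bound xs≤) (*-monoˡ-≤ L l≤)) ⟩
      2 + L + L * L              ≤⟨ +-monoˡ-≤ (L * L) (≤-trans (+≤* ≤-refl 2≤L) (*-monoˡ-≤ L 2≤L)) ⟩
      L * L + L * L              ≡⟨ cong (L * L +_) (+-identityʳ (L * L)) ⟨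
      2 * (L * L)                ≤⟨ *-monoˡ-≤ (L * L) 2≤L ⟩
      L * (L * L)                ≡⟨ cong (λ x → L * (L * x)) (*-identityʳ L) ⟨
      L ^ 3                      ∎

  -- A time bound at one word capacity is a time bound at all larger ones.
  at-all-capacities : ∀ {p P T} → Calls W₀ p (enc I) P T → ∀ W → room (enc I) ^ exponent K ≤ W → Calls W p (enc I) P T
  at-all-capacities c W le = calls-mono (subst (_≤ W) W₀≡ le) c

-- The first cell of the output of the finding program is the decision.
forget-witness : ∀ (I : Instance) {W p T} → 1 ≤ W → Calls W p (enc I) (FindsCorrectly I) T → Calls W (p ⨟ 0 ≔ lit 1) (enc I) (DecidesCorrectly I) (T + 2)
forget-witness I {W} {p} {T} 1≤W (ys , t , runs , correct , t≤) = answer correct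
  where
  keep : ∀ {d rest} → ys ≡ d ∷ rest → (∀ {zs} → zs ≡ d ∷ [] → DecidesCorrectly I zs) → Calls W (p ⨟ 0 ≔ lit 1) (enc I) (DecidesCorrectly I) (T + 2)
  keep refl verdict = let zs , t′ , runs′ , zs≡ , t′≤ = first-cell 1≤W runs in
    zs , t′ , runs′ , verdict zs≡ , ≤-trans t′≤ (+-monoˡ-≤ 2 t≤)
  answer : FindsCorrectly I ys → Calls W (p ⨟ 0 ≔ lit 1) (enc I) (DecidesCorrectly I) (T + 2)
  answer (inj₁ (F , w , ys≡)) = keep ys≡ λ zs≡ → inj₁ (zs≡ , F , w)
  answer (inj₂ (ys≡ , ¬f))    = keep ys≡ λ zs≡ → inj₂ (zs≡ , ¬f)

length-encodeEdges : ∀ G → length (encodeEdges G) ≡ Graph.m G * 3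
length-encodeEdges G = length-triples (toℕ ∘ Graph.src G) (toℕ ∘ Graph.tgt G) (Graph.ℓ G) id

runs-≥ : ∀ {W p xs ys t} → Runs W p xs ys t → length xs ≤ t
runs-≥ {xs = xs} {ys} (_ , t₀ , _ , _ , refl) = ≤-trans (m≤m+n (length xs) t₀) (m≤m+n _ (length ys))

-- The algorithm for arbitrary lengths.

module General (spsp : Program) (S : ℕ → ℕ → ℕ) (apsp : Program) (A : ℕ → ℕ → ℕ)
  (spsp-algorithm : SPSP-Algorithm spsp S) (apsp-algorithm : APSP₂-Algorithm apsp A) where

  K₁ K₂ K : ℕ
  K₁ = proj₁ (proj₁ spsp-algorithm)
  K₂ = proj₁ (proj₁ apsp-algorithm)
  K = K₁ + K₂

  prep chk find decide : Program
  prep = PrepareProgram.prepare apsp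
  chk = DetourProgram.detour spsp
  find = MainProgram.main prep chk
  decide = find ⨟ 0 ≔ lit 1

  Hard : Instance → Set
  Hard I = ∃[ f ] ¬ Detour I (Removable I) f

  module _ (I : Instance) where
    open Instance I
    open Words I K

    Tp Tc : ℕ
    Tp = A n m + A n m + m * 230 + 83
    Tc = S n m + S n m + m * 92 + 102

    Few : ℕ → Set
    Few it = ∀ τ → (∀ e → Removable I e → ¬ ¬ Sparse I τ e) → it ≤ (ϱ * (τ + τ + 1)) ^ ϱ

    time : ℕ → ℕ
    time it = Tp + it * (ϱ * (Tc + 97) + m * 9 + 89) + m * 60 + 100

    abstract
      result : ∃[ it ] Calls W₀ find (enc I) (FindsCorrectly I) (time it) × (it ≡ 0 ⊎ (ϱ ≤ m × Hard I × Few it))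
      result = MainRun.main-result I W₀ capacity₀ prep chk Tp Tc (Hard I)
        (PrepareSpec.prepare-calls I W₀ capacity₀ apsp A K₂ (proj₂ (proj₁ apsp-algorithm)) (roomy (m≤n+m K₂ K₁)))
        (DetourSpec.detour-calls I W₀ capacity₀ spsp S K₁ (proj₂ (proj₁ spsp-algorithm)) (roomy (m≤m+n K₁ K₂)))

    find-time decide-time : ℕ
    find-time = time (proj₁ result)
    decide-time = find-time + 2

  find-solves : Solves find SpannerWitness find-time
  find-solves = exponent K , λ I → Words.at-all-capacities I K (proj₁ (proj₂ (result I)))

  decide-solves : Solves decide SpannerDecision decide-time
  decide-solves = exponent K , λ I → Words.at-all-capacities I K (forget-witness I {T = find-time I} (Words.1≤W₀ I K) (proj₁ (proj₂ (result I))))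

  -- Running times include reading the input, so the time of a correct program is at least the
  -- length of the encoded graph.
  m≤A : ∀ I → Instance.m I ≤ A (Instance.n I) (Instance.m I)
  m≤A I = let open Instance I
              _ , _ , runs , _ , t≤ = proj₂ (proj₁ apsp-algorithm) (graph , connected) _ ≤-refl in
    ≤-trans (≤-trans (m≤m*n m 3) (m≤n+m (m * 3) 2))
      (≤-trans (≤-reflexive (cong (2 +_) (sym (length-encodeEdges graph)))) (≤-trans (runs-≥ runs) t≤))

  S-large : ∀ I → Fin (Instance.n I) → 4 + Instance.m I * 3 ≤ S (Instance.n I) (Instance.m I)
  S-large I v = let open Instance I
                    _ , _ , runs , _ , t≤ = proj₂ (proj₁ spsp-algorithm) (record { graph = graph ; connected = connected ; source = v ; target = v }) _ ≤-refl in
    ≤-trans (≤-reflexive (cong (4 +_) (sym (length-encodeEdges graph)))) (≤-trans (runs-≥ runs) t≤)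

  decide-≤ : ∀ x → decide-time (proj₁ x) ≤ scale * (decisionBound S A x + 1)
  decide-≤ (I , τ , tight) = decision-total {A n m} {m} {ϱ ^ (2 * ϱ + 1) * τ ^ (2 * ϱ) * S n m} (m≤A I) (search (proj₁ (result I)) (proj₂ (proj₂ (result I))))
    where
    open Instance I
    search : ∀ it → it ≡ 0 ⊎ (ϱ ≤ m × Hard I × Few I it) →
      it * (ϱ * (S n m + S n m + m * 92 + 102 + 97) + m * 9 + 89) ≤ 3519 * (ϱ ^ (2 * ϱ + 1) * τ ^ (2 * ϱ) * S n m) + (m * 9 + 89)
    search .0 (inj₁ refl) = z≤n
    -- The edge f of the certificate gives τ ≥ 1, and its source serves as the vertex of a
    -- single-pair query, whose input length shows that S is at least m and at least 1.
    search it (inj₂ (_ , hard@(f , _) , few)) = decision-search ϱ τ it (Tight.positive-τ I tight hard)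
      (≤-trans (≤-trans (m≤m*n m 3) (m≤n+m (m * 3) 4)) (S-large I (src f)))
      (≤-trans (s≤s z≤n) (S-large I (src f))) (few τ (Tight.sparse I tight))

  decide-fpt : FPT SpannerDecision ByϱAndτ decide-time
  decide-fpt =
    let cS , dS , S≤ = proj₂ spsp-algorithm
        cA , A≤      = proj₂ apsp-algorithm in
    factor , factor-computable , scale * (cS + 3 * cA + 1) , dS + 3 , λ { I _ (τ , tight , refl) → let open Instance I in
      decision-polynomial scale {T = decide-time I} {F = ϱ ^ (2 * ϱ + 1) * τ ^ (2 * ϱ)} {S n m} {A n m} {n} {m} {size I} {factor (ϱ ∷ τ ∷ [])} cS dS cA (1≤factor (ϱ ∷ τ ∷ [])) (≤factor ϱ τ {τ} {[]} ≤-refl)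
        (graph≤size I) (S≤ n m) (A≤ (n , m)) (decide-≤ (I , τ , tight)) }

  find-fpt : FPT SpannerWitness ByϱAndτ find-time
  find-fpt = let f , computable , c , d , bound = decide-fpt in
    f , computable , c , d , λ I k param → ≤-trans (m≤m+n (find-time I) 2) (bound I k param)

  -- The decision program runs the finding program, so finding a witness takes no longer than
  -- deciding.
  find-≤ : find-time ∈O witnessBound decide-time
  find-≤ = 1 , λ I → ≤-trans (≤-trans (m≤m+n (find-time I) 2) (≤-trans (m≤m+n (decide-time I) _) (m≤m+n _ 1))) (≤-reflexive (sym (+-identityʳ _)))

-- The algorithm for basic instances.

module Basic where
  find : Program
  find = MainProgram.main basicPrepare BasicDetourProgram.basicDetour

  module _ (x : BasicInstance) where
    I : Instance
    I = proj₁ x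
    open Instance I
    open Words I 0
    open import Data.Nat.DivMod using (m≥n⇒m/n>0; m/n*n≤m; m*n/n≡m; /-monoˡ-≤)

    κ : ℕ
    κ = num I / den I

    Tp Tc : ℕ
    Tp = n * (m * 276 + n * 21 + 75) + m * 19 + 38
    Tc = κ * (m * 59 + 31) + m * 4 + 67

    time : ℕ → ℕ
    time it = Tp + it * (ϱ * (Tc + 97) + m * 9 + 89) + m * 60 + 100

    Few : ℕ → Set
    Few it = ∀ τ → (∀ e → Removable I e → ¬ ¬ Sparse I τ e) → it ≤ (ϱ * (τ + τ + 1)) ^ ϱ

    abstract
      result : ∃[ it ] Calls W₀ find (enc I) (FindsCorrectly I) (time it) × (it ≡ 0 ⊎ (ϱ ≤ m × Unit.⊤ × Few it))
      result = MainRun.main-result I W₀ capacity₀ basicPrepare BasicDetourProgram.basicDetour Tp Tc Unit.⊤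
        (BasicPrepareSpec.basic-prepare-calls I (proj₂ x) W₀ capacity₀)
        (BasicDetourSpec.basic-calls I (proj₂ x) W₀ capacity₀)

    find-time : ℕ
    find-time = time (proj₁ result)

    1≤κ : 1 ≤ κ
    1≤κ = m≥n⇒m/n>0 (den≤num I)

    κ≤α : fromℕ κ ℚ.≤ α
    κ≤α = subst (fromℕ κ ℚ.≤_) (ℚ.*-identityʳ α) (from-fits I {κ} {1}
      (≤-trans (≤-reflexive (*-comm (den I) κ)) (≤-trans (m/n*n≤m (num I) (den I)) (≤-reflexive (sym (*-identityʳ (num I)))))))

    -- With unit lengths the number of edges is the length, and a short walk between adjacent
    -- vertices has an integral length of at most α, hence at most ⌊α⌋. All its edges are counted,
    -- nontrivial or not.
    sparse : ∀ e → Removable I e → ¬ ¬ Sparse I κ e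
    sparse e (P , avoids , short) none = none (P , short , (λ e∈ → All.lookup avoids e∈ refl) , λ es u es⊆ →
      ≤-trans (length-⊆ u (proj₁ ∘ es⊆)) (≤-trans (≤-reflexive (sym (unit P))) len≤))
      where
      unit : ∀ {u v} (P : Walk graph u v) → len P ≡ length (edges P)
      unit stop         = refl
      unit (step f j P) = cong₂ _+_ (proj₂ x f) (unit P)
      len≤ : len P ≤ κ
      len≤ = subst (_≤ κ) (m*n/n≡m (len P) (den I)) (/-monoˡ-≤ (den I) (≤-trans (≤-reflexive (*-comm (len P) (den I)))
        (≤-trans (short (Walks.edgeʷ graph e)) (≤-reflexive (trans (cong (num I *_) (trans (Walks.len-edgeʷ graph e) (proj₂ x e))) (*-identityʳ (num I)))))))

    find-≤ : find-time ≤ scale * (ϱ ^ (2 * ϱ + 1) * κ ^ (2 * ϱ) * m + n * m + 1)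
    find-≤ = basic-total {n} {m} {ϱ ^ (2 * ϱ + 1) * κ ^ (2 * ϱ) * m} (vertices≤ I) (n≤nm I) (m≤nm I) (search (proj₁ result) (proj₂ (proj₂ result)))
      where
      search : ∀ it → it ≡ 0 ⊎ (ϱ ≤ m × Unit.⊤ × Few it) →
        it * (ϱ * (κ * (m * 59 + 31) + m * 4 + 67 + 97) + m * 9 + 89) ≤ 3204 * (ϱ ^ (2 * ϱ + 1) * κ ^ (2 * ϱ) * m) + (m * 9 + 89)
      search .0 (inj₁ refl) = z≤n
      search it (inj₂ (ϱ≤m , _ , few)) = basic-search ϱ κ it 1≤κ ϱ≤m (few κ sparse)

  find-solves : Solves find BasicSpannerWitness find-time
  find-solves = exponent 0 , λ x → Words.at-all-capacities (proj₁ x) 0 (proj₁ (proj₂ (result x)))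

  find-fpt : FPT BasicSpannerWitness ByϱAndα find-time
  find-fpt = factor , factor-computable , 3 * scale , 2 , λ { x@(I , _) _ refl → let open Instance I in
    basic-polynomial scale {find-time x} {ϱ ^ (2 * ϱ + 1) * κ x ^ (2 * ϱ)} {E = size I} {factor (ϱ ∷ num I ∷ den I ∷ [])} (1≤factor (ϱ ∷ num I ∷ den I ∷ [])) (≤factor ϱ (num I) {κ x} {den I ∷ []} (m/n≤m (num I) (den I)))
      (graph≤size I) (m≤nm I) (find-≤ x) }
    where open import Data.Nat.DivMod using (m/n≤m)

  -- The analysis is carried out with κ = ⌊α⌋ in the naturals; only the final bound passes to the
  -- rationals, by monotonicity of powers and κ ≤ α.
  find-≤α : find-time ∈Oℚ basicBound
  find-≤α = scale , λ x → bound x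
    where
    bound : ∀ x → fromℕ (find-time x) ℚ.≤ fromℕ scale ℚ.* (basicBound x ℚ.+ ℚ.1ℚ)
    bound x@(I , _) = ℚ.≤-trans (fromℕ-mono (find-≤ x)) (ℚ.≤-trans (ℚ.≤-reflexive (fromℕ-* scale _))
      (ℚ.*-monoˡ-≤-nonNeg (fromℕ scale) {{fromℕ-nonNeg scale}} (ℚ.≤-trans (ℚ.≤-reflexive (fromℕ-+ (F * m + n * m) 1))
        (ℚ.+-monoˡ-≤ ℚ.1ℚ (ℚ.≤-trans (ℚ.≤-reflexive (fromℕ-+ (F * m) (n * m))) (ℚ.+-monoˡ-≤ (fromℕ (n * m)) F-bound))))))
      where
      open Instance I
      G F : ℕ
      G = ϱ ^ (2 * ϱ + 1)
      F = G * κ x ^ (2 * ϱ)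
      F-bound : fromℕ (F * m) ℚ.≤ fromℕ G ℚ.* α ^ℚ (2 * ϱ) ℚ.* fromℕ m
      F-bound = ℚ.≤-trans (ℚ.≤-reflexive (trans (fromℕ-* F m) (cong (ℚ._* fromℕ m) (fromℕ-* G (κ x ^ (2 * ϱ))))))
        (ℚ.*-monoʳ-≤-nonNeg (fromℕ m) {{fromℕ-nonNeg m}} (ℚ.*-monoˡ-≤-nonNeg (fromℕ G) {{fromℕ-nonNeg G}} (fromℕ-^ (κ≤α x) (2 * ϱ))))

corollary6 : (∀ spsp S apsp₂ A → SPSP-Algorithm spsp S → APSP₂-Algorithm apsp₂ A →
    ∃[ decide ] ∃[ find ] ∃[ T ] ∃[ T′ ]
    Solves decide SpannerDecision T
    × FPT SpannerDecision ByϱAndτ T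
    × (T ∘ proj₁) ∈O decisionBound S A
    × Solves find SpannerWitness T′
    × FPT SpannerWitness ByϱAndτ T′
    × T′ ∈O witnessBound T)
    × (∃[ find ] ∃[ T ]
    Solves find BasicSpannerWitness T
    × FPT BasicSpannerWitness ByϱAndα T
    × T ∈Oℚ basicBound)
corollary6 =
  (λ spsp S apsp₂ A spsp-algorithm apsp₂-algorithm →
    let open General spsp S apsp₂ A spsp-algorithm apsp₂-algorithm in
    decide , find , decide-time , find-time ,
    decide-solves , decide-fpt , (scale , decide-≤) , find-solves , find-fpt , find-≤) ,
  (Basic.find , Basic.find-time , Basic.find-solves , Basic.find-fpt , Basic.find-≤α)
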